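{- Let $p \geq 5$ be a prime. For $p \equiv 1 \pmod{3}$, write $p = x^2+3y^2$ with $x, y \in \mathbb{Z}$. Let $\chi_{ -3}$ denote the non-principal Dirichlet character modulo $3$. Then for $m \in \mathbb{Z}$, \[ H_{m,6}(p) = \begin{cases} \frac{p+1}{3}+\frac{1}{3}\chi_{ -3}(x)x&\text{if }m \equiv 0 \pmod{6},\ p \equiv 1 \pmod{3},\\ \frac{2p-4}{3}&\text{if }m \equiv 0 \pmod{6},\ p \equiv 2 \pmod{3},\\ \frac{p+1}{4}+\frac{1}{6}\chi_{ -3}(x)x&\text{if }m \equiv 1, 5 \pmod{6},\ p \equiv 1 \pmod{3},\\ \frac{p+1}{6}&\text{if }m \equiv 1, 5 \pmod{6},\ p \equiv 2 \pmod{3},\\ \frac{p-1}{2}-\frac{1}{6}\chi_{ -3}(x)x&\text{if }m \equiv 2, 4 \pmod{6},\ p \equiv 1 \pmod{3},\\ \frac{p+1}{3}&\text{if }m \equiv 2,3,4 \pmod{6},\ p \equiv 2 \pmod{3},\\ \frac{p+1}{6}-\frac{1}{3}\chi_{ -3}(x)x&\text{if }m \equiv 3 \pmod{6},\ p \equiv 1 \pmod{3}. \end{cases} \]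
   Context: For an integer $n>0$ with $n \equiv 0,3 \pmod 4$, the Hurwitz class number $H(n)$ is $\sum_{Q}1/\omega_Q$, where $Q$ runs over $\mathrm{SL}_2(\mathbb{Z})$-equivalence classes of positive definite binary integral quadratic forms of discriminant $-n$, and $\omega_Q = 2$ if $Q$ is equivalent to $a(x^2+y^2)$, $\omega_Q=3$ if $Q$ is equivalent to $a(x^2+xy+y^2)$, and $\omega_Q=1$ otherwise. Also $H(0) = -\frac{1}{12}$ and $H(n)=0$ if $n<0$ or $n \equiv 1,2 \pmod 4$. For $m \in \mathbb{Z}$, $M \in \mathbb{Z}_{\geq 1}$, $n \in \mathbb{Z}_{\geq 0}$, define $H_{m,M}(n) := \sum_{t \in \mathbb{Z},\, t \equiv m \pmod{M}} H(4n-t^2)$. -}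

module Defs where

open import Data.Nat as ℕ using (ℕ; zero; suc; NonZero)
open import Data.Integer as ℤ using (ℤ; +_; -[1+_]; _%ℕ_)
open import Data.Rational as ℚ using (ℚ)
open import Data.Product using (Σ; ∃; _×_; _,_)
open import Data.Sum using (_⊎_)
open import Data.List using (List; []; _∷_; map; upTo; foldr)
open import Data.List.Relation.Unary.All using (All)
open import Data.List.Relation.Unary.Any using (Any)
open import Data.List.Relation.Unary.AllPairs using (AllPairs)
open import Relation.Binary.PropositionalEquality using (_≡_)
open import Relation.Nullary using (¬_; yes; no)

Form : Set
Form = ℤ × ℤ × ℤ

evalForm : Form → ℤ → ℤ → ℤ
evalForm (a , b , c) x y = a ℤ.* x ℤ.* x ℤ.+ b ℤ.* x ℤ.* y ℤ.+ c ℤ.* y ℤ.* y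

disc : Form → ℤ
disc (a , b , c) = b ℤ.* b ℤ.- + 4 ℤ.* a ℤ.* c

PosDef : Form → Set
PosDef Q = ∀ x y → ¬ (x ≡ + 0 × y ≡ + 0) → + 0 ℤ.< evalForm Q x y

-- Q ∘ γ for γ = (α β ; γ δ), i.e. (Q∘γ)(x,y) = Q(αx+βy, γx+δy)
act : ℤ → ℤ → ℤ → ℤ → Form → Form
act α β γ δ (a , b , c) =
    a ℤ.* α ℤ.* α ℤ.+ b ℤ.* α ℤ.* γ ℤ.+ c ℤ.* γ ℤ.* γ
  , + 2 ℤ.* a ℤ.* α ℤ.* β ℤ.+ b ℤ.* (α ℤ.* δ ℤ.+ β ℤ.* γ) ℤ.+ + 2 ℤ.* c ℤ.* γ ℤ.* δ
  , a ℤ.* β ℤ.* β ℤ.+ b ℤ.* β ℤ.* δ ℤ.+ c ℤ.* δ ℤ.* δ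

Equiv : Form → Form → Set
Equiv Q Q' = Σ ℤ λ α → Σ ℤ λ β → Σ ℤ λ γ → Σ ℤ λ δ →
  (α ℤ.* δ ℤ.- β ℤ.* γ ≡ + 1) × (act α β γ δ Q ≡ Q')

data InvOmega (Q : Form) : ℚ → Set where
  ω2 : (∃ λ a → Equiv Q (a , + 0 , a)) → InvOmega Q (+ 1 ℚ./ 2)
  ω3 : (∃ λ a → Equiv Q (a , a , a)) → InvOmega Q (+ 1 ℚ./ 3)
  ω1 : ¬ (∃ λ a → Equiv Q (a , + 0 , a)) → ¬ (∃ λ a → Equiv Q (a , a , a)) →
       InvOmega Q (+ 1 ℚ./ 1)

RepSystem : ℕ → List Form → Set
RepSystem n L =
    All (λ Q → PosDef Q × disc Q ≡ ℤ.- (+ n)) L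
  × (∀ Q → PosDef Q → disc Q ≡ ℤ.- (+ n) → Any (Equiv Q) L)
  × AllPairs (λ Q Q' → ¬ Equiv Q Q') L

data WeightedSum : List Form → ℚ → Set where
  ws[] : WeightedSum [] ℚ.0ℚ
  ws∷  : ∀ {Q L w s} → InvOmega Q w → WeightedSum L s → WeightedSum (Q ∷ L) (w ℚ.+ s)

IsHurwitz : (ℕ → ℚ) → Set
IsHurwitz Hf =
    (Hf 0 ≡ ℚ.- (+ 1 ℚ./ 12))
  × (∀ n → (n ℕ.% 4 ≡ 1 ⊎ n ℕ.% 4 ≡ 2) → Hf n ≡ ℚ.0ℚ)
  × (∀ n → 0 ℕ.< n → (n ℕ.% 4 ≡ 0 ⊎ n ℕ.% 4 ≡ 3) →
       Σ (List Form) λ L → RepSystem n L × WeightedSum L (Hf n))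

Hℤ : (ℕ → ℚ) → ℤ → ℚ
Hℤ Hf (+ n)    = Hf n
Hℤ Hf -[1+ n ] = ℚ.0ℚ

-- the integers -(2n+1), …, 2n+1 ; outside this range 4n - t² < 0
tRange : ℕ → List ℤ
tRange n = map (λ i → + i ℤ.- + (2 ℕ.* n ℕ.+ 1)) (upTo (4 ℕ.* n ℕ.+ 3))

Hmod : (ℕ → ℚ) → ℤ → (M : ℕ) → .{{NonZero M}} → ℕ → ℚ
Hmod Hf m M n = foldr step ℚ.0ℚ (tRange n)
  where
  step : ℤ → ℚ → ℚ
  step t acc with (t ℤ.- m) %ℕ M ℕ.≟ 0
  ... | yes _ = Hℤ Hf (+ (4 ℕ.* n) ℤ.- t ℤ.* t) ℚ.+ acc
  ... | no  _ = acc

χ₋₃ : ℤ → ℤ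
χ₋₃ x = go (x %ℕ 3)
  where
  go : ℕ → ℤ
  go 0 = + 0
  go 1 = + 1
  go _ = ℤ.- (+ 1)

{-# OPTIONS --safe #-}
-- For D = 4p - t² > 0 the number 6H(D) is a weighted count of the obtuse triples (u, v, w) with
-- 4uv - (u + v - w)² = D.  A cancellation of sign patterns turns this count into the number of positive
-- solutions of ad + bc = p with a - b - c = ±t minus the number of those with a + b + c = t, up to
-- boundary terms.  Summing over t against the even functions 1, (-1)^t, [3 | t] and (-1)^t [3 | t], which
-- separate the classes modulo 6 up to sign, leaves character sums over ad + bc = p.  Liouville's identity
-- for F(a - b) - F(a + b) evaluates all of them except U = Σ χ(a) χ(b) (2 + 4 [2 | bc]) κ(bc), where
-- κ(n) = 1 if 3 | n and -1 otherwise.  The latter comes from Uspensky's identity on i² + de = n: for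
-- n ≡ 1 (mod 3) it gives 3 Σ κ(i) χ(d) = 2 χ(s) s + 1 if n = s² and 0 if n is not a square.  Adding this up over
-- n = p - 3y² yields U, because x² + 3y² represents m exactly (2 + 4 [2 | m]) Σ_{d | m} χ(d) times.  This
-- last formula is proved by induction on m, from a second instance of Uspensky's identity, weighted by parity.

module Submission where

open import Defs
open import Data.Nat as ℕ using (ℕ; zero; suc; _≤_; _%_; z≤n; s≤s)
open import Data.Integer as ℤ using (ℤ; +_; -[1+_]; _%ℕ_; _+_; _*_; _-_; -_; ∣_∣; +≤+)
open import Data.List using (List; []; _∷_; _++_; map; foldr; applyUpTo)
open import Data.Product using (Σ; _×_; _,_; proj₁; proj₂)
open import Data.Sum using (_⊎_; inj₁; inj₂)
open import Data.Empty using (⊥; ⊥-elim)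
open import Relation.Nullary using (¬_; Dec; yes; no)
open import Relation.Nullary.Decidable using (_×-dec_; _⊎-dec_; ¬?)
open import Relation.Binary.PropositionalEquality using (_≡_; _≢_; refl; sym; trans; cong; cong₂; subst; module ≡-Reasoning)
open import Data.Integer.Tactic.RingSolver using () renaming (solve-∀ to ring)
import Data.Nat.Properties as NP
import Data.Integer.Properties as ZP
open import Data.Rational as ℚ using (ℚ)
import Data.Rational.Properties as QP
open import Data.Rational.Unnormalised as ℚᵘ using (mkℚᵘ; *≡*)
import Data.Rational.Unnormalised.Properties as UP
open import Data.List.Relation.Unary.All using (All; []; _∷_)
open import Data.List.Relation.Unary.Any using (Any; here; there)
open import Data.List.Relation.Unary.AllPairs using (AllPairs; []; _∷_)
open import Data.List.Membership.Propositional using (_∈_)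
open import Data.Bool using (Bool; true; false; _∧_; _∨_; not; if_then_else_) renaming (_≟_ to _≟ᵇ_)
import Data.Integer.DivMod as DM
open import Data.Nat.Primality using (Prime; prime⇒irreducible)
open import Data.Nat.Divisibility using (divides)
open import Data.Unit using (⊤; tt)
open import Data.List.Properties using (map-applyUpTo)
import Data.Nat.DivMod as ND
import Data.Nat.Tactic.RingSolver as NS

-- All sums run over finite boxes, although the quadrics `dsc` = D and x² + 4y² - z² = 4n carry
-- infinitely many points. The boundary lines in Uspensky's identity are infinite too; there two
-- parallel lines are added before summing, and the sum has bounded support. Primality enters at
-- several places. For t ≤ p it excludes the value 0 on the quadric, so u, v, w always have signs.
-- It makes the solutions with a zero entry, and the diagonal ones a = b or c = d, explicit. It
-- gives Σ χ(d) = 2 over d | p when p ≡ 1 (mod 3), hence exactly four representations by x² + 3y²,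
-- so that the x, y of the hypothesis may be arbitrary. The weight identities modulo 6 are checked
-- on all residue classes instead of being derived; the auxiliary weights `k₁`, `k₂` and `ε₂` are
-- chosen so that these linear conditions hold. Multiples of the wanted quantities are computed and
-- cancelled, which keeps everything in ℤ up to the last step.

infixr 5 _∙_
_∙_ : ∀ {A : Set} {x y z : A} → x ≡ y → y ≡ z → x ≡ z
_∙_ = trans

-- Polynomial identities, kept outside the parametrised modules and referred to by number.
r1 : ∀ t P → (t + (+ 1 + P)) * + 0 + + 1 * P ≡ P
r1 = ring
r2 : ∀ t P → t + (+ 1 + P) - + 1 * (+ 1 + P) ≡ t
r2 = ring
r3 : ∀ t P → (t + (P + + 1)) * + 0 + P * + 1 ≡ P
r3 = ring
r4 : ∀ t P → t + (P + + 1) - + 1 * (P + + 1) ≡ t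
r4 = ring
r5 : ∀ P t a x y → P + P + P - x ≡ P - a + (P - t) + y + P + (- (+ 1)) * (x + y - (a + t))
r5 = ring
r6 : ∀ P t a → - (+ 1) ≡ a - + 1 + (P - t) + + 1 + (- (+ 1)) * (a + + 1 + P - t)
r6 = ring
r7 : ∀ P t a → - (+ 1) ≡ a - + 1 + (P - t) + + 1 + (- (+ 1)) * (a + P + + 1 - t)
r7 = ring
r8 : ∀ c d → - (+ 1) ≡ c - + 1 + (d - + 1) + (- (+ 1)) * (d + c - + 1)
r8 = ring
r9 : ∀ c d → + 1 * d + + 1 * c - d ≡ c
r9 = ring
r10 : ∀ a b → - (+ 1) ≡ a - + 1 + (b - + 1) + (- (+ 1)) * (a + b - + 1)
r10 = ring
r11 : ∀ e → e ≡ e + - (+ 2) + + 2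
r11 = ring
r12 : ∀ m s x → m - s ≡ m - x + (s * s - s) + (x - s * s)
r12 = ring
r13 : ∀ m s x → m + s ≡ m - x + (s * s + s) + (x - s * s)
r13 = ring
r14 : ∀ s → - (+ 1) ≡ s - + 1 + (s - + 1) + + 1 + - (+ 1) * (s - - s)
r14 = ring
r15 : ∀ s → - s * - s ≡ s * s
r15 = ring
r16 : ∀ m → m - m ≡ + 0
r16 = ring
r17 : ∀ u w → w - u - u ≡ - (u + u - w)
r17 = ring
r18 : ∀ u v → v + u - u ≡ u + v - u
r18 = ring
r19 : ∀ a → + 2 * a + + 2 * a - (a + a + a) ≡ a
r19 = ring
r20 : ∀ x y → + 4 * (y - x) ≡ + 4 * y - + 4 * x
r20 = ring
r21 : ∀ a b c → a ≡ a - + 1 * (b + c) + (b + c)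
r21 = ring
r22 : ∀ t b c → t + (b + c) - + 1 ≡ t + (b - + 1) + (c - + 1) + + 1
r22 = ring
r23 : ∀ P t b c → P + P + P - (t + (b + c)) ≡ P - t + (P - b) + (P - c)
r23 = ring
r24 : ∀ a b c → b * c ≡ a * + 0 + b * c
r24 = ring
r25 : ∀ a b c → b + c ≡ a - (a - + 1 * (b + c))
r25 = ring
r26 : ∀ a t → a - - t ≡ a + t
r26 = ring
r27 : ∀ P t → + 1 * P + + 0 * (+ 1 + t) ≡ P
r27 = ring
r28 : ∀ P t → P - + 1 * (+ 0 + (P + t)) ≡ - t
r28 = ring
r29 : ∀ P t → P * + 1 + + 0 * (P + t) ≡ P
r29 = ring
r30 : ∀ t → + 1 - + 1 * (+ 0 + (+ 1 + t)) ≡ - t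
r30 = ring
r31 : ∀ P t → + 1 * P + (+ 1 + t) * + 0 ≡ P
r31 = ring
r32 : ∀ P t → P - + 1 * (P + t + + 0) ≡ - t
r32 = ring
r33 : ∀ P t → P * + 1 + (P + t) * + 0 ≡ P
r33 = ring
r34 : ∀ t → + 1 - + 1 * (+ 1 + t + + 0) ≡ - t
r34 = ring
r35 : ∀ P t → P + t - + 1 ≡ P - + 1 + t
r35 = ring
r36 : ∀ t → + 1 + t - + 1 ≡ t
r36 = ring
r37 : ∀ P t a b c → P - a ≡ P - t + b + c + (- (+ 1)) * (a + b + c - t)
r37 = ring
r38 : ∀ P t a b c → P - b ≡ P - t + a + c + (- (+ 1)) * (a + b + c - t)
r38 = ring
r39 : ∀ P t a b c → P - c ≡ P - t + a + b + (- (+ 1)) * (a + b + c - t)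
r39 = ring
r40 : ∀ a c → c ≡ a - - (+ 1) * (+ 0 + c) - a
r40 = ring
r41 : ∀ a b → b ≡ a - - (+ 1) * (b + + 0) - a
r41 = ring
r42 : ∀ P t → + 1 * P + + 0 * (t - + 1) ≡ P
r42 = ring
r43 : ∀ P t → P - - (+ 1) * (+ 0 + (t - P)) ≡ t
r43 = ring
r44 : ∀ P t → P * + 1 + + 0 * (t - P) ≡ P
r44 = ring
r45 : ∀ t → + 1 - - (+ 1) * (+ 0 + (t - + 1)) ≡ t
r45 = ring
r46 : ∀ t → t - + 1 - + 1 ≡ t - + 2
r46 = ring
r47 : ∀ t P → t - P - + 1 + (P - t) ≡ - (+ 1)
r47 = ring
r48 : ∀ P t → + 1 * P + (t - + 1) * + 0 ≡ P
r48 = ring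
r49 : ∀ t → + 1 - - (+ 1) * (t - + 1 + + 0) ≡ t
r49 = ring
r50 : ∀ k x y z → k + x + (y + z) ≡ k + (y + z + x)
r50 = ring
r51 : ∀ P t → - (+ 1) ≡ P - t + + 0 + + 1 * (t - + 1 - P)
r51 = ring
r52 : ∀ P t → - (+ 1) ≡ P - t + + 0 + + 1 * (t - P - + 1)
r52 = ring
r53 : ∀ P t h → - (+ 1) ≡ P - + 1 + (- h - + 1) * t + (h * h + t) + + 0 + + 1 * (h * (t - h) - P)
r53 = ring
r54 : ∀ z t → z ≡ z + t - t
r54 = ring
r55 : ∀ P t v h → + 4 * (P - h * (t - h)) ≡ + 4 * P - t * t - (+ 4 * + 0 * v - (h + h - t) * (h + h - t))
r55 = ring
r56 : ∀ P t → + 4 * P - t * t ≡ + 4 * P - - t * - t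
r56 = ring
r57 : ∀ a b c e → a + + 2 + (b + + 4) - (c + e) ≡ a + b - c + + 6 - e
r57 = ring
r58 : ∀ x y → - x ≡ y - (x + y)
r58 = ring
r59 : ∀ x y → - y ≡ x - (x + y)
r59 = ring
r60 : ∀ P a c → P - c - a ≡ P + + 1 - (a + + 1 + c)
r60 = ring
r61 : ∀ P c → P - + 1 - c ≡ P - c - + 1
r61 = ring
r62 : ∀ P c → (P - c) * + 1 + + 1 * c ≡ P
r62 = ring
r63 : ∀ P c → P - c + + 1 + c ≡ P + + 1
r63 = ring
r64 : ∀ P c → P - c - + 1 ≡ P - + 1 - c
r64 = ring
r65 : ∀ P a b → P - (b - + 1) - + 1 - a ≡ P + + 1 - (a + b + + 1)
r65 = ring
r66 : ∀ P b → P - + 2 - (b - + 1) ≡ P - b - + 1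
r66 = ring
r67 : ∀ P x → (P - x - + 1) * + 1 + (x + + 1) * + 1 ≡ P
r67 = ring
r68 : ∀ P x → P - x - + 1 + (x + + 1) + + 1 ≡ P + + 1
r68 = ring
r69 : ∀ P x → P - x - + 1 - + 1 ≡ P - + 2 - x
r69 = ring
r70 : ∀ x → x + + 1 - + 1 ≡ x
r70 = ring
r71 : ∀ x → x + + 1 - + 2 ≡ x - + 1
r71 = ring
r72 : ∀ x P → x - P + (P - + 1 - x) ≡ - (+ 1)
r72 = ring
r73 : ∀ x P → P - + 1 - x ≡ - (x - P) - + 1
r73 = ring
r74 : ∀ x → x - + 2 + (+ 1 - x) ≡ - (+ 1)
r74 = ring
r75 : ∀ x → + 1 - x ≡ - (x - + 2) - + 1
r75 = ring
r76 : ∀ a c d → a * (d + c) ≡ a * d + a * c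
r76 = ring
r77 : ∀ P d → + 1 * d + + 1 * (P - d) ≡ P
r77 = ring
r78 : ∀ a b c → c * (a + b) ≡ a * c + b * c
r78 = ring
r79 : ∀ a b → a + b - a ≡ b
r79 = ring
r80 : ∀ P a → a * + 1 + (P - a) * + 1 ≡ P
r80 = ring
r81 : ∀ x → + 2 * x ≡ x - (- (+ 1)) * x
r81 = ring
r82 : ∀ s x → + 2 * s - - x ≡ + 2 * s + x
r82 = ring
r83 : ∀ s x → + 2 * - s - - x ≡ - (+ 2 * s - x)
r83 = ring
r84 : ∀ a b e p q → a * b * - a * e * p + a * - b * - a * e * - q ≡ - (b * (a * a * e * (p + q)))
r84 = ring
r85 : ∀ a e b → - (a * (+ 0 * e * b)) ≡ + 0
r85 = ring
r86 : ∀ a b q → - (a * (b * (+ 1 + q))) + - (a * (b * (q + + 1))) ≡ - (+ 2) * (a * (b * (+ 1 + q)))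
r86 = ring
r87 : ∀ s x → + 2 * s + x - + 1 ≡ s - + 1 + (s - + 1) + (x - + 1) + + 2
r87 = ring
r88 : ∀ s → - (+ 1) ≡ + 4 * (s - + 1) + + 3 + (- (+ 1)) * (+ 2 * s - - (+ 2 * s))
r88 = ring
r89 : ∀ s → + 2 * - s ≡ - (+ 2 * s)
r89 = ring
r90 : ∀ s y → + 2 * s + + 2 * y ≡ + 2 * (s + y)
r90 = ring
r91 : ∀ s y → - (+ 2 * s) + + 2 * y ≡ - (+ 2 * (s - y))
r91 = ring
r92 : ∀ a b e p q → - b * a * - a * e * p + - - b * a * - a * e * - q ≡ b * (a * a * e * (p + q))
r92 = ring
r93 : ∀ a e b → a * (+ 0 * e * b) ≡ + 0
r93 = ring
r94 : ∀ a b q → a * (b * (+ 1 + q)) + a * (b * (+ 1 + q)) ≡ + 2 * (a * (b * (+ 1 + q)))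
r94 = ring
r95 : ∀ a b → a * (b * (+ 1 + - (+ 1))) ≡ + 0
r95 = ring
r96 : ∀ s y → s + y - + 1 ≡ s - + 1 + (y - + 1) + + 1
r96 = ring
r97 : ∀ B s y → B - + 2 * y ≡ B - + 2 * s + + 2 * (s - y)
r97 = ring
r98 : ∀ y → + 2 * y ≡ + 2 * (y - + 1) + + 2
r98 = ring
r99 : ∀ a b → a - b ≡ a + - (+ 1) * b
r99 = ring
r100 : ∀ a b → a + - (+ 1) * b ≡ a - b
r100 = ring
r101 : ∀ x y → + 3 * (y - x) ≡ + 3 * y - + 3 * x
r101 = ring
r102 : ∀ i → i * i - + 1 ≡ (i - + 1) * (i - + 1) + + 2 * (i - + 1)
r102 = ring
r103 : ∀ i → i * i - + 1 ≡ (- i - + 1) * (- i - + 1) + + 2 * (- i - + 1)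
r103 = ring
r104 : ∀ e → e ≡ e + + 0
r104 = ring
r105 : ∀ m s x → m - s ≡ m - x + (s * s - s) + - (+ 1) * (s * s - x)
r105 = ring
r106 : ∀ k o → k * (+ 2 * (o * + 0)) ≡ + 0
r106 = ring
r107 : ∀ x → x * + 1 * + 1 ≡ x + + 0
r107 = ring
r108 : ∀ u s → - (+ 1) ≡ u - + 1 + (s - + 1) + + 1 + - (+ 1) * (u - - s)
r108 = ring
r109 : ∀ u z → + 3 * (z * z) ≡ u * u + + 3 * (z * z) - u * u
r109 = ring
r110 : ∀ x y → x * x + + 3 * (y * y) - x * x ≡ + 3 * (y * y)
r110 = ring
r111 : ∀ s → s ≡ + 4 + s - + 4
r111 = ring
r112 : ∀ P → P - + 1 ≡ P - + 2 + + 1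
r112 = ring
r113 : ∀ P t → + 3 * P + + 3 * P - (+ 4 * P - t * t) ≡ + 2 * (P - + 2) + + 4 + t * t
r113 = ring
r114 : ∀ P → P + + 1 ≡ P - + 2 + + 3
r114 = ring
r115 : ∀ a → + 4 * (a * (+ 3 * + 3)) ≡ + 18 * (+ 2 * a)
r115 = ring
r116 : ∀ P X → + 18 * (+ 3 * (P + + 1) + (+ 4 * X + P + + 1)) ≡ + 4 * (((P + + 1) * + 3 + X * + 3) * + 6)
r116 = ring
r117 : ∀ b → + 4 * (b * (+ 6 * + 3)) ≡ + 36 * (+ 2 * b)
r117 = ring
r118 : ∀ P X → + 36 * (+ 3 * (P + + 1) - (+ 4 * X + P + + 1)) ≡ + 4 * (((P + + 1) * + 3 + - X * + 6) * + 6)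
r118 = ring
r119 : ∀ c → + 4 * (c * (+ 2 * + 6)) ≡ + 12 * (+ 4 * c)
r119 = ring
r120 : ∀ P X → + 12 * (+ 12 * P + (+ 4 * P - + 8) - + 3 * (P + + 1) - (+ 4 * X + P + + 1)) ≡ + 4 * (((P - + 1) * + 6 + - X * + 2) * + 6)
r120 = ring
r121 : ∀ d → + 4 * (d * (+ 4 * + 6)) ≡ + 24 * (+ 4 * d)
r121 = ring
r122 : ∀ P X → + 24 * (+ 12 * P - (+ 4 * P - + 8) - + 3 * (P + + 1) + (+ 4 * X + P + + 1)) ≡ + 4 * (((P + + 1) * + 6 + X * + 4) * + 6)
r122 = ring
r123 : ∀ a → + 4 * (a * + 3) ≡ + 6 * (+ 2 * a)
r123 = ring
r124 : ∀ P → + 6 * (+ 6 * P - + 6 + (+ 2 * P - + 10)) ≡ + 4 * ((+ 2 * P - + 4) * + 6)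
r124 = ring
r125 : ∀ P → + 6 * (+ 6 * P - + 6 - (+ 2 * P - + 10)) ≡ + 4 * ((P + + 1) * + 6)
r125 = ring
r126 : ∀ c → + 4 * (c * + 3) ≡ + 3 * (+ 4 * c)
r126 = ring
r127 : ∀ P → + 3 * (+ 12 * P + (+ 4 * P - + 8) - (+ 6 * P - + 6) - (+ 2 * P - + 10)) ≡ + 4 * ((P + + 1) * + 6)
r127 = ring
r128 : ∀ c → + 4 * (c * + 6) ≡ + 6 * (+ 4 * c)
r128 = ring
r129 : ∀ P → + 6 * (+ 12 * P - (+ 4 * P - + 8) - (+ 6 * P - + 6) + (+ 2 * P - + 10)) ≡ + 4 * ((P + + 1) * + 6)
r129 = ring
r130 : ∀ x y → x * x + + 3 * y * y ≡ x * x + + 3 * (y * y)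
r130 = ring
r131 : ∀ u v w → u + u ≡ u + w - v + (u + v - w)
r131 = ring
r132 : ∀ u v w → v + v ≡ v + w - u + (u + v - w)
r132 = ring
r133 : ∀ u v w → w + w ≡ v + w - u + (u + w - v)
r133 = ring
r134 : ∀ u v w → u + w - v ≡ w + u - v
r134 = ring
r135 : ∀ u v → + 4 * v * u ≡ + 4 * u * v
r135 = ring
r136 : ∀ B P t x → B - x ≡ B - P - P - t + (P - x) + t + P
r136 = ring
r137 : ∀ x → - (+ 1) * x ≡ - x
r137 = ring
r138 : ∀ x → x - + 3 * + 0 ≡ x
r138 = ring
r139 : ∀ p a b c → a + b - c - p ≡ - (p - a - b + c)
r139 = ring
r140 : ∀ z τ → τ ≡ z + τ - z
r140 = ring
r141 : ∀ ε x → ε * (ε * x) ≡ ε * ε * x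
r141 = ring
r142 : ∀ a s → a ≡ a - s + s
r142 = ring
r143 : ∀ d τ → + 2 * d - τ + τ ≡ d + d
r143 = ring
r144 : ∀ u v w h → + 4 * (w * h + + 1 * ((v - h) * (u - h))) ≡ + 4 * u * v - (u + v - w) * (u + v - w) + (h + h - (u + v - w)) * (h + h - (u + v - w))
r144 = ring
r145 : ∀ P τ → + 4 * P - τ * τ + τ * τ ≡ + 4 * P
r145 = ring
r146 : ∀ K P x → K - x ≡ K - P - P - P + (P + P + P - x)
r146 = ring
r147 : ∀ P x → P + P + P - x ≡ P - x + (P + P)
r147 = ring
r148 : ∀ P x y z → P - y ≡ (x - + 1) * y + z + (- (+ 1)) * (x * y + z - P)
r148 = ring
r149 : ∀ P a b c d → P + + 1 - (a + b + c) ≡ a * (d - + 1) + (b - + 1) * (c - + 1) + (- (+ 1)) * (a * d + b * c - P)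
r149 = ring
r150 : ∀ K P x → K - x ≡ K - P - P - P + (P - x - + 1) + (P + P + + 1)
r150 = ring
r151 : ∀ P a b c d → a * (d - + 1) + (b - + 1) * (c - + 1) ≡ P + + 1 - (a + b + c) + (a * d + b * c - P)
r151 = ring
r152 : ∀ b → b - + 2 ≡ b - + 1 - + 1
r152 = ring
r153 : ∀ b → b - + 1 + + 1 ≡ b
r153 = ring
r154 : ∀ B K P n → B - P - P - n ≡ B - (K + K) + (K - P - P - P + (K - P - P - P)) + (P - n) + (P + (P + P))
r154 = ring
r155 : ∀ a b c → + 3 * a - b - c ≡ + 3 * a + - (+ 1) * b + - (+ 1) * c
r155 = ring
r156 : ∀ y → y * (+ 1 + + 1 + + 1) ≡ + 3 * y - + 0 - + 0
r156 = ring
r157 : ∀ y → y * (+ 1 + + 1 + + 0) ≡ + 3 * y - + 0 - y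
r157 = ring
r158 : ∀ y → y * (+ 1 + + 0 + + 1) ≡ + 3 * y - y - + 0
r158 = ring
r159 : ∀ y → y * (+ 1 + + 0 + + 0) ≡ + 3 * y - y - y
r159 = ring
r160 : ∀ k → k + k - + 0 + + 6 - + 0 ≡ k + k + + 6
r160 = ring
r161 : ∀ f a b c e → f * (a + b - c + + 6 - e) + f * (a + b - c + + 6 - e) ≡ + 2 * (f * a + f * b) - + 2 * (f * c) + + 12 * f - + 2 * (f * e)
r161 = ring
r162 : ∀ a b c d → + 2 * a - + 2 * b + + 12 * c - + 2 * d ≡ + 2 * a + - (+ 2) * b + + 12 * c + - (+ 2) * d
r162 = ring
r163 : ∀ h → + 2 * h - + 1 ≡ h + h - + 1
r163 = ring
r164 : ∀ b → b + b - + 1 ≡ b - + 1 + (b - + 1) + + 1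
r164 = ring
r165 : ∀ a b h d → a * d + (b + b) * h ≡ a * d + b * (h + h)
r165 = ring
r166 : ∀ a h c d → a * d + h * (c + c) ≡ a * d + (h + h) * c
r166 = ring
r167 : ∀ x y z → + 2 * x - (+ 3 * y + z) ≡ + 2 * x - + 3 * y - z + + 0
r167 = ring
r168 : ∀ x y → x - - y ≡ x + y + + 0
r168 = ring
r169 : ∀ x → x ≡ x + + 0 + + 0
r169 = ring
r170 : ∀ x → x ≡ + 0 + x + + 0
r170 = ring
r171 : ∀ x → x ≡ + 0 + + 0 + x
r171 = ring
r172 : ∀ x y → x + x + y ≡ + 2 * x + y
r172 = ring
r173 : ∀ a b → a - b + b ≡ a
r173 = ring
r174 : ∀ x y z w m → z - w - (x - y) ≡ y + m + z - (x + m + w)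
r174 = ring
r175 : ∀ x y f a c → + 2 * x + f * a - (+ 2 * y + c) ≡ + 2 * (x - y) + f * a - c
r175 = ring
r176 : ∀ P f0 f1 fp s → + 2 * ((P - + 1) * f1 - s) + f0 * ((P - + 1) * + 1) - (P - + 1) * fp ≡ (P - + 1) * f0 + + 2 * ((P - + 1) * f1) - + 2 * s - (P - + 1) * fp
r176 = ring
r177 : ∀ x → - x ≡ - (+ 1) * x
r177 = ring
r178 : ∀ F a b → + 4 * (F * (a * b)) ≡ F * ((+ 2 * a) * (+ 2 * b))
r178 = ring
r179 : ∀ F s d t e → F * ((+ 1 + s - d) * (+ 1 + t - e)) ≡ F * + 1 + F * s + F * t + F * (s * t) + - (+ 1) * (F * d) + - (+ 1) * (F * e) + F * (d * e) + - (+ 1) * (F * (d * t)) + - (+ 1) * (F * (e * s))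
r179 = ring
r180 : ∀ s → - (+ 1) ≡ s - + 1 + (s - + 1) + + 1 + (- (+ 1)) * (s - - s)
r180 = ring
r181 : ∀ j → + 1 + (+ 1 + (j + j)) ≡ + 2 * (+ 1 + j)
r181 = ring
r182 : ∀ x t → x * x + + 4 * (t * t) - - x * - x ≡ + 4 * (t * t)
r182 = ring
r183 : ∀ x → x + - x ≡ + 0
r183 = ring
r184 : ∀ t y → t * t + + 4 * (y * y) - (+ 2 * y) * (+ 2 * y) ≡ t * t
r184 = ring
r185 : ∀ y → + 2 * y - + 2 * y ≡ + 0
r185 = ring
r186 : ∀ s → + 2 * s * (+ 2 * s) ≡ + 4 * (s * s)
r186 = ring
r187 : ∀ c a b e → - (- (+ 2) * (c * (+ 2 * a + e))) - + 2 * (c * (+ 2 * b + e)) ≡ + 4 * (c * (a - b))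
r187 = ring
r188 : ∀ m s → m - s ≡ m - s * s + (s * s - s)
r188 = ring
r189 : ∀ m x → m - x ≡ m - + 3 * x + (+ 2 * (x - + 1) + + 2)
r189 = ring
r190 : ∀ y t → + 3 * (y * y + + 3 * (t * t)) ≡ + 3 * t * (+ 3 * t) + + 3 * (y * y)
r190 = ring
r191 : ∀ a y → + 3 * y * (+ 3 * y) + + 3 * (a * a) ≡ + 3 * (a * a + + 3 * (y * y))
r191 = ring
r192 : ∀ b t → + 3 * (b * t) ≡ b * (+ 3 * t)
r192 = ring
r193 : ∀ b c → b * (+ 3 * c) ≡ + 3 * (b * c)
r193 = ring
r194 : ∀ c → + 3 * c - + 1 ≡ + 3 * (c - + 1) + + 2
r194 = ring
r196 : ∀ i x → x ≡ i * i + x - i * i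
r196 = ring
r197 : ∀ i n → i * i + (n - i * i) ≡ n
r197 = ring
r198 : ∀ k c w → k * c * w ≡ k * w * c
r198 = ring
r199 : ∀ x i → x - (x - i * i) - + 1 ≡ i * i - + 1
r199 = ring
r200 : ∀ w → + 0 - + 2 * (w * + 0) ≡ + 0
r200 = ring
r201 : ∀ k t → k - t ≡ + 1 + k - + 3 * t + (+ 2 * (t - + 1) + + 1)
r201 = ring
r202 : ∀ i d e y P → i * i + + 3 * (y * y) ≡ i * i + d * e + + 3 * (y * y) - d * e
r202 = ring
r203 : ∀ P y → P - + 3 * (y * y) + + 3 * (y * y) ≡ P
r203 = ring
r204 : ∀ i d e y → i * i + d * e ≡ i * i + + 3 * (y * y) + d * e - + 3 * (y * y)
r204 = ring
r205 : ∀ P d e y → P - d * e + d * e - + 3 * (y * y) ≡ P - + 3 * (y * y)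
r205 = ring
r206 : ∀ k c → k * c * + 1 ≡ c * k * + 1
r206 = ring
r207 : ∀ c k o r → c * k * (+ 2 * o) * r ≡ c * k * (+ 2 * (o * r))
r207 = ring
r208 : ∀ a b o k → a * b * o * k ≡ a * k * o * b
r208 = ring
r209 : ∀ m P a d → m - (P - a * d) ≡ m - P + ((a - + 1) * (d - + 1) + (a - + 1) + (d - + 1) + + 1)
r209 = ring
r210 : ∀ K P y → K - (P - + 3 * (y * y)) ≡ K - P + + 3 * (y * y)
r210 = ring
r211 : ∀ x y → x * x + + 3 * (- y * - y) ≡ x * x + + 3 * (y * y)
r211 = ring
r212 : ∀ x y → - x * - x + + 3 * (y * y) ≡ x * x + + 3 * (y * y)
r212 = ring
r213 : ∀ x y → - x * - x + + 3 * (- y * - y) ≡ x * x + + 3 * (y * y)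
r213 = ring
r214 : ∀ u → + 3 * u + + 3 * u ≡ + 6 * (+ 2 + u) - + 12
r214 = ring
r215 : ∀ t → + 2 * t + + 1 + (+ 2 * t + + 1 + (+ 2 * t + + 1 + (+ 2 * t + + 1 + + 0))) + + 0 - + 12 ≡ + 4 * t - + 4 + (+ 4 * t - + 4)
r215 = ring
r216 : ∀ P s → + 3 * ((P - + 1) + + 2 * ((P - + 1) * + 0) - + 2 * s - (P - + 1) * + 0) ≡ + 3 * (P - + 1) - + 2 * (+ 3 * s)
r216 = ring
r217 : ∀ x → + 6 * x ≡ + 3 * (+ 2 * x)
r217 = ring
r218 : ∀ P → + 3 * (P - + 1) - + 2 * (P - + 1) + + 6 * (P - + 1 + (P - + 2)) * + 0 + + 18 + + 8 * (P - + 1) + + 0 - + 0 ≡ + 3 * (+ 3 * (P + + 1))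
r218 = ring
r219 : ∀ u q → + 3 * (+ 3 * u + q) ≡ + 3 * (+ 3 * u) + + 3 * q
r219 = ring
r220 : ∀ X P → + 3 * (+ 4 * X - + 4) + (+ 3 * (P - + 1) - + 2 * + 0) + + 6 * (P - + 1 + (P - + 2)) * + 0 + + 18 + + 8 * + 0 + + 0 - + 0 ≡ + 3 * (+ 4 * X + P + + 1)
r220 = ring
r221 : ∀ P → - (+ 2) * (+ 3 * (P - + 1) - + 2 * (+ 1 * (P - + 1) + - (+ 1))) + + 6 * (P - + 1 + (P - + 2)) * + 1 + + 18 + + 8 * (+ 1 * P + - (+ 2)) + + 0 - + 0 ≡ + 3 * (+ 6 * P - + 6)
r221 = ring
r222 : ∀ P → - (+ 2) * (+ 3 * (P - + 1) - + 2 * - (+ 3)) + + 6 * (P - + 1 + (P - + 2)) * + 1 + + 18 + + 8 * - (+ 3) + + 0 - + 0 ≡ + 3 * (+ 2 * P - + 10)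
r222 = ring
r223 : ∀ a b c d → a + b + + 2 * c + + 2 * d ≡ + 1 * a + (+ 1 * b + (+ 1 * c + (+ 1 * d + (+ 1 * c + + 1 * d))))
r223 = ring
r224 : ∀ a b c d → a - b + + 2 * c - + 2 * d ≡ + 1 * a + (- (+ 1) * b + (+ 1 * c + (- (+ 1) * d + (+ 1 * c + - (+ 1) * d))))
r224 = ring
r225 : ∀ a b c d → a + b ≡ + 1 * a + (+ 1 * b + (+ 0 * c + (+ 0 * d + (+ 0 * c + + 0 * d))))
r225 = ring
r226 : ∀ a b c d → a - b ≡ + 1 * a + (- (+ 1) * b + (+ 0 * c + (+ 0 * d + (+ 0 * c + + 0 * d))))
r226 = ring
r227 : ∀ a b → + 2 * a ≡ a + b + (a - b)
r227 = ring
r228 : ∀ a b → + 2 * b ≡ a + b - (a - b)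
r228 = ring
r229 : ∀ a b c d → + 4 * c ≡ (a + b + + 2 * c + + 2 * d) + (a - b + + 2 * c - + 2 * d) - (a + b) - (a - b)
r229 = ring
r230 : ∀ a b c d → + 4 * d ≡ (a + b + + 2 * c + + 2 * d) - (a - b + + 2 * c - + 2 * d) - (a + b) + (a - b)
r230 = ring
r231 : ∀ P → P - + 2 ≡ P - + 5 + + 3
r231 = ring
r232 : ∀ P → + 3 * P - P - P - P ≡ + 0
r232 = ring
r233 : ∀ h → h + h + + 0 ≡ + 2 * h
r233 = ring
r234 : ∀ h → + 4 * (h * h) ≡ (h + h + + 0) * (h + h + + 0)
r234 = ring
r235 : ∀ h P → (+ 2 * (h * h) + + 2 * h - + 2 * P) + (+ 2 * (h * h) + + 2 * h - + 2 * P) + + 1 ≡ (h + h + + 1) * (h + h + + 1) - + 4 * P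
r235 = ring
r236 : ∀ P s → - (+ 4 * P - s * s) - + 1 ≡ (s - (P + + 1)) * (s - (P + + 1) + + 2 * (P + + 1)) + (P - + 2) * (P - + 2) + + 2 * (P - + 2)
r236 = ring
r237 : ∀ x y → y - x + x ≡ y
r237 = ring
r238 : ∀ a b c d → a + b + (c + d) ≡ a + c + (b + d)
r238 = ring
r239 : ∀ a b → a - b ≡ a + (- (+ 1)) * b
r239 = ring
r240 : ∀ x y → - (+ 1) ≡ (+ 2 * x + y) * (+ 2 * x + y) + + 3 * ((- (+ 1 - y) - + 1) * (- (+ 1 - y) - + 1)) + + 12 * (- (+ 1 - y) - + 1) + + 7 + (- (+ 4)) * ((x * x + x * y + y * y) - + 1)
r240 = ring
r241 : ∀ γ δ → + 0 * δ - + 0 * γ ≡ + 0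
r241 = ring
r242 : ∀ α β → α * + 0 - β * + 0 ≡ + 0
r242 = ring
r243 : ∀ α β γ δ → α * δ - β * γ ≡ (α - γ) * δ - (β - δ) * γ
r243 = ring
r244 : ∀ u v w → u + v + w ≡ + 2 * u + + 2 * v + (w - u - v)
r244 = ring
r245 : ∀ p q r → - p ≡ - (p + q + r) + (q + r)
r245 = ring
r246 : ∀ p q r → - q ≡ - (p + q + r) + (p + r)
r246 = ring
r247 : ∀ p q r → - r ≡ - (p + q + r) + (p + q)
r247 = ring
r248 : ∀ u v w → u * (+ 1) * (+ 1) + (w - u - v) * (+ 1) * (+ 0) + v * (+ 0) * (+ 0) ≡ u
r248 = ring
r249 : ∀ u v w → + 2 * u * (+ 1) * (+ 0) + (w - u - v) * ((+ 1) * (+ 1) + (+ 0) * (+ 0)) + + 2 * v * (+ 0) * (+ 1) ≡ w - u - v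
r249 = ring
r250 : ∀ u v w → u * (+ 0) * (+ 0) + (w - u - v) * (+ 0) * (+ 1) + v * (+ 1) * (+ 1) ≡ v
r250 = ring
r251 : ∀ u v w → u * (+ 1) * (+ 1) + (w - u - v) * (+ 1) * (- (+ 1)) + v * (- (+ 1)) * (- (+ 1)) ≡ (+ 2 * u + + 2 * v - w)
r251 = ring
r252 : ∀ u v w → + 2 * u * (+ 1) * (+ 0) + (w - u - v) * ((+ 1) * (+ 1) + (+ 0) * (- (+ 1))) + + 2 * v * (- (+ 1)) * (+ 1) ≡ u - (+ 2 * u + + 2 * v - w) - v
r252 = ring
r253 : ∀ u v w → u * (+ 0) * (+ 0) + (w - u - v) * (+ 0) * (- (+ 1)) + v * (- (+ 1)) * (- (+ 1)) ≡ v
r253 = ring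
r254 : ∀ u v w → + 2 * u * (+ 0) * (+ 1) + (w - u - v) * ((+ 0) * (+ 0) + (+ 1) * (- (+ 1))) + + 2 * v * (- (+ 1)) * (+ 0) ≡ (+ 2 * u + + 2 * v - w) - v - u
r254 = ring
r255 : ∀ u v w → + 2 * u * (+ 0) * (+ 1) + (w - u - v) * ((+ 0) * (+ 1) + (+ 1) * (- (+ 1))) + + 2 * v * (- (+ 1)) * (+ 1) ≡ u - v - w
r255 = ring
r256 : ∀ u v w → u * (+ 1) * (+ 1) + (w - u - v) * (+ 1) * (+ 1) + v * (+ 1) * (+ 1) ≡ w
r256 = ring
r257 : ∀ u v w → u * (- (+ 1)) * (- (+ 1)) + (w - u - v) * (- (+ 1)) * (+ 0) + v * (+ 0) * (+ 0) ≡ u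
r257 = ring
r258 : ∀ u v w → + 2 * u * (- (+ 1)) * (+ 0) + (w - u - v) * ((- (+ 1)) * (- (+ 1)) + (+ 0) * (+ 0)) + + 2 * v * (+ 0) * (- (+ 1)) ≡ w - u - v
r258 = ring
r259 : ∀ u v w → u * (- (+ 1)) * (- (+ 1)) + (w - u - v) * (- (+ 1)) * (+ 1) + v * (+ 1) * (+ 1) ≡ (+ 2 * u + + 2 * v - w)
r259 = ring
r260 : ∀ u v w → + 2 * u * (- (+ 1)) * (+ 0) + (w - u - v) * ((- (+ 1)) * (- (+ 1)) + (+ 0) * (+ 1)) + + 2 * v * (+ 1) * (- (+ 1)) ≡ u - (+ 2 * u + + 2 * v - w) - v
r260 = ring
r261 : ∀ u v w → + 2 * u * (+ 0) * (- (+ 1)) + (w - u - v) * ((+ 0) * (+ 0) + (- (+ 1)) * (+ 1)) + + 2 * v * (+ 1) * (+ 0) ≡ (+ 2 * u + + 2 * v - w) - v - u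
r261 = ring
r262 : ∀ u v w → + 2 * u * (+ 0) * (- (+ 1)) + (w - u - v) * ((+ 0) * (- (+ 1)) + (- (+ 1)) * (+ 1)) + + 2 * v * (+ 1) * (- (+ 1)) ≡ u - v - w
r262 = ring
r263 : ∀ u v w → u * (- (+ 1)) * (- (+ 1)) + (w - u - v) * (- (+ 1)) * (- (+ 1)) + v * (- (+ 1)) * (- (+ 1)) ≡ w
r263 = ring
r264 : ∀ u v w → + 2 * u * (+ 1) * (- (+ 1)) + (w - u - v) * ((+ 1) * (+ 0) + (- (+ 1)) * (+ 1)) + + 2 * v * (+ 1) * (+ 0) ≡ v - w - u
r264 = ring
r265 : ∀ u v w → + 2 * u * (+ 1) * (- (+ 1)) + (w - u - v) * ((+ 1) * (+ 1) + (- (+ 1)) * (+ 0)) + + 2 * v * (+ 0) * (+ 1) ≡ v - u - (+ 2 * u + + 2 * v - w)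
r265 = ring
r266 : ∀ u v w → + 2 * u * (- (+ 1)) * (+ 1) + (w - u - v) * ((- (+ 1)) * (+ 0) + (+ 1) * (- (+ 1))) + + 2 * v * (- (+ 1)) * (+ 0) ≡ v - w - u
r266 = ring
r267 : ∀ u v w → + 2 * u * (- (+ 1)) * (+ 1) + (w - u - v) * ((- (+ 1)) * (- (+ 1)) + (+ 1) * (+ 0)) + + 2 * v * (+ 0) * (- (+ 1)) ≡ v - u - (+ 2 * u + + 2 * v - w)
r267 = ring
r268 : ∀ u v w n → n - (v + u + (+ 2 * u + + 2 * v - w)) ≡ (+ 1 + n) - (u + v + w) + ((- (u + v - w) - + 1) + (- (u + v - w) - + 1)) + + 1
r268 = ring
r269 : ∀ x y z u → x * y + y * z + z * x - u ≡ (x - + 1) * (y + z) + y * z + u + (- (+ 1)) * (u + u - (y + z))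
r269 = ring
r270 : ∀ z → + 0 * + 0 + + 0 * z + z * + 0 - + 1 ≡ - (+ 1)
r270 = ring
r271 : ∀ y → + 0 * y + y * + 0 + + 0 * + 0 - + 1 ≡ - (+ 1)
r271 = ring
r272 : ∀ y z u → + 0 * y + y * z + z * + 0 - u + (+ 0 * y + y * z + z * + 0 - u) ≡ + 0 * y + y * z + z * + 0 - + 1 + (y - + 1) * (z - + 1) + (- (+ 1)) * (u + u - (y + z))
r272 = ring
r273 : ∀ a → a + a - a - a ≡ + 0
r273 = ring
r274 : ∀ a → a + (a + a) - a - + 1 ≡ a - + 1 + (a - + 1) + + 1
r274 = ring
r275 : ∀ a → a + a - (a + a) ≡ + 0
r275 = ring
r276 : ∀ a → a ≡ a + a - a
r276 = ring
r277 : ∀ a → a + a - a - + 1 ≡ a - + 1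
r277 = ring
r278 : ∀ u b v x → u * x * x + b * x * + 0 + v * + 0 * + 0 - + 1 ≡ (u - + 1) * (x * x) + (x * x - + 1)
r278 = ring
r279 : ∀ u b v x y D → + 4 * (u * (u * x * x + b * x * y + v * y * y)) - + 1 ≡ (+ 2 * u * x + b * y) * (+ 2 * u * x + b * y) + (D - + 1) * (y * y - + 1) + (D - + 1) + (y * y - + 1) + (- (y * y)) * (D - (+ 4 * u * v - b * b))
r279 = ring
r280 : ∀ P t z u v → + 4 * (P - u * v) ≡ (t - z) * (t + z) + (- (+ 1)) * (+ 4 * u * v - z * z - (+ 4 * P - t * t))
r280 = ring
r281 : ∀ u v w → w + u - v ≡ u + w - v
r281 = ring
r282 : ∀ u v w → v + u - w ≡ u + v - w
r282 = ring
r283 : ∀ u v w → w + v - u ≡ v + w - u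
r283 = ring
r284 : ∀ u v w → - v + - w - - u ≡ - (v + w - u)
r284 = ring
r285 : ∀ u v w → - u + - w - - v ≡ - (u + w - v)
r285 = ring
r286 : ∀ u v w → - u + - v - - w ≡ - (u + v - w)
r286 = ring
r287 : ∀ x → + 6 * x ≡ (x + x + x) + (x + x + x)
r287 = ring
r288 : ∀ u v w → + 2 * v + + 2 * u - (+ 2 * u + + 2 * v - w) ≡ w
r288 = ring
r289 : ∀ B P t u v w → B - w ≡ B - P - P - t + (P - u) + (P - v) + (t + (u + v - w))
r289 = ring
r290 : ∀ B P t u v w → B + w ≡ B - P - P - t + (t - (u + v - w)) + (u - + 1 + (v - + 1)) + (P - + 1 + (P - + 1)) + + 4
r290 = ring
r291 : ∀ m → - (+ 1) ≡ m - + 1 + (m - + 1) + + 2 + (- (+ 1)) * (m + m + + 1 - + 0)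
r291 = ring
r292 : ∀ m → - (+ 1) ≡ - m - + 1 + (- m - + 1) + + 0 + + 1 * (m + m + + 1 - + 0)
r292 = ring
r293 : ∀ P z u v h → (+ 2 * h * h + + 2 * h - + 2 * h * z - z - + 2 * (P - u * v)) + (+ 2 * h * h + + 2 * h - + 2 * h * z - z - + 2 * (P - u * v)) + + 1 ≡ (z + (h + h + + 1 - z)) * ((h + h + + 1 - z) - z) - + 4 * (P - u * v)
r293 = ring
r294 : ∀ P τ z u v → (z + τ) * (τ - z) - + 4 * (P - u * v) ≡ + 4 * u * v - z * z - (+ 4 * P - τ * τ)
r294 = ring
r295 : ∀ a b c d ε → d + ε * c + (d + ε * b) - a ≡ + 2 * d - (a - ε * (b + c))
r295 = ring
r296 : ∀ a b c d ε → d + ε * b + a - (d + ε * c) ≡ a - ε * (b + c) + + 2 * (ε * b)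
r296 = ring
r297 : ∀ a b c d ε → d + ε * c + a - (d + ε * b) ≡ a - ε * (b + c) + + 2 * (ε * c)
r297 = ring
r298 : ∀ b c d ε τ → + 4 * (d + ε * c) * (d + ε * b) - (+ 2 * d - τ) * (+ 2 * d - τ) ≡ + 4 * (d * (τ + ε * (b + c)) + ε * ε * (b * c)) - τ * τ
r298 = ring
r299 : ∀ a b c d τ → + 4 * (d * a + + 1 * (b * c)) - τ * τ ≡ + 4 * (a * d + b * c) - τ * τ
r299 = ring
r300 : ∀ h u → h + (u - h) ≡ u
r300 = ring
r301 : ∀ u v w h ε → w * h + ε * (v - h) * (ε * (u - h)) ≡ w * h + ε * ε * ((v - h) * (u - h))
r301 = ring
r302 : ∀ u v w h ε → w - ε * (ε * (v - h) + ε * (u - h)) ≡ w - ε * ε * (v - h + (u - h))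
r302 = ring
r303 : ∀ u v w h → w - + 1 * (v - h + (u - h)) ≡ h + h - (u + v - w)
r303 = ring
r304 : ∀ P x y z → P - y - + 1 ≡ (x - + 1) * y + (z - + 1) + (- (+ 1)) * (x * y + z - P)
r304 = ring
r305 : ∀ x y → x * y - + 1 ≡ (x - + 1) * (y - + 1) + (x - + 1 + (y - + 1))
r305 = ring
r306 : ∀ a b c → a + b + c - + 3 ≡ a - + 1 + (b - + 1) + (c - + 1)
r306 = ring
r307 : ∀ s t → - (+ 1) ≡ s - + 3 + - t + + 2 + (- (+ 1)) * (s - t)
r307 = ring
r308 : ∀ P a b c → P - (a - b - c) ≡ P - a - + 1 + (b - + 1) + (c - + 1) + + 3
r308 = ring
r309 : ∀ P a b c → P + (a - b - c) ≡ P + + 1 - (a + b + c) + (a - + 1 + (a - + 1)) + + 1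
r309 = ring
r310 : ∀ x → x ≡ x - + 3 + + 3
r310 = ring
r311 : ∀ k → k ≡ + 2 + k - + 2
r311 = ring
r312 : ∀ k → + 1 + k ≡ + 2 + k - + 1
r312 = ring
r313 : ∀ K P → K - (P - + 1) ≡ K - P - P - P + (P + P) + + 1
r313 = ring
r314 : ∀ s x y → + 3 * (s + x) - s - (+ 0 + y) ≡ + 2 * (s + x) + x - y
r314 = ring
r315 : ∀ P → + 0 - P + (P - + 2) + + 1 ≡ - (+ 1)
r315 = ring
r316 : ∀ f0 k0 d t s fp f1 → f0 * (k0 + k0 + + 6) + (+ 2 * d - + 2 * t + + 12 * s - + 2 * (+ 2 * s + fp - f1)) ≡ + 2 * (f0 * k0 + d) - + 2 * t + + 6 * f0 + + 8 * s + + 2 * f1 - + 2 * fp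
r316 = ring
r317 : ∀ d t fe n f0 s f1 fp → + 2 * d - + 2 * (t - fe * n) + + 6 * f0 + + 8 * s + + 2 * f1 - + 2 * fp ≡ + 2 * d - + 2 * t + + 2 * n * fe + + 6 * f0 + + 8 * s + + 2 * f1 - + 2 * fp
r317 = ring
r318 : ∀ k → - (+ 1) ≡ + 3 * (k - + 1) + + 3 + (- (+ 1)) * (+ 3 * k + + 1 - + 0)
r318 = ring
r319 : ∀ k → - (+ 1) ≡ + 3 * (- k - + 1) + + 1 + + 1 * (+ 3 * k + + 1 - + 0)
r319 = ring
r320 : ∀ k → - (+ 1) ≡ + 3 * (k - + 1) + + 1 + (- (+ 1)) * (+ 3 * k - + 1 - + 0)
r320 = ring
r321 : ∀ k → - (+ 1) ≡ + 3 * (- k - + 1) + + 3 + + 1 * (+ 3 * k - + 1 - + 0)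
r321 = ring
r322 : ∀ k → - (k + k + + 1) ≡ (- k - + 1) + (- k - + 1) + + 1
r322 = ring
r323 : ∀ k → - (k + k + + 0) ≡ (- k - + 0) + (- k - + 0) + + 0
r323 = ring
r324 : ∀ a b c d → d * a + b * c ≡ a * d + b * c
r324 = ring
r325 : ∀ a b c d → a * d + c * b ≡ a * d + b * c
r325 = ring
r326 : ∀ x → + 8 * x ≡ (x + x) + (x + x) + ((x + x) + (x + x))
r326 = ring
r327 : ∀ x → x + - (+ 1) * x ≡ + 0
r327 = ring
r328 : ∀ s x y → s * (x - y) ≡ s * x - s * y
r328 = ring
r329 : ∀ a b c d → (a - b) * d + b * (c + d) ≡ a * d + b * c
r329 = ring
r330 : ∀ c d → c + d - d - + 1 ≡ c - + 1
r330 = ring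
r331 : ∀ c d → c + d - d ≡ c
r331 = ring
r332 : ∀ a b c d → (a + b) * d + b * (c - d) ≡ a * d + b * c
r332 = ring
r333 : ∀ x y z → - x * - x + + 4 * (- y * - y) - - z * - z ≡ x * x + + 4 * (y * y) - z * z
r333 = ring
r334 : ∀ a b c e → - a * b * c * e ≡ - (a * b * c * e)
r334 = ring
r335 : ∀ a b c e → a * - b * c * e ≡ - (a * b * c * e)
r335 = ring
r336 : ∀ a b c e → - a * - b * - c * e ≡ - (a * b * c * e)
r336 = ring
r337 : ∀ x z → - x + - z ≡ - (x + z)
r337 = ring
r338 : ∀ a b → - a * - b ≡ a * b
r338 = ring
r339 : ∀ x y → + 0 + - (+ 1) * x + - (+ 1) * y ≡ - x - y
r339 = ring
r340 : ∀ m k → + 1 + m - (+ 1 + k) ≡ m - k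
r340 = ring
r341 : ∀ y → y * (+ 1 + + 1) ≡ y + y
r341 = ring
r342 : ∀ y → y * (+ 1 + + 0) ≡ + 0 + y
r342 = ring
r343 : ∀ y → y * (+ 1 + - (+ 1)) ≡ + 0 + + 0
r343 = ring
r344 : ∀ m k → m - (+ 1 + k) ≡ m - k - + 1
r344 = ring
r345 : ∀ F s → F * (+ 0 * s) ≡ + 0
r345 = ring
r346 : ∀ h → + 4 * (h * h) ≡ (h + h) * (h + h)
r346 = ring
r347 : ∀ h → h + h ≡ + 2 * h
r347 = ring
r349 : ∀ m n i d e → m - i ≡ m - n + (i * i - i) + ((d - + 1) * (e - + 1) + (d - + 1) + (e - + 1) + + 1) + - (+ 1) * (i * i + d * e - n)
r349 = ring
r350 : ∀ m n i d e → m + i ≡ m - n + (i * i + i) + ((d - + 1) * (e - + 1) + (d - + 1) + (e - + 1) + + 1) + - (+ 1) * (i * i + d * e - n)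
r350 = ring
r351 : ∀ m n i d e → m - d ≡ m - n + i * i + ((d - + 1) * (e - + 1) + (e - + 1)) + - (+ 1) * (i * i + d * e - n)
r351 = ring
r352 : ∀ m n i d e → m - e ≡ m - n + i * i + ((d - + 1) * (e - + 1) + (d - + 1)) + - (+ 1) * (i * i + d * e - n)
r352 = ring
r353 : ∀ m d → m + d ≡ m - d + + 2 * (d - + 1) + + 2
r353 = ring
r354 : ∀ b m i e → b - (e - + 2 * i) ≡ b - + 6 * m + (m - e) + + 2 * (m + i) + + 3 * m
r354 = ring
r355 : ∀ b m i e → b + (e - + 2 * i) ≡ b - + 6 * m + (m + e) + + 2 * (m - i) + + 3 * m
r355 = ring
r356 : ∀ b m i d → b - (d + i) ≡ b - + 6 * m + (m - d) + (m - i) + + 4 * m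
r356 = ring
r357 : ∀ b m i d → b + (d + i) ≡ b - + 6 * m + (m + d) + (m + i) + + 4 * m
r357 = ring
r358 : ∀ b m i d e → b - (+ 2 * (d + i) - e) ≡ b - + 6 * m + + 2 * (m - d) + + 2 * (m - i) + (m + e) + m
r358 = ring
r359 : ∀ b m i d e → b + (+ 2 * (d + i) - e) ≡ b - + 6 * m + + 2 * (m + d) + + 2 * (m + i) + (m - e) + m
r359 = ring
r360 : ∀ i d e → (e - + 2 * i) * (e - + 2 * i) + + 4 * ((d + i) * (d + i)) - (+ 2 * (d + i) - e) * (+ 2 * (d + i) - e) ≡ + 4 * (i * i + d * e)
r360 = ring
r361 : ∀ i d e → e - + 2 * i + (+ 2 * (d + i) - e) - + 1 ≡ d - + 1 + (d - + 1) + + 1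
r361 = ring
r362 : ∀ i d e → + 2 * (d + i) - (+ 2 * (d + i) - e) - + 1 ≡ e - + 1
r362 = ring
r363 : ∀ i d e → e - + 2 * i + (+ 2 * (d + i) - e) ≡ d + d
r363 = ring
r364 : ∀ i d e → + 2 * (d + i) - (+ 2 * (d + i) - e) ≡ e
r364 = ring
r365 : ∀ y z h → + 4 * ((y - h) * (y - h) + h * (+ 2 * y - z)) ≡ (h + h - z) * (h + h - z) + + 4 * (y * y) - z * z
r365 = ring
r366 : ∀ h → h - + 1 + (h - + 1) + + 1 ≡ h + h - + 1
r366 = ring
r367 : ∀ y z h → + 2 * y - z - + 2 * (y - h) ≡ h + h - z
r367 = ring
r368 : ∀ y h → h + (y - h) ≡ y
r368 = ring
r369 : ∀ y z h → + 2 * (h + (y - h)) - (+ 2 * y - z) ≡ z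
r369 = ring
r370 : ∀ F → F * (+ 1 * + 1) ≡ F
r370 = ring
r371 : ∀ F → F * (+ 1 * + 0) ≡ + 0
r371 = ring
r372 : ∀ i d e → - i * - i + d * e ≡ i * i + d * e
r372 = ring
r373 : ∀ i d e → i * i + d * e ≡ - i * - i + d * e
r373 = ring
r374 : ∀ s → + 4 * s ≡ (s + s) + (s + s)
r374 = ring
r375 : ∀ a y x → - (+ 1) ≡ a * a + + 3 * (y * y) + (- x - + 1) + - (+ 1) * (a * a + + 3 * (y * y) - x)
r375 = ring
r376 : ∀ b c x → - (+ 1) ≡ (b - + 1) * (c - + 1) + (b - + 1) + (c - + 1) + - x + - (+ 1) * (b * c - x)
r376 = ring
r377 : ∀ a y → - (a * a) ≡ + 3 * (y * y) + - (+ 1) * (a * a + + 3 * (y * y) - + 0)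
r377 = ring
r378 : ∀ a y → - (y * y) + - (y * y) ≡ a * a + y * y + - (+ 1) * (a * a + + 3 * (y * y) - + 0)
r378 = ring
r379 : ∀ m x a y → m - a ≡ m - x + (a * a - a) + + 3 * (y * y) + - (+ 1) * (a * a + + 3 * (y * y) - x)
r379 = ring
r380 : ∀ m x a y → m + a ≡ m - x + (a * a + a) + + 3 * (y * y) + - (+ 1) * (a * a + + 3 * (y * y) - x)
r380 = ring
r381 : ∀ m x a y → m - y ≡ m - x + (y * y - y) + (a * a + + 2 * (y * y)) + - (+ 1) * (a * a + + 3 * (y * y) - x)
r381 = ring
r382 : ∀ m x a y → m + y ≡ m - x + (y * y + y) + (a * a + + 2 * (y * y)) + - (+ 1) * (a * a + + 3 * (y * y) - x)
r382 = ring
r383 : ∀ m x b c → m - b ≡ m - x + ((b - + 1) * (c - + 1) + (c - + 1)) + - (+ 1) * (b * c - x)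
r383 = ring
r384 : ∀ m x b c → m - c ≡ m - x + ((b - + 1) * (c - + 1) + (b - + 1)) + - (+ 1) * (b * c - x)
r384 = ring
r385 : ∀ x → + 2 * x ≡ x + x
r385 = ring
r386 : ∀ i a y → a * a + + 3 * (y * y) ≡ i * i + a * a + + 3 * (y * y) - i * i
r386 = ring
r387 : ∀ i a y → i * i + a * a + + 3 * (y * y) ≡ i * i + (a * a + + 3 * (y * y))
r387 = ring
r388 : ∀ i a y → a * a + i * i + + 3 * (y * y) ≡ i * i + a * a + + 3 * (y * y)
r388 = ring
r389 : ∀ k a b → k * (a - + 2 * b) ≡ k * a + - (+ 2) * (k * b)
r389 = ring
r390 : ∀ x → + 0 - x + (x - + 1) ≡ - (+ 1)
r390 = ring
r391 : ∀ k x z → k - z ≡ + 1 + k - x + (x - z - + 1)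
r391 = ring
r392 : ∀ m x z → m - z ≡ m - x + (x - z - + 1) + + 1
r392 = ring
r393 : ∀ K P → K - P ≡ K - P - P - P + (P - + 2 + (P - + 2)) + + 4
r393 = ring
r394 : ∀ x → x ≡ + 0 + x
r394 = ring
r395 : ∀ u y P → u * u ≡ u * u + + 3 * (y * y) - + 3 * (y * y)
r395 = ring
r396 : ∀ a → + 6 * a ≡ + 3 * a + + 3 * a
r396 = ring
r397 : ∀ u → - - u - + 1 ≡ u - + 1
r397 = ring
r398 : ∀ a b n v z s o w → + 3 * (+ 2 * a - + 2 * b + + 2 * n * v + + 6 * z + + 8 * s + + 2 * o - + 2 * w) ≡ + 6 * (a - b) + + 6 * n * v + + 18 * z + + 8 * (+ 3 * s) + + 6 * o - + 6 * w
r398 = ring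
r399 : ∀ P → + 6 * + 0 + + 6 * (P - + 1 + (P - + 2)) * + 1 + + 18 + + 8 * (+ 3 * P) + + 6 - + 6 ≡ + 3 * (+ 12 * P)
r399 = ring
r400 : ∀ P → + 6 * + 0 + + 6 * (P - + 1 + (P - + 2)) * + 1 + + 18 + + 8 * - (+ 3) + - (+ 6) - + 6 * - (+ 1) ≡ + 3 * (+ 4 * P - + 8)
r400 = ring
r401 : ∀ a b c d e f → a ≡ a * + 1 + (b * + 0 + (c * + 0 + (d * + 0 + (e * + 0 + f * + 0))))
r401 = ring
r402 : ∀ a b c d e f → b ≡ a * + 0 + (b * + 1 + (c * + 0 + (d * + 0 + (e * + 0 + f * + 0))))
r402 = ring
r403 : ∀ a b c d e f → c ≡ a * + 0 + (b * + 0 + (c * + 1 + (d * + 0 + (e * + 0 + f * + 0))))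
r403 = ring
r404 : ∀ a b c d e f → d ≡ a * + 0 + (b * + 0 + (c * + 0 + (d * + 1 + (e * + 0 + f * + 0))))
r404 = ring
r405 : ∀ a b c d e f → e ≡ a * + 0 + (b * + 0 + (c * + 0 + (d * + 0 + (e * + 1 + f * + 0))))
r405 = ring
r406 : ∀ a b c d e f → f ≡ a * + 0 + (b * + 0 + (c * + 0 + (d * + 0 + (e * + 0 + f * + 1))))
r406 = ring
r407 : ∀ s D → - (+ 1) ≡ s + (- D - + 1) + - (+ 1) * (s - D)
r407 = ring
r408 : ∀ a → - (- (+ 1 + a)) - + 1 ≡ a
r408 = ring
r409 : ∀ n → (+ 1 + n) - + 1 ≡ n
r409 = ring
r410 : ∀ c k l → c + k * (l - l) ≡ c
r410 = ring
r411 : ∀ x → x * + 0 - + 1 ≡ - (+ 1)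
r411 = ring
r412 : ∀ x y → x * y - + 1 + (x - + 1) * (- y - + 1) + (x - + 1 + (- y - + 1 + + 1)) ≡ - (+ 1)
r412 = ring
r413 : ∀ w u v → w - u - v + (u + v) ≡ w
r413 = ring
r414 : ∀ a b c α β γ δ x y → (a * α * α + b * α * γ + c * γ * γ) * x * x + (+ 2 * a * α * β + b * (α * δ + β * γ) + + 2 * c * γ * δ) * x * y + (a * β * β + b * β * δ + c * δ * δ) * y * y ≡ a * (α * x + β * y) * (α * x + β * y) + b * (α * x + β * y) * (γ * x + δ * y) + c * (γ * x + δ * y) * (γ * x + δ * y)
r414 = ring
r415 : ∀ a b c α β γ δ α′ β′ γ′ δ′ → + 2 * (a * α * α + b * α * γ + c * γ * γ) * α′ * β′ + (+ 2 * a * α * β + b * (α * δ + β * γ) + + 2 * c * γ * δ) * (α′ * δ′ + β′ * γ′) + + 2 * (a * β * β + b * β * δ + c * δ * δ) * γ′ * δ′ ≡ + 2 * a * (α * α′ + β * γ′) * (α * β′ + β * δ′) + b * ((α * α′ + β * γ′) * (γ * β′ + δ * δ′) + (α * β′ + β * δ′) * (γ * α′ + δ * γ′)) + + 2 * c * (γ * α′ + δ * γ′) * (γ * β′ + δ * δ′)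
r415 = ring
r416 : ∀ a b c → a * + 1 * + 1 + b * + 1 * + 0 + c * + 0 * + 0 ≡ a
r416 = ring
r417 : ∀ a b c → + 2 * a * + 1 * + 0 + b * (+ 1 * + 1 + + 0 * + 0) + + 2 * c * + 0 * + 1 ≡ b
r417 = ring
r418 : ∀ a b c → a * + 0 * + 0 + b * + 0 * + 1 + c * + 1 * + 1 ≡ c
r418 = ring
r419 : ∀ α β γ δ α′ β′ γ′ δ′ → (α * α′ + β * γ′) * (γ * β′ + δ * δ′) - (α * β′ + β * δ′) * (γ * α′ + δ * γ′) ≡ (α * δ - β * γ) * (α′ * δ′ - β′ * γ′)
r419 = ring
r420 : ∀ α β γ δ → δ * α - (- β) * (- γ) ≡ α * δ - β * γ
r420 = ring
r421 : ∀ α β γ δ → α * δ + β * (- γ) ≡ α * δ - β * γ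
r421 = ring
r422 : ∀ α β → α * (- β) + β * α ≡ + 0
r422 = ring
r423 : ∀ γ δ → γ * δ + δ * (- γ) ≡ + 0
r423 = ring
r424 : ∀ α β γ δ → γ * (- β) + δ * α ≡ α * δ - β * γ
r424 = ring
r425 : ∀ u v w → u * + 0 * + 0 + (w - u - v) * + 0 * (- (+ 1)) + v * (- (+ 1)) * (- (+ 1)) ≡ v
r425 = ring
r426 : ∀ u v w → + 2 * u * + 0 * + 1 + (w - u - v) * (+ 0 * + 1 + + 1 * (- (+ 1))) + + 2 * v * (- (+ 1)) * + 1 ≡ u - v - w
r426 = ring
r427 : ∀ u v w → u * + 1 * + 1 + (w - u - v) * + 1 * + 1 + v * + 1 * + 1 ≡ w
r427 = ring
r428 : ∀ u v w → + 2 * u * + 0 * + 1 + (w - u - v) * (+ 0 * + 0 + + 1 * (- (+ 1))) + + 2 * v * (- (+ 1)) * + 0 ≡ (+ 2 * u + + 2 * v - w) - v - u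
r428 = ring
r429 : ∀ u v w → u * + 1 * + 1 + (w - u - v) * + 1 * + 0 + v * + 0 * + 0 ≡ u
r429 = ring
r430 : ∀ y → y * y - + 1 ≡ (y - + 1) * (y - + 1) + (y - + 1 + (y - + 1))
r430 = ring
r431 : ∀ y → y * y - + 1 ≡ (- y - + 1) * (- y - + 1) + (- y - + 1 + (- y - + 1))
r431 = ring
r433 : ∀ x y → (+ 2 * x + y) * (+ 2 * x + y) + + 3 * (y * y - + 1) + + 4 * (- ((x * x + x * y + y * y) - + 1) - + 1) + + 2 ≡ - (+ 1)
r433 = ring
r434 : ∀ x → x * x + x * + 0 + + 0 * + 0 - + 1 ≡ x * x - + 1
r434 = ring
r435 : ∀ x → x ≡ x - + 1 + + 1
r435 = ring
r436 : ∀ u v w → + 2 * u + + 2 * v - w ≡ w + + 2 * (u + v - w)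
r436 = ring
r437 : ∀ w → w + + 2 * + 0 ≡ w
r437 = ring
r438 : ∀ a b → - (b - a) ≡ a - b
r438 = ring
r439 : ∀ n → - (+ 1 + n) + - (+ 1 + n) + + 1 + n + n ≡ - (+ 1)
r439 = ring
r440 : ∀ u v w → + 4 * (u * v) - + 1 ≡ + 4 * u * v - (u + v - w) * (u + v - w) - + 1 + (u + v - w) * (u + v - w)
r440 = ring
r441 : ∀ x → x + (- x - + 1) ≡ - (+ 1)
r441 = ring
r442 : ∀ u v w → v + w - u ≡ v + w - u
r442 = ring
r443 : ∀ u v w → w + u - v - + 1 ≡ u + w - v - + 1
r443 = ring
r444 : ∀ u v w → v + u - w - + 1 ≡ u + v - w - + 1
r444 = ring
r445 : ∀ y z → + 0 * y + y * z + z * + 0 - + 1 ≡ y * z - + 1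
r445 = ring
r446 : ∀ u v w → w + v - u - + 1 ≡ v + w - u - + 1
r446 = ring
r447 : ∀ x z → x * + 0 + + 0 * z + z * x - + 1 ≡ x * z - + 1
r447 = ring
r448 : ∀ u v w → + 0 - (u + v + w) + (u - + 1) + (v - + 1 + (w - + 1)) + + 2 ≡ - (+ 1)
r448 = ring
r449 : ∀ n u v w → n - (v + w + u) ≡ n - (u + v + w)
r449 = ring
r450 : ∀ u v w → (w + u - v) * (v + u - w) * (v + w - u) ≡ (v + w - u) * (u + w - v) * (u + v - w)
r450 = ring
r451 : ∀ u v w → + 4 * v * u - (v + u - w) * (v + u - w) ≡ + 4 * u * v - (u + v - w) * (u + v - w)
r451 = ring
r452 : ∀ u v w → (u + w - v) * (v + w - u) * (v + u - w) ≡ (v + w - u) * (u + w - v) * (u + v - w)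
r452 = ring
r453 : ∀ x → + 1 * + 1 * x ≡ x
r453 = ring
r454 : ∀ β δ → + 0 * δ - β * + 0 ≡ + 0
r454 = ring
r455 : ∀ a b c → a + b + c - a - c ≡ b
r455 = ring
r456 : ∀ a b → (a * + 6 + b * + 6) * + 6 ≡ (a + b) * + 36
r456 = ring
r457 : ∀ v z → + 4 * + 0 * v - z * z - + 1 + z * z ≡ - (+ 1)
r457 = ring
r458 : ∀ u v w → (u + v - w) * (u + v - w) ≡ (w - u - v) * (w - u - v)
r458 = ring
r459 : ∀ w s → - (+ 1) ≡ - w - + 1 + (- w - + 1) + (s - + 1) + + 2 + + 1 * (w + w - s)
r459 = ring
r460 : ∀ w x y → - (+ 1) ≡ w - + 1 + (w - + 1) + (- x - y - + 1) + + 2 + (- (+ 1)) * (w + w - (x + y))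
r460 = ring
r461 : ∀ t x y → x + y - + 1 ≡ (((((x - t - + 1) + (y - t - + 1)) + t) + t) + + 1)
r461 = ring
r462 : ∀ t x y → x + y - + 1 ≡ ((((x - t - + 1) + (y - + 1)) + t) + + 1)
r462 = ring
r463 : ∀ t x → x + + 0 - + 1 ≡ ((x - t - + 1) + t)
r463 = ring
r464 : ∀ t x y → x + y - + 1 ≡ ((x - t - + 1) + (t + y))
r464 = ring
r465 : ∀ t x y → x + y - + 1 ≡ ((((x - + 1) + (y - t - + 1)) + t) + + 1)
r465 = ring
r466 : ∀ t x y → x + y - + 1 ≡ (((x - + 1) + (y - + 1)) + + 1)
r466 = ring
r467 : ∀ t x → x + + 0 - + 1 ≡ (x - + 1)
r467 = ring
r468 : ∀ t x y → - x - y - + 1 ≡ ((t - x) + (- y - t - + 1))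
r468 = ring
r469 : ∀ t y → + 0 + y - + 1 ≡ ((y - t - + 1) + t)
r469 = ring
r470 : ∀ t y → + 0 + y - + 1 ≡ (y - + 1)
r470 = ring
r471 : ∀ t y → - (+ 0) - y - + 1 ≡ (- y - + 1)
r471 = ring
r472 : ∀ t y → - (+ 0) - y - + 1 ≡ ((- y - t - + 1) + t)
r472 = ring
r473 : ∀ t x y → x + y - + 1 ≡ ((t + x) + (y - t - + 1))
r473 = ring
r474 : ∀ t x → - x - + 0 - + 1 ≡ (- x - + 1)
r474 = ring
r475 : ∀ t x y → - x - y - + 1 ≡ (((- x - + 1) + (- y - + 1)) + + 1)
r475 = ring
r476 : ∀ t x y → - x - y - + 1 ≡ ((((- x - + 1) + (- y - t - + 1)) + t) + + 1)
r476 = ring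
r477 : ∀ t x y → - x - y - + 1 ≡ ((- x - t - + 1) + (t - y))
r477 = ring
r478 : ∀ t x → - x - + 0 - + 1 ≡ ((- x - t - + 1) + t)
r478 = ring
r479 : ∀ t x y → - x - y - + 1 ≡ ((((- x - t - + 1) + (- y - + 1)) + t) + + 1)
r479 = ring
r480 : ∀ t x y → - x - y - + 1 ≡ (((((- x - t - + 1) + (- y - t - + 1)) + t) + t) + + 1)
r480 = ring
r481 : ∀ t x → t - x ≡ - (x - t - + 1) - + 1
r481 = ring
r482 : ∀ t x → t + x ≡ - (- x - t - + 1) - + 1
r482 = ring
r483 : ∀ t x → t - (- x) ≡ t + x
r483 = ring
r484 : ∀ x → - (- x) - + 1 ≡ x - + 1
r484 = ring
r485 : ∀ t x → - (- x) - t - + 1 ≡ x - t - + 1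
r485 = ring
r486 : ∀ t x → ((x - t - + 1) + (t - x)) ≡ - (+ 1)
r486 = ring
r487 : ∀ t → ((+ 0 - t - + 1) + t) ≡ - (+ 1)
r487 = ring
r488 : ∀ t x → ((((x - t - + 1) + (- x - + 1)) + t) + + 1) ≡ - (+ 1)
r488 = ring
r489 : ∀ t x → (((((x - t - + 1) + (- x - t - + 1)) + t) + t) + + 1) ≡ - (+ 1)
r489 = ring
r490 : ∀ t x → ((t - x) + (x - t - + 1)) ≡ - (+ 1)
r490 = ring
r491 : ∀ t → (+ 0 - + 1) ≡ - (+ 1)
r491 = ring
r492 : ∀ t x → (((x - + 1) + (- x - + 1)) + + 1) ≡ - (+ 1)
r492 = ring
r493 : ∀ t x → ((((x - + 1) + (- x - t - + 1)) + t) + + 1) ≡ - (+ 1)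
r493 = ring
r494 : ∀ t → (- (+ 0) - + 1) ≡ - (+ 1)
r494 = ring
r495 : ∀ t → ((- (+ 0) - t - + 1) + t) ≡ - (+ 1)
r495 = ring
r496 : ∀ t x → ((((- x - + 1) + (x - t - + 1)) + t) + + 1) ≡ - (+ 1)
r496 = ring
r497 : ∀ t x → (((- x - + 1) + (x - + 1)) + + 1) ≡ - (+ 1)
r497 = ring
r498 : ∀ t x → ((t + x) + (- x - t - + 1)) ≡ - (+ 1)
r498 = ring
r499 : ∀ t x → (((((- x - t - + 1) + (x - t - + 1)) + t) + t) + + 1) ≡ - (+ 1)
r499 = ring
r500 : ∀ t x → ((((- x - t - + 1) + (x - + 1)) + t) + + 1) ≡ - (+ 1)
r500 = ring
r501 : ∀ t x → ((- x - t - + 1) + (t + x)) ≡ - (+ 1)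
r501 = ring
r502 : ∀ a b c → a + (b + c) ≡ b + (a + c)
r502 = ring
r503 : ∀ z → + 0 * + 0 + + 0 * z + z * + 0 ≡ + 0
r503 = ring
r504 : ∀ y → + 0 * y + y * + 0 + + 0 * + 0 ≡ + 0
r504 = ring
r505 : ∀ x → x * + 0 + + 0 * + 0 + + 0 * x ≡ + 0
r505 = ring
r506 : ∀ t → - (+ 0) - t - + 1 + t ≡ - (+ 1)
r506 = ring
r507 : ∀ t x → - x - t - + 1 + t + (x - + 1) + + 1 ≡ - (+ 1)
r507 = ring
r508 : ∀ t → + 0 - t - + 1 + t ≡ - (+ 1)
r508 = ring
r509 : ∀ t x → x - t - + 1 + t + (- x - + 1) + + 1 ≡ - (+ 1)
r509 = ring
r510 : ∀ t x → - x - t - + 1 + (t + x) ≡ - (+ 1)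
r510 = ring
r511 : ∀ t x → t - x ≡ - x - t - + 1 + (t + t) + + 1
r511 = ring
r512 : ∀ t x → - x - t - + 1 + (x - t - + 1) + (t + t + + 1) ≡ - (+ 1)
r512 = ring
r513 : ∀ t x → t - x ≡ - x - + 1 + t + + 1
r513 = ring
r514 : ∀ t x → - x - + 1 + (x - t - + 1) + (t + + 1) ≡ - (+ 1)
r514 = ring
r515 : ∀ t → t + + 0 ≡ t
r515 = ring
r516 : ∀ t → t - + 0 ≡ t
r516 = ring
r517 : ∀ t x → t + x ≡ x - + 1 + t + + 1
r517 = ring
r518 : ∀ t x → x - t - + 1 + (t - x) ≡ - (+ 1)
r518 = ring
r519 : ∀ t x → t + x ≡ x - t - + 1 + (t + t) + + 1
r519 = ring
r520 : ∀ P t z u v → + 4 * (u * v) - + 1 ≡ + 4 * (P - + 1) + ((z - t - + 1) * (z - t - + 1) + (z - t - + 1 + (z - t - + 1)) + ((t + t) * (z - t - + 1) + (t + t))) + + 4 + + 1 * (+ 4 * u * v - z * z - (+ 4 * P - t * t))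
r520 = ring
r521 : ∀ P u v → P - u ≡ P - u * v + u * (v - + 1)
r521 = ring
r522 : ∀ h → + 0 + h * + 2 ≡ h + h
r522 = ring
r523 : ∀ h → + 1 + h * + 2 ≡ h + h + + 1
r523 = ring
r525 : ∀ x y → + 2 * (y - x) ≡ y + y - (x + x)
r525 = ring
r526 : ∀ h d → (h - d) + (h - d) + + 1 ≡ h + h + + 1 - (d + d)
r526 = ring
r527 : ∀ a b c d → a + (b + (c + d)) ≡ c + (d + (a + b))
r527 = ring
r528 : ∀ q → + 0 + q * + 3 ≡ + 3 * q + + 0
r528 = ring
r529 : ∀ q → + 1 + q * + 3 ≡ + 3 * q + + 1
r529 = ring
r530 : ∀ q → + 2 + q * + 3 ≡ + 3 * (q + + 1) + - (+ 1)
r530 = ring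
r531 : ∀ k m a b → + 3 * (k - m) + (a - b) ≡ + 3 * k + a - (+ 3 * m + b)
r531 = ring
r532 : ∀ n → + 3 * (n + + 1) - + 1 ≡ + 3 * n + + 2
r532 = ring
r533 : ∀ n → + 3 * (n - + 1) + + 1 ≡ + 3 * n + - (+ 2)
r533 = ring
r534 : ∀ k m a b → + 3 * k + a + (+ 3 * m + b) ≡ + 3 * (k + m) + (a + b)
r534 = ring
r535 : ∀ k c v → + 3 * k + (+ 3 * c + v) ≡ + 3 * (k + c) + v
r535 = ring
r536 : ∀ k a → - (+ 3 * k + a) ≡ + 3 * - k + - a
r536 = ring
r537 : ∀ k m a b → (+ 3 * k + a) * (+ 3 * m + b) ≡ + 3 * (+ 3 * k * m + k * b + a * m) + a * b
r537 = ring
r538 : ∀ q → + 0 + q * + 2 ≡ q + q + + 0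
r538 = ring
r539 : ∀ k m → (k - m) + (k - m) + + 1 ≡ k + k + + 1 - (m + m + + 0)
r539 = ring
r540 : ∀ k m a b → k + k + a + (m + m + b) ≡ k + k + (m + m) + (a + b)
r540 = ring
r541 : ∀ k m c v → k + k + (m + m) + (c + c + v) ≡ k + m + c + (k + m + c) + v
r541 = ring
r542 : ∀ k m a b → (k + k + a) * (m + m + b) ≡ (+ 2 * k * m + k * b + a * m) + (+ 2 * k * m + k * b + a * m) + a * b
r542 = ring
r543 : ∀ a b → a + (a + b) ≡ + 2 * a + b
r543 = ring
r544 : ∀ F s → F * (+ 1 * s) ≡ F * s + + 0
r544 = ring
r545 : ∀ F s → F * (+ 1 * s) ≡ + 0 + F * s
r545 = ring
r546 : ∀ x → x * x - x ≡ (x - + 1) * (x - + 1) + (x - + 1)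
r546 = ring
r547 : ∀ x → x * x - x ≡ x * x + (- x - + 1) + + 1
r547 = ring
r548 : ∀ x → x * x + x ≡ - x * - x - - x
r548 = ring
r549 : ∀ a b → + 3 * (a + b) ≡ + 3 * a + + 3 * b
r549 = ring
r550 : ∀ a b c → a + b + c ≡ a + (b + c)
r550 = ring
r551 : ∀ k m c → k * m + (k + c) ≡ k * (+ 1 + m) + c
r551 = ring
r552 : ∀ c a b → + 3 * (c * (a - b)) ≡ c * (+ 3 * a - + 3 * b)
r552 = ring
r553 : ∀ c j u v → c * (+ 2 * (+ 1 + (j + j)) + u - (+ 2 * j + v)) ≡ + 2 * (c * (+ 1 + j)) + c * (u - v)
r553 = ring
r554 : ∀ c j u v → c * (+ 4 * (+ 1 + (j + j)) + u - (+ 8 * j + v)) ≡ c * (+ 4 + u - v)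
r554 = ring
r555 : ∀ s → - (+ 1) ≡ s + - (+ 1) * (+ 1 + s - + 0)
r555 = ring
r556 : ∀ N → + 1 + (+ 1 + (N + N)) - (+ 1 + N) ≡ + 1 + N
r556 = ring
r557 : ∀ a s b → a + (s + b) ≡ b + (a + s)
r557 = ring
r558 : ∀ q r s → - (+ 1) ≡ + 3 - r + s + + 4 * (q - + 1) + - (+ 1) * (+ 4 * q - (r - s))
r558 = ring
r559 : ∀ q r s → - (+ 1) ≡ + 3 - s + r + + 4 * (- q - + 1) + + 1 * (+ 4 * q - (r - s))
r559 = ring
r560 : ∀ P h q r → + 4 * (P - h * h - q) ≡ (+ 4 * P - (h + h + + 0) * (h + h + + 0)) - (r + q * + 4) + (r - + 0)
r560 = ring
r561 : ∀ P h q r → + 4 * (P - h * h - h - + 1 - q) ≡ (+ 4 * P - (h + h + + 1) * (h + h + + 1)) - (r + q * + 4) + (r - + 3)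
r561 = ring

-- Certificates of nonnegativity for integers

NN : ℤ → Set
NN x = + 0 ℤ.≤ x

NN? : ∀ x → Dec (NN x)
NN? x = + 0 ℤ.≤? x

nn : ∀ {n} → NN (+ n)
nn = +≤+ z≤n

nn+ : ∀ {x y} → NN x → NN y → NN (x + y)
nn+ p q = ZP.+-mono-≤ p q

nn* : ∀ {x y} → NN x → NN y → NN (x * y)
nn* {+ a} {+ b} p q = subst NN (ZP.pos-* a b) nn

nn² : ∀ x → NN (x * x)
nn² (+ a) = nn* {+ a} {+ a} nn nn
nn² -[1+ a ] = nn

≈nn : ∀ {x y} → NN x → y ≡ x → NN y
≈nn p refl = p

neg1 : ¬ NN (- (+ 1))
neg1 ()

-- A contradiction certificate: two nonnegative quantities cannot sum to -1.
nn⊥ : ∀ {x} → NN x → x ≡ - (+ 1) → ⊥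
nn⊥ p refl = neg1 p

¬nn : ∀ {x} → ¬ NN x → NN (- x - + 1)
¬nn {+ a} h = ⊥-elim (h nn)
¬nn { -[1+ a ]} h = ≈nn (nn {a}) (r408 (+ a))

-- Strict inequalities are written `NN (x - + 1)`, so that integrality is part of the hypothesis and
-- a contradiction only needs a polynomial identity for -1.
data Tri (x : ℤ) : Set where
  pos : NN (x - + 1) → Tri x
  zer : x ≡ + 0 → Tri x
  neg : NN (- x - + 1) → Tri x

tri : ∀ x → Tri x
tri (+ zero)  = zer refl
tri (+ suc n) = pos (≈nn (nn {n}) (r409 (+ n)))
tri -[1+ n ]  = neg (¬nn {x = -[1+ n ]} λ ())

private
  cancel : ∀ x y → y - x ≡ + 0 → x ≡ y
  cancel x y e = sym (cong (λ s → s + x) e ∙ ZP.+-identityˡ x) ∙ r237 x y 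

≡-from-0 : ∀ {x y} → y - x ≡ + 0 → x ≡ y
≡-from-0 = cancel _ _

sub0 : ∀ {x y} → x ≡ y → y - x ≡ + 0
sub0 {x} refl = r16 x

-- Add a multiple of an equation to a certificate.
nn-mod : ∀ {c g l r} k → NN c → l ≡ r → g ≡ c + k * (l - r) → NN g
nn-mod {c} {l = l} k p refl e = ≈nn p (e ∙ r410 c k l)

-- A refutation is an identity -1 = c + k (l - r) with c visibly nonnegative and l = r a hypothesis;
-- the numbered polynomial identities supply these certificates.
nn-absurd : ∀ {c l r} k → NN c → l ≡ r → - (+ 1) ≡ c + k * (l - r) → ⊥
nn-absurd k p e q = neg1 (nn-mod k p e q)

antisym0 : ∀ {x} → NN x → NN (- x) → x ≡ + 0
antisym0 {+ zero} p q = refl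
antisym0 {+ suc n} p ()

0≢pos : ∀ {x} → x ≡ + 0 → NN (x - + 1) → ⊥
0≢pos refl ()

∣∣≤ : ∀ {x n} → NN (+ n - x) → NN (+ n + x) → ∣ x ∣ ≤ n
∣∣≤ {+ a} {n} p q = ZP.drop‿+≤+ (ZP.0≤i-j⇒j≤i p)
∣∣≤ { -[1+ a ]} {n} p q = ZP.drop‿+≤+ (ZP.0≤i-j⇒j≤i (≈nn q refl))

*≡0 : ∀ {x y} → x * y ≡ + 0 → x ≡ + 0 ⊎ y ≡ + 0
*≡0 {x} {y} e = ZP.i*j≡0⇒i≡0∨j≡0 x e

cancelˡ : ∀ {x} k → + (suc k) * x ≡ + 0 → x ≡ + 0
cancelˡ k e with *≡0 {+ suc k} e
... | inj₂ h = h

pos-factor : ∀ x y → NN (x - + 1) → NN (x * y - + 1) → NN (y - + 1)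
pos-factor x y p q with tri y
... | pos h = h
... | zer refl = ⊥-elim (nn⊥ q (r411 x))
... | neg h = ⊥-elim (nn⊥ (nn+ (nn+ q (nn* p h)) (nn+ p (nn+ h (nn {1})))) (r412 x y))

-- Finite sums, indicators and bijections

when : ∀ {P : Set} → Dec P → ℤ → ℤ
when (yes _) x = x
when (no _)  x = + 0

∑ : ∀ {A : Set} → List A → (A → ℤ) → ℤ
∑ []      f = + 0
∑ (x ∷ L) f = f x + ∑ L f

module _ {A : Set} where

  ∑-cong : ∀ L {f g : A → ℤ} → (∀ x → f x ≡ g x) → ∑ L f ≡ ∑ L g
  ∑-cong []      e = refl
  ∑-cong (x ∷ L) e = cong₂ _+_ (e x) (∑-cong L e)

  ∑-+ : ∀ L (f g : A → ℤ) → ∑ L (λ x → f x + g x) ≡ ∑ L f + ∑ L g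
  ∑-+ []      f g = refl
  ∑-+ (x ∷ L) f g = cong (λ s → f x + g x + s) (∑-+ L f g) ∙ r238 (f x) (g x) _ _

  ∑-* : ∀ L k (f : A → ℤ) → ∑ L (λ x → k * f x) ≡ k * ∑ L f
  ∑-* []      k f = sym (ZP.*-zeroʳ k)
  ∑-* (x ∷ L) k f = cong (λ s → k * f x + s) (∑-* L k f) ∙ sym (ZP.*-distribˡ-+ k (f x) _)

  ∑-0 : ∀ L → ∑ {A} L (λ _ → + 0) ≡ + 0
  ∑-0 []      = refl
  ∑-0 (x ∷ L) = ZP.+-identityˡ _ ∙ ∑-0 L

  ∑-- : ∀ L (f g : A → ℤ) → ∑ L (λ x → f x - g x) ≡ ∑ L f - ∑ L g
  ∑-- L f g = ∑-cong L (λ x → r239 (f x) (g x)) ∙ ∑-+ L f _ ∙ cong (λ s → ∑ L f + s) (∑-* L (- (+ 1)) g) ∙ sym (r239 (∑ L f) (∑ L g))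

  ∑-++ : ∀ L M (f : A → ℤ) → ∑ (L ++ M) f ≡ ∑ L f + ∑ M f
  ∑-++ []      M f = sym (ZP.+-identityˡ _)
  ∑-++ (x ∷ L) M f = cong (λ s → f x + s) (∑-++ L M f) ∙ sym (ZP.+-assoc (f x) _ _)

∑-swap : ∀ {A B : Set} (L : List A) (M : List B) (f : A → B → ℤ) → ∑ L (λ x → ∑ M (f x)) ≡ ∑ M (λ y → ∑ L (λ x → f x y))
∑-swap []      M f = sym (∑-0 M)
∑-swap (x ∷ L) M f = cong (λ s → ∑ M (f x) + s) (∑-swap L M f) ∙ sym (∑-+ M (f x) _)

∑-map : ∀ {A B : Set} (h : A → B) L f → ∑ (map h L) f ≡ ∑ L (λ x → f (h x))
∑-map h []      f = refl
∑-map h (x ∷ L) f = cong (λ s → f (h x) + s) (∑-map h L f)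

cart : ∀ {A B : Set} → List A → List B → List (A × B)
cart []      M = []
cart (x ∷ L) M = map (x ,_) M ++ cart L M

∑-cart : ∀ {A B : Set} (L : List A) (M : List B) f → ∑ (cart L M) f ≡ ∑ L (λ x → ∑ M (λ y → f (x , y)))
∑-cart []      M f = refl
∑-cart (x ∷ L) M f = ∑-++ (map (x ,_) M) _ f ∙ cong₂ _+_ (∑-map (x ,_) M f) (∑-cart L M f)

when-0 : ∀ {P : Set} (d : Dec P) → when d (+ 0) ≡ + 0
when-0 (yes _) = refl
when-0 (no _)  = refl

when-yes : ∀ {P : Set} (d : Dec P) {x} → P → when d x ≡ x
when-yes (yes _) p = refl
when-yes (no n)  p = ⊥-elim (n p)

when-no : ∀ {P : Set} (d : Dec P) {x} → ¬ P → when d x ≡ + 0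
when-no (yes p) n = ⊥-elim (n p)
when-no (no _)  n = refl

when-⇔ : ∀ {P Q : Set} (d : Dec P) (e : Dec Q) {x y} → (P → Q) → (Q → P) → (P → x ≡ y) → when d x ≡ when e y
when-⇔ (yes p) (yes q) f g h = h p
when-⇔ (yes p) (no ¬q) f g h = ⊥-elim (¬q (f p))
when-⇔ (no ¬p) (yes q) f g h = ⊥-elim (¬p (g q))
when-⇔ (no ¬p) (no ¬q) f g h = refl

when-× : ∀ {P Q : Set} (d : Dec P) (e : Dec Q) {x} → when (d ×-dec e) x ≡ when d (when e x)
when-× (yes p) (yes q) = refl
when-× (yes p) (no ¬q) = refl
when-× (no ¬p) (yes q) = refl
when-× (no ¬p) (no ¬q) = refl

∑-when : ∀ {A P : Set} (L : List A) (d : Dec P) f → ∑ L (λ x → when d (f x)) ≡ when d (∑ L f)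
∑-when L (yes p) f = refl
∑-when L (no ¬p) f = ∑-0 L

-- A list in which every element of the domain In occurs exactly once.
record Dom : Set₁ where
  field
    A    : Set
    _≟_  : (x y : A) → Dec (x ≡ y)
    L    : List A
    In   : A → Set
    full : ∀ x → In x → ∀ c → ∑ L (λ w → when (w ≟ x) c) ≡ c

-- Listed from the outside inwards in pairs ±x: induction on the radius then adds a symmetric pair,
-- and invariance under negation is immediate.
ints : ℕ → List ℤ
ints zero    = + 0 ∷ []
ints (suc n) = + suc n ∷ -[1+ n ] ∷ ints n

private
  ints-none : ∀ n x c → n ℕ.< ∣ x ∣ → ∑ (ints n) (λ w → when (w ℤ.≟ x) c) ≡ + 0
  ints-none zero x c h rewrite when-no (+ 0 ℤ.≟ x) {c} (λ { refl → NP.<-irrefl refl h }) = refl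
  ints-none (suc n) x c h
    rewrite when-no (+ suc n ℤ.≟ x) {c} (λ { refl → NP.<-irrefl refl h })
          | when-no (-[1+ n ] ℤ.≟ x) {c} (λ { refl → NP.<-irrefl refl h })
          | ints-none n x c (NP.<-trans (NP.n<1+n n) h) = refl

  ints-full : ∀ n x → ∣ x ∣ ≤ n → ∀ c → ∑ (ints n) (λ w → when (w ℤ.≟ x) c) ≡ c
  ints-full zero (+ zero) h c = ZP.+-identityʳ c
  ints-full (suc n) x h c with ∣ x ∣ ℕ.≤? n
  ... | yes h′
    rewrite when-no (+ suc n ℤ.≟ x) {c} (λ { refl → NP.<-irrefl refl h′ })
          | when-no (-[1+ n ] ℤ.≟ x) {c} (λ { refl → NP.<-irrefl refl h′ })
          | ints-full n x h′ c = ZP.+-identityˡ _ ∙ ZP.+-identityˡ c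
  ints-full (suc n) (+ k) h c | no ¬h with NP.≤-antisym h (NP.≰⇒> ¬h)
  ... | refl
    rewrite when-yes (+ suc n ℤ.≟ + suc n) {c} refl
          | when-no (-[1+ n ] ℤ.≟ + suc n) {c} (λ ())
          | ints-none n (+ suc n) c (NP.n<1+n n) = ZP.+-identityʳ c
  ints-full (suc n) -[1+ k ] h c | no ¬h with NP.≤-antisym h (NP.≰⇒> ¬h)
  ... | refl
    rewrite when-no (+ suc n ℤ.≟ -[1+ n ]) {c} (λ ())
          | when-yes (-[1+ n ] ℤ.≟ -[1+ n ]) {c} refl
          | ints-none n -[1+ n ] c (NP.n<1+n n) = ZP.+-identityˡ _ ∙ ZP.+-identityʳ c

ℤD : ℕ → Dom
ℤD n = record { A = ℤ ; _≟_ = ℤ._≟_ ; L = ints n ; In = λ x → ∣ x ∣ ≤ n ; full = ints-full n }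

private
  pair≟ : ∀ {A B : Set} → ((x y : A) → Dec (x ≡ y)) → ((x y : B) → Dec (x ≡ y)) → (x y : A × B) → Dec (x ≡ y)
  pair≟ e f (x , y) (x′ , y′) with e x x′ | f y y′
  ... | yes refl | yes refl = yes refl
  ... | no n     | _        = no λ { refl → n refl }
  ... | yes _    | no n     = no λ { refl → n refl }

  when-pair : ∀ {A B : Set} (e : (x y : A) → Dec (x ≡ y)) (f : (x y : B) → Dec (x ≡ y)) x y x′ y′ c →
              when (pair≟ e f (x , y) (x′ , y′)) c ≡ when (e x x′) (when (f y y′) c)
  when-pair e f x y x′ y′ c with e x x′ | f y y′
  ... | yes refl | yes refl = refl
  ... | yes refl | no _     = refl
  ... | no _     | yes _    = refl
  ... | no _     | no _     = refl

infixr 4 _×D_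
_×D_ : Dom → Dom → Dom
D ×D E = record
  { A = D.A × E.A ; _≟_ = pair≟ D._≟_ E._≟_ ; L = cart D.L E.L ; In = λ { (x , y) → D.In x × E.In y }
  ; full = λ { (x , y) (i , j) c → ∑-cart D.L E.L _ ∙ ∑-cong D.L (λ x′ →
      trans (∑-cong E.L (λ y′ → when-pair D._≟_ E._≟_ x′ y′ x y c))
        (∑-when E.L (x′ D.≟ x) _ ∙ cong (when (x′ D.≟ x)) (E.full y j c))) ∙ D.full x i c } } where
  module D = Dom D
  module E = Dom E

module _ (D E : Dom) where
  private
    module D = Dom D
    module E = Dom E

  -- Every guarded term is spread over a sum selecting its partner, which occurs exactly once in the
  -- other list. The two double sums agree termwise, and the order of summation is exchanged. Only
  -- the supports `P` and `Q` must lie in the domains, so maps that leave the boxes elsewhere are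
  -- allowed.
  ∑-bij : {P : D.A → Set} {Q : E.A → Set} (P? : ∀ v → Dec (P v)) (Q? : ∀ w → Dec (Q w))
    (f : D.A → ℤ) (g : E.A → ℤ) (φ : D.A → E.A) (ψ : E.A → D.A) →
    (∀ v → P v → D.In v) → (∀ w → Q w → E.In w) →
    (∀ v → P v → Q (φ v) × ψ (φ v) ≡ v × g (φ v) ≡ f v) →
    (∀ w → Q w → P (ψ w) × φ (ψ w) ≡ w) →
    ∑ D.L (λ v → when (P? v) (f v)) ≡ ∑ E.L (λ w → when (Q? w) (g w))
  ∑-bij P? Q? f g φ ψ inD inE to from = begin
    ∑ D.L (λ v → when (P? v) (f v))
      ≡⟨ ∑-cong D.L expandˡ ⟩
    ∑ D.L (λ v → ∑ E.L (λ w → when (P? v) (when (w E.≟ φ v) (f v))))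
      ≡⟨ ∑-cong D.L (λ v → ∑-cong E.L (same v)) ⟩
    ∑ D.L (λ v → ∑ E.L (λ w → when (Q? w) (when (v D.≟ ψ w) (g w))))
      ≡⟨ ∑-swap D.L E.L _ ⟩
    ∑ E.L (λ w → ∑ D.L (λ v → when (Q? w) (when (v D.≟ ψ w) (g w))))
      ≡⟨ ∑-cong E.L (λ w → sym (expandʳ w)) ⟩
    ∑ E.L (λ w → when (Q? w) (g w)) ∎ where
    open ≡-Reasoning
    expandˡ : ∀ v → when (P? v) (f v) ≡ ∑ E.L (λ w → when (P? v) (when (w E.≟ φ v) (f v)))
    expandˡ v with P? v
    ... | yes p = sym (E.full (φ v) (inE _ (proj₁ (to v p))) (f v))
    ... | no _  = sym (∑-0 E.L)
    expandʳ : ∀ w → when (Q? w) (g w) ≡ ∑ D.L (λ v → when (Q? w) (when (v D.≟ ψ w) (g w)))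
    expandʳ w with Q? w
    ... | yes q = sym (D.full (ψ w) (inD _ (proj₁ (from w q))) (g w))
    ... | no _  = sym (∑-0 D.L)
    same : ∀ v w → when (P? v) (when (w E.≟ φ v) (f v)) ≡ when (Q? w) (when (v D.≟ ψ w) (g w))
    same v w with P? v | Q? w
    same v w | yes p | yes q with w E.≟ φ v | v D.≟ ψ w
    ... | yes refl | yes _   = sym (proj₂ (proj₂ (to v p)))
    ... | yes refl | no n    = ⊥-elim (n (sym (proj₁ (proj₂ (to v p)))))
    ... | no n     | yes refl = ⊥-elim (n (sym (proj₂ (from w q))))
    ... | no _     | no _    = refl
    same v w | yes p | no ¬q with w E.≟ φ v
    ... | yes refl = ⊥-elim (¬q (proj₁ (to v p)))
    ... | no _     = refl
    same v w | no ¬p | yes q with v D.≟ ψ w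
    ... | yes refl = ⊥-elim (¬p (proj₁ (from w q)))
    ... | no _     = refl
    same v w | no _ | no _ = refl

-- Binary forms as triples of values, and reduction to obtuse triples

-- A form is recorded by its values u, v, w at (1,0), (0,1), (1,1).
F : ℤ → ℤ → ℤ → Form
F u v w = u , w - u - v , v

-- Selling's parameters: `Xc`, `Yc`, `Zc` are -2 times the inner products of pairs in the superbase
-- (1,0), (0,1), (-1,-1). In terms of them `dsc`, minus the discriminant, is XY + YZ + ZX.
Xc Yc Zc dsc : ℤ → ℤ → ℤ → ℤ
Xc u v w = v + w - u
Yc u v w = u + w - v
Zc u v w = u + v - w
dsc u v w = + 4 * u * v - Zc u v w * Zc u v w

form≡ : ∀ {a b c a′ b′ c′ : ℤ} → a ≡ a′ → b ≡ b′ → c ≡ c′ → (a , b , c) ≡ (a′ , b′ , c′)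
form≡ refl refl refl = refl

F-inj : ∀ {u v w u′ v′ w′} → F u v w ≡ F u′ v′ w′ → u ≡ u′ × v ≡ v′ × w ≡ w′
F-inj {u} {v} {w} {u′} {v′} {w′} e with cong proj₁ e | cong (λ q → proj₂ (proj₂ q)) e | cong (λ q → proj₁ (proj₂ q)) e
... | refl | refl | h = refl , refl , sym (r413 w u v) ∙ cong (λ s → s + (u + v)) h ∙ r413 w′ u v

act-∘ : ∀ α β γ δ α′ β′ γ′ δ′ Q →
  act α′ β′ γ′ δ′ (act α β γ δ Q) ≡ act (α * α′ + β * γ′) (α * β′ + β * δ′) (γ * α′ + δ * γ′) (γ * β′ + δ * δ′) Q
act-∘ α β γ δ α′ β′ γ′ δ′ (a , b , c) =
  form≡ (r414 a b c α β γ δ α′ γ′) (r415 a b c α β γ δ α′ β′ γ′ δ′) (r414 a b c α β γ δ β′ δ′)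

act-1 : ∀ Q → act (+ 1) (+ 0) (+ 0) (+ 1) Q ≡ Q
act-1 (a , b , c) = form≡ (r416 a b c) (r417 a b c) (r418 a b c)

Equiv-trans : ∀ P Q R → Equiv P Q → Equiv Q R → Equiv P R
Equiv-trans P Q R (α , β , γ , δ , e , refl) (α′ , β′ , γ′ , δ′ , e′ , refl) =
  α * α′ + β * γ′ , α * β′ + β * δ′ , γ * α′ + δ * γ′ , γ * β′ + δ * δ′ ,
  trans (r419 α β γ δ α′ β′ γ′ δ′) (cong₂ _*_ e e′) , sym (act-∘ α β γ δ α′ β′ γ′ δ′ P)

Equiv-sym : ∀ P Q → Equiv P Q → Equiv Q P
Equiv-sym P Q (α , β , γ , δ , e , refl) =
  δ , - β , - γ , α , r420 α β γ δ ∙ e , act-∘ α β γ δ δ (- β) (- γ) α P ∙ inverse where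
  inverse : act (α * δ + β * (- γ)) (α * (- β) + β * α) (γ * δ + δ * (- γ)) (γ * (- β) + δ * α) P ≡ P
  inverse rewrite trans (r421 α β γ δ) e | r422 α β | r423 γ δ | trans (r424 α β γ δ) e = act-1 P

rot-equiv : ∀ u v w → Equiv (F u v w) (F v w u)
rot-equiv u v w = + 0 , + 1 , - (+ 1) , + 1 , refl , form≡ (r425 u v w) (r426 u v w) (r427 u v w)

-- By the parallelogram law 2u + 2v - w is the value at (1,-1). This is the passage to the
-- neighbouring superbase; it changes the sign of `Zc`.
flip-equiv : ∀ u v w → Equiv (F u v w) (F v u (+ 2 * u + + 2 * v - w))
flip-equiv u v w = + 0 , + 1 , - (+ 1) , + 0 , refl , form≡ (r425 u v w) (r428 u v w) (r429 u v w)

-- The norm form of the Eisenstein integers. It measures how far a row of a substitution is from one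
-- of the six units.
N : ℤ → ℤ → ℤ
N x y = x * x + x * y + y * y

sq≥1 : ∀ {y} → y ≢ + 0 → NN (y * y - + 1)
sq≥1 {y} h with tri y
... | pos p = ≈nn (nn+ (nn* p p) (nn+ p p)) (r430 y)
... | zer e = ⊥-elim (h e)
... | neg p = ≈nn (nn+ (nn* p p) (nn+ p p)) (r431 y)

N≥1 : ∀ x y → ¬ (x ≡ + 0 × y ≡ + 0) → NN (N x y - + 1)
N≥1 x y h with NN? (N x y - + 1)
... | yes p = p
... | no g with y ℤ.≟ + 0
...   | no y≢0 = ⊥-elim (nn⊥ (nn+ (nn+ (nn+ (nn² (+ 2 * x + y)) (nn* (nn {3}) (sq≥1 y≢0))) (nn* (nn {4}) (¬nn g))) (nn {2})) (r433 x y))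
...   | yes refl with x ℤ.≟ + 0
...     | yes x≡0 = ⊥-elim (h (x≡0 , refl))
...     | no x≢0 = ⊥-elim (g (≈nn (sq≥1 x≢0) (r434 x)))

data Unit : ℤ → ℤ → Set where
  u₁ : Unit (+ 1) (+ 0)
  u₂ : Unit (+ 0) (+ 1)
  u₃ : Unit (- (+ 1)) (+ 0)
  u₄ : Unit (+ 0) (- (+ 1))
  u₅ : Unit (+ 1) (- (+ 1))
  u₆ : Unit (- (+ 1)) (+ 1)

module _ where
  N-bound : ∀ x y → N x y ≡ + 1 → NN (+ 1 - y)
  N-bound x y e with NN? (+ 1 - y)
  ... | yes p = p
  ... | no h = ⊥-elim (nn⊥ (nn-mod (- (+ 4)) (nn+ (nn+ (nn+ (nn² (+ 2 * x + y)) (nn* (nn {3}) (nn* (¬nn h) (¬nn h)))) (nn* (nn {12}) (¬nn h))) (nn {7})) e (r240 x y)) refl)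

  N-sym : ∀ x y → (y * y + y * x + x * x) ≡ (x * x + x * y + y * y)
  N-sym = ring
  N-neg : ∀ x y → ((- x) * (- x) + (- x) * (- y) + (- y) * (- y)) ≡ (x * x + x * y + y * y)
  N-neg = ring

data Small : ℤ → Set where
  s₋ : Small (- (+ 1))
  s₀ : Small (+ 0)
  s₊ : Small (+ 1)

small : ∀ x → NN (+ 1 - x) → NN (+ 1 - (- x)) → Small x
small (+ 0) p q = s₀
small (+ 1) p q = s₊
small (+ suc (suc n)) () q
small (-[1+ 0 ]) p q = s₋
small (-[1+ suc n ]) p ()

unit : ∀ x y → N x y ≡ + 1 → Unit x y
unit x y e = go (small x (N-bound y x (N-sym x y ∙ e)) (N-bound (- y) (- x) (N-neg y x ∙ N-sym x y ∙ e)))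
                (small y (N-bound x y e) (N-bound (- x) (- y) (N-neg x y ∙ e))) e where
  go : ∀ {x y} → Small x → Small y → N x y ≡ + 1 → Unit x y
  go s₋ s₊ e = u₆
  go s₋ s₀ e = u₃
  go s₀ s₋ e = u₄
  go s₀ s₊ e = u₂
  go s₊ s₋ e = u₅
  go s₊ s₀ e = u₁
  go s₋ s₋ ()
  go s₀ s₀ ()
  go s₊ s₊ ()

nn1 : ∀ x → NN (x - + 1) → NN x
nn1 x p = ≈nn (nn+ p (nn {1})) (r435 x)

Obt : ℤ → ℤ → ℤ → Set
Obt u v w = NN (Xc u v w) × NN (Yc u v w) × NN (Zc u v w)

-- An obtuse triple normalised so that only Zc may vanish.
Valid : ℤ → ℤ → ℤ → Set
Valid u v w = NN (Xc u v w - + 1) × NN (Yc u v w - + 1) × NN (Zc u v w)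

module _ where
  -- In the coefficients of a form, u + v + w is 2a + b + 2c. Its change under a substitution
  -- combines the defects of three norms with coefficients `Yc`, `Xc`, `Zc`, so an obtuse triple
  -- minimises u + v + w in its class.
  S-formula : ∀ u v w α β γ δ →
    (+ 2 * (u * α * α + (w - u - v) * α * γ + v * γ * γ) + + 2 * (u * β * β + (w - u - v) * β * δ + v * δ * δ)
      + (+ 2 * u * α * β + (w - u - v) * (α * δ + β * γ) + + 2 * v * γ * δ)) - (u + v + w)
    ≡ (u + w - v) * ((α * α + α * β + β * β) - + 1) + (v + w - u) * ((γ * γ + γ * δ + δ * δ) - + 1) + (u + v - w) * (((α - γ) * (α - γ) + (α - γ) * (β - δ) + (β - δ) * (β - δ)) - + 1)
  S-formula = ring

  S≤ : ∀ {u v w u′ v′ w′} → Obt u v w → ((α , β , γ , δ , _) : Equiv (F u v w) (F u′ v′ w′)) →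
       (u′ + v′ + w′) - (u + v + w) ≡ Yc u v w * (N α β - + 1) + Xc u v w * (N γ δ - + 1) + Zc u v w * (N (α - γ) (β - δ) - + 1)
       × NN (N α β - + 1) × NN (N γ δ - + 1) × NN (N (α - γ) (β - δ) - + 1)
  S≤ {u} {v} {w} {u′} {v′} {w′} (x , y , z) (α , β , γ , δ , e , q) = formula ∙ S-formula u v w α β γ δ ,
      N≥1 α β (λ { (refl , refl) → n0 (sym e ∙ r241 γ δ) }) ,
      N≥1 γ δ (λ { (refl , refl) → n0 (sym e ∙ r242 α β) }) ,
      N≥1 (α - γ) (β - δ) (λ { (h , k) → n0 (sym e ∙ r243 α β γ δ ∙ cong₂ (λ s t → s * δ - t * γ) h k ∙ r241 γ δ) }) where
    n0 : + 1 ≢ + 0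
    n0 ()
    formula : (u′ + v′ + w′) - (u + v + w) ≡ (+ 2 * (u * α * α + (w - u - v) * α * γ + v * γ * γ) + + 2 * (u * β * β + (w - u - v) * β * δ + v * δ * δ)
      + (+ 2 * u * α * β + (w - u - v) * (α * δ + β * γ) + + 2 * v * γ * δ)) - (u + v + w)
    formula = cong (λ s → s - (u + v + w)) (r244 u′ v′ w′ ∙
      sym (cong₂ _+_ (cong₂ (λ a c → + 2 * a + + 2 * c) (cong proj₁ q) (cong (λ f → proj₂ (proj₂ f)) q)) (cong (λ f → proj₁ (proj₂ f)) q)))

-- The obtuse triples of one class: rotations of the superbase always, and reflections exactly when
-- `Zc` is 0, because the flip then returns the same three values in another order.
Rel : ℤ × ℤ × ℤ → ℤ × ℤ × ℤ → Set
Rel (u , v , w) s = s ≡ (u , v , w) ⊎ s ≡ (v , w , u) ⊎ s ≡ (w , u , v) ⊎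
  (Zc u v w ≡ + 0 × (s ≡ (w , v , u) ⊎ s ≡ (v , u , w) ⊎ s ≡ (u , w , v)))

module _ where

  zero-part : ∀ x n → NN (x - + 1) → NN n → x * n ≡ + 0 → n ≡ + 0
  zero-part x n p q e with *≡0 {x} e
  ... | inj₁ h = ⊥-elim (0≢pos {x} h p)
  ... | inj₂ h = h

  -- Only x and y are known to be positive, so only a and b are forced to vanish; z may be 0, and
  -- the factor c then stays free. This freedom is the source of the reflections in `Rel`.
  parts : ∀ x y z a b c → NN (x - + 1) → NN (y - + 1) → NN z → NN a → NN b → NN c → NN (- (x * a + y * b + z * c)) →
          a ≡ + 0 × b ≡ + 0 × z * c ≡ + 0
  parts x y z a b c x₁ y₁ z₀ a₀ b₀ c₀ h =
    zero-part x a x₁ a₀ (antisym0 xa (≈nn (nn+ h (nn+ yb zc)) (r245 (x * a) (y * b) (z * c)))) ,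
    zero-part y b y₁ b₀ (antisym0 yb (≈nn (nn+ h (nn+ xa zc)) (r246 (x * a) (y * b) (z * c)))) ,
    antisym0 zc (≈nn (nn+ h (nn+ xa yb)) (r247 (x * a) (y * b) (z * c))) where
    xa = nn* {x} {a} (nn1 x x₁) a₀
    yb = nn* {y} {b} (nn1 y y₁) b₀
    zc = nn* {z} {c} z₀ c₀

module _ where
  act12 : ∀ u v w → act (+ 1) (+ 0) (+ 0) (+ 1) (F u v w) ≡ F u v w
  act12 u v w = form≡ (r248 u v w) (r249 u v w) (r250 u v w)

  act16 : ∀ u v w → act (+ 1) (+ 0) (- (+ 1)) (+ 1) (F u v w) ≡ F (+ 2 * u + + 2 * v - w) v u
  act16 u v w = form≡ (r251 u v w) (r252 u v w) (r250 u v w)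

  act23 : ∀ u v w → act (+ 0) (+ 1) (- (+ 1)) (+ 0) (F u v w) ≡ F v u (+ 2 * u + + 2 * v - w)
  act23 u v w = form≡ (r253 u v w) (r254 u v w) (r248 u v w)

  act26 : ∀ u v w → act (+ 0) (+ 1) (- (+ 1)) (+ 1) (F u v w) ≡ F v w u
  act26 u v w = form≡ (r253 u v w) (r255 u v w) (r256 u v w)

  act34 : ∀ u v w → act (- (+ 1)) (+ 0) (+ 0) (- (+ 1)) (F u v w) ≡ F u v w
  act34 u v w = form≡ (r257 u v w) (r258 u v w) (r253 u v w)

  act35 : ∀ u v w → act (- (+ 1)) (+ 0) (+ 1) (- (+ 1)) (F u v w) ≡ F (+ 2 * u + + 2 * v - w) v u
  act35 u v w = form≡ (r259 u v w) (r260 u v w) (r253 u v w)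

  act41 : ∀ u v w → act (+ 0) (- (+ 1)) (+ 1) (+ 0) (F u v w) ≡ F v u (+ 2 * u + + 2 * v - w)
  act41 u v w = form≡ (r250 u v w) (r261 u v w) (r257 u v w)

  act45 : ∀ u v w → act (+ 0) (- (+ 1)) (+ 1) (- (+ 1)) (F u v w) ≡ F v w u
  act45 u v w = form≡ (r250 u v w) (r262 u v w) (r263 u v w)

  act51 : ∀ u v w → act (+ 1) (- (+ 1)) (+ 1) (+ 0) (F u v w) ≡ F w u v
  act51 u v w = form≡ (r256 u v w) (r264 u v w) (r257 u v w)

  act52 : ∀ u v w → act (+ 1) (- (+ 1)) (+ 0) (+ 1) (F u v w) ≡ F u (+ 2 * u + + 2 * v - w) v
  act52 u v w = form≡ (r248 u v w) (r265 u v w) (r259 u v w)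

  act63 : ∀ u v w → act (- (+ 1)) (+ 1) (- (+ 1)) (+ 0) (F u v w) ≡ F w u v
  act63 u v w = form≡ (r263 u v w) (r266 u v w) (r248 u v w)

  act64 : ∀ u v w → act (- (+ 1)) (+ 1) (+ 0) (- (+ 1)) (F u v w) ≡ F u (+ 2 * u + + 2 * v - w) v
  act64 u v w = form≡ (r257 u v w) (r267 u v w) (r251 u v w)

-- Of the 36 pairs of units 12 have determinant 1, two for each of six resulting forms. For `f₀`,
-- `f₁`, `f₂` the third norm is 3 instead of 1, which equality of the sums u + v + w permits only if
-- `Zc` is 0.
data Columns (u v w : ℤ) (n : ℤ) (Q : Form) : Set where
  r₀ : F u v w ≡ Q → Columns u v w n Q
  r₁ : F v w u ≡ Q → Columns u v w n Q
  r₂ : F w u v ≡ Q → Columns u v w n Q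
  f₀ : n ≡ + 3 → F (+ 2 * u + + 2 * v - w) v u ≡ Q → Columns u v w n Q
  f₁ : n ≡ + 3 → F v u (+ 2 * u + + 2 * v - w) ≡ Q → Columns u v w n Q
  f₂ : n ≡ + 3 → F u (+ 2 * u + + 2 * v - w) v ≡ Q → Columns u v w n Q

columns : ∀ u v w {α β γ δ Q} → Unit α β → Unit γ δ → α * δ - β * γ ≡ + 1 → act α β γ δ (F u v w) ≡ Q → Columns u v w (N (α - γ) (β - δ)) Q
columns u v w u₁ u₁ ()
columns u v w u₁ u₂ e q = r₀ (sym (act12 u v w) ∙ q)
columns u v w u₁ u₃ ()
columns u v w u₁ u₄ ()
columns u v w u₁ u₅ ()
columns u v w u₁ u₆ e q = f₀ refl (sym (act16 u v w) ∙ q)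
columns u v w u₂ u₁ ()
columns u v w u₂ u₂ ()
columns u v w u₂ u₃ e q = f₁ refl (sym (act23 u v w) ∙ q)
columns u v w u₂ u₄ ()
columns u v w u₂ u₅ ()
columns u v w u₂ u₆ e q = r₁ (sym (act26 u v w) ∙ q)
columns u v w u₃ u₁ ()
columns u v w u₃ u₂ ()
columns u v w u₃ u₃ ()
columns u v w u₃ u₄ e q = r₀ (sym (act34 u v w) ∙ q)
columns u v w u₃ u₅ e q = f₀ refl (sym (act35 u v w) ∙ q)
columns u v w u₃ u₆ ()
columns u v w u₄ u₁ e q = f₁ refl (sym (act41 u v w) ∙ q)
columns u v w u₄ u₂ ()
columns u v w u₄ u₃ ()
columns u v w u₄ u₄ ()
columns u v w u₄ u₅ e q = r₁ (sym (act45 u v w) ∙ q)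
columns u v w u₄ u₆ ()
columns u v w u₅ u₁ e q = r₂ (sym (act51 u v w) ∙ q)
columns u v w u₅ u₂ e q = f₂ refl (sym (act52 u v w) ∙ q)
columns u v w u₅ u₃ ()
columns u v w u₅ u₄ ()
columns u v w u₅ u₅ ()
columns u v w u₅ u₆ ()
columns u v w u₆ u₁ ()
columns u v w u₆ u₂ ()
columns u v w u₆ u₃ e q = r₂ (sym (act63 u v w) ∙ q)
columns u v w u₆ u₄ e q = f₂ refl (sym (act64 u v w) ∙ q)
columns u v w u₆ u₅ ()
columns u v w u₆ u₆ ()

flip-fixed : ∀ u v w → Zc u v w ≡ + 0 → + 2 * u + + 2 * v - w ≡ w
flip-fixed u v w h = r436 u v w ∙ cong (λ s → w + + 2 * s) h ∙ r437 w

module _ where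
  columns⇒Rel : ∀ u v w u′ v′ w′ n → Zc u v w * (n - + 1) ≡ + 0 → Columns u v w n (F u′ v′ w′) → Rel (u , v , w) (u′ , v′ , w′)
  columns⇒Rel u v w u′ v′ w′ n z c = go c where
    hit : ∀ {a b c} → F a b c ≡ F u′ v′ w′ → (u′ , v′ , w′) ≡ (a , b , c)
    hit {a} {b} {c} h with F-inj {a} {b} {c} {u′} {v′} {w′} h
    ... | p , q , r = sym (form≡ p q r)
    Z≡0 : n ≡ + 3 → Zc u v w ≡ + 0
    Z≡0 refl = cancelˡ {Zc u v w} 1 (ZP.*-comm (+ 2) (Zc u v w) ∙ z)
    go : Columns u v w n (F u′ v′ w′) → Rel (u , v , w) (u′ , v′ , w′)
    go (r₀ h) = inj₁ (hit h)
    go (r₁ h) = inj₂ (inj₁ (hit h))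
    go (r₂ h) = inj₂ (inj₂ (inj₁ (hit h)))
    go (f₀ e h) = inj₂ (inj₂ (inj₂ (Z≡0 e , inj₁ (hit (subst (λ s → F s v u ≡ F u′ v′ w′) (flip-fixed u v w (Z≡0 e)) h)))))
    go (f₁ e h) = inj₂ (inj₂ (inj₂ (Z≡0 e , inj₂ (inj₁ (hit (subst (λ s → F v u s ≡ F u′ v′ w′) (flip-fixed u v w (Z≡0 e)) h))))))
    go (f₂ e h) = inj₂ (inj₂ (inj₂ (Z≡0 e , inj₂ (inj₂ (hit (subst (λ s → F u s v ≡ F u′ v′ w′) (flip-fixed u v w (Z≡0 e)) h))))))

-- Both triples are obtuse, so S-formula forces u + v + w to agree and the columns of the transformation to be units.
classify : ∀ u v w u′ v′ w′ → Valid u v w → Obt u′ v′ w′ → Equiv (F u v w) (F u′ v′ w′) → Rel (u , v , w) (u′ , v′ , w′)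
classify u v w u′ v′ w′ (x , y , z) (x′ , y′ , z′) E@(α , β , γ , δ , e , q) =
  columns⇒Rel u v w u′ v′ w′ (N (α - γ) (β - δ)) (proj₂ (proj₂ zeros))
    (columns u v w (unit α β (from1 (N α β) (proj₁ zeros))) (unit γ δ (from1 (N γ δ) (proj₁ (proj₂ zeros)))) e q) where
  A = S≤ {u} {v} {w} {u′} {v′} {w′} (nn1 (Xc u v w) x , nn1 (Yc u v w) y , z) E
  B = S≤ {u′} {v′} {w′} {u} {v} {w} (x′ , y′ , z′) (Equiv-sym (F u v w) (F u′ v′ w′) E)
  from1 : ∀ x → x - + 1 ≡ + 0 → x ≡ + 1
  from1 x h = sym (≡-from-0 {+ 1} {x} h)
  zeros = parts (Yc u v w) (Xc u v w) (Zc u v w) (N α β - + 1) (N γ δ - + 1) (N (α - γ) (β - δ) - + 1) y x z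
    (proj₁ (proj₂ A)) (proj₁ (proj₂ (proj₂ A))) (proj₂ (proj₂ (proj₂ A)))
    (≈nn (≈nn (nn+ (nn+ (nn* y′ (proj₁ (proj₂ B))) (nn* x′ (proj₁ (proj₂ (proj₂ B))))) (nn* z′ (proj₂ (proj₂ (proj₂ B))))) (proj₁ B))
         (cong -_ (sym (proj₁ A)) ∙ r438 (u + v + w) (u′ + v′ + w′)))

Rel⇒Equiv : ∀ u v w u′ v′ w′ → Rel (u , v , w) (u′ , v′ , w′) → Equiv (F u v w) (F u′ v′ w′)
Rel⇒Equiv u v w u′ v′ w′ (inj₁ refl) = + 1 , + 0 , + 0 , + 1 , refl , act-1 (F u v w)
Rel⇒Equiv u v w u′ v′ w′ (inj₂ (inj₁ refl)) = rot-equiv u v w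
Rel⇒Equiv u v w u′ v′ w′ (inj₂ (inj₂ (inj₁ refl))) = Equiv-trans (F u v w) (F v w u) (F w u v) (rot-equiv u v w) (rot-equiv v w u)
Rel⇒Equiv u v w u′ v′ w′ (inj₂ (inj₂ (inj₂ (h , s)))) = go u′ v′ w′ s where
  fl : Equiv (F u v w) (F v u w)
  fl = subst (λ s → Equiv (F u v w) (F v u s)) (flip-fixed u v w h) (flip-equiv u v w)
  go : ∀ u′ v′ w′ → (u′ , v′ , w′) ≡ (w , v , u) ⊎ (u′ , v′ , w′) ≡ (v , u , w) ⊎ (u′ , v′ , w′) ≡ (u , w , v) → Equiv (F u v w) (F u′ v′ w′)
  go u′ v′ w′ (inj₁ refl) = Equiv-trans (F u v w) (F v u w) (F w v u) fl
    (Equiv-trans (F v u w) (F u w v) (F w v u) (rot-equiv v u w) (rot-equiv u w v))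
  go u′ v′ w′ (inj₂ (inj₁ refl)) = fl
  go u′ v′ w′ (inj₂ (inj₂ refl)) = Equiv-trans (F u v w) (F v u w) (F u w v) fl (rot-equiv v u w)

∑-enum : (D : Dom) → {P : Dom.A D → Set} (P? : ∀ s → Dec (P s)) (f : Dom.A D → ℤ) (R : List (Dom.A D)) →
  AllPairs _≢_ R → All (Dom.In D) R → All P R → (∀ s → P s → s ∈ R) →
  ∑ (Dom.L D) (λ s → when (P? s) (f s)) ≡ ∑ R f
∑-enum D {P} P? f R distinct inside sound complete = begin
  ∑ L (λ s → when (P? s) (f s))                   ≡⟨ ∑-cong L pointwise ⟩
  ∑ L (λ s → ∑ R (λ r → when (s ≟ r) (f r)))       ≡⟨ ∑-swap L R _ ⟩
  ∑ R (λ r → ∑ L (λ s → when (s ≟ r) (f r)))       ≡⟨ select R inside ⟩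
  ∑ R f ∎ where
  open Dom D
  open ≡-Reasoning
  select : ∀ R → All In R → ∑ R (λ r → ∑ L (λ s → when (s ≟ r) (f r))) ≡ ∑ R f
  select []      []       = refl
  select (r ∷ R) (i ∷ is) = cong₂ _+_ (full r i (f r)) (select R is)
  absent : ∀ R s → ¬ (s ∈ R) → ∑ R (λ r → when (s ≟ r) (f r)) ≡ + 0
  absent []      s n = refl
  absent (r ∷ R) s n = cong₂ _+_ (when-no (s ≟ r) (λ e → n (here e))) (absent R s (λ h → n (there h)))
  notin : ∀ {r : A} {R} → All (r ≢_) R → ¬ (r ∈ R)
  notin (n ∷ _)  (here e)  = n e
  notin (_ ∷ ns) (there h) = notin ns h
  present : ∀ R s → AllPairs _≢_ R → s ∈ R → ∑ R (λ r → when (s ≟ r) (f r)) ≡ f s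
  present (r ∷ R) s (d ∷ _) (here refl) = cong₂ _+_ (when-yes (s ≟ s) refl) (absent R s (notin d)) ∙ ZP.+-identityʳ (f s)
  present (r ∷ R) s (d ∷ ds) (there h) =
    trans (cong₂ _+_ (when-no (s ≟ r) (λ { refl → notin d h })) (present R s ds h)) (ZP.+-identityˡ (f s))
  sound-∈ : ∀ {R s} → All P R → s ∈ R → P s
  sound-∈ (p ∷ _)  (here refl) = p
  sound-∈ (_ ∷ ps) (there h)   = sound-∈ ps h
  pointwise : ∀ s → when (P? s) (f s) ≡ ∑ R (λ r → when (s ≟ r) (f r))
  pointwise s with P? s
  ... | yes p = sym (present R s distinct (complete s p))
  ... | no n  = sym (absent R s (λ h → n (sound-∈ sound h)))

T³ : Set
T³ = ℤ × ℤ × ℤ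

cube : ℕ → Dom
cube B = ℤD B ×D ℤD B ×D ℤD B

half : ∀ x → NN (x + x) → NN x
half (+ n) p = nn
half -[1+ n ] ()

half1 : ∀ x → NN (x + x + + 1) → NN x
half1 (+ n) p = nn
half1 -[1+ n ] p = ⊥-elim (nn⊥ (nn+ (nn+ p (nn {n})) (nn {n})) (r439 (+ n)))

quarter : ∀ x → NN (+ 4 * x - + 1) → NN (x - + 1)
quarter x p = pos-factor (+ 4) x nn p

dsc-XYZ : ∀ u v w → + 4 * u * v - (u + v - w) * (u + v - w) ≡ (v + w - u) * (u + w - v) + (u + w - v) * (u + v - w) + (u + v - w) * (v + w - u)
dsc-XYZ = ring

dsc-rot : ∀ u v w → + 4 * v * w - (v + w - u) * (v + w - u) ≡ + 4 * u * v - (u + v - w) * (u + v - w)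
dsc-rot = ring

dsc-flip : ∀ u v w → + 4 * v * u - (v + u - (+ 2 * u + + 2 * v - w)) * (v + u - (+ 2 * u + + 2 * v - w)) ≡ + 4 * u * v - (u + v - w) * (u + v - w)
dsc-flip = ring

second-pos : ∀ u v w → NN (u - + 1) → NN (dsc u v w - + 1) → NN (v - + 1)
second-pos u v w p q = pos-factor u v p (quarter (u * v) (≈nn (nn+ q (nn² (u + v - w))) (r440 u v w)))

rot-pos : ∀ u v w → NN (dsc u v w - + 1) → NN (dsc v w u - + 1)
rot-pos u v w q = ≈nn q (cong (λ s → s - + 1) (dsc-rot u v w))

Normal : ℤ → ℤ → ℤ → Set
Normal u v w = Σ ℤ λ u′ → Σ ℤ λ v′ → Σ ℤ λ w′ → Valid u′ v′ w′ × Equiv (F u v w) (F u′ v′ w′) × dsc u′ v′ w′ ≡ dsc u v w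

Normal-trans : ∀ u v w u′ v′ w′ → Equiv (F u v w) (F u′ v′ w′) → dsc u′ v′ w′ ≡ dsc u v w → Normal u′ v′ w′ → Normal u v w
Normal-trans u v w u′ v′ w′ E e (a , b , c , V , E′ , e′) = a , b , c , V , Equiv-trans (F u v w) (F u′ v′ w′) (F a b c) E E′ , e′ ∙ e

Normal-rot : ∀ u v w → Normal v w u → Normal u v w
Normal-rot u v w = Normal-trans u v w v w u (rot-equiv u v w) (dsc-rot u v w)

-- Since `dsc` = XY + YZ + ZX is positive, at most one parameter vanishes; a rotation moves it to
-- the position of `Zc`.
normalise : ∀ u v w → Obt u v w → NN (dsc u v w - + 1) → Normal u v w
normalise u v w (x , y , z) d with tri (Xc u v w) | tri (Yc u v w)
... | pos p | pos q = u , v , w , (p , q , z) , (+ 1 , + 0 , + 0 , + 1 , refl , act-1 (F u v w)) , refl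
... | neg p | _     = ⊥-elim (nn⊥ (nn+ x p) (r441 (Xc u v w)))
... | _     | neg p = ⊥-elim (nn⊥ (nn+ y p) (r441 (Yc u v w)))
... | zer e | pos q = Normal-rot u v w (v , w , u , (y′ , z′ , ≈nn x (r442 u v w)) , (+ 1 , + 0 , + 0 , + 1 , refl , act-1 (F v w u)) , refl) where
  y′ : NN (Xc v w u - + 1)
  y′ = ≈nn q (r443 u v w)
  z′ : NN (Yc v w u - + 1)
  z′ = ≈nn (pos-factor (Yc u v w) (Zc u v w) q (≈nn (≈nn d (sym (cong (λ s → s - + 1) (dsc-XYZ u v w)))) (sym (r445 (Yc u v w) (Zc u v w)) ∙ cong (λ s → s * Yc u v w + Yc u v w * Zc u v w + Zc u v w * s - + 1) (sym e)))) (r444 u v w)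
... | zer e | zer f = ⊥-elim (nn⊥ (≈nn d (sym (cong (λ s → s - + 1) (dsc-XYZ u v w)))) (cong₂ (λ s t → s * t + t * Zc u v w + Zc u v w * s - + 1) e f ∙ r270 (Zc u v w)))
... | pos p | zer f = Normal-rot u v w (Normal-rot v w u (w , u , v , (z′ , ≈nn p (r446 u v w) , ≈nn y (r281 u v w)) , (+ 1 , + 0 , + 0 , + 1 , refl , act-1 (F w u v)) , refl)) where
  z′ : NN (Xc w u v - + 1)
  z′ = pos-factor (Xc u v w) (Zc u v w) p (≈nn (≈nn d (sym (cong (λ s → s - + 1) (dsc-XYZ u v w)))) (sym (r447 (Xc u v w) (Zc u v w)) ∙ cong (λ s → Xc u v w * s + s * Zc u v w + Zc u v w * Xc u v w - + 1) (sym f)))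

-- Selling's reduction. Flipping at a negative parameter adds twice that parameter to u + v + w, so
-- the sum drops by at least 2, while the values stay positive. The fuel n bounds the sum from
-- above.
reduce : ∀ n u v w → NN (+ n - (u + v + w)) → NN (u - + 1) → NN (dsc u v w - + 1) → Normal u v w
reduce zero u v w h p d = ⊥-elim (nn⊥ (nn+ (nn+ (nn+ h p) (nn+ (second-pos u v w p d) q)) (nn {2})) (r448 u v w)) where
  q = second-pos v w u (second-pos u v w p d) (rot-pos u v w d)
reduce (suc n) u v w h p d = go (NN? (Zc u v w)) (NN? (Xc u v w)) (NN? (Yc u v w)) where
  p₂ = second-pos u v w p d
  d₂ = rot-pos u v w d
  p₃ = second-pos v w u p₂ d₂
  d₃ = rot-pos v w u d₂
  flip : ∀ u v w → NN (+ suc n - (u + v + w)) → NN (v - + 1) → NN (dsc u v w - + 1) → ¬ NN (Zc u v w) → Normal u v w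
  flip u v w h q d z = Normal-trans u v w v u (+ 2 * u + + 2 * v - w) (flip-equiv u v w) (dsc-flip u v w)
    (reduce n v u (+ 2 * u + + 2 * v - w) (≈nn (nn+ (nn+ h (nn+ (¬nn {Zc u v w} z) (¬nn {Zc u v w} z))) (nn {1})) (r268 u v w (+ n))) q (≈nn d (cong (λ s → s - + 1) (dsc-flip u v w))))
  go : Dec (NN (Zc u v w)) → Dec (NN (Xc u v w)) → Dec (NN (Yc u v w)) → Normal u v w
  go (no z)  _       _       = flip u v w h p₂ d z
  go (yes z) (no x)  _       = Normal-rot u v w (flip v w u (≈nn h (r449 (+ suc n) u v w)) p₃ d₂ x)
  go (yes z) (yes x) (no y)  = Normal-rot u v w (Normal-rot v w u (flip w u v (≈nn (≈nn h (r449 (+ suc n) u v w)) (r449 (+ suc n) v w u)) p d₃ (λ k → y (≈nn k (r134 u v w)))))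
  go (yes z) (yes x) (yes y) = normalise u v w (x , y , z) d

-- Class numbers as weighted counts of obtuse triples

obt? : ∀ u v w → Dec (Obt u v w)
obt? u v w = NN? (Xc u v w) ×-dec NN? (Yc u v w) ×-dec NN? (Zc u v w)

two : ∀ {P : Set} → Dec P → ℤ
two (yes _) = + 1
two (no _)  = + 2

prod : T³ → ℤ
prod (u , v , w) = Xc u v w * Yc u v w * Zc u v w

-- With these weights each class contributes 6/ω. For ω = 1 these are three rotations of weight 2,
-- or six arrangements of weight 1 if a parameter vanishes. The class of a(x² + y²) has three
-- triples of weight 1, that of a(x² + xy + y²) one triple of weight 2.
wt : T³ → ℤ
wt (u , v , w) = when (obt? u v w) (two (prod (u , v , w) ℤ.≟ + 0))

_≟³_ : (s r : T³) → Dec (s ≡ r)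
_≟³_ = Dom._≟_ (cube 0)

Rel? : ∀ s r → Dec (Rel s r)
Rel? (u , v , w) s = (s ≟³ (u , v , w)) ⊎-dec (s ≟³ (v , w , u)) ⊎-dec (s ≟³ (w , u , v)) ⊎-dec
  ((Zc u v w ℤ.≟ + 0) ×-dec ((s ≟³ (w , v , u)) ⊎-dec (s ≟³ (v , u , w)) ⊎-dec (s ≟³ (u , w , v))))

Good : T³ → T³ → Set
Good (u , v , w) (u′ , v′ , w′) = Obt u′ v′ w′ × dsc u′ v′ w′ ≡ dsc u v w × prod (u′ , v′ , w′) ≡ prod (u , v , w)

Good-trans : ∀ r s t → Good r s → Good s t → Good r t
Good-trans _ _ _ (_ , d , p) (o , d′ , p′) = o , d′ ∙ d , p′ ∙ p

Good-rot : ∀ u v w → Obt u v w → Good (u , v , w) (v , w , u)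
Good-rot u v w (x , y , z) = (≈nn y (r281 u v w) , ≈nn z (r282 u v w) , x) , dsc-rot u v w , r450 u v w

Good-swap : ∀ u v w → Obt u v w → Good (u , v , w) (v , u , w)
Good-swap u v w (x , y , z) = (y , x , ≈nn z (r282 u v w)) , r451 u v w , r452 u v w

Rel⇒Good : ∀ u v w s → Obt u v w → Rel (u , v , w) s → Good (u , v , w) s
Rel⇒Good u v w s o (inj₁ refl) = o , refl , refl
Rel⇒Good u v w s o (inj₂ (inj₁ refl)) = Good-rot u v w o
Rel⇒Good u v w s o (inj₂ (inj₂ (inj₁ refl))) = Good-trans (u , v , w) (v , w , u) (w , u , v) (Good-rot u v w o) (Good-rot v w u (proj₁ (Good-rot u v w o)))
Rel⇒Good u v w s o (inj₂ (inj₂ (inj₂ (_ , inj₂ (inj₁ refl))))) = Good-swap u v w o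
Rel⇒Good u v w s o (inj₂ (inj₂ (inj₂ (_ , inj₂ (inj₂ refl))))) = Good-trans (u , v , w) (v , u , w) (u , w , v) (Good-swap u v w o) (Good-rot v u w (proj₁ (Good-swap u v w o)))
Rel⇒Good u v w s o (inj₂ (inj₂ (inj₂ (_ , inj₁ refl)))) = Good-trans (u , v , w) (v , w , u) (w , v , u) (Good-rot u v w o) (Good-swap v w u (proj₁ (Good-rot u v w o)))

dsc-XYZ′ : ∀ u v w → dsc u v w ≡ Xc u v w * Yc u v w + Yc u v w * Zc u v w + Zc u v w * Xc u v w
dsc-XYZ′ = dsc-XYZ

nn-neg⊥ : ∀ x → NN x → NN (- x - + 1) → ⊥
nn-neg⊥ (+ zero) p ()
nn-neg⊥ (+ suc n) p ()

-- The bound u ≤ `dsc` confines the obtuse triples of given discriminant to a cube. Here 2u = y + z.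
-- If x ≥ 1, the term x (y + z) suffices; if x = 0, then y, z ≥ 1 and 2yz ≥ y + z.
u-bounds-XYZ : ∀ x y z u → NN x → NN y → NN z → NN (x * y + y * z + z * x - + 1) → u + u ≡ y + z →
  NN u × NN (x * y + y * z + z * x - u)
u-bounds-XYZ x y z u x₀ y₀ z₀ d e = u₀ , go (tri x) (tri y) (tri z) where
  u₀ : NN u
  u₀ = half u (≈nn (nn+ y₀ z₀) e)
  go : Tri x → Tri y → Tri z → NN (x * y + y * z + z * x - u)
  go (pos p) _ _ = nn-mod {g = x * y + y * z + z * x - u} (- (+ 1)) (nn+ (nn+ (nn* p (nn+ y₀ z₀)) (nn* y₀ z₀)) u₀) e (r269 x y z u)
  go (neg p) _ _ = ⊥-elim (nn-neg⊥ x x₀ p)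
  go _ (neg p) _ = ⊥-elim (nn-neg⊥ y y₀ p)
  go _ _ (neg p) = ⊥-elim (nn-neg⊥ z z₀ p)
  go (zer refl) (zer refl) _ = ⊥-elim (nn⊥ d (r270 z))
  go (zer refl) _ (zer refl) = ⊥-elim (nn⊥ d (r271 y))
  go (zer refl) (pos q) (pos r) = half (+ 0 * y + y * z + z * + 0 - u)
    (nn-mod {g = + 0 * y + y * z + z * + 0 - u + (+ 0 * y + y * z + z * + 0 - u)} (- (+ 1)) (nn+ d (nn* q r)) e (r272 y z u))

u-bounds : ∀ u v w → Obt u v w → NN (dsc u v w - + 1) → NN u × NN (dsc u v w - u)
u-bounds u v w (x , y , z) d = proj₁ b , subst (λ s → NN (s - u)) (sym (dsc-XYZ′ u v w)) (proj₂ b) where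
  b = u-bounds-XYZ (Xc u v w) (Yc u v w) (Zc u v w) u x y z (subst (λ s → NN (s - + 1)) (dsc-XYZ′ u v w) d) (r131 u v w)

nn-≤ : ∀ {x n} → NN x → NN (+ n - x) → ∣ x ∣ ≤ n
nn-≤ {+ a} {n} p q = ZP.drop‿+≤+ (ZP.0≤i-j⇒j≤i {+ n} {+ a} q)

in-cube : ∀ B n u v w → n ≤ B → Obt u v w → dsc u v w ≡ + n → NN (+ n - + 1) → Dom.In (cube B) (u , v , w)
in-cube B n u v w n≤B o e p = bound u v w o e , bound v w u (proj₁ g₁) (proj₁ (proj₂ g₁) ∙ e) ,
    bound w u v (proj₁ g₂) (proj₁ (proj₂ g₂) ∙ proj₁ (proj₂ g₁) ∙ e) where
  g₁ = Good-rot u v w o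
  g₂ = Good-rot v w u (proj₁ g₁)
  bound : ∀ u v w → Obt u v w → dsc u v w ≡ + n → ∣ u ∣ ≤ B
  bound u v w o e = NP.≤-trans (nn-≤ {u} {n} (proj₁ b) (subst (λ s → NN (s - u)) e (proj₂ b))) n≤B
    where b = u-bounds u v w o (subst (λ s → NN (s - + 1)) (sym e) p)

wt-obt : ∀ u v w m → Obt u v w → prod (u , v , w) ≡ m → wt (u , v , w) ≡ two (m ℤ.≟ + 0)
wt-obt u v w m o refl = when-yes (obt? u v w) o

Rel-count : ∀ B n u v w (R : List T³) → n ≤ B → Obt u v w → dsc u v w ≡ + n → NN (+ n - + 1) →
  AllPairs _≢_ R → All (Rel (u , v , w)) R → (∀ s → Rel (u , v , w) s → s ∈ R) →
  ∑ (Dom.L (cube B)) (λ s → when (Rel? (u , v , w) s) (wt s)) ≡ ∑ R (λ _ → two (prod (u , v , w) ℤ.≟ + 0))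
Rel-count B n u v w R n≤B o e p distinct sound complete =
  trans (∑-enum (cube B) (Rel? (u , v , w)) wt R distinct (inside R sound) sound complete) (same R sound) where
  inside : ∀ R → All (Rel (u , v , w)) R → All (Dom.In (cube B)) R
  inside [] [] = []
  inside ((a , b , c) ∷ R) (r ∷ rs) = in-cube B n a b c n≤B (proj₁ g) (proj₁ (proj₂ g) ∙ e) p ∷ inside R rs
    where g = Rel⇒Good u v w (a , b , c) o r
  same : ∀ R → All (Rel (u , v , w)) R → ∑ R wt ≡ ∑ R (λ _ → two (prod (u , v , w) ℤ.≟ + 0))
  same [] [] = refl
  same ((a , b , c) ∷ R) (r ∷ rs) = cong₂ _+_ (wt-obt a b c (prod (u , v , w)) (proj₁ g) (proj₂ (proj₂ g))) (same R rs)
    where g = Rel⇒Good u v w (a , b , c) o r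

disc-act : ∀ α β γ δ a b c →
  (+ 2 * a * α * β + b * (α * δ + β * γ) + + 2 * c * γ * δ) * (+ 2 * a * α * β + b * (α * δ + β * γ) + + 2 * c * γ * δ)
    - + 4 * (a * α * α + b * α * γ + c * γ * γ) * (a * β * β + b * β * δ + c * δ * δ)
  ≡ (α * δ - β * γ) * (α * δ - β * γ) * (b * b - + 4 * a * c)
disc-act = ring

disc-Equiv : ∀ P Q → Equiv P Q → disc Q ≡ disc P
disc-Equiv (a , b , c) Q (α , β , γ , δ , e , refl) =
  trans (disc-act α β γ δ a b c) (cong (λ s → s * s * (b * b - + 4 * a * c)) e ∙ r453 (b * b - + 4 * a * c))

disc-F : ∀ u v w → (w - u - v) * (w - u - v) - + 4 * u * v ≡ - (+ 4 * u * v - (u + v - w) * (u + v - w))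
disc-F = ring

dsc-Equiv : ∀ n Q u v w → disc Q ≡ - (+ n) → Equiv Q (F u v w) → dsc u v w ≡ + n
dsc-Equiv n Q u v w d E = sym (ZP.neg-involutive (dsc u v w)) ∙ cong -_ (sym (disc-F u v w) ∙ disc-Equiv Q (F u v w) E ∙ d) ∙ ZP.neg-involutive (+ n)

<⇒nn : ∀ x → + 0 ℤ.< x → NN (x - + 1)
<⇒nn (+ suc n) p = nn
<⇒nn (+ zero) (ℤ.+<+ ())

nn⇒< : ∀ x → NN (x - + 1) → + 0 ℤ.< x
nn⇒< (+ suc n) p = ℤ.+<+ (s≤s z≤n)

PosDef-Equiv : ∀ Q u v w → PosDef Q → Equiv Q (F u v w) → NN (u - + 1)
PosDef-Equiv (a , b , c) u v w pd (α , β , γ , δ , e , q) = <⇒nn u (subst (λ s → + 0 ℤ.< s) (cong proj₁ q) (pd α γ λ { (refl , refl) → 0≢1 (sym (r454 β δ) ∙ e) })) where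
  0≢1 : + 0 ≢ + 1
  0≢1 ()

F-of : ∀ a b c → F a c (a + b + c) ≡ (a , b , c)
F-of a b c = form≡ refl (r455 a b c) refl

Equiv-refl : ∀ Q → Equiv Q Q
Equiv-refl Q = + 1 , + 0 , + 0 , + 1 , refl , act-1 Q

-- The data of one class: an obtuse representative and 6/ω as a number of weighted obtuse triples.
Class : ℕ → ℕ → Form → ℚ → Set
Class B n Q ω = Σ ℤ λ u → Σ ℤ λ v → Σ ℤ λ w → Valid u v w × Equiv Q (F u v w) × dsc u v w ≡ + n ×
  ω ≡ ∑ (Dom.L (cube B)) (λ s → when (Rel? (u , v , w) s) (wt s)) ℚ./ 6

Valid⇒Obt : ∀ u v w → Valid u v w → Obt u v w
Valid⇒Obt u v w (x , y , z) = nn1 (Xc u v w) x , nn1 (Yc u v w) y , z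

two-no : ∀ {P : Set} (d : Dec P) → ¬ P → two d ≡ + 2
two-no (yes p) n = ⊥-elim (n p)
two-no (no _)  n = refl

two-yes : ∀ {P : Set} (d : Dec P) → P → two d ≡ + 1
two-yes (yes p) _ = refl
two-yes (no n)  p = ⊥-elim (n p)

*≢0 : ∀ x y → x ≢ + 0 → y ≢ + 0 → x * y ≢ + 0
*≢0 x y p q e with *≡0 {x} {y} e
... | inj₁ h = p h
... | inj₂ h = q h

pos≢0 : ∀ x → NN (x - + 1) → x ≢ + 0
pos≢0 x p e = 0≢pos {x} e p

module _ where
  ∑-const : ∀ {A : Set} (R : List A) c c′ → c ≡ c′ → ∑ R (λ _ → c) ≡ ∑ R (λ _ → c′)
  ∑-const R c c′ refl = refl

prod-pos : ∀ u v w → NN (Xc u v w - + 1) → NN (Yc u v w - + 1) → NN (Zc u v w - + 1) → two (prod (u , v , w) ℤ.≟ + 0) ≡ + 2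
prod-pos u v w x y z = two-no (prod (u , v , w) ℤ.≟ + 0)
  (*≢0 (Xc u v w * Yc u v w) (Zc u v w) (*≢0 (Xc u v w) (Yc u v w) (pos≢0 (Xc u v w) x) (pos≢0 (Yc u v w) y)) (pos≢0 (Zc u v w) z))

prod-zero : ∀ u v w → Zc u v w ≡ + 0 → two (prod (u , v , w) ℤ.≟ + 0) ≡ + 1
prod-zero u v w z = two-yes (prod (u , v , w) ℤ.≟ + 0) (cong (λ s → Xc u v w * Yc u v w * s) z ∙ ZP.*-zeroʳ (Xc u v w * Yc u v w))

module Shapes (B n : ℕ) (n≤B : n ≤ B) (n≥1 : NN (+ n - + 1)) where

  Count : ℤ → ℤ → ℤ → ℤ
  Count u v w = ∑ (Dom.L (cube B)) (λ s → when (Rel? (u , v , w) s) (wt s))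

  equal : ∀ a → NN (Zc a a a - + 1) → Valid a a a → dsc a a a ≡ + n → Count a a a ≡ + 2
  equal a z V d = Rel-count B n a a a ((a , a , a) ∷ []) n≤B (Valid⇒Obt a a a V) d n≥1 ([] ∷ []) (inj₁ refl ∷ []) complete ∙
    ∑-const ((a , a , a) ∷ []) (two (prod (a , a , a) ℤ.≟ + 0)) (+ 2) (prod-pos a a a (proj₁ V) (proj₁ (proj₂ V)) z) where
    complete : ∀ s → Rel (a , a , a) s → s ∈ ((a , a , a) ∷ [])
    complete s (inj₁ e) = here e
    complete s (inj₂ (inj₁ e)) = here e
    complete s (inj₂ (inj₂ (inj₁ e))) = here e
    complete s (inj₂ (inj₂ (inj₂ (h , _)))) = ⊥-elim (pos≢0 (Zc a a a) z h)

  generic : ∀ u v w → NN (Zc u v w - + 1) → Valid u v w → dsc u v w ≡ + n → ¬ (u ≡ v × v ≡ w) → Count u v w ≡ + 6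
  generic u v w z V d ne = Rel-count B n u v w R n≤B (Valid⇒Obt u v w V) d n≥1 distinct (inj₁ refl ∷ inj₂ (inj₁ refl) ∷ inj₂ (inj₂ (inj₁ refl)) ∷ []) complete ∙
    ∑-const R (two (prod (u , v , w) ℤ.≟ + 0)) (+ 2) (prod-pos u v w (proj₁ V) (proj₁ (proj₂ V)) z) where
    R = (u , v , w) ∷ (v , w , u) ∷ (w , u , v) ∷ []
    distinct : AllPairs _≢_ R
    distinct = ((λ { refl → ne (refl , refl) }) ∷ (λ { refl → ne (refl , refl) }) ∷ []) ∷ ((λ { refl → ne (refl , refl) }) ∷ []) ∷ [] ∷ []
    complete : ∀ s → Rel (u , v , w) s → s ∈ R
    complete s (inj₁ e) = here e
    complete s (inj₂ (inj₁ e)) = there (here e)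
    complete s (inj₂ (inj₂ (inj₁ e))) = there (there (here e))
    complete s (inj₂ (inj₂ (inj₂ (h , _)))) = ⊥-elim (pos≢0 (Zc u v w) z h)

  square : ∀ a w → Zc a a w ≡ + 0 → Valid a a w → dsc a a w ≡ + n → a ≢ w → Count a a w ≡ + 3
  square a w z V d ne = Rel-count B n a a w R n≤B (Valid⇒Obt a a w V) d n≥1 distinct (inj₁ refl ∷ inj₂ (inj₁ refl) ∷ inj₂ (inj₂ (inj₁ refl)) ∷ []) complete ∙
    ∑-const R (two (prod (a , a , w) ℤ.≟ + 0)) (+ 1) (prod-zero a a w z) where
    R = (a , a , w) ∷ (a , w , a) ∷ (w , a , a) ∷ []
    distinct : AllPairs _≢_ R
    distinct = ((λ { refl → ne refl }) ∷ (λ { refl → ne refl }) ∷ []) ∷ ((λ { refl → ne refl }) ∷ []) ∷ [] ∷ []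
    complete : ∀ s → Rel (a , a , w) s → s ∈ R
    complete s (inj₁ e) = here e
    complete s (inj₂ (inj₁ e)) = there (here e)
    complete s (inj₂ (inj₂ (inj₁ e))) = there (there (here e))
    complete s (inj₂ (inj₂ (inj₂ (_ , inj₁ e)))) = there (there (here e))
    complete s (inj₂ (inj₂ (inj₂ (_ , inj₂ (inj₁ e))))) = here e
    complete s (inj₂ (inj₂ (inj₂ (_ , inj₂ (inj₂ e))))) = there (here e)

  right : ∀ u v w → Zc u v w ≡ + 0 → Valid u v w → dsc u v w ≡ + n → u ≢ v → u ≢ w → v ≢ w → Count u v w ≡ + 6
  right u v w z V d uv uw vw = Rel-count B n u v w R n≤B (Valid⇒Obt u v w V) d n≥1 distinct
      (inj₁ refl ∷ inj₂ (inj₁ refl) ∷ inj₂ (inj₂ (inj₁ refl)) ∷ inj₂ (inj₂ (inj₂ (z , inj₁ refl))) ∷ inj₂ (inj₂ (inj₂ (z , inj₂ (inj₁ refl)))) ∷ inj₂ (inj₂ (inj₂ (z , inj₂ (inj₂ refl)))) ∷ []) complete ∙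
    ∑-const R (two (prod (u , v , w) ℤ.≟ + 0)) (+ 1) (prod-zero u v w z) where
    R = (u , v , w) ∷ (v , w , u) ∷ (w , u , v) ∷ (w , v , u) ∷ (v , u , w) ∷ (u , w , v) ∷ []
    distinct : AllPairs _≢_ R
    distinct = ((λ { refl → uv refl }) ∷ (λ { refl → uw refl }) ∷ (λ { refl → uw refl }) ∷ (λ { refl → uv refl }) ∷ (λ { refl → vw refl }) ∷ [])
      ∷ ((λ { refl → vw refl }) ∷ (λ { refl → vw refl }) ∷ (λ { refl → uw refl }) ∷ (λ { refl → uv refl }) ∷ [])
      ∷ ((λ { refl → uv refl }) ∷ (λ { refl → vw refl }) ∷ (λ { refl → uw refl }) ∷ [])
      ∷ ((λ { refl → vw refl }) ∷ (λ { refl → uw refl }) ∷ [])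
      ∷ ((λ { refl → uv refl }) ∷ [])
      ∷ [] ∷ []
    complete : ∀ s → Rel (u , v , w) s → s ∈ R
    complete s (inj₁ e) = here e
    complete s (inj₂ (inj₁ e)) = there (here e)
    complete s (inj₂ (inj₂ (inj₁ e))) = there (there (here e))
    complete s (inj₂ (inj₂ (inj₂ (_ , inj₁ e)))) = there (there (there (here e)))
    complete s (inj₂ (inj₂ (inj₂ (_ , inj₂ (inj₁ e))))) = there (there (there (there (here e))))
    complete s (inj₂ (inj₂ (inj₂ (_ , inj₂ (inj₂ e))))) = there (there (there (there (there (here e)))))

  class : ∀ Q ω → PosDef Q → disc Q ≡ - (+ n) → InvOmega Q ω → Class B n Q ω
  class Q .(+ 1 ℚ./ 2) pd d (ω2 (a , E)) = a , a , a + a , V , E′ , dd , cong (λ s → s ℚ./ 6) (sym (square a (a + a) (r275 a) V dd (λ e → pos≢0 a a≥1 (l₄ e)))) where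
    l₄ : a ≡ a + a → a ≡ + 0
    l₄ e = r276 a ∙ cong (λ s → s - a) (sym e) ∙ r16 a
    E′ : Equiv Q (F a a (a + a))
    E′ = subst (Equiv Q) (form≡ refl (sym (r273 a)) refl) E
    a≥1 = PosDef-Equiv Q a a (a + a) pd E′
    dd = dsc-Equiv n Q a a (a + a) d E′
    V : Valid a a (a + a)
    V = ≈nn (nn+ (nn+ a≥1 a≥1) (nn {1})) (r274 a) , ≈nn (nn+ (nn+ a≥1 a≥1) (nn {1})) (r274 a) , ≈nn (nn {0}) (r275 a)
  class Q .(+ 1 ℚ./ 3) pd d (ω3 (a , E)) = a , a , a , V , E′ , dd , cong (λ s → s ℚ./ 6) (sym (equal a (≈nn a≥1 (l₂ a)) V dd)) where
    l₂ = r277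
    -- The form (a, a, a) takes the values a, a, 3a; the flip replaces 3a by 2a + 2a - 3a = a and
    -- yields the equilateral triple.
    E′ : Equiv Q (F a a a)
    E′ = Equiv-trans Q (F a a (a + a + a)) (F a a a) (subst (Equiv Q) (sym (F-of a a a)) E)
           (subst (λ s → Equiv (F a a (a + a + a)) (F a a s)) (r19 a) (flip-equiv a a (a + a + a)))
    a≥1 = PosDef-Equiv Q a a a pd E′
    dd = dsc-Equiv n Q a a a d E′
    V : Valid a a a
    V = ≈nn a≥1 (r277 a) , ≈nn a≥1 (r277 a) , nn1 (Zc a a a) (≈nn a≥1 (r277 a))
  class Q@(a , b , c) .(+ 1 ℚ./ 1) pd d (ω1 n2 n3) = go red where
    E₀ : Equiv Q (F a c (a + b + c))
    E₀ = subst (Equiv Q) (sym (F-of a b c)) (Equiv-refl Q)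
    d₀ = dsc-Equiv n Q a c (a + b + c) d E₀
    red : Normal a c (a + b + c)
    red = reduce (∣ a + c + (a + b + c) ∣) a c (a + b + c) (bound (a + c + (a + b + c))) (PosDef-Equiv Q a c (a + b + c) pd E₀) (subst (λ s → NN (s - + 1)) (sym d₀) n≥1) where
      bound : ∀ x → NN (+ ∣ x ∣ - x)
      bound (+ m) = ≈nn (nn {0}) (r16 (+ m))
      bound -[1+ m ] = nn
    go : Normal a c (a + b + c) → Class B n Q (+ 1 ℚ./ 1)
    go (u , v , w , V@(x , y , z) , E , e) = u , v , w , V , E′ , dd , cong (λ s → s ℚ./ 6) (sym (count (Zc u v w ℤ.≟ + 0) (u ℤ.≟ v) (v ℤ.≟ w))) where
      E′ : Equiv Q (F u v w)
      E′ = Equiv-trans Q (F a c (a + b + c)) (F u v w) E₀ E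
      dd = dsc-Equiv n Q u v w d E′
      z≥1 : Zc u v w ≢ + 0 → NN (Zc u v w - + 1)
      z≥1 h = t (tri (Zc u v w)) where
        t : Tri (Zc u v w) → NN (Zc u v w - + 1)
        t (pos p) = p
        t (zer k) = ⊥-elim (h k)
        t (neg p) = ⊥-elim (nn-neg⊥ (Zc u v w) z p)
      count : Dec (Zc u v w ≡ + 0) → Dec (u ≡ v) → Dec (v ≡ w) → Count u v w ≡ + 6
      -- For `Zc` = 0 and u = v the form is u(x² + y²), and for u = v = w it is u(x² - xy + y²);
      -- both contradict ω = 1. With `Zc` = 0, an equality u = w or v = w would make a second
      -- parameter vanish.
      count (yes h) (yes refl) _ = ⊥-elim (n2 (u , subst (Equiv Q) (form≡ refl (r17 u w ∙ cong -_ h) refl) E′))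
      count (yes h) (no ne) _ = right u v w h V dd ne
          (λ { refl → pos≢0 (Xc u v u) x (r18 u v ∙ h) }) (λ { refl → pos≢0 (Yc u v v) y h })
      count (no h) (yes refl) (yes refl) = ⊥-elim (n3 (u , Equiv-trans Q (F u u u) (u , u , u) E′ (Equiv-sym (u , u , u) (F u u u) uuu))) where
        uuu : Equiv (u , u , u) (F u u u)
        uuu = subst (λ q → Equiv q (F u u u)) (F-of u u u) (subst (λ s → Equiv (F u u (u + u + u)) (F u u s)) (r19 u) (flip-equiv u u (u + u + u)))
      count (no h) (no ne) _ = generic u v w (z≥1 h) V dd (λ p → ne (proj₁ p))
      count (no h) (yes _) (no ne) = generic u v w (z≥1 h) V dd (λ p → ne (proj₂ p))

fromℚᵘ-+ : ∀ p q → ℚ.fromℚᵘ p ℚ.+ ℚ.fromℚᵘ q ≡ ℚ.fromℚᵘ (p ℚᵘ.+ q)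
fromℚᵘ-+ p q = QP.toℚᵘ-injective (UP.≃-trans (QP.toℚᵘ-homo-+ (ℚ.fromℚᵘ p) (ℚ.fromℚᵘ q))
  (UP.≃-trans (UP.+-cong (QP.toℚᵘ-fromℚᵘ p) (QP.toℚᵘ-fromℚᵘ q)) (UP.≃-sym (QP.toℚᵘ-fromℚᵘ (p ℚᵘ.+ q)))))

/6-+ : ∀ a b → (a ℚ./ 6) ℚ.+ (b ℚ./ 6) ≡ (a + b) ℚ./ 6
/6-+ a b = fromℚᵘ-+ (mkℚᵘ a 5) (mkℚᵘ b 5) ∙ QP.fromℚᵘ-cong {mkℚᵘ a 5 ℚᵘ.+ mkℚᵘ b 5} {mkℚᵘ (a + b) 5} (*≡* (r456 a b))

-- Completing the square: 4u Q(x, y) = (2ux + by)² + D y². For y = 0 the value is u x².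
PosDef-lemma : ∀ u b v x y D → D ≡ + 4 * u * v - b * b → NN (D - + 1) → NN (u - + 1) → ¬ (x ≡ + 0 × y ≡ + 0) →
  NN (u * x * x + b * x * y + v * y * y - + 1)
PosDef-lemma u b v x y D e d u≥1 h = go (y ℤ.≟ + 0) where
  go : Dec (y ≡ + 0) → NN (u * x * x + b * x * y + v * y * y - + 1)
  go (yes y≡0) = subst (λ y → NN (u * x * x + b * x * y + v * y * y - + 1)) (sym y≡0)
      (≈nn (nn+ (nn* u≥1 (nn² x)) (sq≥1 (λ x≡0 → h (x≡0 , y≡0)))) (r278 u b v x))
  go (no y≢0) = pos-factor u (u * x * x + b * x * y + v * y * y) u≥1 (quarter (u * (u * x * x + b * x * y + v * y * y))
      (nn-mod {g = + 4 * (u * (u * x * x + b * x * y + v * y * y)) - + 1} (- (y * y))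
        (nn+ (nn+ (nn+ (nn² (+ 2 * u * x + b * y)) (nn* d (sq≥1 y≢0))) d) (sq≥1 y≢0)) e (r279 u b v x y D)))

u-pos : ∀ u v w → Obt u v w → NN (dsc u v w - + 1) → NN (u - + 1)
u-pos u v w o d = t (tri u) where
  t : Tri u → NN (u - + 1)
  t (pos p) = p
  t (neg p) = ⊥-elim (nn-neg⊥ u (proj₁ (u-bounds u v w o d)) p)
  t (zer u≡0) = ⊥-elim (nn⊥ (nn+ (subst (λ s → NN (+ 4 * s * v - Zc u v w * Zc u v w - + 1)) u≡0 d) (nn² (Zc u v w))) (r457 v (Zc u v w)))

dsc-b : ∀ u v w → dsc u v w ≡ + 4 * u * v - (w - u - v) * (w - u - v)
dsc-b u v w = cong (λ s → + 4 * u * v - s) (r458 u v w)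

PosDef-F : ∀ u v w → Obt u v w → NN (dsc u v w - + 1) → PosDef (F u v w)
PosDef-F u v w o d x y h = nn⇒< (evalForm (F u v w) x y)
  (PosDef-lemma u (w - u - v) v x y (dsc u v w) (dsc-b u v w) d (u-pos u v w o d) h)

onD : ℤ → T³ → ℤ → ℤ
onD D (u , v , w) x = when (dsc u v w ℤ.≟ D) x

-- This is 6 H(D) for the discriminants that matter: `hurwitz-count` shows it for 0 < D ≤ B with D ≡
-- 0, 3 (mod 4), and `P2-neg` gives the value 0 for D < 0.
P2 : ℕ → ℤ → ℤ
P2 B D = ∑ (Dom.L (cube B)) (λ s → onD D s (wt s))

data Reps (n : ℕ) : List Form → List T³ → Set where
  []  : Reps n [] []
  _∷_ : ∀ {Q L u v w T} → Valid u v w × Equiv Q (F u v w) × dsc u v w ≡ + n → Reps n L T → Reps n (Q ∷ L) ((u , v , w) ∷ T)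

module _ (B n : ℕ) (n≤B : n ≤ B) (n≥1 : NN (+ n - + 1)) where

  Cnt : T³ → ℤ
  Cnt s = ∑ (Dom.L (cube B)) (λ r → when (Rel? s r) (wt r))

  Classes : List Form → ℚ → Set
  Classes L h = Σ (List T³) λ T → Reps n L T × h ≡ ∑ T Cnt ℚ./ 6

  classes : ∀ {L h} → All (λ Q → PosDef Q × disc Q ≡ - (+ n)) L → WeightedSum L h → Classes L h
  classes [] ws[] = [] , [] , refl
  classes ((pd , d) ∷ ps) (ws∷ {Q} {L} {ω} {s} i W) = go (Shapes.class B n n≤B n≥1 Q ω pd d i) (classes ps W) where
    go : Class B n Q ω → Classes L s → Classes (Q ∷ L) (ω ℚ.+ s)
    go (u , v , w , V , E , e , p) (T , R , q) =
      (u , v , w) ∷ T , (V , E , e) ∷ R , cong₂ ℚ._+_ p q ∙ /6-+ (Cnt (u , v , w)) (∑ T Cnt)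

  none : ∀ {L T} u v w Q → Obt u v w → Equiv Q (F u v w) → All (λ Q′ → ¬ Equiv Q Q′) L → Reps n L T →
         ∀ c → ∑ T (λ s → when (Rel? s (u , v , w)) c) ≡ + 0
  none u v w Q o E [] [] c = refl
  none u v w Q o E (ne ∷ nes) (_∷_ {Q′} {L} {a} {b} {c′} (V , E′ , _) R) c = cong₂ _+_
    (when-no (Rel? (a , b , c′) (u , v , w)) λ r →
      ne (Equiv-trans Q (F u v w) Q′ E (Equiv-sym Q′ (F u v w) (Equiv-trans Q′ (F a b c′) (F u v w) E′ (Rel⇒Equiv a b c′ u v w r)))))
    (none u v w Q o E nes R c)

  one : ∀ {L T} u v w → Obt u v w → Any (Equiv (F u v w)) L → AllPairs (λ Q Q′ → ¬ Equiv Q Q′) L → Reps n L T →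
        ∀ c → ∑ T (λ s → when (Rel? s (u , v , w)) c) ≡ c
  one u v w o (here E) (ne ∷ _) (_∷_ {Q} {L} {a} {b} {c′} (V , E′ , _) R) c = cong₂ _+_
    (when-yes (Rel? (a , b , c′) (u , v , w)) (classify a b c′ u v w V o
      (Equiv-trans (F a b c′) Q (F u v w) (Equiv-sym Q (F a b c′) E′) (Equiv-sym (F u v w) Q E))))
    (none u v w Q o (Equiv-sym (F u v w) Q E) ne R c) ∙ ZP.+-identityʳ c
  one u v w o (there k) (ne ∷ nes) (_∷_ {Q} {L} {a} {b} {c′} (V , E′ , _) R) c = cong₂ _+_
    (when-no (Rel? (a , b , c′) (u , v , w)) λ r → clash ne k (Equiv-trans Q (F a b c′) (F u v w) E′ (Rel⇒Equiv a b c′ u v w r)))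
    (one u v w o k nes R c) ∙ ZP.+-identityˡ c where
    clash : ∀ {L} → All (λ Q′ → ¬ Equiv Q Q′) L → Any (Equiv (F u v w)) L → Equiv Q (F u v w) → ⊥
    clash (ne ∷ _)  (here {Q′} E) E₁ = ne (Equiv-trans Q (F u v w) Q′ E₁ E)
    clash (_ ∷ nes) (there k) E₁ = clash nes k E₁

  dsc-Reps : ∀ {L T} u v w → Reps n L T → dsc u v w ≢ + n → ∀ c → ∑ T (λ s → when (Rel? s (u , v , w)) c) ≡ + 0
  dsc-Reps u v w [] ne c = refl
  dsc-Reps u v w (_∷_ {Q} {L} {a} {b} {c′} (V , E′ , e) R) ne c = cong₂ _+_
    (when-no (Rel? (a , b , c′) (u , v , w)) λ r → ne (proj₁ (proj₂ (Rel⇒Good a b c′ (u , v , w) (Valid⇒Obt a b c′ V) r)) ∙ e))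
    (dsc-Reps u v w R ne c)

  -- Double counting of pairs of a chosen representative and an obtuse triple related to it.
  -- Completeness of the system provides a representative for every triple, inequivalence of its
  -- members allows only one.
  hurwitz-count : ∀ {L h} → RepSystem n L → WeightedSum L h → h ≡ P2 B (+ n) ℚ./ 6
  hurwitz-count {L} {h} (props , complete , distinct) W = main (classes props W) where
    main : Classes L h → h ≡ P2 B (+ n) ℚ./ 6
    main (T , R , q) = q ∙ cong (λ s → s ℚ./ 6) (∑-swap T (Dom.L (cube B)) (λ s r → when (Rel? s r) (wt r)) ∙ ∑-cong (Dom.L (cube B)) pointwise) where
      pointwise : ∀ s → ∑ T (λ r → when (Rel? r s) (wt s)) ≡ onD (+ n) s (wt s)
      pointwise (u , v , w) = go (obt? u v w) (dsc u v w ℤ.≟ + n) where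
        go : Dec (Obt u v w) → (d : Dec (dsc u v w ≡ + n)) → ∑ T (λ r → when (Rel? r (u , v , w)) (wt (u , v , w))) ≡ when d (wt (u , v , w))
        go (yes o) (yes e) = one u v w o (complete (F u v w) (PosDef-F u v w o (subst (λ s → NN (s - + 1)) (sym e) n≥1)) (disc-F u v w ∙ cong -_ e)) distinct R (wt (u , v , w))
        go _       (no ne) = dsc-Reps u v w R ne (wt (u , v , w))
        go (no ¬o) (yes e) = ∑-cong T {g = λ _ → + 0} (λ r → cong (when (Rel? r (u , v , w))) w0 ∙ when-0 (Rel? r (u , v , w))) ∙ ∑-0 T ∙ sym w0 where
          w0 : wt (u , v , w) ≡ + 0
          w0 = when-no (obt? u v w) ¬o

-- Cancellation of sign patterns

-- Position of a number relative to -t, 0 and t.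
data Cat : Set where
  lo m₋ m₀ m₊ hi : Cat

data Sg : Set where
  ⊕ ⊖ : Sg

data View (t x : ℤ) : Cat → Set where
  v-lo : NN (- x - t - + 1) → View t x lo
  v-₋  : NN (- x - + 1) → NN (t + x) → View t x m₋
  v-₀  : x ≡ + 0 → View t x m₀
  v-₊  : NN (x - + 1) → NN (t - x) → View t x m₊
  v-hi : NN (x - t - + 1) → View t x hi

data SgView (u : ℤ) : Sg → Set where
  s-⊕ : NN (u - + 1) → SgView u ⊕
  s-⊖ : NN (- u - + 1) → SgView u ⊖

flipC : Cat → Cat
flipC lo = hi
flipC m₋ = m₊
flipC m₀ = m₀
flipC m₊ = m₋
flipC hi = lo

flipS : Sg → Sg
flipS ⊕ = ⊖
flipS ⊖ = ⊕

data Sign³ : Set where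
  n₃ z₃ p₃ : Sign³

tr : Cat → Sign³
tr lo = n₃
tr m₋ = n₃
tr m₀ = z₃
tr m₊ = p₃
tr hi = p₃

wtT : Sign³ → Sign³ → Sign³ → ℤ
wtT p₃ p₃ p₃ = + 2
wtT z₃ p₃ p₃ = + 1
wtT p₃ z₃ p₃ = + 1
wtT p₃ p₃ z₃ = + 1
wtT _  _  _  = + 0

-- `a₁C`, `a₂C`, `a₃C` are the regions that a change of variables turns into quadruples ad + bc = p
-- with a - b - c = t, a - b - c = -t and a + b + c = t. `cC` is a correction term that is odd under
-- `Zc` ↦ -`Zc`, so that its total vanishes.
wtC a₁C a₂C a₃C cC : Cat → Cat → Cat → Sg → Sg → Sg → ℤ
wtC x y z _ _ _ = wtT (tr x) (tr y) (tr z)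

isHi ≥-t ≤t mid : Cat → Bool
isHi hi = true
isHi _  = false
≥-t lo = false
≥-t _  = true
≤t hi = false
≤t _  = true
mid c = ≥-t c ∧ ≤t c

is⊕ : Sg → Bool
is⊕ ⊕ = true
is⊕ ⊖ = false

⟦_⟧ : Bool → ℤ
⟦ true ⟧  = + 1
⟦ false ⟧ = + 0

sgnC : Cat → ℤ
sgnC lo = - (+ 1)
sgnC m₋ = - (+ 1)
sgnC m₀ = + 0
sgnC m₊ = + 1
sgnC hi = + 1

a₁C x y z _ _ _ = ⟦ isHi x ∧ isHi y ∧ ≥-t z ⟧
a₂C x y z _ _ w = ⟦ ≥-t x ∧ ≥-t y ∧ is⊕ w ∧ isHi z ⟧
a₃C x y z _ _ w = ⟦ ≤t x ∧ ≤t y ∧ is⊕ w ∧ ≥-t z ⟧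
cC  x y z u v _ = if mid z ∧ is⊕ u ∧ is⊕ v then sgnC z else + 0

totC : Cat → Cat → Cat → Sg → Sg → Sg → ℤ
totC x y z u v w = wtC x y z u v w - a₁C x y z u v w - a₂C x y z u v w + a₃C x y z u v w - + 3 * cC x y z u v w

sumC : Cat → Cat → Cat → Sg → Sg → Sg → ℤ
sumC x y z u v w = totC x y z u v w + totC y z x v w u + totC z x y w u v

-- The sign of half the sum of two numbers, as far as it is forced by their positions.
okS : Cat → Cat → Sg → Bool
okS hi lo _ = true
okS lo hi _ = true
okS m₋ m₊ _ = true
okS m₊ m₋ _ = true
okS m₀ m₀ _ = false
okS hi _  s = is⊕ s
okS _  hi s = is⊕ s
okS lo _  s = not (is⊕ s)
okS _  lo s = not (is⊕ s)
okS m₊ _  s = is⊕ s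
okS _  m₊ s = is⊕ s
okS m₋ _  s = not (is⊕ s)
okS _  m₋ s = not (is⊕ s)

-- If `Zc` lies outside [-t, t], then 4uv = 4P - t² + `Zc`² is positive, so u and v have the same
-- sign.
okF : Cat → Sg → Sg → Bool
okF lo ⊕ ⊖ = false
okF lo ⊖ ⊕ = false
okF hi ⊕ ⊖ = false
okF hi ⊖ ⊕ = false
okF _  _ _ = true

validC : Cat → Cat → Cat → Sg → Sg → Sg → Bool
validC x y z u v w = okS y z u ∧ okS x z v ∧ okS x y w ∧ okF z u v ∧ okF x v w ∧ okF y u w

isZero : ℤ → Bool
isZero (+ 0) = true
isZero _     = false

isZero-sound : ∀ x → isZero x ≡ true → x ≡ + 0
isZero-sound (+ 0) e = refl
isZero-sound (+ suc n) ()
isZero-sound -[1+ n ] ()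

allC : (Cat → Bool) → Bool
allC f = f lo ∧ f m₋ ∧ f m₀ ∧ f m₊ ∧ f hi

allS : (Sg → Bool) → Bool
allS f = f ⊕ ∧ f ⊖

∧ˡ : ∀ {a b} → a ∧ b ≡ true → a ≡ true
∧ˡ {true} e = refl

∧ʳ : ∀ {a b} → a ∧ b ≡ true → b ≡ true
∧ʳ {true} e = e

∧-intro : ∀ {a b} → a ≡ true → b ≡ true → a ∧ b ≡ true
∧-intro refl e = e

allC-elim : ∀ f → allC f ≡ true → ∀ c → f c ≡ true
allC-elim f e lo = ∧ˡ {f lo} e
allC-elim f e m₋ = ∧ˡ {f m₋} (∧ʳ {f lo} e)
allC-elim f e m₀ = ∧ˡ {f m₀} (∧ʳ {f m₋} (∧ʳ {f lo} e))
allC-elim f e m₊ = ∧ˡ {f m₊} (∧ʳ {f m₀} (∧ʳ {f m₋} (∧ʳ {f lo} e)))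
allC-elim f e hi = ∧ʳ {f m₊} (∧ʳ {f m₀} (∧ʳ {f m₋} (∧ʳ {f lo} e)))

allS-elim : ∀ f → allS f ≡ true → ∀ c → f c ≡ true
allS-elim f e ⊕ = ∧ˡ {f ⊕} e
allS-elim f e ⊖ = ∧ʳ {f ⊕} e

checkC : Cat → Cat → Cat → Sg → Sg → Sg → Bool
checkC x y z u v w = not (validC x y z u v w) ∨ isZero (sumC x y z u v w + sumC (flipC x) (flipC y) (flipC z) (flipS u) (flipS v) (flipS w))

-- The combinatorial heart: after symmetrisation all sign patterns cancel.
check-all : allC (λ x → allC λ y → allC λ z → allS λ u → allS λ v → allS λ w → checkC x y z u v w) ≡ true
check-all = refl

pattern-sum : ∀ x y z u v w → validC x y z u v w ≡ true →
  sumC x y z u v w + sumC (flipC x) (flipC y) (flipC z) (flipS u) (flipS v) (flipS w) ≡ + 0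
pattern-sum x y z u v w e = isZero-sound _ (strip e
  (allS-elim (λ w → checkC x y z u v w) (allS-elim (λ v → allS λ w → checkC x y z u v w) (allS-elim (λ u → allS λ v → allS λ w → checkC x y z u v w)
    (allC-elim (λ z → allS λ u → allS λ v → allS λ w → checkC x y z u v w) (allC-elim (λ y → allC λ z → allS λ u → allS λ v → allS λ w → checkC x y z u v w)
      (allC-elim (λ x → allC λ y → allC λ z → allS λ u → allS λ v → allS λ w → checkC x y z u v w) check-all x) y) z) u) v) w)) where
  strip : ∀ {a b} → a ≡ true → not a ∨ b ≡ true → b ≡ true
  strip refl h = h

sum-pos : ∀ x y w s → SgView w s → w + w ≡ x + y → NN (x + y - + 1) → is⊕ s ≡ true
sum-pos x y w ⊕ _ e p = refl
sum-pos x y w ⊖ (s-⊖ q) e p = ⊥-elim (nn-absurd (+ 1) (nn+ (nn+ (nn+ q q) p) (nn {2})) e (r459 w (x + y)))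

sum-neg : ∀ x y w s → SgView w s → w + w ≡ x + y → NN (- x - y - + 1) → not (is⊕ s) ≡ true
sum-neg x y w ⊖ _ e p = refl
sum-neg x y w ⊕ (s-⊕ q) e p = ⊥-elim (nn-absurd (- (+ 1)) (nn+ (nn+ (nn+ q q) p) (nn {2})) e (r460 w x y))

okS-sound : ∀ t x y w {c d s} → NN t → View t x c → View t y d → SgView w s → w ≢ + 0 → w + w ≡ x + y → okS c d s ≡ true
okS-sound t x y w {hi} {hi} {s} t₀ (v-hi h1) (v-hi h2) sv w≢0 e = sum-pos x y w s sv e (≈nn (nn+ (nn+ (nn+ (nn+ h1 h2) t₀) t₀) (nn {1})) (r461 t x y))
okS-sound t x y w {hi} {m₊} {s} t₀ (v-hi h1) (v-₊ h2 g2) sv w≢0 e = sum-pos x y w s sv e (≈nn (nn+ (nn+ (nn+ h1 h2) t₀) (nn {1})) (r462 t x y))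
okS-sound t x y w {hi} {m₀} {s} t₀ (v-hi h1) (v-₀ refl) sv w≢0 e = sum-pos x (+ 0) w s sv e (≈nn (nn+ h1 t₀) (r463 t x))
okS-sound t x y w {hi} {m₋} {s} t₀ (v-hi h1) (v-₋ h2 g2) sv w≢0 e = sum-pos x y w s sv e (≈nn (nn+ h1 g2) (r464 t x y))
okS-sound t x y w {hi} {lo}  t₀ (v-hi h1) (v-lo h2) sv w≢0 e = refl
okS-sound t x y w {m₊} {hi} {s} t₀ (v-₊ h1 g1) (v-hi h2) sv w≢0 e = sum-pos x y w s sv e (≈nn (nn+ (nn+ (nn+ h1 h2) t₀) (nn {1})) (r465 t x y))
okS-sound t x y w {m₊} {m₊} {s} t₀ (v-₊ h1 g1) (v-₊ h2 g2) sv w≢0 e = sum-pos x y w s sv e (≈nn (nn+ (nn+ h1 h2) (nn {1})) (r466 t x y))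
okS-sound t x y w {m₊} {m₀} {s} t₀ (v-₊ h1 g1) (v-₀ refl) sv w≢0 e = sum-pos x (+ 0) w s sv e (≈nn h1 (r467 t x))
okS-sound t x y w {m₊} {m₋}  t₀ (v-₊ h1 g1) (v-₋ h2 g2) sv w≢0 e = refl
okS-sound t x y w {m₊} {lo} {s} t₀ (v-₊ h1 g1) (v-lo h2) sv w≢0 e = sum-neg x y w s sv e (≈nn (nn+ g1 h2) (r468 t x y))
okS-sound t x y w {m₀} {hi} {s} t₀ (v-₀ refl) (v-hi h2) sv w≢0 e = sum-pos (+ 0) y w s sv e (≈nn (nn+ h2 t₀) (r469 t y))
okS-sound t x y w {m₀} {m₊} {s} t₀ (v-₀ refl) (v-₊ h2 g2) sv w≢0 e = sum-pos (+ 0) y w s sv e (≈nn h2 (r470 t y))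
okS-sound t x y w {m₀} {m₀} {s} t₀ (v-₀ refl) (v-₀ refl) sv w≢0 e = ⊥-elim (w≢0 (cancelˡ {w} 1 (r385 w ∙ e)))
okS-sound t x y w {m₀} {m₋} {s} t₀ (v-₀ refl) (v-₋ h2 g2) sv w≢0 e = sum-neg (+ 0) y w s sv e (≈nn h2 (r471 t y))
okS-sound t x y w {m₀} {lo} {s} t₀ (v-₀ refl) (v-lo h2) sv w≢0 e = sum-neg (+ 0) y w s sv e (≈nn (nn+ h2 t₀) (r472 t y))
okS-sound t x y w {m₋} {hi} {s} t₀ (v-₋ h1 g1) (v-hi h2) sv w≢0 e = sum-pos x y w s sv e (≈nn (nn+ g1 h2) (r473 t x y))
okS-sound t x y w {m₋} {m₊}  t₀ (v-₋ h1 g1) (v-₊ h2 g2) sv w≢0 e = refl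
okS-sound t x y w {m₋} {m₀} {s} t₀ (v-₋ h1 g1) (v-₀ refl) sv w≢0 e = sum-neg x (+ 0) w s sv e (≈nn h1 (r474 t x))
okS-sound t x y w {m₋} {m₋} {s} t₀ (v-₋ h1 g1) (v-₋ h2 g2) sv w≢0 e = sum-neg x y w s sv e (≈nn (nn+ (nn+ h1 h2) (nn {1})) (r475 t x y))
okS-sound t x y w {m₋} {lo} {s} t₀ (v-₋ h1 g1) (v-lo h2) sv w≢0 e = sum-neg x y w s sv e (≈nn (nn+ (nn+ (nn+ h1 h2) t₀) (nn {1})) (r476 t x y))
okS-sound t x y w {lo} {hi}  t₀ (v-lo h1) (v-hi h2) sv w≢0 e = refl
okS-sound t x y w {lo} {m₊} {s} t₀ (v-lo h1) (v-₊ h2 g2) sv w≢0 e = sum-neg x y w s sv e (≈nn (nn+ h1 g2) (r477 t x y))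
okS-sound t x y w {lo} {m₀} {s} t₀ (v-lo h1) (v-₀ refl) sv w≢0 e = sum-neg x (+ 0) w s sv e (≈nn (nn+ h1 t₀) (r478 t x))
okS-sound t x y w {lo} {m₋} {s} t₀ (v-lo h1) (v-₋ h2 g2) sv w≢0 e = sum-neg x y w s sv e (≈nn (nn+ (nn+ (nn+ h1 h2) t₀) (nn {1})) (r479 t x y))
okS-sound t x y w {lo} {lo} {s} t₀ (v-lo h1) (v-lo h2) sv w≢0 e = sum-neg x y w s sv e (≈nn (nn+ (nn+ (nn+ (nn+ h1 h2) t₀) t₀) (nn {1})) (r480 t x y))

opposite : ∀ u v → NN (u - + 1) → NN (- v - + 1) → NN (u * v - + 1) → ⊥
opposite u v p q h = nn-neg⊥ v (nn1 v (pos-factor u v p h)) q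

okF-sound : ∀ {c s r} u v → (c ≡ lo ⊎ c ≡ hi → NN (u * v - + 1)) → SgView u s → SgView v r → okF c s r ≡ true
okF-sound {lo} {⊕} {⊕} u v h _ _ = refl
okF-sound {lo} {⊖} {⊖} u v h _ _ = refl
okF-sound {hi} {⊕} {⊕} u v h _ _ = refl
okF-sound {hi} {⊖} {⊖} u v h _ _ = refl
okF-sound {m₋} u v h _ _ = refl
okF-sound {m₀} u v h _ _ = refl
okF-sound {m₊} u v h _ _ = refl
okF-sound {lo} {⊕} {⊖} u v h (s-⊕ p) (s-⊖ q) = ⊥-elim (opposite u v p q (h (inj₁ refl)))
okF-sound {hi} {⊕} {⊖} u v h (s-⊕ p) (s-⊖ q) = ⊥-elim (opposite u v p q (h (inj₂ refl)))
okF-sound {lo} {⊖} {⊕} u v h (s-⊖ p) (s-⊕ q) = ⊥-elim (opposite v u q p (≈nn (h (inj₁ refl)) (cong (λ s → s - + 1) (ZP.*-comm v u))))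
okF-sound {hi} {⊖} {⊕} u v h (s-⊖ p) (s-⊕ q) = ⊥-elim (opposite v u q p (≈nn (h (inj₂ refl)) (cong (λ s → s - + 1) (ZP.*-comm v u))))

catOf : ∀ {t x} → Dec (NN (x - t - + 1)) → Dec (NN (- x - t - + 1)) → Tri x → Cat
catOf (yes _) _       _       = hi
catOf (no _)  (yes _) _       = lo
catOf (no _)  (no _)  (pos _) = m₊
catOf (no _)  (no _)  (zer _) = m₀
catOf (no _)  (no _)  (neg _) = m₋

cat : ℤ → ℤ → Cat
cat t x = catOf {t} {x} (NN? (x - t - + 1)) (NN? (- x - t - + 1)) (tri x)

view : ∀ t x → View t x (cat t x)
view t x = go (NN? (x - t - + 1)) (NN? (- x - t - + 1)) (tri x) where
  go : ∀ d e f → View t x (catOf {t} {x} d e f)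
  go (yes p) _       _       = v-hi p
  go (no _)  (yes p) _       = v-lo p
  go (no n)  (no _)  (pos p) = v-₊ p (≈nn (¬nn n) (r481 t x))
  go (no _)  (no _)  (zer e) = v-₀ e
  go (no _)  (no n)  (neg p) = v-₋ p (≈nn (¬nn n) (r482 t x))

view-neg : ∀ t x {c} → View t x c → View t (- x) (flipC c)
view-neg t x (v-lo p) = v-hi p
view-neg t x (v-₋ p q) = v-₊ p (≈nn q (r483 t x))
view-neg t x (v-₀ refl) = v-₀ refl
view-neg t x (v-₊ p q) = v-₋ (≈nn p (r484 x)) q
view-neg t x (v-hi p) = v-lo (≈nn p (r485 t x))

view-unique : ∀ t x {c d} → NN t → View t x c → View t x d → c ≡ d
view-unique t x t₀ (v-hi h1) (v-hi h2) = refl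
view-unique t x t₀ (v-hi h1) (v-₊ h2 g2) = ⊥-elim (nn⊥ (nn+ h1 g2) (r486 t x))
view-unique t x t₀ (v-hi h1) (v-₀ refl) = ⊥-elim (nn⊥ (nn+ h1 t₀) (r487 t))
view-unique t x t₀ (v-hi h1) (v-₋ h2 g2) = ⊥-elim (nn⊥ (nn+ (nn+ (nn+ h1 h2) t₀) (nn {1})) (r488 t x))
view-unique t x t₀ (v-hi h1) (v-lo h2) = ⊥-elim (nn⊥ (nn+ (nn+ (nn+ (nn+ h1 h2) t₀) t₀) (nn {1})) (r489 t x))
view-unique t x t₀ (v-₊ h1 g1) (v-hi h2) = ⊥-elim (nn⊥ (nn+ g1 h2) (r490 t x))
view-unique t x t₀ (v-₊ h1 g1) (v-₊ h2 g2) = refl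
view-unique t x t₀ (v-₊ h1 g1) (v-₀ refl) = ⊥-elim (nn⊥ h1 (r491 t))
view-unique t x t₀ (v-₊ h1 g1) (v-₋ h2 g2) = ⊥-elim (nn⊥ (nn+ (nn+ h1 h2) (nn {1})) (r492 t x))
view-unique t x t₀ (v-₊ h1 g1) (v-lo h2) = ⊥-elim (nn⊥ (nn+ (nn+ (nn+ h1 h2) t₀) (nn {1})) (r493 t x))
view-unique t x t₀ (v-₀ refl) (v-hi h2) = ⊥-elim (nn⊥ (nn+ h2 t₀) (r487 t))
view-unique t x t₀ (v-₀ refl) (v-₊ h2 g2) = ⊥-elim (nn⊥ h2 (r491 t))
view-unique t x t₀ (v-₀ _) (v-₀ _) = refl
view-unique t x t₀ (v-₀ refl) (v-₋ h2 g2) = ⊥-elim (nn⊥ h2 (r494 t))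
view-unique t x t₀ (v-₀ refl) (v-lo h2) = ⊥-elim (nn⊥ (nn+ h2 t₀) (r495 t))
view-unique t x t₀ (v-₋ h1 g1) (v-hi h2) = ⊥-elim (nn⊥ (nn+ (nn+ (nn+ h1 h2) t₀) (nn {1})) (r496 t x))
view-unique t x t₀ (v-₋ h1 g1) (v-₊ h2 g2) = ⊥-elim (nn⊥ (nn+ (nn+ h1 h2) (nn {1})) (r497 t x))
view-unique t x t₀ (v-₋ h1 g1) (v-₀ refl) = ⊥-elim (nn⊥ h1 (r494 t))
view-unique t x t₀ (v-₋ h1 g1) (v-₋ h2 g2) = refl
view-unique t x t₀ (v-₋ h1 g1) (v-lo h2) = ⊥-elim (nn⊥ (nn+ g1 h2) (r498 t x))
view-unique t x t₀ (v-lo h1) (v-hi h2) = ⊥-elim (nn⊥ (nn+ (nn+ (nn+ (nn+ h1 h2) t₀) t₀) (nn {1})) (r499 t x))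
view-unique t x t₀ (v-lo h1) (v-₊ h2 g2) = ⊥-elim (nn⊥ (nn+ (nn+ (nn+ h1 h2) t₀) (nn {1})) (r500 t x))
view-unique t x t₀ (v-lo h1) (v-₀ refl) = ⊥-elim (nn⊥ (nn+ h1 t₀) (r495 t))
view-unique t x t₀ (v-lo h1) (v-₋ h2 g2) = ⊥-elim (nn⊥ (nn+ h1 g2) (r501 t x))
view-unique t x t₀ (v-lo h1) (v-lo h2) = refl

cat-neg : ∀ t x → NN t → cat t (- x) ≡ flipC (cat t x)
cat-neg t x t₀ = view-unique t (- x) t₀ (view t (- x)) (view-neg t x (view t x))

sgOf : ∀ {u} → Dec (NN (u - + 1)) → Sg
sgOf (yes _) = ⊕
sgOf (no _)  = ⊖

sg : ℤ → Sg
sg u = sgOf {u} (NN? (u - + 1))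

sg-view : ∀ u → u ≢ + 0 → SgView u (sg u)
sg-view u h = go (NN? (u - + 1)) (tri u) where
  go : ∀ d → Tri u → SgView u (sgOf {u} d)
  go (yes p) _       = s-⊕ p
  go (no n)  (pos p) = ⊥-elim (n p)
  go (no n)  (zer e) = ⊥-elim (h e)
  go (no n)  (neg p) = s-⊖ p

sg-neg : ∀ u → u ≢ + 0 → sg (- u) ≡ flipS (sg u)
sg-neg u h = go (NN? (u - + 1)) (NN? (- u - + 1)) (tri u) where
  go : ∀ d e → Tri u → sgOf { - u} e ≡ flipS (sgOf {u} d)
  go (yes p) (yes q) _ = ⊥-elim (nn-neg⊥ u (nn1 u p) q)
  go (yes p) (no n)  _ = refl
  go (no n)  (yes q) _ = refl
  go (no n)  (no m)  (pos p) = ⊥-elim (n p)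
  go (no n)  (no m)  (zer e) = ⊥-elim (h e)
  go (no n)  (no m)  (neg p) = ⊥-elim (m p)

-- Symmetrisation over the triples of discriminant 4P - t²

∑-ints-neg : ∀ n (f : ℤ → ℤ) → ∑ (ints n) (λ x → f (- x)) ≡ ∑ (ints n) f
∑-ints-neg zero    f = refl
∑-ints-neg (suc n) f = cong (λ s → f -[1+ n ] + (f (+ suc n) + s)) (∑-ints-neg n f) ∙ r502 (f -[1+ n ]) (f (+ suc n)) (∑ (ints n) f)

rot₃ neg₃ : T³ → T³
rot₃ (u , v , w) = v , w , u
neg₃ (u , v , w) = - u , - v , - w

∑-cube : ∀ B (g : T³ → ℤ) → ∑ (Dom.L (cube B)) g ≡ ∑ (ints B) (λ u → ∑ (ints B) (λ v → ∑ (ints B) (λ w → g (u , v , w))))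
∑-cube B g = ∑-cart (ints B) (cart (ints B) (ints B)) g ∙ ∑-cong (ints B) (λ u → ∑-cart (ints B) (ints B) (λ s → g (u , s)))

∑-rot : ∀ B (g : T³ → ℤ) → ∑ (Dom.L (cube B)) (λ s → g (rot₃ s)) ≡ ∑ (Dom.L (cube B)) g
∑-rot B g = begin
  ∑ (Dom.L (cube B)) (λ s → g (rot₃ s))                                    ≡⟨ ∑-cube B (λ s → g (rot₃ s)) ⟩
  ∑ I (λ u → ∑ I (λ v → ∑ I (λ w → g (v , w , u))))   ≡⟨ ∑-swap I I (λ u v → ∑ I (λ w → g (v , w , u))) ⟩
  ∑ I (λ v → ∑ I (λ u → ∑ I (λ w → g (v , w , u))))   ≡⟨ ∑-cong I (λ v → ∑-swap I I (λ u w → g (v , w , u))) ⟩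
  ∑ I (λ v → ∑ I (λ w → ∑ I (λ u → g (v , w , u))))   ≡⟨ sym (∑-cube B g) ⟩
  ∑ (Dom.L (cube B)) g ∎ where
  open ≡-Reasoning
  I = ints B

∑-neg₃ : ∀ B (g : T³ → ℤ) → ∑ (Dom.L (cube B)) (λ s → g (neg₃ s)) ≡ ∑ (Dom.L (cube B)) g
∑-neg₃ B g = ∑-cube B (λ s → g (neg₃ s)) ∙ 
  (∑-ints-neg B (λ u → ∑ I (λ v → ∑ I (λ w → g (u , - v , - w)))) ∙ ∑-cong I (λ u →
    trans (∑-ints-neg B (λ v → ∑ I (λ w → g (u , v , - w)))) (∑-cong I (λ v → ∑-ints-neg B (λ w → g (u , v , w)))))) ∙
  sym (∑-cube B g)
  where I = ints B

triOf : ∀ {x} → Tri x → Sign³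
triOf (pos _) = p₃
triOf (zer _) = z₃
triOf (neg _) = n₃

-- Two vanishing parameters would make `dsc` vanish; hence for nonzero `dsc` the weight depends on
-- the three signs through `wtT`.
wt-signs : ∀ u v w → dsc u v w ≢ + 0 → (a : Tri (Xc u v w)) (b : Tri (Yc u v w)) (c : Tri (Zc u v w)) →
  wt (u , v , w) ≡ wtT (triOf a) (triOf b) (triOf c)
wt-signs u v w d = go where
  X = Xc u v w
  Y = Yc u v w
  Z = Zc u v w
  not-obt : ¬ Obt u v w → wt (u , v , w) ≡ + 0
  not-obt = when-no (obt? u v w)
  D = λ (x y z : ℤ) → x * y + y * z + z * x
  one′ : Obt u v w → X * Y * Z ≡ + 0 → wt (u , v , w) ≡ + 1
  one′ o e = when-yes (obt? u v w) o ∙ two-yes (prod (u , v , w) ℤ.≟ + 0) e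
  nz : ∀ {x} → x ≡ + 0 → NN x
  nz refl = nn
  go : (a : Tri X) (b : Tri Y) (c : Tri Z) → wt (u , v , w) ≡ wtT (triOf a) (triOf b) (triOf c)
  go (neg p) b c = not-obt (λ o → nn-neg⊥ X (proj₁ o) p) ∙ z b c where
    z : (b : Tri Y) (c : Tri Z) → + 0 ≡ wtT n₃ (triOf b) (triOf c)
    z (pos _) (pos _) = refl
    z (pos _) (zer _) = refl
    z (pos _) (neg _) = refl
    z (zer _) _ = refl
    z (neg _) _ = refl
  go (pos _) (neg p) c = not-obt (λ o → nn-neg⊥ Y (proj₁ (proj₂ o)) p)
  go (zer _) (neg p) c = not-obt (λ o → nn-neg⊥ Y (proj₁ (proj₂ o)) p)
  go (pos _) (pos _) (neg p) = not-obt (λ o → nn-neg⊥ Z (proj₂ (proj₂ o)) p)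
  go (pos _) (zer _) (neg p) = not-obt (λ o → nn-neg⊥ Z (proj₂ (proj₂ o)) p)
  go (zer _) (pos _) (neg p) = not-obt (λ o → nn-neg⊥ Z (proj₂ (proj₂ o)) p)
  go (zer _) (zer _) (neg p) = not-obt (λ o → nn-neg⊥ Z (proj₂ (proj₂ o)) p)
  go (pos x) (pos y) (pos z) = when-yes (obt? u v w) (nn1 X x , nn1 Y y , nn1 Z z) ∙ prod-pos u v w x y z
  go (zer x) (pos y) (pos z) = one′ (nz x , nn1 Y y , nn1 Z z) (cong (λ s → s * Y * Z) x)
  go (pos x) (zer y) (pos z) = one′ (nn1 X x , nz y , nn1 Z z) (cong (λ s → X * s * Z) y ∙ cong (λ s → s * Z) (ZP.*-zeroʳ X))
  go (pos x) (pos y) (zer z) = one′ (nn1 X x , nn1 Y y , nz z) (cong (λ s → X * Y * s) z ∙ ZP.*-zeroʳ (X * Y))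
  go (zer x) (zer y) (pos z) = ⊥-elim (d (dsc-XYZ′ u v w ∙ cong₂ (λ s t → D s t Z) x y ∙ r503 Z))
  go (zer x) (zer y) (zer z) = ⊥-elim (d (dsc-XYZ′ u v w ∙ cong₂ (λ s t → D s t Z) x y ∙ r503 Z))
  go (zer x) (pos y) (zer z) = ⊥-elim (d (dsc-XYZ′ u v w ∙ cong₂ (λ s t → D s Y t) x z ∙ r504 Y))
  go (pos x) (zer y) (zer z) = ⊥-elim (d (dsc-XYZ′ u v w ∙ cong₂ (λ s t → D X s t) y z ∙ r505 X))

tr-view : ∀ t x {c} → NN t → View t x c → (a : Tri x) → tr c ≡ triOf a
tr-view t x t₀ (v-lo p) (neg q) = refl
tr-view t x t₀ (v-₋ p _) (neg q) = refl
tr-view t x t₀ (v-₀ e) (zer q) = refl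
tr-view t x t₀ (v-₊ p _) (pos q) = refl
tr-view t x t₀ (v-hi p) (pos q) = refl
tr-view t x t₀ (v-lo p) (zer refl) = ⊥-elim (nn⊥ (nn+ p t₀) (r506 t))
tr-view t x t₀ (v-lo p) (pos q) = ⊥-elim (nn⊥ (nn+ (nn+ (nn+ p t₀) q) (nn {1})) (r507 t x))
tr-view t x t₀ (v-₋ p _) (zer refl) = ⊥-elim (neg1 p)
tr-view t x t₀ (v-₋ p _) (pos q) = ⊥-elim (nn-neg⊥ x (nn1 x q) p)
tr-view t x t₀ (v-₀ refl) (pos q) = ⊥-elim (neg1 q)
tr-view t x t₀ (v-₀ refl) (neg q) = ⊥-elim (neg1 q)
tr-view t x t₀ (v-₊ p _) (zer refl) = ⊥-elim (neg1 p)
tr-view t x t₀ (v-₊ p _) (neg q) = ⊥-elim (nn-neg⊥ x (nn1 x p) q)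
tr-view t x t₀ (v-hi p) (zer refl) = ⊥-elim (nn⊥ (nn+ p t₀) (r508 t))
tr-view t x t₀ (v-hi p) (neg q) = ⊥-elim (nn⊥ (nn+ (nn+ (nn+ p t₀) q) (nn {1})) (r509 t x))

T⇔ : Bool → Set → Set
T⇔ b P = (b ≡ true → P) × (P → b ≡ true)

T⇔-∧ : ∀ {a b P Q} → T⇔ a P → T⇔ b Q → T⇔ (a ∧ b) (P × Q)
T⇔-∧ {a} {b} (f , g) (h , k) = (λ e → f (∧ˡ {a} e) , h (∧ʳ {a} e)) , (λ { (p , q) → ∧-intro (g p) (k q) })

if-when : ∀ {P : Set} b (d : Dec P) x → T⇔ b P → (if b then x else + 0) ≡ when d x
if-when true  (yes _) x _ = refl
if-when false (no _)  x _ = refl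
if-when true  (no n)  x (f , g) = ⊥-elim (n (f refl))
if-when false (yes p) x (f , g) with g p
... | ()

⟦⟧-when : ∀ {P : Set} b (d : Dec P) → T⇔ b P → ⟦ b ⟧ ≡ when d (+ 1)
⟦⟧-when true  (yes _) _ = refl
⟦⟧-when false (no _)  _ = refl
⟦⟧-when true  (no n)  (f , g) = ⊥-elim (n (f refl))
⟦⟧-when false (yes p) (f , g) with g p
... | ()

view-bound : ∀ t x {c} → NN t → View t x c → T⇔ (≥-t c) (NN (t + x)) × T⇔ (≤t c) (NN (t - x)) × T⇔ (isHi c) (NN (x - t - + 1))
view-bound t x {lo} t₀ (v-lo p) = ((λ ()) , λ q → ⊥-elim (nn⊥ (nn+ p q) (r510 t x))) , ((λ _ → ≈nn (nn+ (nn+ p (nn+ t₀ t₀)) (nn {1})) (r511 t x)) , λ _ → refl) ,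
    ((λ ()) , λ q → ⊥-elim (nn⊥ (nn+ (nn+ p q) (nn+ (nn+ t₀ t₀) (nn {1}))) (r512 t x)))
view-bound t x {m₋} t₀ (v-₋ p q) = ((λ _ → q) , λ _ → refl) , ((λ _ → ≈nn (nn+ (nn+ p t₀) (nn {1})) (r513 t x)) , λ _ → refl) ,
    ((λ ()) , λ r → ⊥-elim (nn⊥ (nn+ (nn+ p r) (nn+ t₀ (nn {1}))) (r514 t x)))
view-bound t x {m₀} t₀ (v-₀ refl) = ((λ _ → ≈nn t₀ (r515 t)) , λ _ → refl) , ((λ _ → ≈nn t₀ (r516 t)) , λ _ → refl) , ((λ ()) , λ r → ⊥-elim (nn⊥ (nn+ r t₀) (r508 t)))
view-bound t x {m₊} t₀ (v-₊ p q) = ((λ _ → ≈nn (nn+ (nn+ p t₀) (nn {1})) (r517 t x)) , λ _ → refl) , ((λ _ → q) , λ _ → refl) , ((λ ()) , λ r → ⊥-elim (nn⊥ (nn+ r q) (r518 t x)))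
view-bound t x {hi} t₀ (v-hi p) = ((λ _ → ≈nn (nn+ (nn+ p (nn+ t₀ t₀)) (nn {1})) (r519 t x)) , λ _ → refl) , ((λ ()) , λ q → ⊥-elim (nn⊥ (nn+ p q) (r518 t x))) , ((λ _ → p) , λ _ → refl)

⊕⇔ : ∀ u → T⇔ (is⊕ (sg u)) (NN (u - + 1))
⊕⇔ u = go (NN? (u - + 1)) where
  go : (d : Dec (NN (u - + 1))) → T⇔ (is⊕ (sgOf {u} d)) (NN (u - + 1))
  go (yes p) = (λ _ → p) , λ _ → refl
  go (no n)  = (λ ()) , λ p → ⊥-elim (n p)

sgnC-flip : ∀ c → - sgnC (flipC c) ≡ sgnC c
sgnC-flip lo = refl
sgnC-flip m₋ = refl
sgnC-flip m₀ = refl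
sgnC-flip m₊ = refl
sgnC-flip hi = refl

far : ∀ P t z u v → NN (P - + 1) → NN t → NN (z - t - + 1) → + 4 * u * v - z * z ≡ + 4 * P - t * t → NN (u * v - + 1)
far P t z u v p t₀ k e = quarter (u * v) (nn-mod {g = + 4 * (u * v) - + 1} (+ 1)
  (nn+ (nn+ (nn* (nn {4}) p) (nn+ (nn+ (nn* k k) (nn+ k k)) (nn+ (nn* (nn+ t₀ t₀) k) (nn+ t₀ t₀)))) (nn {4})) e (r520 P t z u v))

far-view : ∀ P t z u v {c} → NN (P - + 1) → NN t → View t z c → + 4 * u * v - z * z ≡ + 4 * P - t * t → c ≡ lo ⊎ c ≡ hi → NN (u * v - + 1)
far-view P t z u v p t₀ (v-hi k) e (inj₂ refl) = far P t z u v p t₀ k e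
far-view P t z u v p t₀ (v-lo k) e (inj₁ refl) = far P t (- z) u v p t₀ k (cong (λ s → + 4 * u * v - s) (r15 z) ∙ e)

-- From 4 (P - uv) = (t - z)(t + z) ≥ 0 follows u ≤ uv ≤ P. The support of `cC` is therefore
-- bounded, although the quadric is not.
C-bounds : ∀ P t z u v → NN (t - z) → NN (t + z) → NN (u - + 1) → NN (v - + 1) → + 4 * u * v - z * z ≡ + 4 * P - t * t → NN (P - u)
C-bounds P t z u v p q u⁺ v⁺ e = ≈nn (nn+ (four (P - u * v) h) (nn* (nn1 u u⁺) v⁺)) (r521 P u v) where
  four : ∀ x → NN (+ 4 * x) → NN x
  four (+ n) _ = nn
  four -[1+ n ] ()
  h : NN (+ 4 * (P - u * v))
  h = nn-mod {g = + 4 * (P - u * v)} (- (+ 1)) (nn* p q) e (r280 P t z u v)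

onD-lin : ∀ {Q : Set} (d : Dec Q) a b c e f → when d (a - b - c + e - + 3 * f) ≡ when d a - when d b - when d c + when d e - + 3 * when d f
onD-lin (yes _) a b c e f = refl
onD-lin (no _)  a b c e f = refl

-- The hypothesis `nz` gives each of u, v, w a sign, since rotations preserve the quadric; without
-- it the patterns of `Sg` would not cover all triples.
module Ident (B : ℕ) (P t : ℤ) (P≥1 : NN (P - + 1)) (t₀ : NN t) (D≢0 : + 4 * P - t * t ≢ + 0)
  (nz : ∀ u v w → dsc u v w ≡ + 4 * P - t * t → u ≢ + 0) (B-big : NN (+ B - P - P - t)) where

  D = + 4 * P - t * t

  K = Cat → Cat → Cat → Sg → Sg → Sg → ℤ

  pt : K → T³ → ℤ
  pt f (u , v , w) = f (cat t (Xc u v w)) (cat t (Yc u v w)) (cat t (Zc u v w)) (sg u) (sg v) (sg w)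

  S : (T³ → ℤ) → ℤ
  S f = ∑ (Dom.L (cube B)) (λ s → onD D s (f s))

  pt-rot : ∀ f u v w → pt f (v , w , u) ≡ f (cat t (Yc u v w)) (cat t (Zc u v w)) (cat t (Xc u v w)) (sg v) (sg w) (sg u)
  pt-rot f u v w = cong₂ (λ a b → f (cat t a) (cat t b) (cat t (Xc u v w)) (sg v) (sg w) (sg u)) (r281 u v w) (r282 u v w)

  pt-rot² : ∀ f u v w → pt f (w , u , v) ≡ f (cat t (Zc u v w)) (cat t (Xc u v w)) (cat t (Yc u v w)) (sg w) (sg u) (sg v)
  pt-rot² f u v w = cong₂ (λ a b → f (cat t (Zc u v w)) (cat t a) (cat t b) (sg w) (sg u) (sg v)) (r283 u v w) (r281 u v w)

  sum₃ : ∀ u v w → pt totC (u , v , w) + pt totC (v , w , u) + pt totC (w , u , v)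
                 ≡ sumC (cat t (Xc u v w)) (cat t (Yc u v w)) (cat t (Zc u v w)) (sg u) (sg v) (sg w)
  sum₃ u v w = cong₂ (λ a b → pt totC (u , v , w) + a + b) (pt-rot totC u v w) (pt-rot² totC u v w)

  sumC-neg : ∀ u v w → u ≢ + 0 → v ≢ + 0 → w ≢ + 0 →
    sumC (cat t (Xc (- u) (- v) (- w))) (cat t (Yc (- u) (- v) (- w))) (cat t (Zc (- u) (- v) (- w))) (sg (- u)) (sg (- v)) (sg (- w))
    ≡ sumC (flipC (cat t (Xc u v w))) (flipC (cat t (Yc u v w))) (flipC (cat t (Zc u v w))) (flipS (sg u)) (flipS (sg v)) (flipS (sg w))
  sumC-neg u v w a b c = six (c′ (Xc u v w) (r284 u v w)) (c′ (Yc u v w) (r285 u v w)) (c′ (Zc u v w) (r286 u v w)) (sg-neg u a) (sg-neg v b) (sg-neg w c) where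
    c′ : ∀ {x} y → x ≡ - y → cat t x ≡ flipC (cat t y)
    c′ y refl = cat-neg t y t₀
    six : ∀ {a b c d e f a′ b′ c′ d′ e′ f′} → a ≡ a′ → b ≡ b′ → c ≡ c′ → d ≡ d′ → e ≡ e′ → f ≡ f′ → sumC a b c d e f ≡ sumC a′ b′ c′ d′ e′ f′
    six refl refl refl refl refl refl = refl

  module On (u v w : ℤ) (e : dsc u v w ≡ D) where
    e₂ : dsc v w u ≡ D
    e₂ = dsc-rot u v w ∙ e
    e₃ : dsc w u v ≡ D
    e₃ = dsc-rot v w u ∙ e₂
    u≢0 = nz u v w e
    v≢0 = nz v w u e₂
    w≢0 = nz w u v e₃
    X = Xc u v w
    Y = Yc u v w
    Z = Zc u v w

    valid : validC (cat t X) (cat t Y) (cat t Z) (sg u) (sg v) (sg w) ≡ true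
    valid = ∧-intro (okS-sound t Y Z u t₀ (view t Y) (view t Z) (sg-view u u≢0) u≢0 (r131 u v w))
      (∧-intro (okS-sound t X Z v t₀ (view t X) (view t Z) (sg-view v v≢0) v≢0 (r132 u v w))
      (∧-intro (okS-sound t X Y w t₀ (view t X) (view t Y) (sg-view w w≢0) w≢0 (r133 u v w))
      (∧-intro (okF-sound u v (far-view P t Z u v P≥1 t₀ (view t Z) e) (sg-view u u≢0) (sg-view v v≢0))
      (∧-intro (okF-sound v w (far-view P t X v w P≥1 t₀ (view t X) e₂) (sg-view v v≢0) (sg-view w w≢0))
        (okF-sound u w (λ h → ≈nn (far-view P t (Zc w u v) w u P≥1 t₀ (view t (Zc w u v)) e₃ (subst (λ z → cat t z ≡ lo ⊎ cat t z ≡ hi) (r134 u v w) h)) (cong (λ s → s - + 1) (ZP.*-comm u w)))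
          (sg-view u u≢0) (sg-view w w≢0))))))

    cancels : (pt totC (u , v , w) + pt totC (v , w , u) + pt totC (w , u , v))
      + (pt totC (- u , - v , - w) + pt totC (- v , - w , - u) + pt totC (- w , - u , - v)) ≡ + 0
    cancels = cong₂ _+_ (sum₃ u v w) (sum₃ (- u) (- v) (- w) ∙ sumC-neg u v w u≢0 v≢0 w≢0) ∙
      pattern-sum (cat t X) (cat t Y) (cat t Z) (sg u) (sg v) (sg w) valid

    wt≡ : wt (u , v , w) ≡ pt wtC (u , v , w)
    wt≡ = wt-signs u v w (λ h → D≢0 (sym e ∙ h)) (tri X) (tri Y) (tri Z) ∙
      three (tr-view t X t₀ (view t X) (tri X)) (tr-view t Y t₀ (view t Y) (tri Y)) (tr-view t Z t₀ (view t Z) (tri Z)) where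
      three : ∀ {a b c a′ b′ c′} → a′ ≡ a → b′ ≡ b → c′ ≡ c → wtT a b c ≡ wtT a′ b′ c′
      three refl refl refl = refl

  dsc-neg : ∀ u v w → + 4 * - u * - v - (- u + - v - - w) * (- u + - v - - w) ≡ + 4 * u * v - (u + v - w) * (u + v - w)
  dsc-neg = ring

  G : T³ → ℤ
  G s = onD D s (pt totC s)

  G-sum : ∀ s → (G s + G (rot₃ s) + G (rot₃ (rot₃ s))) + (G (neg₃ s) + G (rot₃ (neg₃ s)) + G (rot₃ (rot₃ (neg₃ s)))) ≡ + 0
  G-sum (u , v , w) = go (dsc u v w ℤ.≟ D) where
    yes′ : ∀ a b c → dsc a b c ≡ D → G (a , b , c) ≡ pt totC (a , b , c)
    yes′ a b c h = when-yes (dsc a b c ℤ.≟ D) h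
    no′ : ∀ a b c → dsc a b c ≢ D → G (a , b , c) ≡ + 0
    no′ a b c h = when-no (dsc a b c ℤ.≟ D) h
    six : ∀ {a b c d e f a′ b′ c′ d′ e′ f′ : ℤ} → a ≡ a′ → b ≡ b′ → c ≡ c′ → d ≡ d′ → e ≡ e′ → f ≡ f′ → (a + b + c) + (d + e + f) ≡ (a′ + b′ + c′) + (d′ + e′ + f′)
    six refl refl refl refl refl refl = refl
    q₁ = dsc-rot u v w
    q₂ = dsc-rot v w u ∙ q₁
    k₀ = dsc-neg u v w
    k₁ = dsc-rot (- u) (- v) (- w) ∙ k₀
    k₂ = dsc-rot (- v) (- w) (- u) ∙ k₁
    go : Dec (dsc u v w ≡ D) → (G (u , v , w) + G (v , w , u) + G (w , u , v)) + (G (- u , - v , - w) + G (- v , - w , - u) + G (- w , - u , - v)) ≡ + 0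
    go (yes e) = six (yes′ u v w e) (yes′ v w u (q₁ ∙ e)) (yes′ w u v (q₂ ∙ e)) (yes′ (- u) (- v) (- w) (k₀ ∙ e)) (yes′ (- v) (- w) (- u) (k₁ ∙ e)) (yes′ (- w) (- u) (- v) (k₂ ∙ e)) ∙ On.cancels u v w e
    go (no n) = six (no′ u v w n) (no′ v w u (λ h → n (sym q₁ ∙ h))) (no′ w u v (λ h → n (sym q₂ ∙ h)))
      (no′ (- u) (- v) (- w) (λ h → n (sym k₀ ∙ h))) (no′ (- v) (- w) (- u) (λ h → n (sym k₁ ∙ h))) (no′ (- w) (- u) (- v) (λ h → n (sym k₂ ∙ h)))

  -- Rotations and negation preserve both the cube and the quadric, and the six translates of `G`
  -- cancel pointwise by `G-sum`. All six have the same total, so six times the truncated sum is 0.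
  SG≡0 : S (pt totC) ≡ + 0
  SG≡0 = cancelˡ {S (pt totC)} 5 (r287 σ ∙ sym (cong₂ _+_
      (cong₂ _+_ (cong₂ _+_ (refl {x = σ}) (∑-rot B G)) (∑-rot B (λ s → G (rot₃ s)) ∙ ∑-rot B G))
      (cong₂ _+_ (cong₂ _+_ (∑-neg₃ B G) (∑-neg₃ B (λ s → G (rot₃ s)) ∙ ∑-rot B G)) (∑-neg₃ B (λ s → G (rot₃ (rot₃ s))) ∙ ∑-rot B (λ s → G (rot₃ s)) ∙ ∑-rot B G))) ∙
      sym split ∙ ∑-cong L G-sum ∙ ∑-0 L) where
    L = Dom.L (cube B)
    σ = ∑ L G
    plus₃ : ∀ f g h → ∑ L (λ s → f s + g s + h s) ≡ ∑ L f + ∑ L g + ∑ L h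
    plus₃ f g h = ∑-+ L (λ s → f s + g s) h ∙ cong (λ x → x + ∑ L h) (∑-+ L f g)
    split : ∑ L (λ s → (G s + G (rot₃ s) + G (rot₃ (rot₃ s))) + (G (neg₃ s) + G (rot₃ (neg₃ s)) + G (rot₃ (rot₃ (neg₃ s))))) ≡
      (∑ L G + ∑ L (λ s → G (rot₃ s)) + ∑ L (λ s → G (rot₃ (rot₃ s)))) + (∑ L (λ s → G (neg₃ s)) + ∑ L (λ s → G (rot₃ (neg₃ s))) + ∑ L (λ s → G (rot₃ (rot₃ (neg₃ s)))))
    split = ∑-+ L (λ s → G s + G (rot₃ s) + G (rot₃ (rot₃ s))) (λ s → G (neg₃ s) + G (rot₃ (neg₃ s)) + G (rot₃ (rot₃ (neg₃ s)))) ∙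
      cong₂ _+_ (plus₃ G (λ s → G (rot₃ s)) (λ s → G (rot₃ (rot₃ s)))) (plus₃ (λ s → G (neg₃ s)) (λ s → G (rot₃ (neg₃ s))) (λ s → G (rot₃ (rot₃ (neg₃ s)))))

  InC : T³ → Set
  InC (u , v , w) = (NN (t + Zc u v w) × NN (t - Zc u v w)) × NN (u - + 1) × NN (v - + 1)

  InC? : ∀ s → Dec (InC s)
  InC? (u , v , w) = (NN? (t + Zc u v w) ×-dec NN? (t - Zc u v w)) ×-dec NN? (u - + 1) ×-dec NN? (v - + 1)

  OnC : T³ → Set
  OnC s@(u , v , w) = dsc u v w ≡ D × InC s

  OnC? : ∀ s → Dec (OnC s)
  OnC? s@(u , v , w) = (dsc u v w ℤ.≟ D) ×-dec InC? s

  zsign : T³ → ℤ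
  zsign (u , v , w) = sgnC (cat t (Zc u v w))

  c≡when : ∀ s → onD D s (pt cC s) ≡ when (OnC? s) (zsign s)
  c≡when s@(u , v , w) = cong (λ x → onD D s x) (if-when (mid (cat t Z) ∧ is⊕ (sg u) ∧ is⊕ (sg v)) (InC? s) (zsign s)
      (T⇔-∧ (T⇔-∧ (proj₁ b) (proj₁ (proj₂ b))) (T⇔-∧ (⊕⇔ u) (⊕⇔ v)))) ∙
      sym (when-× (dsc u v w ℤ.≟ D) (InC? s)) where
    Z = Zc u v w
    b = view-bound t Z t₀ (view t Z)

  flip₃ : T³ → T³
  flip₃ (u , v , w) = v , u , + 2 * u + + 2 * v - w

  flip-Z : ∀ u v w → v + u - (+ 2 * u + + 2 * v - w) ≡ - (u + v - w)
  flip-Z = ring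

  flip-OnC : ∀ s → OnC s → OnC (flip₃ s) × flip₃ (flip₃ s) ≡ s
  flip-OnC (u , v , w) (e , (p , q) , a , b) =
    (dsc-flip u v w ∙ e , (subst (λ z → NN (t + z)) (sym (flip-Z u v w)) q , subst (λ z → NN (t - z)) (sym (flip-Z u v w)) (≈nn p (r26 t (Zc u v w)))) , b , a) ,
    form≡ refl refl (r288 u v w)

  OnC-in : ∀ s → OnC s → Dom.In (cube B) s
  OnC-in (u , v , w) (e , (p , q) , a , b) = le u a hu , le v b hv ,
      ∣∣≤ {w} {B} (≈nn (nn+ (nn+ (nn+ B-big hu) hv) p) (r289 (+ B) P t u v w)) (≈nn (nn+ (nn+ (nn+ (nn+ B-big q) (nn+ a b)) (nn+ P≥1 P≥1)) (nn {4})) (r290 (+ B) P t u v w)) where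
    hu : NN (P - u)
    hu = C-bounds P t (Zc u v w) u v q p a b e
    hv : NN (P - v)
    hv = C-bounds P t (Zc u v w) v u q p b a (cong (λ s → s - Zc u v w * Zc u v w) (r135 u v) ∙ e)
    le : ∀ x → NN (x - + 1) → NN (P - x) → ∣ x ∣ ≤ B
    le x x⁺ h = nn-≤ {x} {B} (nn1 x x⁺) (≈nn (nn+ (nn+ (nn+ B-big h) t₀) (nn1 P P≥1)) (r136 (+ B) P t x))

  -- The flip changes the sign of `Zc` and hence of the summand. It does not preserve the cube, so
  -- it is applied as a bijection of the bounded support `OnC`.
  Sc≡0 : S (pt cC) ≡ + 0
  Sc≡0 = self-neg (S (pt cC)) (∑-cong L c≡when ∙ swap ∙ ∑-* L (- (+ 1)) (λ s → when (OnC? s) (zsign s)) ∙ cong (λ x → (- (+ 1)) * x) (sym (∑-cong L c≡when))) where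
    L = Dom.L (cube B)
    self-neg : ∀ x → x ≡ (- (+ 1)) * x → x ≡ + 0
    self-neg x e = cancelˡ {x} 1 (r81 x ∙ cong (λ y → x - y) (sym e) ∙ r16 x)
    g : T³ → ℤ
    g s = (- (+ 1)) * zsign s
    match : ∀ s → OnC s → g (flip₃ s) ≡ zsign s
    match (u , v , w) _ = cong (λ c → (- (+ 1)) * sgnC c) (cong (cat t) (flip-Z u v w) ∙ cat-neg t (Zc u v w) t₀) ∙
      r137 (sgnC (flipC (cat t (Zc u v w)))) ∙ sgnC-flip (cat t (Zc u v w))
    pull : ∀ s → when (OnC? s) (g s) ≡ (- (+ 1)) * when (OnC? s) (zsign s)
    pull s = go (OnC? s) where
      go : (d : Dec (OnC s)) → when d (g s) ≡ (- (+ 1)) * when d (zsign s)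
      go (yes _) = refl
      go (no _)  = refl
    swap : ∑ L (λ s → when (OnC? s) (zsign s)) ≡ ∑ L (λ s → (- (+ 1)) * when (OnC? s) (zsign s))
    swap = ∑-bij (cube B) (cube B) OnC? OnC? zsign g flip₃ flip₃ OnC-in OnC-in
      (λ s h → proj₁ (flip-OnC s h) , proj₂ (flip-OnC s h) , match s h) flip-OnC ∙ ∑-cong L pull

  P2-formula : P2 B D ≡ S (pt a₁C) + S (pt a₂C) - S (pt a₃C)
  P2-formula = solve-for (P2 B D) (S (pt a₁C)) (S (pt a₂C)) (S (pt a₃C)) (sym expand ∙ SG≡0) where
    L = Dom.L (cube B)
    onD-cong : ∀ s → onD D s (wt s) ≡ onD D s (pt wtC s)
    onD-cong (u , v , w) = go (dsc u v w ℤ.≟ D) where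
      go : (d : Dec (dsc u v w ≡ D)) → when d (wt (u , v , w)) ≡ when d (pt wtC (u , v , w))
      go (yes e) = On.wt≡ u v w e
      go (no _)  = refl
    lin : ∀ s → G s ≡ onD D s (wt s) - onD D s (pt a₁C s) - onD D s (pt a₂C s) + onD D s (pt a₃C s) - + 3 * onD D s (pt cC s)
    lin s@(u , v , w) = onD-lin (dsc u v w ℤ.≟ D) (pt wtC s) (pt a₁C s) (pt a₂C s) (pt a₃C s) (pt cC s) ∙
      cong (λ x → x - onD D s (pt a₁C s) - onD D s (pt a₂C s) + onD D s (pt a₃C s) - + 3 * onD D s (pt cC s)) (sym (onD-cong s))
    lin∑ : ∀ (f g h k m : T³ → ℤ) → ∑ L (λ s → f s - g s - h s + k s - + 3 * m s) ≡ ∑ L f - ∑ L g - ∑ L h + ∑ L k - + 3 * ∑ L m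
    lin∑ f g h k m = ∑-- L (λ s → f s - g s - h s + k s) (λ s → + 3 * m s) ∙ cong₂ _-_
      (∑-+ L (λ s → f s - g s - h s) k ∙ cong (λ x → x + ∑ L k) (∑-- L (λ s → f s - g s) h ∙ cong (λ x → x - ∑ L h) (∑-- L f g)))
      (∑-* L (+ 3) m)
    expand : S (pt totC) ≡ P2 B D - S (pt a₁C) - S (pt a₂C) + S (pt a₃C)
    expand = ∑-cong L lin ∙ lin∑ (λ s → onD D s (wt s)) (λ s → onD D s (pt a₁C s)) (λ s → onD D s (pt a₂C s)) (λ s → onD D s (pt a₃C s)) (λ s → onD D s (pt cC s)) ∙
      cong (λ x → P2 B D - S (pt a₁C) - S (pt a₂C) + S (pt a₃C) - + 3 * x) Sc≡0 ∙ r138 (P2 B D - S (pt a₁C) - S (pt a₂C) + S (pt a₃C))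
    solve-for : ∀ p a b c → p - a - b + c ≡ + 0 → p ≡ a + b - c
    solve-for p a b c e = ≡-from-0 {p} {a + b - c} (r139 p a b c ∙ cong -_ e)

-- Change of variables from triples to quadruples

hlf : ℤ → ℤ
hlf x = x ℤ./ℕ 2

data Parity (x : ℤ) : Set where
  even : x ≡ hlf x + hlf x → Parity x
  odd  : x ≡ hlf x + hlf x + + 1 → Parity x

parity : ∀ x → Parity x
parity x = go (x %ℕ 2) (DM.n%ℕd<d x 2) (DM.a≡a%ℕn+[a/ℕn]*n x 2) where
  go : ∀ r → r ℕ.< 2 → x ≡ + r + hlf x * + 2 → Parity x
  go 0 _ e = even (e ∙ r522 (hlf x))
  go 1 _ e = odd (e ∙ r523 (hlf x))
  go (suc (suc r)) (s≤s (s≤s ())) e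

odd≢0 : ∀ m → m + m + + 1 ≢ + 0
odd≢0 m e = go (tri m) where
  go : Tri m → ⊥
  go (pos p) = nn-absurd (- (+ 1)) (nn+ (nn+ p p) (nn {2})) e (r291 m)
  go (zer refl) = 1≢0 e where
    1≢0 : + 1 ≢ + 0
    1≢0 ()
  go (neg p) = nn-absurd (+ 1) (nn+ (nn+ p p) (nn {0})) e (r292 m)

double-inj : ∀ x y → x + x ≡ y + y → x ≡ y
double-inj x y e = ≡-from-0 {x} {y} (cancelˡ {y - x} 1 (r525 x y ∙ sub0 {x + x} {y + y} e))

hlf-double : ∀ d x → x ≡ d + d → hlf x ≡ d
hlf-double d x e = go (parity x) where
  go : Parity x → hlf x ≡ d
  go (even h) = double-inj (hlf x) d (sym h ∙ e)
  go (odd h)  = ⊥-elim (odd≢0 (hlf x - d) (r526 (hlf x) d ∙ sub0 {d + d} {hlf x + hlf x + + 1} (sym e ∙ h)))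

-- Modulo 4 the equation says z² ≡ τ², so z and τ have the same parity and d = (z + τ)/2 is an
-- integer.
hlf-even : ∀ P τ z u v → + 4 * u * v - z * z ≡ + 4 * P - τ * τ → z + τ ≡ hlf (z + τ) + hlf (z + τ)
hlf-even P τ z u v e = go (parity (z + τ)) where
  h = hlf (z + τ)
  go : Parity (z + τ) → z + τ ≡ h + h
  go (even q) = q
  go (odd q)  = ⊥-elim (odd≢0 m (r293 P z u v h ∙ cong (λ τ → (z + τ) * (τ - z) - + 4 * (P - u * v)) (sym τ≡) ∙ r294 P τ z u v ∙ sub0 {+ 4 * P - τ * τ} {+ 4 * u * v - z * z} (sym e))) where
    m = + 2 * h * h + + 2 * h - + 2 * h * z - z - + 2 * (P - u * v)
    τ≡ : τ ≡ h + h + + 1 - z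
    τ≡ = r140 z τ ∙ cong (λ s → s - z) q

T⁴ : Set
T⁴ = ℤ × ℤ × ℤ × ℤ

box : ℕ → Dom
box K = ℤD K ×D ℤD K ×D ℤD K ×D ℤD K

tet≡ : ∀ {a b c d a′ b′ c′ d′ : ℤ} → a ≡ a′ → b ≡ b′ → c ≡ c′ → d ≡ d′ → (a , b , c , d) ≡ (a′ , b′ , c′ , d′)
tet≡ refl refl refl refl = refl

-- The change of variables (u , v , w) = (d + ε c , d + ε b , a) between triples of discriminant 4P - τ² and quadruples.
module Transfer (P ε τ : ℤ) (ε² : ε * ε ≡ + 1) where

  D = + 4 * P - τ * τ

  Quad : T⁴ → Set
  Quad (a , b , c , d) = a * d + b * c ≡ P × a - ε * (b + c) ≡ τ

  Quad? : ∀ q → Dec (Quad q)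
  Quad? (a , b , c , d) = (a * d + b * c ℤ.≟ P) ×-dec (a - ε * (b + c) ℤ.≟ τ)

  φ : T³ → T⁴
  φ (u , v , w) = w , ε * (v - hlf (Zc u v w + τ)) , ε * (u - hlf (Zc u v w + τ)) , hlf (Zc u v w + τ)

  ψ : T⁴ → T³
  ψ (a , b , c , d) = d + ε * c , d + ε * b , a

  module _ where
    ε²x : ∀ x → ε * (ε * x) ≡ x
    ε²x x = r141 ε x ∙ cong (λ s → s * x) ε² ∙ ZP.*-identityˡ x

  -- Together with `Xψ` and `Yψ`: in the new variables Zc = 2d - τ, Xc = τ + 2εb, Yc = τ + 2εc.
  -- Comparisons of the parameters with ±t thus become sign conditions on single entries of the
  -- quadruple.
  Zψ : ∀ a b c d → a - ε * (b + c) ≡ τ → Zc (d + ε * c) (d + ε * b) a ≡ + 2 * d - τ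
  Zψ a b c d e = r295 a b c d ε ∙ cong (λ s → + 2 * d - s) e

  Xψ : ∀ a b c d → a - ε * (b + c) ≡ τ → Xc (d + ε * c) (d + ε * b) a ≡ τ + + 2 * (ε * b)
  Xψ a b c d e = r296 a b c d ε ∙ cong (λ s → s + + 2 * (ε * b)) e

  Yψ : ∀ a b c d → a - ε * (b + c) ≡ τ → Yc (d + ε * c) (d + ε * b) a ≡ τ + + 2 * (ε * c)
  Yψ a b c d e = r297 a b c d ε ∙ cong (λ s → s + + 2 * (ε * c)) e

  dscψ : ∀ a b c d → Quad (a , b , c , d) → dsc (d + ε * c) (d + ε * b) a ≡ D
  dscψ a b c d (e₁ , e₂) = cong (λ z → + 4 * (d + ε * c) * (d + ε * b) - z * z) (Zψ a b c d e₂) ∙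
    r298 b c d ε τ ∙ cong (λ s → + 4 * (d * (τ + ε * (b + c)) + s * (b * c)) - τ * τ) ε² ∙
      cong (λ s → + 4 * (d * s + + 1 * (b * c)) - τ * τ) (sym a≡) ∙ r299 a b c d τ ∙ cong (λ s → + 4 * s - τ * τ) e₁ where
    a≡ : a ≡ τ + ε * (b + c)
    a≡ = r142 a (ε * (b + c)) ∙ cong (λ s → s + ε * (b + c)) e₂

  φψ : ∀ q → Quad q → φ (ψ q) ≡ q
  φψ (a , b , c , d) (e₁ , e₂) = tet≡ refl
      (cong (λ h → ε * (d + ε * b - h)) h≡ ∙ cong (λ s → ε * s) (r79 d (ε * b)) ∙ ε²x b)
      (cong (λ h → ε * (d + ε * c - h)) h≡ ∙ cong (λ s → ε * s) (r79 d (ε * c)) ∙ ε²x c) h≡ where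
    h≡ : hlf (Zc (d + ε * c) (d + ε * b) a + τ) ≡ d
    h≡ = hlf-double d (Zc (d + ε * c) (d + ε * b) a + τ) (cong (λ z → z + τ) (Zψ a b c d e₂) ∙ r143 d τ)

  ψφ : ∀ s → ψ (φ s) ≡ s
  ψφ (u , v , w) = form≡ (cong (λ s → h + s) (ε²x (u - h)) ∙ r300 h u) (cong (λ s → h + s) (ε²x (v - h)) ∙ r300 h v) refl where
    h = hlf (Zc u v w + τ)

  quadφ : ∀ s → (let (u , v , w) = s in dsc u v w ≡ D) → Quad (φ s)
  quadφ (u , v , w) e = r301 u v w h ε ∙ cong (λ s → w * h + s * ((v - h) * (u - h))) ε² ∙ quad₄ ,
      trans (r302 u v w h ε) (cong (λ s → w - s * (v - h + (u - h))) ε² ∙ r303 u v w h ∙ cong (λ s → s - Zc u v w) (sym ev) ∙ r79 (Zc u v w) τ) where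
    h = hlf (Zc u v w + τ)
    ev : Zc u v w + τ ≡ h + h
    ev = hlf-even P τ (Zc u v w) u v e
    τ≡ : τ ≡ h + h - Zc u v w
    τ≡ = sym (r79 (Zc u v w) τ) ∙ cong (λ s → s - Zc u v w) ev
    quad₄ : w * h + + 1 * ((v - h) * (u - h)) ≡ P
    quad₄ = four-inj (w * h + + 1 * ((v - h) * (u - h))) P (r144 u v w h ∙ cong (λ τ → + 4 * u * v - (u + v - w) * (u + v - w) + τ * τ) (sym τ≡) ∙ cong (λ s → s + τ * τ) e ∙ r145 P τ) where
      four-inj : ∀ x y → + 4 * x ≡ + 4 * y → x ≡ y
      four-inj x y q = ≡-from-0 {x} {y} (cancelˡ {y - x} 3 (r20 x y ∙ sub0 {+ 4 * x} {+ 4 * y} q))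

  transfer : ∀ B K {R : T³ → Set} {R′ : T⁴ → Set} (R? : ∀ s → Dec (R s)) (R′? : ∀ q → Dec (R′ q)) → K ℕ.+ K ≤ B → ∣ ε ∣ ≤ 1 →
    (∀ q → Quad q → R′ q → Dom.In (box K) q) →
    (∀ q → Quad q → R′ q → R (ψ q)) → (∀ q → Quad q → R (ψ q) → R′ q) →
    ∑ (Dom.L (cube B)) (λ s → onD D s (when (R? s) (+ 1))) ≡ ∑ (Dom.L (box K)) (λ q → when (Quad? q ×-dec R′? q) (+ 1))
  transfer B K {R} {R′} R? R′? 2K≤B ε≤1 inK to from = ∑-cong (Dom.L (cube B)) (λ { (u , v , w) → sym (when-× (dsc u v w ℤ.≟ D) (R? (u , v , w))) }) ∙
    ∑-bij (cube B) (box K) {Pr} {λ q → Quad q × R′ q} (λ { (u , v , w) → (dsc u v w ℤ.≟ D) ×-dec R? (u , v , w) }) (λ q → Quad? q ×-dec R′? q) (λ _ → + 1) (λ _ → + 1) φ ψ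
      inB (λ q h → inK q (proj₁ h) (proj₂ h))
      (λ s h → good s h , ψφ s , refl)
      (λ { q@(a , b , c , d) (h , r) → (dscψ a b c d h , to q h r) , φψ q h }) where
    Pr : T³ → Set
    Pr s@(u , v , w) = dsc u v w ≡ D × R s
    good : ∀ s → Pr s → Quad (φ s) × R′ (φ s)
    good s (e , r) = quadφ s e , from (φ s) (quadφ s e) (subst R (sym (ψφ s)) r)
    add : ∀ x y → ∣ x ∣ ≤ K → ∣ y ∣ ≤ K → ∣ x + ε * y ∣ ≤ B
    add x y p q = NP.≤-trans (ZP.∣i+j∣≤∣i∣+∣j∣ x (ε * y)) (NP.≤-trans (NP.+-mono-≤ p (NP.≤-trans (NP.≤-reflexive (ZP.abs-* ε y)) (NP.≤-trans (NP.*-mono-≤ ε≤1 q) (NP.≤-reflexive (NP.*-identityˡ K))))) 2K≤B)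
    inψ : ∀ q → Dom.In (box K) q → Dom.In (cube B) (ψ q)
    inψ (a , b , c , d) (p , q , r , s) = add d c s r , add d b s q , NP.≤-trans p (NP.≤-trans (NP.m≤m+n K K) 2K≤B)
    inB : ∀ s → Pr s → Dom.In (cube B) s
    inB s h = subst (Dom.In (cube B)) (ψφ s) (inψ (φ s) (inK (φ s) (proj₁ (good s h)) (proj₂ (good s h))))

-- Counting the quadruples, boundary solutions included

Cnt⁴ : ℕ → {Q : T⁴ → Set} → (∀ q → Dec (Q q)) → ℤ
Cnt⁴ K Q? = ∑ (Dom.L (box K)) (λ q → when (Q? q) (+ 1))

module _ (K : ℕ) where

  Cnt-⇔ : ∀ {Q Q′ : T⁴ → Set} (Q? : ∀ q → Dec (Q q)) (Q′? : ∀ q → Dec (Q′ q)) → (∀ q → Q q → Q′ q) → (∀ q → Q′ q → Q q) → Cnt⁴ K Q? ≡ Cnt⁴ K Q′?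
  Cnt-⇔ Q? Q′? f g = ∑-cong (Dom.L (box K)) (λ q → when-⇔ (Q? q) (Q′? q) (f q) (g q) (λ _ → refl))

  Cnt-split : ∀ {Q Q₁ Q₂ : T⁴ → Set} (Q? : ∀ q → Dec (Q q)) (Q₁? : ∀ q → Dec (Q₁ q)) (Q₂? : ∀ q → Dec (Q₂ q)) →
    (∀ q → Q q → Q₁ q ⊎ Q₂ q) → (∀ q → Q₁ q → Q q) → (∀ q → Q₂ q → Q q) → (∀ q → Q₁ q → Q₂ q → ⊥) → Cnt⁴ K Q? ≡ Cnt⁴ K Q₁? + Cnt⁴ K Q₂?
  Cnt-split {Q} {Q₁} {Q₂} Q? Q₁? Q₂? f g h k = ∑-cong (Dom.L (box K)) (λ q → go q (Q? q) (Q₁? q) (Q₂? q)) ∙ ∑-+ (Dom.L (box K)) (λ q → when (Q₁? q) (+ 1)) (λ q → when (Q₂? q) (+ 1)) where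
    go : ∀ q (d : Dec (Q q)) (e : Dec (Q₁ q)) (e′ : Dec (Q₂ q)) → when d (+ 1) ≡ when e (+ 1) + when e′ (+ 1)
    go q _ (yes a) (yes b) = ⊥-elim (k q a b)
    go q (yes _) (yes _) (no _) = refl
    go q (yes _) (no _) (yes _) = refl
    go q (no _)  (no _) (no _)  = refl
    go q (no n)  (yes a) _      = ⊥-elim (n (g q a))
    go q (no n)  _ (yes b)      = ⊥-elim (n (h q b))
    go q (yes y) (no a) (no b) with f q y
    ... | inj₁ c = ⊥-elim (a c)
    ... | inj₂ c = ⊥-elim (b c)

  Cnt-one : ∀ {Q : T⁴ → Set} {E : Set} (Q? : ∀ q → Dec (Q q)) (E? : Dec E) q₀ → (∀ q → Q q → q ≡ q₀ × E) → (E → Q q₀ × Dom.In (box K) q₀) → Cnt⁴ K Q? ≡ when E? (+ 1)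
  Cnt-one Q? (yes e) q₀ f g = ∑-enum (box K) Q? (λ _ → + 1) (q₀ ∷ []) ([] ∷ []) (proj₂ (g e) ∷ []) (proj₁ (g e) ∷ []) (λ q h → here (proj₁ (f q h)))
  Cnt-one {Q} Q? (no ne) q₀ f g = ∑-cong (Dom.L (box K)) {g = λ _ → + 0} (λ q → when-no (Q? q) (λ h → ne (proj₂ (f q h)))) ∙ ∑-0 (Dom.L (box K))

2x-1 : ∀ x → NN (+ 2 * x - + 1) → NN (x - + 1)
2x-1 x p = pos-factor (+ 2) x nn p

prime-split : ∀ p → Prime p → ∀ x y → NN (x - + 1) → x * y ≡ + p → (x ≡ + 1 × y ≡ + p) ⊎ (x ≡ + p × y ≡ + 1)
prime-split p pr x y x⁺ e = go x y x⁺ e where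
  go : ∀ x y → NN (x - + 1) → x * y ≡ + p → (x ≡ + 1 × y ≡ + p) ⊎ (x ≡ + p × y ≡ + 1)
  go (+ suc n) y x⁺ e with prime⇒irreducible pr {suc n} (divides ∣ y ∣ (sym (cong ∣_∣ e) ∙ ZP.abs-* (+ suc n) y ∙ NP.*-comm (suc n) ∣ y ∣))
  ... | inj₁ refl = inj₁ (refl , sym (ZP.*-identityˡ y) ∙ e)
  ... | inj₂ refl = inj₂ (refl , ZP.*-cancelˡ-≡ (+ suc n) y (+ 1) (e ∙ sym (ZP.*-identityʳ (+ suc n))))

module Counts (p : ℕ) (pr : Prime p) (K : ℕ) (P : ℤ) (P≡ : P ≡ + p) where

  P-split : ∀ x y → NN (x - + 1) → x * y ≡ P → (x ≡ + 1 × y ≡ P) ⊎ (x ≡ P × y ≡ + 1)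
  P-split x y x⁺ e = subst (λ P → (x ≡ + 1 × y ≡ P) ⊎ (x ≡ P × y ≡ + 1)) (sym P≡) (prime-split p pr x y x⁺ (e ∙ P≡))

  S⁺ : T⁴ → Set
  S⁺ (a , b , c , d) = a * d + b * c ≡ P × NN (a - + 1) × NN (b - + 1) × NN (c - + 1) × NN (d - + 1)

  S⁺? : ∀ q → Dec (S⁺ q)
  S⁺? (a , b , c , d) = (a * d + b * c ℤ.≟ P) ×-dec NN? (a - + 1) ×-dec NN? (b - + 1) ×-dec NN? (c - + 1) ×-dec NN? (d - + 1)

  dif tot : T⁴ → ℤ
  dif (a , b , c , d) = a - b - c
  tot (a , b , c , d) = a + b + c

  Kd Kt : ℤ → ℤ
  Kd τ = Cnt⁴ K (λ q → S⁺? q ×-dec (dif q ℤ.≟ τ))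
  Kt τ = Cnt⁴ K (λ q → S⁺? q ×-dec (tot q ℤ.≟ τ))

  -- The solutions with b = 0 or c = 0 and a + b + c = t: (1, 0, t-1, p), (p, 0, t-p, 1) and (1,
  -- t-1, 0, p), the last one with b ≥ 1. The fourth candidate (p, t-p, 0, 1) with b ≥ 1 would
  -- require t > p.
  edge : ℤ → ℤ
  edge t = when (NN? (t - + 1)) (+ 1) + when (NN? (t - P)) (+ 1) + when (NN? (t - + 2)) (+ 1)

  module At (t : ℤ) (t₀ : NN t) (t≤P : NN (P - t)) (P≥2 : NN (P - + 2)) (K-big : NN (+ K - P - P - P)) where

    P≥1 : NN (P - + 1)
    P≥1 = ≈nn (nn+ P≥2 (nn {1})) (r112 P)

    P₀ : NN P
    P₀ = nn1 P P≥1

    small-in : ∀ x → NN x → NN (P + P + P - x) → ∣ x ∣ ≤ K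
    small-in x x₀ h = nn-≤ {x} {K} x₀ (≈nn (nn+ K-big h) (r146 (+ K) P x))

    ≤P⇒≤3P : ∀ x → NN (P - x) → NN (P + P + P - x)
    ≤P⇒≤3P x h = ≈nn (nn+ h (nn+ P₀ P₀)) (r147 P x)

    factor≤ : ∀ x y z → NN (x - + 1) → NN y → NN z → x * y + z ≡ P → NN (P - y)
    factor≤ x y z x⁺ y₀ z₀ e = nn-mod {g = P - y} (- (+ 1)) (nn+ (nn* x⁺ y₀) z₀) e (r148 P x y z)

    comm-eq : ∀ a b c d → a * d + b * c ≡ P → d * a + b * c ≡ P
    comm-eq a b c d e = cong (λ s → s + b * c) (ZP.*-comm d a) ∙ e

    bc-eq : ∀ a b c d → a * d + b * c ≡ P → b * c + a * d ≡ P
    bc-eq a b c d e = ZP.+-comm (b * c) (a * d) ∙ e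

    cb-eq : ∀ a b c d → a * d + b * c ≡ P → c * b + a * d ≡ P
    cb-eq a b c d e = cong (λ s → s + a * d) (ZP.*-comm c b) ∙ bc-eq a b c d e

    dif≡ : ∀ a b c → a - + 1 * (b + c) ≡ a - b - c
    dif≡ = ring
    tot≡ : ∀ a b c → a - - (+ 1) * (b + c) ≡ a + b + c
    tot≡ = ring

    pos-or-zero : ∀ x → NN x → NN (x - + 1) ⊎ x ≡ + 0
    pos-or-zero x x₀ = go (tri x) where
      go : Tri x → NN (x - + 1) ⊎ x ≡ + 0
      go (pos h) = inj₁ h
      go (zer h) = inj₂ h
      go (neg h) = ⊥-elim (nn-neg⊥ x x₀ h)

    1≢P : + 1 ≢ P
    1≢P e = nn⊥ (subst (λ x → NN (x - + 2)) (sym e) P≥2) refl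

    in⁴ : ∀ a b c d → NN a → NN b → NN c → NN d → NN (P + P + P - a) → NN (P + P + P - b) → NN (P + P + P - c) → NN (P + P + P - d) → Dom.In (box K) (a , b , c , d)
    in⁴ a b c d a₀ b₀ c₀ d₀ ha hb hc hd = small-in a a₀ ha , small-in b b₀ hb , small-in c c₀ hc , small-in d d₀ hd

    -- With ε = 1 and τ = t the region becomes b, c ≥ 1 and d ≥ 0, and a = t + b + c is positive.
    -- For d = 0 one has bc = p, which gives two boundary solutions.
    module A₁ where
      module Tr = Transfer P (+ 1) t refl
      R : T³ → Set
      R (u , v , w) = NN (Xc u v w - t - + 1) × NN (Yc u v w - t - + 1) × NN (t + Zc u v w)
      R? : ∀ s → Dec (R s)
      R? (u , v , w) = NN? (Xc u v w - t - + 1) ×-dec NN? (Yc u v w - t - + 1) ×-dec NN? (t + Zc u v w)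
      R′ : T⁴ → Set
      R′ (a , b , c , d) = NN (b - + 1) × NN (c - + 1) × NN d
      R′? : ∀ q → Dec (R′ q)
      R′? (a , b , c , d) = NN? (b - + 1) ×-dec NN? (c - + 1) ×-dec NN? d

      lx : ∀ t b → t + + 2 * (+ 1 * b) - t - + 1 ≡ + 2 * b - + 1
      lx = ring
      lz : ∀ t d → t + (+ 2 * d - t) ≡ d + d
      lz = ring
      lz′ : ∀ b → + 2 * b - + 1 ≡ b - + 1 + (b - + 1) + + 1
      lz′ = ring

      to : ∀ q → Tr.Quad q → R′ q → R (Tr.ψ q)
      to (a , b , c , d) (_ , e) (b⁺ , c⁺ , d₀) =
        ≈nn (nn+ (nn+ b⁺ b⁺) (nn {1})) (cong (λ x → x - t - + 1) (Tr.Xψ a b c d e) ∙ lx t b ∙ lz′ b) ,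
        ≈nn (nn+ (nn+ c⁺ c⁺) (nn {1})) (cong (λ x → x - t - + 1) (Tr.Yψ a b c d e) ∙ lx t c ∙ lz′ c) ,
        ≈nn (nn+ d₀ d₀) (cong (λ x → t + x) (Tr.Zψ a b c d e) ∙ lz t d)

      from : ∀ q → Tr.Quad q → R (Tr.ψ q) → R′ q
      from (a , b , c , d) (_ , e) (x , y , z) =
        2x-1 b (≈nn x (sym (cong (λ x → x - t - + 1) (Tr.Xψ a b c d e) ∙ lx t b))) ,
        2x-1 c (≈nn y (sym (cong (λ x → x - t - + 1) (Tr.Yψ a b c d e) ∙ lx t c))) ,
        half d (≈nn z (sym (cong (λ x → t + x) (Tr.Zψ a b c d e) ∙ lz t d)))

      a-val : ∀ a b c → a - + 1 * (b + c) ≡ t → a ≡ t + (b + c)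
      a-val a b c e = r21 a b c ∙ cong (λ s → s + (b + c)) e

      a-pos : ∀ a b c → a - + 1 * (b + c) ≡ t → NN (b - + 1) → NN (c - + 1) → NN (a - + 1)
      a-pos a b c e b⁺ c⁺ = ≈nn (nn+ (nn+ (nn+ t₀ b⁺) c⁺) (nn {1})) (cong (λ s → s - + 1) (a-val a b c e) ∙ r22 t b c)

      inK : ∀ q → Tr.Quad q → R′ q → Dom.In (box K) q
      inK (a , b , c , d) (e₁ , e₂) (b⁺ , c⁺ , d₀) = in⁴ a b c d (nn1 a a⁺) (nn1 b b⁺) (nn1 c c⁺) d₀
          (subst (λ a → NN (P + P + P - a)) (sym (a-val a b c e₂)) (≈nn (nn+ (nn+ t≤P hb) hc) (r23 P t b c))) (≤P⇒≤3P b hb) (≤P⇒≤3P c hc) (≤P⇒≤3P d hd) where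
        a⁺ = a-pos a b c e₂ b⁺ c⁺
        ad₀ = nn* (nn1 a a⁺) d₀
        hb = factor≤ c b (a * d) c⁺ (nn1 b b⁺) ad₀ (cb-eq a b c d e₁)
        hc = factor≤ b c (a * d) b⁺ (nn1 c c⁺) ad₀ (bc-eq a b c d e₁)
        hd = factor≤ a d (b * c) a⁺ d₀ (nn* (nn1 b b⁺) (nn1 c c⁺)) e₁

      Q : T⁴ → Set
      Q q = Tr.Quad q × R′ q
      Q? : ∀ q → Dec (Q q)
      Q? q = Tr.Quad? q ×-dec R′? q
      Q₁ Q₂ Q₃ Q₄ : T⁴ → Set
      Q₁ q = S⁺ q × dif q ≡ t
      Q₂ q = Q q × proj₂ (proj₂ (proj₂ q)) ≡ + 0
      Q₃ q = Q₂ q × proj₁ (proj₂ q) ≡ + 1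
      Q₄ q = Q₂ q × proj₁ (proj₂ q) ≡ P
      Q₂? : ∀ q → Dec (Q₂ q)
      Q₂? q = Q? q ×-dec (proj₂ (proj₂ (proj₂ q)) ℤ.≟ + 0)
      Q₃? : ∀ q → Dec (Q₃ q)
      Q₃? q = Q₂? q ×-dec (proj₁ (proj₂ q) ℤ.≟ + 1)
      Q₄? : ∀ q → Dec (Q₄ q)
      Q₄? q = Q₂? q ×-dec (proj₁ (proj₂ q) ℤ.≟ P)

      split₁ : Cnt⁴ K Q? ≡ Kd t + Cnt⁴ K Q₂?
      split₁ = Cnt-split K Q? (λ q → S⁺? q ×-dec (dif q ℤ.≟ t)) Q₂? f g (λ _ → proj₁) clash where
        f : ∀ q → Q q → Q₁ q ⊎ Q₂ q
        f (a , b , c , d) h@((e₁ , e₂) , b⁺ , c⁺ , d₀) = go (pos-or-zero d d₀) where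
          go : NN (d - + 1) ⊎ d ≡ + 0 → Q₁ (a , b , c , d) ⊎ Q₂ (a , b , c , d)
          go (inj₁ d⁺) = inj₁ ((e₁ , a-pos a b c e₂ b⁺ c⁺ , b⁺ , c⁺ , d⁺) , sym (dif≡ a b c) ∙ e₂)
          go (inj₂ z)  = inj₂ (h , z)
        g : ∀ q → Q₁ q → Q q
        g (a , b , c , d) ((e₁ , a⁺ , b⁺ , c⁺ , d⁺) , e₂) = (e₁ , dif≡ a b c ∙ e₂) , b⁺ , c⁺ , nn1 d d⁺
        clash : ∀ q → Q₁ q → Q₂ q → ⊥
        clash (a , b , c , d) ((e₁ , a⁺ , b⁺ , c⁺ , d⁺) , e₂) (_ , z) = pos≢0 d d⁺ z

      d0 : ∀ a b c d → d ≡ + 0 → a * d + b * c ≡ P → b * c ≡ P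
      d0 a b c d refl e = r24 a b c ∙ e

      split₂ : Cnt⁴ K Q₂? ≡ Cnt⁴ K Q₃? + Cnt⁴ K Q₄?
      split₂ = Cnt-split K Q₂? Q₃? Q₄? f (λ _ → proj₁) (λ _ → proj₁) (λ q h k → 1≢P (sym (proj₂ h) ∙ proj₂ k)) where
        f : ∀ q → Q₂ q → Q₃ q ⊎ Q₄ q
        f (a , b , c , d) h@(((e₁ , e₂) , b⁺ , c⁺ , d₀) , z) with P-split b c b⁺ (d0 a b c d z e₁)
        ... | inj₁ (x , _) = inj₁ (h , x)
        ... | inj₂ (x , _) = inj₂ (h , x)

      one₃ : Cnt⁴ K Q₃? ≡ + 1
      one₃ = Cnt-one K Q₃? (yes tt) (t + (+ 1 + P) , + 1 , P , + 0) f (λ _ → (q₀ , refl) , inK (t + (+ 1 + P) , + 1 , P , + 0) (proj₁ (proj₁ q₀)) (proj₂ (proj₁ q₀))) where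
        f : ∀ q → Q₃ q → q ≡ (t + (+ 1 + P) , + 1 , P , + 0) × ⊤
        f (a , b , c , d) ((((e₁ , e₂) , b⁺ , c⁺ , d₀) , refl) , refl) = tet≡ (a-val a (+ 1) c e₂ ∙ cong (λ c → t + (+ 1 + c)) c≡) refl c≡ refl , tt where
          c≡ : c ≡ P
          c≡ = sym (ZP.*-identityˡ c) ∙ d0 a (+ 1) c (+ 0) refl e₁
        q₀ : Q₂ (t + (+ 1 + P) , + 1 , P , + 0)
        q₀ = ((r1 t P , r2 t P) , nn , P≥1 , nn) , refl

      one₄ : Cnt⁴ K Q₄? ≡ + 1
      one₄ = Cnt-one K Q₄? (yes tt) (t + (P + + 1) , P , + 1 , + 0) f (λ _ → (q₀ , refl) , inK (t + (P + + 1) , P , + 1 , + 0) (proj₁ (proj₁ q₀)) (proj₂ (proj₁ q₀))) where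
        f : ∀ q → Q₄ q → q ≡ (t + (P + + 1) , P , + 1 , + 0) × ⊤
        f (a , b , c , d) ((((e₁ , e₂) , b⁺ , c⁺ , d₀) , refl) , refl) = tet≡ (a-val a P c e₂ ∙ cong (λ c → t + (P + c)) c≡) refl c≡ refl , tt where
          c≡ : c ≡ + 1
          c≡ with P-split P c P≥1 (d0 a P c (+ 0) refl e₁)
          ... | inj₁ (h , _) = ⊥-elim (1≢P (sym h))
          ... | inj₂ (_ , h) = h
        q₀ : Q₂ (t + (P + + 1) , P , + 1 , + 0)
        q₀ = ((r3 t P , r4 t P) , P≥1 , nn , nn) , refl

      count : Cnt⁴ K Q? ≡ Kd t + + 2
      count = split₁ ∙ cong (λ s → Kd t + s) (split₂ ∙ cong₂ _+_ one₃ one₄)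

    -- With ε = 1 and τ = -t the region becomes b, c ≥ 0 and a, d ≥ 1. If one of b, c is 0, then ad
    -- = p and the other is a + t ≥ 1, so there are four boundary solutions.
    module A₂ where
      module Tr = Transfer P (+ 1) (- t) refl
      R : T³ → Set
      R (u , v , w) = NN (t + Xc u v w) × NN (t + Yc u v w) × NN (w - + 1) × NN (Zc u v w - t - + 1)
      R? : ∀ s → Dec (R s)
      R? (u , v , w) = NN? (t + Xc u v w) ×-dec NN? (t + Yc u v w) ×-dec NN? (w - + 1) ×-dec NN? (Zc u v w - t - + 1)
      R′ : T⁴ → Set
      R′ (a , b , c , d) = NN b × NN c × NN (a - + 1) × NN (d - + 1)
      R′? : ∀ q → Dec (R′ q)
      R′? (a , b , c , d) = NN? b ×-dec NN? c ×-dec NN? (a - + 1) ×-dec NN? (d - + 1)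

      lx : ∀ t b → t + (- t + + 2 * (+ 1 * b)) ≡ b + b
      lx = ring
      lz : ∀ t d → + 2 * d - - t - t - + 1 ≡ + 2 * d - + 1
      lz = ring
      lz′ : ∀ b → + 2 * b - + 1 ≡ b - + 1 + (b - + 1) + + 1
      lz′ = ring

      to : ∀ q → Tr.Quad q → R′ q → R (Tr.ψ q)
      to (a , b , c , d) (_ , e) (b₀ , c₀ , a⁺ , d⁺) =
        ≈nn (nn+ b₀ b₀) (cong (λ x → t + x) (Tr.Xψ a b c d e) ∙ lx t b) ,
        ≈nn (nn+ c₀ c₀) (cong (λ x → t + x) (Tr.Yψ a b c d e) ∙ lx t c) , a⁺ ,
        ≈nn (nn+ (nn+ d⁺ d⁺) (nn {1})) (cong (λ x → x - t - + 1) (Tr.Zψ a b c d e) ∙ lz t d ∙ lz′ d)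

      from : ∀ q → Tr.Quad q → R (Tr.ψ q) → R′ q
      from (a , b , c , d) (_ , e) (x , y , w , z) =
        half b (≈nn x (sym (cong (λ x → t + x) (Tr.Xψ a b c d e) ∙ lx t b))) ,
        half c (≈nn y (sym (cong (λ x → t + x) (Tr.Yψ a b c d e) ∙ lx t c))) , w ,
        2x-1 d (≈nn z (sym (cong (λ x → x - t - + 1) (Tr.Zψ a b c d e) ∙ lz t d)))

      sum-val : ∀ a b c → a - + 1 * (b + c) ≡ - t → b + c ≡ a + t
      sum-val a b c e = r25 a b c ∙ cong (λ s → a - s) e ∙ r26 a t

      inK : ∀ q → Tr.Quad q → R′ q → Dom.In (box K) q
      inK (a , b , c , d) (e₁ , e₂) (b₀ , c₀ , a⁺ , d⁺) = in⁴ a b c d (nn1 a a⁺) b₀ c₀ (nn1 d d⁺) (≤P⇒≤3P a ha) (sum≤ b c c₀ (sum-val a b c e₂))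
          (sum≤ c b b₀ (ZP.+-comm c b ∙ sum-val a b c e₂)) (≤P⇒≤3P d hd) where
        bc₀ = nn* b₀ c₀
        hd = factor≤ a d (b * c) a⁺ (nn1 d d⁺) bc₀ e₁
        ha = factor≤ d a (b * c) d⁺ (nn1 a a⁺) bc₀ (comm-eq a b c d e₁)
        sum≤ : ∀ x y → NN y → x + y ≡ a + t → NN (P + P + P - x)
        sum≤ x y y₀ e = nn-mod {g = P + P + P - x} (- (+ 1)) (nn+ (nn+ (nn+ ha t≤P) y₀) P₀) e (r5 P t a x y)

      Q : T⁴ → Set
      Q q = Tr.Quad q × R′ q
      Q? : ∀ q → Dec (Q q)
      Q? q = Tr.Quad? q ×-dec R′? q
      Q₁ Q₂ Q₃ Q₃′ : T⁴ → Set
      Q₁ q = S⁺ q × dif q ≡ - t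
      Q₂ q = Q q × proj₁ (proj₂ q) ≡ + 0
      Q₃ q = (Q q × NN (proj₁ (proj₂ q) - + 1)) × proj₁ (proj₂ (proj₂ q)) ≡ + 0
      Q₃′ q = Q q × NN (proj₁ (proj₂ q) - + 1)
      Q₂? : ∀ q → Dec (Q₂ q)
      Q₂? q = Q? q ×-dec (proj₁ (proj₂ q) ℤ.≟ + 0)
      Q₃′? : ∀ q → Dec (Q₃′ q)
      Q₃′? q = Q? q ×-dec NN? (proj₁ (proj₂ q) - + 1)
      Q₃? : ∀ q → Dec (Q₃ q)
      Q₃? q = Q₃′? q ×-dec (proj₁ (proj₂ (proj₂ q)) ℤ.≟ + 0)

      split₁ : Cnt⁴ K Q? ≡ Cnt⁴ K Q₃′? + Cnt⁴ K Q₂?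
      split₁ = Cnt-split K Q? Q₃′? Q₂? f (λ _ → proj₁) (λ _ → proj₁) (λ q h k → pos≢0 (proj₁ (proj₂ q)) (proj₂ h) (proj₂ k)) where
        f : ∀ q → Q q → Q₃′ q ⊎ Q₂ q
        f (a , b , c , d) h@(_ , b₀ , _) = go (pos-or-zero b b₀) where
          go : NN (b - + 1) ⊎ b ≡ + 0 → Q₃′ (a , b , c , d) ⊎ Q₂ (a , b , c , d)
          go (inj₁ b⁺) = inj₁ (h , b⁺)
          go (inj₂ z)  = inj₂ (h , z)

      split₂ : Cnt⁴ K Q₃′? ≡ Kd (- t) + Cnt⁴ K Q₃?
      split₂ = Cnt-split K Q₃′? (λ q → S⁺? q ×-dec (dif q ℤ.≟ - t)) Q₃? f g (λ _ → proj₁) clash where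
        f : ∀ q → Q₃′ q → Q₁ q ⊎ Q₃ q
        f (a , b , c , d) h@(((e₁ , e₂) , b₀ , c₀ , a⁺ , d⁺) , b⁺) = go (pos-or-zero c c₀) where
          go : NN (c - + 1) ⊎ c ≡ + 0 → Q₁ (a , b , c , d) ⊎ Q₃ (a , b , c , d)
          go (inj₁ c⁺) = inj₁ ((e₁ , a⁺ , b⁺ , c⁺ , d⁺) , sym (dif≡ a b c) ∙ e₂)
          go (inj₂ z)  = inj₂ (h , z)
        g : ∀ q → Q₁ q → Q₃′ q
        g (a , b , c , d) ((e₁ , a⁺ , b⁺ , c⁺ , d⁺) , e₂) = ((e₁ , dif≡ a b c ∙ e₂) , nn1 b b⁺ , nn1 c c⁺ , a⁺ , d⁺) , b⁺
        clash : ∀ q → Q₁ q → Q₃ q → ⊥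
        clash (a , b , c , d) ((e₁ , a⁺ , b⁺ , c⁺ , d⁺) , e₂) (_ , z) = pos≢0 c c⁺ z

      ad≡P : ∀ a b c d → b * c ≡ + 0 → a * d + b * c ≡ P → a * d ≡ P
      ad≡P a b c d z e = sym (ZP.+-identityʳ (a * d)) ∙ cong (λ s → a * d + s) (sym z) ∙ e

      two-by-a : (H : T⁴ → Set) (H? : ∀ q → Dec (H q)) → (∀ a b c d → H (a , b , c , d) → NN (a - + 1) × a * d ≡ P) →
        Cnt⁴ K H? ≡ Cnt⁴ K (λ q → H? q ×-dec (proj₁ q ℤ.≟ + 1)) + Cnt⁴ K (λ q → H? q ×-dec (proj₁ q ℤ.≟ P))
      two-by-a H H? h = Cnt-split K H? (λ q → H? q ×-dec (proj₁ q ℤ.≟ + 1)) (λ q → H? q ×-dec (proj₁ q ℤ.≟ P)) f (λ _ → proj₁) (λ _ → proj₁) (λ q x y → 1≢P (sym (proj₂ x) ∙ proj₂ y)) where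
        f : ∀ q → H q → (H q × proj₁ q ≡ + 1) ⊎ (H q × proj₁ q ≡ P)
        f (a , b , c , d) x with P-split a d (proj₁ (h a b c d x)) (proj₂ (h a b c d x))
        ... | inj₁ (y , _) = inj₁ (x , y)
        ... | inj₂ (y , _) = inj₂ (x , y)

      d-of-1 : ∀ d → + 1 * d ≡ P → d ≡ P
      d-of-1 d e = sym (ZP.*-identityˡ d) ∙ e
      d-of-P : ∀ d → P * d ≡ P → d ≡ + 1
      d-of-P d e with P-split P d P≥1 e
      ... | inj₁ (h , _) = ⊥-elim (1≢P (sym h))
      ... | inj₂ (_ , h) = h

      two₂ : Cnt⁴ K Q₂? ≡ + 2
      two₂ = two-by-a Q₂ Q₂? (λ { a b c d (((e₁ , _) , _ , _ , a⁺ , _) , refl) → a⁺ , ad≡P a (+ 0) c d refl e₁ }) ∙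
        cong₂ _+_ (Cnt-one K (λ q → Q₂? q ×-dec (proj₁ q ℤ.≟ + 1)) (yes tt) (+ 1 , + 0 , + 1 + t , P) f (λ _ → (q₀ , refl) , inK (+ 1 , + 0 , + 1 + t , P) (proj₁ (proj₁ q₀)) (proj₂ (proj₁ q₀))))
                   (Cnt-one K (λ q → Q₂? q ×-dec (proj₁ q ℤ.≟ P)) (yes tt) (P , + 0 , P + t , + 1) f′ (λ _ → (q₀′ , refl) , inK (P , + 0 , P + t , + 1) (proj₁ (proj₁ q₀′)) (proj₂ (proj₁ q₀′)))) where
        c≡ : ∀ a c → a - + 1 * (+ 0 + c) ≡ - t → c ≡ a + t
        c≡ a c e = sym (ZP.+-identityˡ c) ∙ sum-val a (+ 0) c e
        f : ∀ q → Q₂ q × proj₁ q ≡ + 1 → q ≡ (+ 1 , + 0 , + 1 + t , P) × ⊤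
        f (a , b , c , d) ((((e₁ , e₂) , _) , refl) , refl) = tet≡ refl refl (c≡ (+ 1) c e₂) (d-of-1 d (ad≡P (+ 1) (+ 0) c d refl e₁)) , tt
        f′ : ∀ q → Q₂ q × proj₁ q ≡ P → q ≡ (P , + 0 , P + t , + 1) × ⊤
        f′ (a , b , c , d) ((((e₁ , e₂) , _) , refl) , refl) = tet≡ refl refl (c≡ P c e₂) (d-of-P d (ad≡P P (+ 0) c d refl e₁)) , tt
        q₀ : Q₂ (+ 1 , + 0 , + 1 + t , P)
        q₀ = ((r27 P t , r30 t) , nn , nn+ (nn {1}) t₀ , nn , P≥1) , refl
        q₀′ : Q₂ (P , + 0 , P + t , + 1)
        q₀′ = ((r29 P t , r28 P t) , nn , nn+ P₀ t₀ , P≥1 , nn) , refl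

      two₃ : Cnt⁴ K Q₃? ≡ + 2
      two₃ = two-by-a Q₃ Q₃? (λ { a b c d ((((e₁ , _) , _ , _ , a⁺ , _) , _) , refl) → a⁺ , ad≡P a b (+ 0) d (ZP.*-zeroʳ b) e₁ }) ∙
        cong₂ _+_ (Cnt-one K (λ q → Q₃? q ×-dec (proj₁ q ℤ.≟ + 1)) (yes tt) (+ 1 , + 1 + t , + 0 , P) f (λ _ → (q₀ , refl) , inK (+ 1 , + 1 + t , + 0 , P) (proj₁ (proj₁ (proj₁ q₀))) (proj₂ (proj₁ (proj₁ q₀)))))
                   (Cnt-one K (λ q → Q₃? q ×-dec (proj₁ q ℤ.≟ P)) (yes tt) (P , P + t , + 0 , + 1) f′ (λ _ → (q₀′ , refl) , inK (P , P + t , + 0 , + 1) (proj₁ (proj₁ (proj₁ q₀′))) (proj₂ (proj₁ (proj₁ q₀′))))) where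
        b≡ : ∀ a b → a - + 1 * (b + + 0) ≡ - t → b ≡ a + t
        b≡ a b e = sym (ZP.+-identityʳ b) ∙ sum-val a b (+ 0) e
        f : ∀ q → Q₃ q × proj₁ q ≡ + 1 → q ≡ (+ 1 , + 1 + t , + 0 , P) × ⊤
        f (a , b , c , d) (((((e₁ , e₂) , _) , _) , refl) , refl) = tet≡ refl (b≡ (+ 1) b e₂) refl (d-of-1 d (ad≡P (+ 1) b (+ 0) d (ZP.*-zeroʳ b) e₁)) , tt
        f′ : ∀ q → Q₃ q × proj₁ q ≡ P → q ≡ (P , P + t , + 0 , + 1) × ⊤
        f′ (a , b , c , d) (((((e₁ , e₂) , _) , _) , refl) , refl) = tet≡ refl (b≡ P b e₂) refl (d-of-P d (ad≡P P b (+ 0) d (ZP.*-zeroʳ b) e₁)) , tt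
        q₀ : Q₃ (+ 1 , + 1 + t , + 0 , P)
        q₀ = (((r31 P t , r34 t) , nn+ (nn {1}) t₀ , nn , nn , P≥1) , ≈nn t₀ (r36 t)) , refl
        q₀′ : Q₃ (P , P + t , + 0 , + 1)
        q₀′ = (((r33 P t , r32 P t) , nn+ P₀ t₀ , nn , P≥1 , nn) , ≈nn (nn+ P≥1 t₀) (r35 P t)) , refl

      count : Cnt⁴ K Q? ≡ Kd (- t) + + 4
      count = split₁ ∙ cong₂ _+_ (split₂ ∙ cong (λ s → Kd (- t) + s) two₃) two₂ ∙ ZP.+-assoc (Kd (- t)) (+ 2) (+ 2)

    -- With ε = -1 and τ = t the region becomes a ≥ 1 and b, c, d ≥ 0 with a + b + c = t. The bound
    -- t ≤ p rules out d = 0 and limits the boundary to `edge`.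
    module A₃ where
      module Tr = Transfer P (- (+ 1)) t refl
      R : T³ → Set
      R (u , v , w) = NN (t - Xc u v w) × NN (t - Yc u v w) × NN (w - + 1) × NN (t + Zc u v w)
      R? : ∀ s → Dec (R s)
      R? (u , v , w) = NN? (t - Xc u v w) ×-dec NN? (t - Yc u v w) ×-dec NN? (w - + 1) ×-dec NN? (t + Zc u v w)
      R′ : T⁴ → Set
      R′ (a , b , c , d) = NN b × NN c × NN (a - + 1) × NN d
      R′? : ∀ q → Dec (R′ q)
      R′? (a , b , c , d) = NN? b ×-dec NN? c ×-dec NN? (a - + 1) ×-dec NN? d

      lx : ∀ t b → t - (t + + 2 * (- (+ 1) * b)) ≡ b + b
      lx = ring
      lz : ∀ t d → t + (+ 2 * d - t) ≡ d + d
      lz = ring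

      to : ∀ q → Tr.Quad q → R′ q → R (Tr.ψ q)
      to (a , b , c , d) (_ , e) (b₀ , c₀ , a⁺ , d₀) =
        ≈nn (nn+ b₀ b₀) (cong (λ x → t - x) (Tr.Xψ a b c d e) ∙ lx t b) ,
        ≈nn (nn+ c₀ c₀) (cong (λ x → t - x) (Tr.Yψ a b c d e) ∙ lx t c) , a⁺ ,
        ≈nn (nn+ d₀ d₀) (cong (λ x → t + x) (Tr.Zψ a b c d e) ∙ lz t d)

      from : ∀ q → Tr.Quad q → R (Tr.ψ q) → R′ q
      from (a , b , c , d) (_ , e) (x , y , w , z) =
        half b (≈nn x (sym (cong (λ x → t - x) (Tr.Xψ a b c d e) ∙ lx t b))) ,
        half c (≈nn y (sym (cong (λ x → t - x) (Tr.Yψ a b c d e) ∙ lx t c))) , w ,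
        half d (≈nn z (sym (cong (λ x → t + x) (Tr.Zψ a b c d e) ∙ lz t d)))

      sum-eq : ∀ a b c → a - - (+ 1) * (b + c) ≡ t → a + b + c ≡ t
      sum-eq a b c e = sym (tot≡ a b c) ∙ e

      inK : ∀ q → Tr.Quad q → R′ q → Dom.In (box K) q
      inK (a , b , c , d) (e₁ , e₂) (b₀ , c₀ , a⁺ , d₀) = in⁴ a b c d (nn1 a a⁺) b₀ c₀ d₀
          (≤P⇒≤3P a (nn-mod {g = P - a} (- (+ 1)) (nn+ (nn+ t≤P b₀) c₀) s (r37 P t a b c)))
          (≤P⇒≤3P b (nn-mod {g = P - b} (- (+ 1)) (nn+ (nn+ t≤P (nn1 a a⁺)) c₀) s (r38 P t a b c)))
          (≤P⇒≤3P c (nn-mod {g = P - c} (- (+ 1)) (nn+ (nn+ t≤P (nn1 a a⁺)) b₀) s (r39 P t a b c)))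
          (≤P⇒≤3P d (factor≤ a d (b * c) a⁺ d₀ (nn* b₀ c₀) e₁)) where
        s = sum-eq a b c e₂

      Q : T⁴ → Set
      Q q = Tr.Quad q × R′ q
      Q? : ∀ q → Dec (Q q)
      Q? q = Tr.Quad? q ×-dec R′? q
      Q₁ Q₂ Q₃ Q₃′ Qd : T⁴ → Set
      Q₁ q = S⁺ q × tot q ≡ t
      Qd q = Q q × NN (proj₂ (proj₂ (proj₂ q)) - + 1)
      Q₂ q = Qd q × proj₁ (proj₂ q) ≡ + 0
      Q₃′ q = Qd q × NN (proj₁ (proj₂ q) - + 1)
      Q₃ q = Q₃′ q × proj₁ (proj₂ (proj₂ q)) ≡ + 0
      Qd? : ∀ q → Dec (Qd q)
      Qd? q = Q? q ×-dec NN? (proj₂ (proj₂ (proj₂ q)) - + 1)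
      Q₂? : ∀ q → Dec (Q₂ q)
      Q₂? q = Qd? q ×-dec (proj₁ (proj₂ q) ℤ.≟ + 0)
      Q₃′? : ∀ q → Dec (Q₃′ q)
      Q₃′? q = Qd? q ×-dec NN? (proj₁ (proj₂ q) - + 1)
      Q₃? : ∀ q → Dec (Q₃ q)
      Q₃? q = Q₃′? q ×-dec (proj₁ (proj₂ (proj₂ q)) ℤ.≟ + 0)

      -- d = 0 would force b + c = p + 1 > t.
      d-pos : ∀ q → Q q → Qd q
      d-pos (a , b , c , d) h@((e₁ , e₂) , b₀ , c₀ , a⁺ , d₀) = h , go (pos-or-zero d d₀) where
        go : NN (d - + 1) ⊎ d ≡ + 0 → NN (d - + 1)
        go (inj₁ x) = x
        go (inj₂ z) = ⊥-elim (bad (pos-or-zero b b₀)) where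
          bc : b * c ≡ P
          bc = A₁.d0 a b c d z e₁
          bad : NN (b - + 1) ⊎ b ≡ + 0 → ⊥
          bad (inj₂ refl) = pos≢0 P P≥1 (sym bc)
          bad (inj₁ b⁺) with P-split b c b⁺ bc
          ... | inj₁ (x , y) = nn-absurd (- (+ 1)) (nn+ (nn+ a⁺ t≤P) (nn {1})) (sym (cong₂ (λ b c → a + b + c) x y) ∙ sum-eq a b c e₂) (r6 P t a)
          ... | inj₂ (x , y) = nn-absurd (- (+ 1)) (nn+ (nn+ a⁺ t≤P) (nn {1})) (sym (cong₂ (λ b c → a + b + c) x y) ∙ sum-eq a b c e₂) (r7 P t a)

      split₁ : Cnt⁴ K Qd? ≡ Cnt⁴ K Q₃′? + Cnt⁴ K Q₂?
      split₁ = Cnt-split K Qd? Q₃′? Q₂? f (λ _ → proj₁) (λ _ → proj₁) (λ q h k → pos≢0 (proj₁ (proj₂ q)) (proj₂ h) (proj₂ k)) where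
        f : ∀ q → Qd q → Q₃′ q ⊎ Q₂ q
        f (a , b , c , d) h@((_ , b₀ , _) , _) = go (pos-or-zero b b₀) where
          go : NN (b - + 1) ⊎ b ≡ + 0 → Q₃′ (a , b , c , d) ⊎ Q₂ (a , b , c , d)
          go (inj₁ b⁺) = inj₁ (h , b⁺)
          go (inj₂ z)  = inj₂ (h , z)

      split₂ : Cnt⁴ K Q₃′? ≡ Kt t + Cnt⁴ K Q₃?
      split₂ = Cnt-split K Q₃′? (λ q → S⁺? q ×-dec (tot q ℤ.≟ t)) Q₃? f g (λ _ → proj₁) clash where
        f : ∀ q → Q₃′ q → Q₁ q ⊎ Q₃ q
        f (a , b , c , d) h@((((e₁ , e₂) , b₀ , c₀ , a⁺ , d₀) , d⁺) , b⁺) = go (pos-or-zero c c₀) where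
          go : NN (c - + 1) ⊎ c ≡ + 0 → Q₁ (a , b , c , d) ⊎ Q₃ (a , b , c , d)
          go (inj₁ c⁺) = inj₁ ((e₁ , a⁺ , b⁺ , c⁺ , d⁺) , sum-eq a b c e₂)
          go (inj₂ z)  = inj₂ (h , z)
        g : ∀ q → Q₁ q → Q₃′ q
        g (a , b , c , d) ((e₁ , a⁺ , b⁺ , c⁺ , d⁺) , e₂) = (((e₁ , tot≡ a b c ∙ e₂) , nn1 b b⁺ , nn1 c c⁺ , a⁺ , nn1 d d⁺) , d⁺) , b⁺
        clash : ∀ q → Q₁ q → Q₃ q → ⊥
        clash (a , b , c , d) ((e₁ , a⁺ , b⁺ , c⁺ , d⁺) , e₂) (_ , z) = pos≢0 c c⁺ z

      c-val : ∀ a c → a - - (+ 1) * (+ 0 + c) ≡ t → c ≡ t - a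
      c-val a c e = r40 a c ∙ cong (λ s → s - a) e
      b-val : ∀ a b → a - - (+ 1) * (b + + 0) ≡ t → b ≡ t - a
      b-val a b e = r41 a b ∙ cong (λ s → s - a) e

      two₂ : Cnt⁴ K Q₂? ≡ when (NN? (t - + 1)) (+ 1) + when (NN? (t - P)) (+ 1)
      two₂ = A₂.two-by-a Q₂ Q₂? (λ { a b c d ((((e₁ , _) , _ , _ , a⁺ , _) , _) , refl) → a⁺ , A₂.ad≡P a (+ 0) c d refl e₁ }) ∙
        cong₂ _+_ (Cnt-one K (λ q → Q₂? q ×-dec (proj₁ q ℤ.≟ + 1)) (NN? (t - + 1)) (+ 1 , + 0 , t - + 1 , P) f (λ h → (q₀ h , refl) , inK (+ 1 , + 0 , t - + 1 , P) (proj₁ (proj₁ (proj₁ (q₀ h)))) (proj₂ (proj₁ (proj₁ (q₀ h))))))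
                   (Cnt-one K (λ q → Q₂? q ×-dec (proj₁ q ℤ.≟ P)) (NN? (t - P)) (P , + 0 , t - P , + 1) f′ (λ h → (q₀′ h , refl) , inK (P , + 0 , t - P , + 1) (proj₁ (proj₁ (proj₁ (q₀′ h)))) (proj₂ (proj₁ (proj₁ (q₀′ h)))))) where
        f : ∀ q → Q₂ q × proj₁ q ≡ + 1 → q ≡ (+ 1 , + 0 , t - + 1 , P) × NN (t - + 1)
        f (a , b , c , d) (((((e₁ , e₂) , _ , c₀ , _) , _) , refl) , refl) = tet≡ refl refl (c-val (+ 1) c e₂) (A₂.d-of-1 d (A₂.ad≡P (+ 1) (+ 0) c d refl e₁)) , subst NN (c-val (+ 1) c e₂) c₀
        f′ : ∀ q → Q₂ q × proj₁ q ≡ P → q ≡ (P , + 0 , t - P , + 1) × NN (t - P)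
        f′ (a , b , c , d) (((((e₁ , e₂) , _ , c₀ , _) , _) , refl) , refl) = tet≡ refl refl (c-val P c e₂) (A₂.d-of-P d (A₂.ad≡P P (+ 0) c d refl e₁)) , subst NN (c-val P c e₂) c₀
        q₀ : NN (t - + 1) → Q₂ (+ 1 , + 0 , t - + 1 , P)
        q₀ h = (((r42 P t , r45 t) , nn , h , nn , P₀) , P≥1) , refl
        q₀′ : NN (t - P) → Q₂ (P , + 0 , t - P , + 1)
        q₀′ h = (((r44 P t , r43 P t) , nn , h , P≥1 , nn) , nn) , refl

      two₃ : Cnt⁴ K Q₃? ≡ when (NN? (t - + 2)) (+ 1)
      two₃ = A₂.two-by-a Q₃ Q₃? (λ { a b c d (((((e₁ , _) , _ , _ , a⁺ , _) , _) , _) , refl) → a⁺ , A₂.ad≡P a b (+ 0) d (ZP.*-zeroʳ b) e₁ }) ∙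
        cong₂ _+_ (Cnt-one K (λ q → Q₃? q ×-dec (proj₁ q ℤ.≟ + 1)) (NN? (t - + 2)) (+ 1 , t - + 1 , + 0 , P) f (λ h → (q₀ h , refl) , inK (+ 1 , t - + 1 , + 0 , P) (proj₁ (proj₁ (proj₁ (proj₁ (q₀ h))))) (proj₂ (proj₁ (proj₁ (proj₁ (q₀ h)))))))
                   (Cnt-one K (λ q → Q₃? q ×-dec (proj₁ q ℤ.≟ P)) (no (λ (x : ⊥) → x)) (P , t - P , + 0 , + 1) f′ (λ ())) ∙ ZP.+-identityʳ (when (NN? (t - + 2)) (+ 1)) where
        f : ∀ q → Q₃ q × proj₁ q ≡ + 1 → q ≡ (+ 1 , t - + 1 , + 0 , P) × NN (t - + 2)
        f (a , b , c , d) ((((((e₁ , e₂) , _) , _) , b⁺) , refl) , refl) = tet≡ refl (b-val (+ 1) b e₂) refl (A₂.d-of-1 d (A₂.ad≡P (+ 1) b (+ 0) d (ZP.*-zeroʳ b) e₁)) ,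
          ≈nn (subst (λ b → NN (b - + 1)) (b-val (+ 1) b e₂) b⁺) (sym (r46 t))
        f′ : ∀ q → Q₃ q × proj₁ q ≡ P → q ≡ (P , t - P , + 0 , + 1) × ⊥
        f′ (a , b , c , d) ((((((e₁ , e₂) , _) , _) , b⁺) , refl) , refl) = ⊥-elim (nn⊥ (nn+ (subst (λ b → NN (b - + 1)) (b-val P b e₂) b⁺) t≤P) (r47 t P))
        q₀ : NN (t - + 2) → Q₃ (+ 1 , t - + 1 , + 0 , P)
        q₀ h = ((((r48 P t , r49 t) , nn1 (t - + 1) (≈nn h (r46 t)) , nn , nn , P₀) , P≥1) , ≈nn h (r46 t)) , refl

      count : Cnt⁴ K Q? ≡ Kt t + edge t
      count = Cnt-⇔ K Q? Qd? d-pos (λ _ → proj₁) ∙ split₁ ∙ cong₂ _+_ (split₂ ∙ cong (λ s → Kt t + s) two₃) two₂ ∙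
        r50 (Kt t) (when (NN? (t - + 2)) (+ 1)) (when (NN? (t - + 1)) (+ 1)) (when (NN? (t - P)) (+ 1))

    -- For u = 0 on the quadric and h = (z + t)/2 one gets h (t - h) = p. Primality then forces t =
    -- p + 1, against t ≤ p. The same argument shows 4p ≠ t².
    no-sum : ∀ h → h * (t - h) ≡ P → ⊥
    no-sum h prod≡ = go (tri h) where
      go : Tri h → ⊥
      go (pos h⁺) with P-split h (t - h) h⁺ prod≡
      ... | inj₁ (x , y) = nn-absurd (+ 1) (nn+ t≤P (nn {0})) (cong (λ h → t - h) (sym x) ∙ y) (r51 P t)
      ... | inj₂ (x , y) = nn-absurd (+ 1) (nn+ t≤P (nn {0})) (cong (λ h → t - h) (sym x) ∙ y) (r52 P t)
      go (zer x) = pos≢0 P P≥1 (sym prod≡ ∙ cong (λ h → h * (t - h)) x)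
      go (neg h⁻) = nn-absurd (+ 1) (nn+ (nn+ (nn+ P≥1 (nn* h⁻ t₀)) (nn+ (nn² h) t₀)) (nn {0})) prod≡ (r53 P t h)

    no-split : ∀ z v → + 4 * + 0 * v - z * z ≡ + 4 * P - t * t → ⊥
    no-split z v e = no-sum h prod≡ where
      h = hlf (z + t)
      ev : z + t ≡ h + h
      ev = hlf-even P t z (+ 0) v e
      z≡ : z ≡ h + h - t
      z≡ = r54 z t ∙ cong (λ s → s - t) ev
      prod≡ : h * (t - h) ≡ P
      prod≡ = ≡-from-0 {h * (t - h)} {P} (cancelˡ {P - h * (t - h)} 3 (r55 P t v h ∙ cong (λ z → + 4 * P - t * t - (+ 4 * + 0 * v - z * z)) (sym z≡) ∙ sub0 {+ 4 * + 0 * v - z * z} {+ 4 * P - t * t} e))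

    D≢0 : + 4 * P - t * t ≢ + 0
    D≢0 e = no-split (+ 0) (+ 0) (sym e)

    nz : ∀ u v w → dsc u v w ≡ + 4 * P - t * t → u ≢ + 0
    nz u v w e u≡0 = no-split (Zc u v w) v (cong (λ u′ → + 4 * u′ * v - Zc u v w * Zc u v w) (sym u≡0) ∙ e)

    module Final (B : ℕ) (B-big : NN (+ B - P - P - t)) (2K≤B : K ℕ.+ K ≤ B) where
      module I = Ident B P t P≥1 t₀ D≢0 nz B-big

      s₁ : I.S (I.pt a₁C) ≡ Kd t + + 2
      s₁ = ∑-cong (Dom.L (cube B)) (λ { s@(u , v , w) → cong (λ x → onD I.D s x) (conv u v w) }) ∙
             A₁.Tr.transfer B K A₁.R? A₁.R′? 2K≤B NP.≤-refl A₁.inK A₁.to A₁.from ∙ A₁.count where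
        conv : ∀ u v w → I.pt a₁C (u , v , w) ≡ when (A₁.R? (u , v , w)) (+ 1)
        conv u v w = ⟦⟧-when (isHi (cat t (Xc u v w)) ∧ isHi (cat t (Yc u v w)) ∧ ≥-t (cat t (Zc u v w))) (A₁.R? (u , v , w))
          (T⇔-∧ (proj₂ (proj₂ (vb (Xc u v w)))) (T⇔-∧ (proj₂ (proj₂ (vb (Yc u v w)))) (proj₁ (vb (Zc u v w))))) where
          vb = λ x → view-bound t x t₀ (view t x)

      s₂ : I.S (I.pt a₂C) ≡ Kd (- t) + + 4
      s₂ = ∑-cong (Dom.L (cube B)) (λ { s@(u , v , w) → cong (λ x → onD I.D s x) (conv u v w) ∙ cong (λ D → onD D s (when (A₂.R? s) (+ 1))) (r56 P t) }) ∙
             A₂.Tr.transfer B K A₂.R? A₂.R′? 2K≤B NP.≤-refl A₂.inK A₂.to A₂.from ∙ A₂.count where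
        conv : ∀ u v w → I.pt a₂C (u , v , w) ≡ when (A₂.R? (u , v , w)) (+ 1)
        conv u v w = ⟦⟧-when (≥-t (cat t (Xc u v w)) ∧ ≥-t (cat t (Yc u v w)) ∧ is⊕ (sg w) ∧ isHi (cat t (Zc u v w))) (A₂.R? (u , v , w))
          (T⇔-∧ (proj₁ (vb (Xc u v w))) (T⇔-∧ (proj₁ (vb (Yc u v w))) (T⇔-∧ (⊕⇔ w) (proj₂ (proj₂ (vb (Zc u v w))))))) where
          vb = λ x → view-bound t x t₀ (view t x)

      s₃ : I.S (I.pt a₃C) ≡ Kt t + edge t
      s₃ = ∑-cong (Dom.L (cube B)) (λ { s@(u , v , w) → cong (λ x → onD I.D s x) (conv u v w) }) ∙
             A₃.Tr.transfer B K A₃.R? A₃.R′? 2K≤B NP.≤-refl A₃.inK A₃.to A₃.from ∙ A₃.count where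
        conv : ∀ u v w → I.pt a₃C (u , v , w) ≡ when (A₃.R? (u , v , w)) (+ 1)
        conv u v w = ⟦⟧-when (≤t (cat t (Xc u v w)) ∧ ≤t (cat t (Yc u v w)) ∧ is⊕ (sg w) ∧ ≥-t (cat t (Zc u v w))) (A₃.R? (u , v , w))
          (T⇔-∧ (proj₁ (proj₂ (vb (Xc u v w)))) (T⇔-∧ (proj₁ (proj₂ (vb (Yc u v w)))) (T⇔-∧ (⊕⇔ w) (proj₁ (vb (Zc u v w)))))) where
          vb = λ x → view-bound t x t₀ (view t x)

      -- The constant 6 is 2 + 4, the boundary solutions of the first two regions; the third region
      -- contributes `edge t` with the opposite sign. What remains counts quadruples with all
      -- entries positive.
      P2-count : P2 B (+ 4 * P - t * t) ≡ Kd t + Kd (- t) - Kt t + + 6 - edge t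
      P2-count = I.P2-formula ∙ cong₂ _-_ (cong₂ _+_ s₁ s₂) s₃ ∙ r57 (Kd t) (Kd (- t)) (Kt t) (edge t)

-- Summation over t against an even function

Σ1 : ℕ → (ℤ → ℤ) → ℤ
Σ1 zero    f = + 0
Σ1 (suc m) f = Σ1 m f + f (+ suc m)

Σ1-cong : ∀ m {f g : ℤ → ℤ} → (∀ n → suc n ≤ m → f (+ suc n) ≡ g (+ suc n)) → Σ1 m f ≡ Σ1 m g
Σ1-cong zero    h = refl
Σ1-cong (suc m) h = cong₂ _+_ (Σ1-cong m (λ n n≤m → h n (NP.m≤n⇒m≤1+n n≤m))) (h m NP.≤-refl)

Σ1-+ : ∀ m f g → Σ1 m (λ x → f x + g x) ≡ Σ1 m f + Σ1 m g
Σ1-+ zero    f g = refl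
Σ1-+ (suc m) f g = cong (λ s → s + (f (+ suc m) + g (+ suc m))) (Σ1-+ m f g) ∙ r238 (Σ1 m f) (Σ1 m g) (f (+ suc m)) (g (+ suc m))

Σ1-* : ∀ m k f → Σ1 m (λ x → k * f x) ≡ k * Σ1 m f
Σ1-* zero    k f = sym (ZP.*-zeroʳ k)
Σ1-* (suc m) k f = cong (λ s → s + k * f (+ suc m)) (Σ1-* m k f) ∙ sym (ZP.*-distribˡ-+ k (Σ1 m f) (f (+ suc m)))

Σ1-const : ∀ m → Σ1 m (λ _ → + 1) ≡ + m
Σ1-const zero    = refl
Σ1-const (suc m) = cong (λ s → s + + 1) (Σ1-const m) ∙ ZP.+-comm (+ m) (+ 1)

∑-ints : ∀ n g → ∑ (ints n) g ≡ g (+ 0) + Σ1 n (λ x → g x + g (- x))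
∑-ints zero    g = refl
∑-ints (suc n) g = cong (λ s → g (+ suc n) + (g -[1+ n ] + s)) (∑-ints n g) ∙ r527 (g (+ suc n)) (g -[1+ n ]) (g (+ 0)) (Σ1 n (λ x → g x + g (- x)))

module _ where
  suc-pos : ∀ n → + suc n - + 1 ≡ + n
  suc-pos n = r36 (+ n)

Upto : ℕ → ℤ → Set
Upto m x = NN (x - + 1) × NN (+ m - x)

Upto? : ∀ m x → Dec (Upto m x)
Upto? m x = NN? (x - + 1) ×-dec NN? (+ m - x)

≤⇒nn : ∀ {m n} → m ≤ n → NN (+ n - + m)
≤⇒nn h = ZP.i≤j⇒0≤j-i (+≤+ h)

nn⇒≤ : ∀ {m n} → NN (+ n - + m) → m ≤ n
nn⇒≤ {m} {n} h = ZP.drop‿+≤+ (ZP.0≤i-j⇒j≤i {+ n} {+ m} h)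

Σ1-when : ∀ m n → m ≤ n → ∀ f → Σ1 n (λ x → when (Upto? m x) (f x)) ≡ Σ1 m f
Σ1-when zero zero z≤n f = refl
Σ1-when m (suc n) h f with m NP.≟ suc n
... | yes refl = Σ1-cong (suc n) (λ k k≤ → when-yes (Upto? (suc n) (+ suc k)) (≈nn (nn {k}) (suc-pos k) , ≤⇒nn k≤))
... | no ne = cong₂ _+_ (Σ1-when m n (NP.≤-pred (NP.≤∧≢⇒< h ne)) f) (when-no (Upto? m (+ suc n)) (λ u → NP.<-irrefl refl (NP.≤-trans (NP.≤∧≢⇒< h ne) (nn⇒≤ (proj₂ u))))) ∙ ZP.+-identityʳ (Σ1 m f)

∑-Upto : ∀ m n → m ≤ n → ∀ f → ∑ (ints n) (λ x → when (Upto? m x) (f x)) ≡ Σ1 m f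
∑-Upto m n h f = ∑-ints n (λ x → when (Upto? m x) (f x)) ∙ cong (λ s → s + Σ1 n (λ x → when (Upto? m x) (f x) + when (Upto? m (- x)) (f (- x)))) (when-no (Upto? m (+ 0)) {f (+ 0)} (λ u → neg1 (proj₁ u))) ∙
  ZP.+-identityˡ (Σ1 n (λ x → when (Upto? m x) (f x) + when (Upto? m (- x)) (f (- x)))) ∙ Σ1-cong n (λ k _ → cong (λ s → when (Upto? m (+ suc k)) (f (+ suc k)) + s) (when-no (Upto? m -[1+ k ]) {f -[1+ k ]} (λ u → no-neg k (proj₁ u))) ∙ ZP.+-identityʳ (when (Upto? m (+ suc k)) (f (+ suc k)))) ∙ Σ1-when m n h f where
  no-neg : ∀ k → ¬ NN (-[1+ k ] - + 1)
  no-neg k ()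

module Sums (p : ℕ) (pr : Prime p) (K : ℕ) (P : ℤ) (P≡ : P ≡ + p) (P≥2 : NN (P - + 2)) (K-big : NN (+ K - P - P - P)) where

  open Counts p pr K P P≡ public

  sumS : (T⁴ → ℤ) → ℤ
  sumS g = ∑ (Dom.L (box K)) (λ q → when (S⁺? q) (g q))

  sumS-cong : ∀ {f g : T⁴ → ℤ} → (∀ q → S⁺ q → f q ≡ g q) → sumS f ≡ sumS g
  sumS-cong {f} {g} h = ∑-cong (Dom.L (box K)) (λ q → when-⇔ (S⁺? q) (S⁺? q) (λ x → x) (λ x → x) (h q))

  sumS-+ : ∀ f g → sumS (λ q → f q + g q) ≡ sumS f + sumS g
  sumS-+ f g = ∑-cong (Dom.L (box K)) (λ q → go q (S⁺? q)) ∙ ∑-+ (Dom.L (box K)) (λ q → when (S⁺? q) (f q)) (λ q → when (S⁺? q) (g q)) where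
    go : ∀ q (d : Dec (S⁺ q)) → when d (f q + g q) ≡ when d (f q) + when d (g q)
    go q (yes _) = refl
    go q (no _)  = refl

  sumS-* : ∀ k f → sumS (λ q → k * f q) ≡ k * sumS f
  sumS-* k f = ∑-cong (Dom.L (box K)) (λ q → go q (S⁺? q)) ∙ ∑-* (Dom.L (box K)) k (λ q → when (S⁺? q) (f q)) where
    go : ∀ q (d : Dec (S⁺ q)) → when d (k * f q) ≡ k * when d (f q)
    go q (yes _) = refl
    go q (no _)  = sym (ZP.*-zeroʳ k)

  sumS-0 : sumS (λ _ → + 0) ≡ + 0
  sumS-0 = ∑-cong (Dom.L (box K)) {g = λ _ → + 0} (λ q → when-0 (S⁺? q)) ∙ ∑-0 (Dom.L (box K))

  P≥1 : NN (P - + 1)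
  P≥1 = ≈nn (nn+ P≥2 (nn {1})) (r112 P)

  P₀ : NN P
  P₀ = nn1 P P≥1

  entry≤ : ∀ x y z → NN (x - + 1) → NN (y - + 1) → NN (z - + 1) → x * y + z ≡ P → NN (P - y - + 1)
  entry≤ x y z x⁺ y⁺ z⁺ e = nn-mod {g = P - y - + 1} (- (+ 1)) (nn+ (nn* x⁺ (nn1 y y⁺)) z⁺) e (r304 P x y z)

  prod⁺ : ∀ x y → NN (x - + 1) → NN (y - + 1) → NN (x * y - + 1)
  prod⁺ x y x⁺ y⁺ = ≈nn (nn+ (nn* x⁺ y⁺) (nn+ x⁺ y⁺)) (r305 x y)

  module Bounds (a b c d : ℤ) (s : S⁺ (a , b , c , d)) where
    e = proj₁ s
    a⁺ = proj₁ (proj₂ s)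
    b⁺ = proj₁ (proj₂ (proj₂ s))
    c⁺ = proj₁ (proj₂ (proj₂ (proj₂ s)))
    d⁺ = proj₂ (proj₂ (proj₂ (proj₂ s)))
    l₁ : ∀ a b c d → d * a + b * c ≡ a * d + b * c
    l₁ = ring
    l₂ : ∀ a b c d → c * b + a * d ≡ a * d + b * c
    l₂ = ring
    l₃ : ∀ a b c d → b * c + a * d ≡ a * d + b * c
    l₃ = ring
    d≤ = entry≤ a d (b * c) a⁺ d⁺ (prod⁺ b c b⁺ c⁺) e
    a≤ = entry≤ d a (b * c) d⁺ a⁺ (prod⁺ b c b⁺ c⁺) (l₁ a b c d ∙ e)
    b≤ = entry≤ c b (a * d) c⁺ b⁺ (prod⁺ a d a⁺ d⁺) (l₂ a b c d ∙ e)
    c≤ = entry≤ b c (a * d) b⁺ c⁺ (prod⁺ a d a⁺ d⁺) (l₃ a b c d ∙ e)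
    -- a + b + c - 1 ≤ a + b c ≤ p
    tot≤ : NN (P + + 1 - (a + b + c))
    tot≤ = nn-mod {g = P + + 1 - (a + b + c)} (- (+ 1)) (nn+ (nn* (nn1 a a⁺) d⁺) (nn* b⁺ c⁺)) e (r149 P a b c d)

  S⁺-in : ∀ q → S⁺ q → Dom.In (box K) q
  S⁺-in (a , b , c , d) s = le a a⁺ a≤ , le b b⁺ b≤ , le c c⁺ c≤ , le d d⁺ d≤ where
    open Bounds a b c d s
    le : ∀ x → NN (x - + 1) → NN (P - x - + 1) → ∣ x ∣ ≤ K
    le x x⁺ h = nn-≤ {x} {K} (nn1 x x⁺) (≈nn (nn+ (nn+ K-big h) (nn+ (nn+ P₀ P₀) (nn {1}))) (r150 (+ K) P x))

  -- Quadruples are grouped by the value of h. With h = `dif` or `tot` the fibre counts are `Kd` and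
  -- `Kt`, so the sum over t becomes a sum over quadruples.
  fibres : ∀ n (h : T⁴ → ℤ) (f : ℤ → ℤ) → (∀ q → S⁺ q → ∣ h q ∣ ≤ n) →
    ∑ (ints n) (λ t → f t * Cnt⁴ K (λ q → S⁺? q ×-dec (h q ℤ.≟ t))) ≡ sumS (λ q → f (h q))
  fibres n h f bound = ∑-cong (ints n) (λ t → sym (∑-* (Dom.L (box K)) (f t) (λ q → when (S⁺? q ×-dec (h q ℤ.≟ t)) (+ 1)))) ∙
    ∑-swap (ints n) (Dom.L (box K)) (λ t q → f t * when (S⁺? q ×-dec (h q ℤ.≟ t)) (+ 1)) ∙
      ∑-cong (Dom.L (box K)) (λ q → inner q (S⁺? q)) where
    inner : ∀ q (d : Dec (S⁺ q)) → ∑ (ints n) (λ t → f t * when (d ×-dec (h q ℤ.≟ t)) (+ 1)) ≡ when d (f (h q))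
    inner q (no ns) = ∑-cong (ints n) {g = λ _ → + 0} (λ t → cong (λ s → f t * s) (when-no (no ns ×-dec (h q ℤ.≟ t)) {+ 1} (λ x → ns (proj₁ x))) ∙ ZP.*-zeroʳ (f t)) ∙ ∑-0 (ints n)
    inner q (yes s) = ∑-cong (ints n) (λ t → go t (h q ℤ.≟ t) (t ℤ.≟ h q)) ∙ Dom.full (ℤD n) (h q) (bound q s) (f (h q)) where
      go : ∀ t (d : Dec (h q ≡ t)) (e : Dec (t ≡ h q)) → f t * when (yes s ×-dec d) (+ 1) ≡ when e (f (h q))
      go t (yes refl) (yes _) = ZP.*-identityʳ (f t)
      go t (yes refl) (no n)  = ⊥-elim (n refl)
      go t (no n) (yes refl)  = ⊥-elim (n refl)
      go t (no _) (no _)      = ZP.*-zeroʳ (f t)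

  empty : ∀ {Q : T⁴ → Set} (Q? : ∀ q → Dec (Q q)) → (∀ q → Q q → ⊥) → Cnt⁴ K Q? ≡ + 0
  empty Q? h = ∑-cong (Dom.L (box K)) {g = λ _ → + 0} (λ q → when-no (Q? q) (h q)) ∙ ∑-0 (Dom.L (box K))

  tot-pos : ∀ q → S⁺ q → NN (tot q - + 3)
  tot-pos (a , b , c , d) (_ , a⁺ , b⁺ , c⁺ , _) = ≈nn (nn+ (nn+ a⁺ b⁺) c⁺) (r306 a b c)

  Kt-neg : ∀ t → NN (- t) → Kt t ≡ + 0
  Kt-neg t h = empty (λ q → S⁺? q ×-dec (tot q ℤ.≟ t)) (λ q x → nn-absurd (- (+ 1)) (nn+ (nn+ (tot-pos q (proj₁ x)) h) (nn {2})) (proj₂ x) (r307 (tot q) t))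

  dif≤ : ∀ q → S⁺ q → ∣ dif q ∣ ≤ p
  dif≤ (a , b , c , d) s = ∣∣≤ {a - b - c} {p} (subst (λ P → NN (P - (a - b - c))) P≡ (≈nn (nn+ (nn+ (nn+ a≤ b⁺) c⁺) (nn {3})) (r308 P a b c)))
      (subst (λ P → NN (P + (a - b - c))) P≡ (≈nn (nn+ (nn+ tot≤ (nn+ a⁺ a⁺)) (nn {1})) (r309 P a b c))) where
    open Bounds a b c d s

  tot≤′ : ∀ q → S⁺ q → ∣ tot q ∣ ≤ suc p
  tot≤′ q@(a , b , c , d) s = nn-≤ {a + b + c} {suc p} (≈nn (nn+ (tot-pos q s) (nn {3})) (r310 (a + b + c)))
      (subst (λ x → NN (x - (a + b + c))) (cong (λ x → x + + 1) P≡ ∙ ZP.+-comm (+ p) (+ 1)) (Bounds.tot≤ a b c d s))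

module Total (k : ℕ) (pr : Prime (suc (suc k))) (K : ℕ) (P : ℤ) (P≡ : P ≡ + suc (suc k)) (P≥2 : NN (P - + 2)) (K-big : NN (+ K - P - P - P))
  (B : ℕ) (2K≤B : K ℕ.+ K ≤ B) where

  p : ℕ
  p = suc (suc k)

  open Sums p pr K P P≡ P≥2 K-big public

  k≡ : + k ≡ P - + 2
  k≡ = r311 (+ k) ∙ cong (λ x → x - + 2) (sym P≡)

  k′≡ : + suc k ≡ P - + 1
  k′≡ = r312 (+ k) ∙ cong (λ x → x - + 1) (sym P≡)

  k≤K : suc k ≤ K
  k≤K = nn⇒≤ (≈nn (nn+ (nn+ K-big (nn+ P₀ P₀)) (nn {1})) (cong (λ x → + K - x) k′≡ ∙ r313 (+ K) P))

  module _ where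
    End : T⁴ → Set
    End q = S⁺ q × tot q ≡ P + + 1
    End? : ∀ q → Dec (End q)
    End? q = S⁺? q ×-dec (tot q ℤ.≟ P + + 1)

    -- On ad + bc = p the difference p + 1 - (a + b + c) equals a (d - 1) + (b - 1)(c - 1), a sum of
    -- two nonnegative terms; at the extreme value both vanish.
    end-eq : ∀ a b c d → End (a , b , c , d) → d ≡ + 1 × (b - + 1) * (c - + 1) ≡ + 0
    end-eq a b c d (s , e) = sym (≡-from-0 {+ 1} {d} (zero-part a (d - + 1) a⁺ d⁺ (proj₁ both))) , proj₂ both where
      open Bounds a b c d s using (a⁺; b⁺; c⁺; d⁺)
      x = a * (d - + 1)
      y = (b - + 1) * (c - + 1)
      sum0 : x + y ≡ + 0
      sum0 = r151 P a b c d ∙ cong₂ _+_ (sub0 {a + b + c} {P + + 1} e) (sub0 {P} {a * d + b * c} (sym (proj₁ s)))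
      both : x ≡ + 0 × y ≡ + 0
      both = antisym0 x₀ (≈nn y₀ (r58 x y ∙ cong (λ s → y - s) sum0 ∙ ZP.+-identityʳ y)) , antisym0 y₀ (≈nn x₀ (r59 x y ∙ cong (λ s → x - s) sum0 ∙ ZP.+-identityʳ x)) where
        x₀ = nn* (nn1 a a⁺) d⁺
        y₀ = nn* b⁺ c⁺

    E₁ E₂ : T⁴ → Set
    E₁ q = End q × proj₁ (proj₂ q) ≡ + 1
    E₂ q = End q × NN (proj₁ (proj₂ q) - + 2)
    E₁? : ∀ q → Dec (E₁ q)
    E₁? q = End? q ×-dec (proj₁ (proj₂ q) ℤ.≟ + 1)
    E₂? : ∀ q → Dec (E₂ q)
    E₂? q = End? q ×-dec NN? (proj₁ (proj₂ q) - + 2)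

    b-split : ∀ b → NN (b - + 1) → b ≡ + 1 ⊎ NN (b - + 2)
    b-split b h = go (tri (b - + 1)) where
      go : Tri (b - + 1) → b ≡ + 1 ⊎ NN (b - + 2)
      go (pos x) = inj₂ (≈nn x (r152 b))
      go (zer x) = inj₁ (sym (≡-from-0 {+ 1} {b} x))
      go (neg x) = ⊥-elim (nn-neg⊥ (b - + 1) h x)

    end-split : Cnt⁴ K End? ≡ Cnt⁴ K E₁? + Cnt⁴ K E₂?
    end-split = Cnt-split K End? E₁? E₂? f (λ _ → proj₁) (λ _ → proj₁) (λ q x y → neg1 (subst (λ b → NN (b - + 2)) (proj₂ x) (proj₂ y))) where
      f : ∀ q → End q → E₁ q ⊎ E₂ q
      f (a , b , c , d) h = go (b-split b (proj₁ (proj₂ (proj₂ (proj₁ h))))) where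
        go : b ≡ + 1 ⊎ NN (b - + 2) → E₁ (a , b , c , d) ⊎ E₂ (a , b , c , d)
        go (inj₁ x) = inj₁ (h , x)
        go (inj₂ x) = inj₂ (h , x)

    Upto-in : ∀ m x → m ≤ K → Upto m x → ∣ x ∣ ≤ K
    Upto-in m x h (x⁺ , x≤) = NP.≤-trans (nn-≤ {x} {m} (nn1 x x⁺) x≤) h

    count₁ : Cnt⁴ K E₁? ≡ P - + 1
    count₁ = ∑-bij (box K) (ℤD K) E₁? (Upto? (suc k)) (λ _ → + 1) (λ _ → + 1) (λ q → proj₁ (proj₂ (proj₂ q))) (λ c → P - c , + 1 , c , + 1)
        (λ q h → S⁺-in q (proj₁ (proj₁ h))) (λ c h → Upto-in (suc k) c k≤K h) to from ∙
      ∑-Upto (suc k) K k≤K (λ _ → + 1) ∙ Σ1-const (suc k) ∙ k′≡ where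
      a-of : ∀ a c → a + + 1 + c ≡ P + + 1 → P - c ≡ a
      a-of a c e = sym (≡-from-0 {a} {P - c} (r60 P a c ∙ sub0 {a + + 1 + c} {P + + 1} e))
      to : ∀ q → E₁ q → Upto (suc k) (proj₁ (proj₂ (proj₂ q))) × (P - proj₁ (proj₂ (proj₂ q)) , + 1 , proj₁ (proj₂ (proj₂ q)) , + 1) ≡ q × + 1 ≡ + 1
      to (a , b , c , d) (h@(s , e) , refl) = (Bounds.c⁺ a b c d s , subst (λ x → NN (x - c)) (sym k′≡) (≈nn (Bounds.c≤ a b c d s) (r61 P c))) ,
          tet≡ (a-of a c e) refl refl (sym (proj₁ (end-eq a b c d h))) , refl
      from : ∀ c → Upto (suc k) c → E₁ (P - c , + 1 , c , + 1) × c ≡ c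
      from c (c⁺ , c≤) = (((r62 P c , ≈nn (subst (λ x → NN (x - c)) k′≡ c≤) (r64 P c) , nn , c⁺ , nn) , r63 P c) , refl) , refl

    count₂ : Cnt⁴ K E₂? ≡ P - + 2
    count₂ = ∑-bij (box K) (ℤD K) E₂? (Upto? k) (λ _ → + 1) (λ _ → + 1) (λ q → proj₁ (proj₂ q) - + 1) (λ x → P - x - + 1 , x + + 1 , + 1 , + 1)
        (λ q h → S⁺-in q (proj₁ (proj₁ h))) (λ c h → Upto-in k c (NP.≤-trans (NP.n≤1+n k) k≤K) h) to from ∙
      ∑-Upto k K (NP.≤-trans (NP.n≤1+n k) k≤K) (λ _ → + 1) ∙ Σ1-const k ∙ k≡ where
      a-of : ∀ a b → a + b + + 1 ≡ P + + 1 → P - (b - + 1) - + 1 ≡ a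
      a-of a b e = sym (≡-from-0 {a} {P - (b - + 1) - + 1} (r65 P a b ∙ sub0 {a + b + + 1} {P + + 1} e))
      c≡1 : ∀ b c → NN (b - + 2) → NN (c - + 1) → (b - + 1) * (c - + 1) ≡ + 0 → c ≡ + 1
      c≡1 b c b₂ c⁺ e = sym (≡-from-0 {+ 1} {c} (zero-part (b - + 1) (c - + 1) (≈nn b₂ (r46 b)) c⁺ e))
      to : ∀ q → E₂ q → Upto k (proj₁ (proj₂ q) - + 1) × (P - (proj₁ (proj₂ q) - + 1) - + 1 , proj₁ (proj₂ q) - + 1 + + 1 , + 1 , + 1) ≡ q × + 1 ≡ + 1
      to (a , b , c , d) (h@(s , e) , b₂) = (≈nn b₂ (r46 b) , subst (λ x → NN (x - (b - + 1))) (sym k≡) (≈nn (Bounds.b≤ a b c d s) (r66 P b))) ,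
          tet≡ (a-of a b (cong (λ c → a + b + c) (sym c1) ∙ e)) (r153 b) (sym c1) (sym (proj₁ (end-eq a b c d h))) , refl where
        c1 = c≡1 b c b₂ (Bounds.c⁺ a b c d s) (proj₂ (end-eq a b c d h))
      from : ∀ x → Upto k x → E₂ (P - x - + 1 , x + + 1 , + 1 , + 1) × x + + 1 - + 1 ≡ x
      from x (x⁺ , x≤) = (((r67 P x , ≈nn (subst (λ y → NN (y - x)) k≡ x≤) (r69 P x) , ≈nn (nn1 x x⁺) (r70 x) , nn , nn) , r68 P x) , ≈nn x⁺ (r71 x)) , r70 x

  -- The formula for the class numbers is available for t ≤ p only, while a + b + c may reach p + 1.
  -- This last fibre is therefore counted by hand: p - 1 solutions with b = 1, and p - 2 with c = 1
  -- and b ≥ 2.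
  Kt-end : Kt (P + + 1) ≡ P - + 1 + (P - + 2)
  Kt-end = end-split ∙ cong₂ _+_ count₁ count₂

  Pt : ℤ → ℤ
  Pt t = P2 B (+ 4 * P - t * t)

  Pt-neg : ∀ t → Pt (- t) ≡ Pt t
  Pt-neg t = cong (λ s → P2 B (+ 4 * P - s)) (r15 t)

  Pt-formula : ∀ n → n ≤ p → Pt (+ n) ≡ Kd (+ n) + Kd (- (+ n)) - Kt (+ n) + + 6 - edge (+ n)
  Pt-formula n n≤p = At.Final.P2-count (+ n) nn t≤P P≥2 K-big B B-big 2K≤B where
    t≤P : NN (P - + n)
    t≤P = subst (λ P → NN (P - + n)) (sym P≡) (≤⇒nn n≤p)
    B-big : NN (+ B - P - P - + n)
    B-big = ≈nn (nn+ (nn+ (nn+ (≤⇒nn {K ℕ.+ K} {B} 2K≤B) (nn+ K-big K-big)) t≤P) (nn+ P₀ (nn+ P₀ P₀))) (r154 (+ B) (+ K) P (+ n) ∙ cong (λ x → + B - x + (+ K - P - P - P + (+ K - P - P - P)) + (P - + n) + (P + (P + P))) (sym (ZP.pos-+ K K)))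

  -- The conditions t ≥ 1, t ≥ p and t ≥ 2 contribute the whole sum, its last term, and the whole
  -- sum without its first term.
  Σ1-edge : ∀ f → Σ1 p (λ x → f x * edge x) ≡ + 2 * Σ1 p f + f P - f (+ 1)
  Σ1-edge f = Σ1-cong p pointwise ∙ Σ1-lin f (λ x → when (Upto? (suc k) x) (f x)) (λ x → when (Upto? 1 x) (f x)) ∙
      cong₂ (λ x y → + 3 * Σ1 p f - x - y) (Σ1-when (suc k) p (NP.n≤1+n (suc k)) f) (Σ1-when 1 p (s≤s z≤n) f) ∙
        cong (λ x → + 3 * (Σ1 (suc k) f + x) - Σ1 (suc k) f - (+ 0 + f (+ 1))) fP ∙ r314 (Σ1 (suc k) f) (f P) (f (+ 1)) ∙ cong (λ x → + 2 * (Σ1 (suc k) f + x) + f P - f (+ 1)) (sym fP) where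
    fP : f (+ p) ≡ f P
    fP = cong f (sym P≡)
    Σ1-lin : ∀ f g h → Σ1 p (λ x → + 3 * f x - g x - h x) ≡ + 3 * Σ1 p f - Σ1 p g - Σ1 p h
    Σ1-lin f g h = Σ1-cong p (λ n _ → r155 (f (+ suc n)) (g (+ suc n)) (h (+ suc n))) ∙ Σ1-+ p (λ x → + 3 * f x + - (+ 1) * g x) (λ x → - (+ 1) * h x) ∙
      cong₂ _+_ (Σ1-+ p (λ x → + 3 * f x) (λ x → - (+ 1) * g x) ∙ cong₂ _+_ (Σ1-* p (+ 3) f) (Σ1-* p (- (+ 1)) g)) (Σ1-* p (- (+ 1)) h) ∙ sym (r155 (Σ1 p f) (Σ1 p g) (Σ1 p h))
    pointwise : ∀ n → suc n ≤ p → f (+ suc n) * edge (+ suc n) ≡ + 3 * f (+ suc n) - when (Upto? (suc k) (+ suc n)) (f (+ suc n)) - when (Upto? 1 (+ suc n)) (f (+ suc n))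
    pointwise n n≤ = go (NN? (x - + 1)) (NN? (x - P)) (NN? (x - + 2)) (Upto? (suc k) x) (Upto? 1 x) where
      x = + suc n
      y = f x
      x⁺ : NN (x - + 1)
      x⁺ = ≈nn (nn {n}) (suc-pos n)
      c₁ : NN (x - P) → Upto (suc k) x → ⊥
      c₁ h (_ , u) = nn⊥ (nn+ h (subst (λ s → NN (s - x)) k′≡ u)) (r72 x P)
      c₂ : ¬ NN (x - P) → Upto (suc k) x
      c₂ h = x⁺ , subst (λ s → NN (s - x)) (sym k′≡) (≈nn (¬nn {x - P} h) (r73 x P))
      c₃ : NN (x - + 2) → Upto 1 x → ⊥
      c₃ h (_ , u) = nn⊥ (nn+ h u) (r74 x)
      c₄ : ¬ NN (x - + 2) → Upto 1 x
      c₄ h = x⁺ , ≈nn (¬nn {x - + 2} h) (r75 x)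
      go : (a : Dec (NN (x - + 1))) (b : Dec (NN (x - P))) (c : Dec (NN (x - + 2))) (d : Dec (Upto (suc k) x)) (e : Dec (Upto 1 x)) →
        y * (when a (+ 1) + when b (+ 1) + when c (+ 1)) ≡ + 3 * y - when d y - when e y
      go (no n) _ _ _ _ = ⊥-elim (n x⁺)
      go (yes _) (yes b) _ (yes d) _ = ⊥-elim (c₁ b d)
      go (yes _) (no b) _ (no d) _ = ⊥-elim (d (c₂ b))
      go (yes _) _ (yes c) _ (yes e) = ⊥-elim (c₃ c e)
      go (yes _) _ (no c) _ (no e) = ⊥-elim (e (c₄ c))
      go (yes _) (yes _) (yes _) (no _) (no _) = r156 y
      go (yes _) (yes _) (no _) (no _) (yes _) = r157 y
      go (yes _) (no _) (yes _) (yes _) (no _) = r158 y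
      go (yes _) (no _) (no _) (yes _) (yes _) = r159 y

  edge-0 : edge (+ 0) ≡ + 0
  edge-0 = cong (λ x → + 0 + x + + 0) (when-no (NN? (+ 0 - P)) {+ 1} (λ h → nn⊥ (nn+ (nn+ h P≥2) (nn {1})) (r315 P)))

  -- The terms at t and -t are combined. Completing the fibre sum of a + b + c to all quadruples
  -- costs the term at p + 1. The coefficient 8 is 2 · 6 from the constant of `P2-count` minus 2 · 2
  -- from `Σ1-edge`.
  total : ∀ f → (∀ t → f (- t) ≡ f t) → ∑ (ints p) (λ t → f t * Pt t) ≡
    + 2 * sumS (λ q → f (dif q)) - + 2 * sumS (λ q → f (tot q)) + + 2 * (P - + 1 + (P - + 2)) * f (P + + 1) + + 6 * f (+ 0) + + 8 * Σ1 p f + + 2 * f (+ 1) - + 2 * f P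
  total f ev = ∑-ints p (λ t → f t * Pt t) ∙ cong₂ _+_ at0 (Σ1-cong p atn ∙ Σ-lin) ∙
      r316 (f (+ 0)) (Kd (+ 0)) σd σt (Σ1 p f) (f P) (f (+ 1)) ∙ cong₂ (λ x y → + 2 * x - + 2 * y + + 6 * f (+ 0) + + 8 * Σ1 p f + + 2 * f (+ 1) - + 2 * f P) sd st ∙ r317 (sumS (λ q → f (dif q))) (sumS (λ q → f (tot q))) (f (P + + 1)) (P - + 1 + (P - + 2)) (f (+ 0)) (Σ1 p f) (f (+ 1)) (f P) where
    σd = Σ1 p (λ x → f x * Kd x + f (- x) * Kd (- x))
    σt = Σ1 p (λ x → f x * Kt x)
    sd : f (+ 0) * Kd (+ 0) + σd ≡ sumS (λ q → f (dif q))
    sd = sym (∑-ints p (λ t → f t * Kd t)) ∙ fibres p dif f dif≤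
    st : σt ≡ sumS (λ q → f (tot q)) - f (P + + 1) * (P - + 1 + (P - + 2))
    st = r54 σt (f (P + + 1) * (P - + 1 + (P - + 2))) ∙ cong (λ s → s - f (P + + 1) * (P - + 1 + (P - + 2))) (sym expand ∙ fibres (suc p) tot f tot≤′) where
      neg0 : ∀ x n → x ≡ - (+ n) → f x * Kt x ≡ + 0
      neg0 x n e = cong (λ s → f x * s) (Kt-neg x (subst (λ x → NN (- x)) (sym e) (≈nn (nn {n}) (ZP.neg-involutive (+ n))))) ∙ ZP.*-zeroʳ (f x)
      sp≡ : + suc p ≡ P + + 1
      sp≡ = ZP.+-comm (+ 1) (+ p) ∙ cong (λ x → x + + 1) (sym P≡)
      expand : ∑ (ints (suc p)) (λ t → f t * Kt t) ≡ σt + f (P + + 1) * (P - + 1 + (P - + 2))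
      expand = ∑-ints (suc p) (λ t → f t * Kt t) ∙ cong₂ _+_ (neg0 (+ 0) 0 refl) (Σ1-cong (suc p) (λ n _ → cong (λ s → f (+ suc n) * Kt (+ suc n) + s) (neg0 -[1+ n ] (suc n) refl) ∙ ZP.+-identityʳ (f (+ suc n) * Kt (+ suc n)))) ∙
        ZP.+-identityˡ (Σ1 (suc p) (λ x → f x * Kt x)) ∙ cong (λ s → σt + s) (cong (λ x → f x * Kt x) sp≡ ∙ cong (λ s → f (P + + 1) * s) Kt-end)
    at0 : f (+ 0) * Pt (+ 0) ≡ f (+ 0) * (Kd (+ 0) + Kd (+ 0) + + 6)
    at0 = cong (λ s → f (+ 0) * s) (Pt-formula 0 z≤n ∙ cong₂ (λ x y → Kd (+ 0) + Kd (+ 0) - x + + 6 - y) (Kt-neg (+ 0) nn) edge-0 ∙ r160 (Kd (+ 0)))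
    term : ℤ → ℤ
    term x = + 2 * (f x * Kd x + f (- x) * Kd (- x)) - + 2 * (f x * Kt x) + + 12 * f x - + 2 * (f x * edge x)
    atn : ∀ n → suc n ≤ p → f (+ suc n) * Pt (+ suc n) + f (- (+ suc n)) * Pt (- (+ suc n)) ≡ term (+ suc n)
    atn n n≤ = cong₂ (λ x y → f (+ suc n) * Pt (+ suc n) + x * y) (ev (+ suc n)) (Pt-neg (+ suc n)) ∙
      cong (λ s → f (+ suc n) * s + f (+ suc n) * s) (Pt-formula (suc n) n≤) ∙
        r161 (f (+ suc n)) (Kd (+ suc n)) (Kd (- (+ suc n))) (Kt (+ suc n)) (edge (+ suc n)) ∙
          cong (λ s → + 2 * (f (+ suc n) * Kd (+ suc n) + s * Kd (- (+ suc n))) - + 2 * (f (+ suc n) * Kt (+ suc n)) + + 12 * f (+ suc n) - + 2 * (f (+ suc n) * edge (+ suc n))) (sym (ev (+ suc n)))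
    Σ-lin : Σ1 p term ≡ + 2 * σd - + 2 * σt + + 12 * Σ1 p f - + 2 * (+ 2 * Σ1 p f + f P - f (+ 1))
    Σ-lin = lin₄ (λ x → f x * Kd x + f (- x) * Kd (- x)) (λ x → f x * Kt x) f (λ x → f x * edge x) ∙ cong (λ s → + 2 * σd - + 2 * σt + + 12 * Σ1 p f - + 2 * s) (Σ1-edge f) where
      lin₄ : ∀ a b c d → Σ1 p (λ x → + 2 * a x - + 2 * b x + + 12 * c x - + 2 * d x) ≡ + 2 * Σ1 p a - + 2 * Σ1 p b + + 12 * Σ1 p c - + 2 * Σ1 p d
      lin₄ a b c d = Σ1-cong p (λ n _ → r162 (a (+ suc n)) (b (+ suc n)) (c (+ suc n)) (d (+ suc n))) ∙
        Σ1-+ p (λ x → + 2 * a x + - (+ 2) * b x + + 12 * c x) (λ x → - (+ 2) * d x) ∙ cong₂ _+_ (Σ1-+ p (λ x → + 2 * a x + - (+ 2) * b x) (λ x → + 12 * c x) ∙ cong₂ _+_ (Σ1-+ p (λ x → + 2 * a x) (λ x → - (+ 2) * b x) ∙ cong₂ _+_ (Σ1-* p (+ 2) a) (Σ1-* p (- (+ 2)) b)) (Σ1-* p (+ 12) c)) (Σ1-* p (- (+ 2)) d) ∙ sym (r162 (Σ1 p a) (Σ1 p b) (Σ1 p c) (Σ1 p d))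

-- Residues modulo 6 and the symmetries of ad + bc = p

-- Residues modulo 3 with balanced representatives, so that the value is also the character χ₋₃.
data F₃ : Set where
  o₃ i₃ j₃ : F₃

val : F₃ → ℤ
val o₃ = + 0
val i₃ = + 1
val j₃ = - (+ 1)

add₃ mul₃ : F₃ → F₃ → F₃
add₃ o₃ y = y
add₃ x o₃ = x
add₃ i₃ i₃ = j₃
add₃ i₃ j₃ = o₃
add₃ j₃ i₃ = o₃
add₃ j₃ j₃ = i₃
mul₃ o₃ y = o₃
mul₃ i₃ y = y
mul₃ j₃ o₃ = o₃
mul₃ j₃ i₃ = j₃
mul₃ j₃ j₃ = i₃

neg₃′ : F₃ → F₃
neg₃′ o₃ = o₃
neg₃′ i₃ = j₃
neg₃′ j₃ = i₃

Mod₃ : ℤ → F₃ → Set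
Mod₃ x r = Σ ℤ λ k → x ≡ + 3 * k + val r

res₃ : ℤ → F₃
res₃ x = go (x %ℕ 3) where
  go : ℕ → F₃
  go 0 = o₃
  go 1 = i₃
  go _ = j₃

mod₃ : ∀ x → Mod₃ x (res₃ x)
mod₃ x = go (x %ℕ 3) (DM.n%ℕd<d x 3) (DM.a≡a%ℕn+[a/ℕn]*n x 3) refl where
  q = x ℤ./ℕ 3
  go : ∀ r → r ℕ.< 3 → x ≡ + r + q * + 3 → x %ℕ 3 ≡ r → Mod₃ x (res₃ x)
  go 0 _ e h rewrite h = q , e ∙ r528 q
  go 1 _ e h rewrite h = q , e ∙ r529 q
  go 2 _ e h rewrite h = q + + 1 , e ∙ r530 q
  go (suc (suc (suc r))) (s≤s (s≤s (s≤s ()))) e h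

3k≢ : ∀ k → + 3 * k + + 1 ≢ + 0 × + 3 * k - + 1 ≢ + 0
3k≢ k = (λ e → go₁ e (tri k)) , (λ e → go₂ e (tri k)) where
  go₁ : + 3 * k + + 1 ≡ + 0 → Tri k → ⊥
  go₁ e (pos p) = nn-absurd (- (+ 1)) (nn+ (nn* (nn {3}) p) (nn {3})) e (r318 k)
  go₁ e (zer refl) with e
  ... | ()
  go₁ e (neg p) = nn-absurd (+ 1) (nn+ (nn* (nn {3}) p) (nn {1})) e (r319 k)
  go₂ : + 3 * k - + 1 ≡ + 0 → Tri k → ⊥
  go₂ e (pos p) = nn-absurd (- (+ 1)) (nn+ (nn* (nn {3}) p) (nn {1})) e (r320 k)
  go₂ e (zer refl) with e
  ... | ()
  go₂ e (neg p) = nn-absurd (+ 1) (nn+ (nn* (nn {3}) p) (nn {3})) e (r321 k)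

unique₃ : ∀ x r s → Mod₃ x r → Mod₃ x s → r ≡ s
unique₃ x r s (k , e) (m , f) = go r s (r531 k m (val r) (val s) ∙ sub0 {+ 3 * m + val s} {+ 3 * k + val r} (sym f ∙ e)) where
  n = k - m
  go : ∀ r s → + 3 * n + (val r - val s) ≡ + 0 → r ≡ s
  go o₃ o₃ _ = refl
  go i₃ i₃ _ = refl
  go j₃ j₃ _ = refl
  go o₃ i₃ h = ⊥-elim (proj₂ (3k≢ n) h)
  go i₃ o₃ h = ⊥-elim (proj₁ (3k≢ n) h)
  go o₃ j₃ h = ⊥-elim (proj₁ (3k≢ n) h)
  go j₃ o₃ h = ⊥-elim (proj₂ (3k≢ n) h)
  go i₃ j₃ h = ⊥-elim (proj₂ (3k≢ (n + + 1)) (r532 n ∙ h))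
  go j₃ i₃ h = ⊥-elim (proj₁ (3k≢ (n - + 1)) (r533 n ∙ h))

res₃-from : ∀ x r → Mod₃ x r → res₃ x ≡ r
res₃-from x r m = unique₃ x (res₃ x) r (mod₃ x) m

res₃-+ : ∀ x y → res₃ (x + y) ≡ add₃ (res₃ x) (res₃ y)
res₃-+ x y = res₃-from (x + y) (add₃ (res₃ x) (res₃ y)) (go (mod₃ x) (mod₃ y)) where
  carry : ∀ r s → Σ ℤ λ c → val r + val s ≡ + 3 * c + val (add₃ r s)
  carry o₃ o₃ = + 0 , refl
  carry o₃ i₃ = + 0 , refl
  carry o₃ j₃ = + 0 , refl
  carry i₃ o₃ = + 0 , refl
  carry i₃ i₃ = + 1 , refl
  carry i₃ j₃ = + 0 , refl
  carry j₃ o₃ = + 0 , refl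
  carry j₃ i₃ = + 0 , refl
  carry j₃ j₃ = - (+ 1) , refl
  go : Mod₃ x (res₃ x) → Mod₃ y (res₃ y) → Mod₃ (x + y) (add₃ (res₃ x) (res₃ y))
  go (k , e) (m , f) = k + m + proj₁ c , cong₂ _+_ e f ∙ r534 k m (val (res₃ x)) (val (res₃ y)) ∙ cong (λ s → + 3 * (k + m) + s) (proj₂ c) ∙ r535 (k + m) (proj₁ c) (val (add₃ (res₃ x) (res₃ y)))
    where c = carry (res₃ x) (res₃ y)

res₃-neg : ∀ x → res₃ (- x) ≡ neg₃′ (res₃ x)
res₃-neg x = res₃-from (- x) (neg₃′ (res₃ x)) (go (mod₃ x)) where
  v : ∀ r → - val r ≡ val (neg₃′ r)
  v o₃ = refl
  v i₃ = refl
  v j₃ = refl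
  go : Mod₃ x (res₃ x) → Mod₃ (- x) (neg₃′ (res₃ x))
  go (k , e) = - k , cong -_ e ∙ r536 k (val (res₃ x)) ∙ cong (λ s → + 3 * - k + s) (v (res₃ x))

val-mul : ∀ r s → val r * val s ≡ val (mul₃ r s)
val-mul o₃ o₃ = refl
val-mul o₃ i₃ = refl
val-mul o₃ j₃ = refl
val-mul i₃ o₃ = refl
val-mul i₃ i₃ = refl
val-mul i₃ j₃ = refl
val-mul j₃ o₃ = refl
val-mul j₃ i₃ = refl
val-mul j₃ j₃ = refl

res₃-* : ∀ x y → res₃ (x * y) ≡ mul₃ (res₃ x) (res₃ y)
res₃-* x y = res₃-from (x * y) (mul₃ (res₃ x) (res₃ y)) (go (mod₃ x) (mod₃ y)) where
  go : Mod₃ x (res₃ x) → Mod₃ y (res₃ y) → Mod₃ (x * y) (mul₃ (res₃ x) (res₃ y))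
  go (k , e) (m , f) = + 3 * k * m + k * val (res₃ y) + val (res₃ x) * m , cong₂ _*_ e f ∙ r537 k m (val (res₃ x)) (val (res₃ y)) ∙ cong (λ s → + 3 * (+ 3 * k * m + k * val (res₃ y) + val (res₃ x) * m) + s) (val-mul (res₃ x) (res₃ y))

bit : Bool → ℤ
bit true  = + 1
bit false = + 0

xor : Bool → Bool → Bool
xor true  b = not b
xor false b = b

Mod₂ : ℤ → Bool → Set
Mod₂ x b = Σ ℤ λ k → x ≡ k + k + bit b

par : ℤ → Bool
par x = go (x %ℕ 2) where
  go : ℕ → Bool
  go 0 = false
  go _ = true

mod₂ : ∀ x → Mod₂ x (par x)
mod₂ x = go (x %ℕ 2) (DM.n%ℕd<d x 2) (DM.a≡a%ℕn+[a/ℕn]*n x 2) refl where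
  q = x ℤ./ℕ 2
  go : ∀ r → r ℕ.< 2 → x ≡ + r + q * + 2 → x %ℕ 2 ≡ r → Mod₂ x (par x)
  go 0 _ e h rewrite h = q , e ∙ r538 q
  go 1 _ e h rewrite h = q , e ∙ r523 q
  go (suc (suc r)) (s≤s (s≤s ())) e h

unique₂ : ∀ x a b → Mod₂ x a → Mod₂ x b → a ≡ b
unique₂ x a b (k , e) (m , f) = go a b (sym e ∙ f) where
  go : ∀ a b → k + k + bit a ≡ m + m + bit b → a ≡ b
  go true  true  _ = refl
  go false false _ = refl
  go true  false h = ⊥-elim (odd≢0 (k - m) (r539 k m ∙ sub0 {m + m + + 0} {k + k + + 1} (sym h)))
  go false true  h = ⊥-elim (odd≢0 (m - k) (r539 m k ∙ sub0 {k + k + + 0} {m + m + + 1} h))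

par-from : ∀ x b → Mod₂ x b → par x ≡ b
par-from x b m = unique₂ x (par x) b (mod₂ x) m

par-+ : ∀ x y → par (x + y) ≡ xor (par x) (par y)
par-+ x y = par-from (x + y) (xor (par x) (par y)) (go (mod₂ x) (mod₂ y)) where
  carry : ∀ a b → Σ ℤ λ c → bit a + bit b ≡ c + c + bit (xor a b)
  carry true  true  = + 1 , refl
  carry true  false = + 0 , refl
  carry false true  = + 0 , refl
  carry false false = + 0 , refl
  go : Mod₂ x (par x) → Mod₂ y (par y) → Mod₂ (x + y) (xor (par x) (par y))
  go (k , e) (m , f) = k + m + proj₁ c , cong₂ _+_ e f ∙ r540 k m (bit (par x)) (bit (par y)) ∙ cong (λ s → k + k + (m + m) + s) (proj₂ c) ∙ r541 k m (proj₁ c) (bit (xor (par x) (par y)))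
    where c = carry (par x) (par y)

par-neg : ∀ x → par (- x) ≡ par x
par-neg x = par-from (- x) (par x) (go (mod₂ x)) where
  flip : ∀ b k → - (k + k + bit b) ≡ (- k - bit b) + (- k - bit b) + bit b
  flip true  = r322
  flip false = r323
  go : Mod₂ x (par x) → Mod₂ (- x) (par x)
  go (k , e) = - k - bit (par x) , cong -_ e ∙ flip (par x) k

par-* : ∀ x y → par (x * y) ≡ par x ∧ par y
par-* x y = par-from (x * y) (par x ∧ par y) (go (mod₂ x) (mod₂ y)) where
  b* : ∀ a b → bit a * bit b ≡ bit (a ∧ b)
  b* true  true  = refl
  b* true  false = refl
  b* false true  = refl
  b* false false = refl
  go : Mod₂ x (par x) → Mod₂ y (par y) → Mod₂ (x * y) (par x ∧ par y)
  go (k , e) (m , f) = + 2 * k * m + k * bit (par y) + bit (par x) * m , cong₂ _*_ e f ∙ r542 k m (bit (par x)) (bit (par y)) ∙ cong (λ s → (+ 2 * k * m + k * bit (par y) + bit (par x) * m) + (+ 2 * k * m + k * bit (par y) + bit (par x) * m) + s) (b* (par x) (par y))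

Res : Set
Res = F₃ × Bool

res : ℤ → Res
res x = res₃ x , par x

R⁴ : Set
R⁴ = Res × Res × Res × Res

sgB : Bool → ℤ
sgB true  = - (+ 1)
sgB false = + 1

is0 : F₃ → ℤ
is0 o₃ = + 1
is0 _  = + 0

I₃ : F₃ → F₃ → F₃ → ℤ
I₃ a b c = is0 (add₃ (add₃ a (neg₃′ b)) (neg₃′ c)) - is0 (add₃ (add₃ a b) c)

κ₃ : F₃ → ℤ
κ₃ o₃ = + 1
κ₃ _  = - (+ 1)

χχ : R⁴ → ℤ
χχ ((a , _) , (b , _) , _) = val a * val b

wU : R⁴ → ℤ
wU ((a , _) , (b , y) , (c , z) , _) = val a * val b * (+ 2 + + 4 * bit (not (y ∧ z))) * κ₃ (mul₃ b c)

-- For every weight k the sum of `rk k` over the quadruples is 0, so `rk k` may be added freely. The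
-- values here are chosen to make the finite checks `passes₂` and `passes₄` succeed.
k₁ k₂ : F₃ → F₃ → F₃ → ℤ
k₁ a b o₃ = + 8 * (val a * val b)
k₁ a b _  = - (+ 10) * (val a * val b)
k₂ a b o₃ = + 0
k₂ a b _  = val a * val b

-- Compares the quadruples with even c and those with even b under (b, c) ↦ (2b, c/2). Modulo 3 both
-- doubling and halving are negation, hence `neg₃′`.
rk : (F₃ → F₃ → F₃ → ℤ) → R⁴ → ℤ
rk k ((a , _) , (b , y) , (c , z) , _) = bit (not z) * k a b c - bit (not y) * k a (neg₃′ b) (neg₃′ c)

-- Weights with total 0: `h₁`, `h₂` for p ≡ 1 and `h₃`, `h₄` for p ≡ 2 (mod 3). They express the
-- difference of [3 | a - b - c] and [3 | a + b + c], without and with the sign (-1)^(a+b+c), by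
-- sums of χ(a) χ(b) and the sum U.
h₁ h₂ h₃ h₄ : R⁴ → ℤ
h₁ r@((a , _) , (b , _) , (c , _) , _) = + 2 * I₃ a b c - χχ r
h₂ r@((a , x) , (b , y) , (c , z) , _) = + 2 * (sgB (xor (xor x y) z) * I₃ a b c) - + 3 * wU r - sgB (xor x y) * χχ r + rk k₁ r
h₃ r@((a , _) , (b , _) , (c , _) , _) = I₃ a b c + χχ r
h₄ r@((a , x) , (b , y) , (c , z) , _) = sgB (xor (xor x y) z) * I₃ a b c + sgB (xor x y) * χχ r + rk k₂ r

-- Generators of the dihedral group of order 8 that preserves ad + bc: exchange a and d, exchange b
-- and c, exchange the two products.
s₁ s₂ s₃ : ∀ {A : Set} → A × A × A × A → A × A × A × A
s₁ (a , b , c , d) = d , b , c , a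
s₂ (a , b , c , d) = a , c , b , d
s₃ (a , b , c , d) = b , a , d , c

sum₈ : (R⁴ → ℤ) → R⁴ → ℤ
sum₈ h r = (h r + h (s₁ r)) + (h (s₂ r) + h (s₁ (s₂ r))) + ((h (s₃ r) + h (s₁ (s₃ r))) + (h (s₂ (s₃ r)) + h (s₁ (s₂ (s₃ r)))))

eq₃ : F₃ → F₃ → Bool
eq₃ o₃ o₃ = true
eq₃ i₃ i₃ = true
eq₃ j₃ j₃ = true
eq₃ _  _  = false

admissible : F₃ → R⁴ → Bool
admissible m ((a , x) , (b , y) , (c , z) , (d , w)) = eq₃ (add₃ (mul₃ a d) (mul₃ b c)) m ∧ xor (x ∧ w) (y ∧ z)

all₃ : (F₃ → Bool) → Bool
all₃ f = f o₃ ∧ f i₃ ∧ f j₃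

all₂ : (Bool → Bool) → Bool
all₂ f = f true ∧ f false

allR : (Res → Bool) → Bool
allR f = all₃ (λ a → all₂ (λ x → f (a , x)))

allR-elim : ∀ f → allR f ≡ true → ∀ r → f r ≡ true
allR-elim f e (a , x) = two′ (λ x → f (a , x)) (three (λ a → all₂ (λ x → f (a , x))) e a) x where
  three : ∀ g → all₃ g ≡ true → ∀ a → g a ≡ true
  three g e o₃ = ∧ˡ {g o₃} e
  three g e i₃ = ∧ˡ {g i₃} (∧ʳ {g o₃} e)
  three g e j₃ = ∧ʳ {g i₃} (∧ʳ {g o₃} e)
  two′ : ∀ g → all₂ g ≡ true → ∀ a → g a ≡ true
  two′ g e true  = ∧ˡ {g true} e
  two′ g e false = ∧ʳ {g true} e

-- A check of all 6⁴ residue classes, evaluated by computation.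
passes : F₃ → (R⁴ → ℤ) → Bool
passes m h = allR λ a → allR λ b → allR λ c → allR λ d → not (admissible m (a , b , c , d)) ∨ isZero (sum₈ h (a , b , c , d))

passes-elim : ∀ m h → passes m h ≡ true → ∀ r → admissible m r ≡ true → sum₈ h r ≡ + 0
passes-elim m h e (a , b , c , d) adm = isZero-sound (sum₈ h (a , b , c , d)) (strip adm
    (allR-elim (t a b c) (allR-elim (λ c → allR (t a b c)) (allR-elim (λ b → allR λ c → allR (t a b c)) (allR-elim (λ a → allR λ b → allR λ c → allR (t a b c)) e a) b) c) d)) where
  t : Res → Res → Res → Res → Bool
  t a b c d = not (admissible m (a , b , c , d)) ∨ isZero (sum₈ h (a , b , c , d))
  strip : ∀ {a b} → a ≡ true → not a ∨ b ≡ true → b ≡ true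
  strip refl h = h

passes₁ : passes i₃ h₁ ≡ true
passes₁ = refl
passes₂ : passes i₃ h₂ ≡ true
passes₂ = refl
passes₃ : passes j₃ h₃ ≡ true
passes₃ = refl
passes₄ : passes j₃ h₄ ≡ true
passes₄ = refl

f₃ f₆ : ℤ → ℤ
f₃ t = is0 (res₃ t)
f₆ t = sgB (par t) * is0 (res₃ t)

f₃-even : ∀ t → f₃ (- t) ≡ f₃ t
f₃-even t = cong is0 (res₃-neg t) ∙ go (res₃ t) where
  go : ∀ r → is0 (neg₃′ r) ≡ is0 r
  go o₃ = refl
  go i₃ = refl
  go j₃ = refl

f₆-even : ∀ t → f₆ (- t) ≡ f₆ t
f₆-even t = cong₂ (λ x y → sgB x * y) (par-neg t) (f₃-even t)

-- With F = [3 | ·] this writes χ(a) χ(b) as F(a - b) - F(a + b), the shape to which Liouville's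
-- identity applies.
is0-χ : ∀ a b → is0 (add₃ a (neg₃′ b)) - is0 (add₃ a b) ≡ val a * val b
is0-χ o₃ o₃ = refl
is0-χ o₃ i₃ = refl
is0-χ o₃ j₃ = refl
is0-χ i₃ o₃ = refl
is0-χ i₃ i₃ = refl
is0-χ i₃ j₃ = refl
is0-χ j₃ o₃ = refl
is0-χ j₃ i₃ = refl
is0-χ j₃ j₃ = refl

res₃-sub : ∀ x y → res₃ (x - y) ≡ add₃ (res₃ x) (neg₃′ (res₃ y))
res₃-sub x y = res₃-+ x (- y) ∙ cong (add₃ (res₃ x)) (res₃-neg y)

par-sub : ∀ x y → par (x - y) ≡ xor (par x) (par y)
par-sub x y = par-+ x (- y) ∙ cong (xor (par x)) (par-neg y)

double₃ : ∀ r → add₃ r r ≡ neg₃′ r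
double₃ o₃ = refl
double₃ i₃ = refl
double₃ j₃ = refl

neg-neg₃ : ∀ r → neg₃′ (neg₃′ r) ≡ r
neg-neg₃ o₃ = refl
neg-neg₃ i₃ = refl
neg-neg₃ j₃ = refl

xor-self : ∀ b → xor b b ≡ false
xor-self true  = refl
xor-self false = refl

hlf-par : ∀ c → par c ≡ false → c ≡ hlf c + hlf c
hlf-par c e = go (mod₂ c) where
  go : Mod₂ c (par c) → c ≡ hlf c + hlf c
  go (k , f) = c≡ ∙ cong₂ _+_ (sym h) (sym h) where
    c≡ : c ≡ k + k
    c≡ = f ∙ cong (λ b → k + k + bit b) e ∙ ZP.+-identityʳ (k + k)
    h : hlf c ≡ k
    h = hlf-double k c c≡

resQ : T⁴ → R⁴
resQ (a , b , c , d) = res a , res b , res c , res d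

module Symm (p : ℕ) (pr : Prime p) (K : ℕ) (P : ℤ) (P≡ : P ≡ + p) (P≥2 : NN (P - + 2)) (K-big : NN (+ K - P - P - P)) where

  open Sums p pr K P P≡ P≥2 K-big

  sumS-inv : ∀ (φ : T⁴ → T⁴) → (∀ q → S⁺ q → S⁺ (φ q)) → (∀ q → φ (φ q) ≡ q) → ∀ g → sumS (λ q → g (φ q)) ≡ sumS g
  sumS-inv φ pres inv g = ∑-bij (box K) (box K) S⁺? S⁺? (λ q → g (φ q)) g φ φ S⁺-in S⁺-in (λ q s → pres q s , inv q , refl) (λ q s → pres q s , inv q)

  inv₁ : ∀ g → sumS (λ q → g (s₁ q)) ≡ sumS g
  inv₁ = sumS-inv s₁ (λ { (a , b , c , d) (e , a⁺ , b⁺ , c⁺ , d⁺) → r324 a b c d ∙ e , d⁺ , b⁺ , c⁺ , a⁺ }) (λ _ → refl)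

  inv₂ : ∀ g → sumS (λ q → g (s₂ q)) ≡ sumS g
  inv₂ = sumS-inv s₂ (λ { (a , b , c , d) (e , a⁺ , b⁺ , c⁺ , d⁺) → r325 a b c d ∙ e , a⁺ , c⁺ , b⁺ , d⁺ }) (λ _ → refl)

  s₃-pres : ∀ q → S⁺ q → S⁺ (s₃ q)
  s₃-pres (a , b , c , d) (e , a⁺ , b⁺ , c⁺ , d⁺) = ZP.+-comm (b * c) (a * d) ∙ e , b⁺ , a⁺ , d⁺ , c⁺

  inv₃ : ∀ g → sumS (λ q → g (s₃ q)) ≡ sumS g
  inv₃ = sumS-inv s₃ s₃-pres (λ _ → refl)

  -- The eight images of a weight under the symmetries have equal totals, so eight times the total
  -- is the total of `sum₈`, which vanishes termwise on admissible residues.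
  symmetrise : ∀ m h → res₃ P ≡ m → par P ≡ true → passes m h ≡ true → sumS (λ q → h (resQ q)) ≡ + 0
  symmetrise m h pm po ok = cancelˡ {sumS H} 7 (r326 (sumS H) ∙ sym expand ∙ sumS-cong zero′ ∙ sumS-0) where
    H : T⁴ → ℤ
    H q = h (resQ q)
    adm : ∀ q → S⁺ q → admissible m (resQ q) ≡ true
    adm (a , b , c , d) (e , _) = ∧-intro (subst (λ r → eq₃ r m ≡ true) (sym pm ∙ r≡) (refl₃ m)) (sym p≡ ∙ po) where
      refl₃ : ∀ m → eq₃ m m ≡ true
      refl₃ o₃ = refl
      refl₃ i₃ = refl
      refl₃ j₃ = refl
      r≡ : res₃ P ≡ add₃ (mul₃ (res₃ a) (res₃ d)) (mul₃ (res₃ b) (res₃ c))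
      r≡ = cong res₃ (sym e) ∙ res₃-+ (a * d) (b * c) ∙ cong₂ add₃ (res₃-* a d) (res₃-* b c)
      p≡ : par P ≡ xor (par a ∧ par d) (par b ∧ par c)
      p≡ = cong par (sym e) ∙ par-+ (a * d) (b * c) ∙ cong₂ xor (par-* a d) (par-* b c)
    zero′ : ∀ q → S⁺ q → sum₈ h (resQ q) ≡ + 0
    zero′ q s = passes-elim m h ok (resQ q) (adm q s)
    g₁ = λ q → H q + H (s₁ q)
    g₂ = λ q → g₁ q + g₁ (s₂ q)
    pair : ∀ g (φ : T⁴ → T⁴) → (∀ g → sumS (λ q → g (φ q)) ≡ sumS g) → sumS (λ q → g q + g (φ q)) ≡ sumS g + sumS g
    pair g φ inv = sumS-+ g (λ q → g (φ q)) ∙ cong (λ x → sumS g + x) (inv g)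
    expand : sumS (λ q → sum₈ h (resQ q)) ≡ (sumS H + sumS H) + (sumS H + sumS H) + ((sumS H + sumS H) + (sumS H + sumS H))
    expand = pair g₂ s₃ inv₃ ∙ cong₂ _+_ e₂ e₂ where
      e₁ : sumS g₁ ≡ sumS H + sumS H
      e₁ = pair H s₁ inv₁
      e₂ : sumS g₂ ≡ (sumS H + sumS H) + (sumS H + sumS H)
      e₂ = pair g₁ s₂ inv₂ ∙ cong₂ _+_ e₁ e₁

  -- Moving a factor 2 from c to b.
  shift : ∀ k → sumS (λ q → rk k (resQ q)) ≡ + 0
  shift k = sumS-cong {g = λ q → left q + - (+ 1) * right q} (λ { (a , b , c , d) _ → r99 (left (a , b , c , d)) (right (a , b , c , d)) }) ∙
    sumS-+ left (λ q → - (+ 1) * right q) ∙ cong₂ _+_ (asˡ ∙ bij ∙ sym asʳ) (sumS-* (- (+ 1)) right) ∙ r327 (sumS right) where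
    left right f g : T⁴ → ℤ
    left (a , b , c , d) = bit (not (par c)) * k (res₃ a) (res₃ b) (res₃ c)
    right (a , b , c , d) = bit (not (par b)) * k (res₃ a) (neg₃′ (res₃ b)) (neg₃′ (res₃ c))
    f (a , b , c , d) = k (res₃ a) (res₃ b) (res₃ c)
    g (a , b , c , d) = k (res₃ a) (neg₃′ (res₃ b)) (neg₃′ (res₃ c))
    Pc Pb : T⁴ → Set
    Pc (a , b , c , d) = S⁺ (a , b , c , d) × par c ≡ false
    Pb (a , b , c , d) = S⁺ (a , b , c , d) × par b ≡ false
    Pc? : ∀ q → Dec (Pc q)
    Pc? (a , b , c , d) = S⁺? (a , b , c , d) ×-dec (par c ≟ᵇ false)
    Pb? : ∀ q → Dec (Pb q)
    Pb? (a , b , c , d) = S⁺? (a , b , c , d) ×-dec (par b ≟ᵇ false)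
    bit-when : ∀ {Q : Set} (d : Dec Q) b x → when d (bit (not b) * x) ≡ when (d ×-dec (b ≟ᵇ false)) x
    bit-when (yes _) true  x = refl
    bit-when (yes _) false x = ZP.*-identityˡ x
    bit-when (no _)  true  x = refl
    bit-when (no _)  false x = refl
    asˡ : sumS left ≡ ∑ (Dom.L (box K)) (λ q → when (Pc? q) (f q))
    asˡ = ∑-cong (Dom.L (box K)) (λ { q@(a , b , c , d) → bit-when (S⁺? q) (par c) (f q) })
    asʳ : sumS right ≡ ∑ (Dom.L (box K)) (λ q → when (Pb? q) (g q))
    asʳ = ∑-cong (Dom.L (box K)) (λ { q@(a , b , c , d) → bit-when (S⁺? q) (par b) (g q) })
    φ ψ : T⁴ → T⁴
    φ (a , b , c , d) = a , b + b , hlf c , d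
    ψ (a , b , c , d) = a , hlf b , c + c , d
    pos-half : ∀ c → par c ≡ false → NN (c - + 1) → NN (hlf c - + 1)
    pos-half c e c⁺ = 2x-1 (hlf c) (≈nn (subst (λ x → NN (x - + 1)) (hlf-par c e) c⁺) (r163 (hlf c)))
    pos-double : ∀ b → NN (b - + 1) → NN (b + b - + 1)
    pos-double b b⁺ = ≈nn (nn+ (nn+ b⁺ b⁺) (nn {1})) (r164 b)
    par-double : ∀ b → par (b + b) ≡ false
    par-double b = par-+ b b ∙ xor-self (par b)
    half-double : ∀ b → hlf (b + b) ≡ b
    half-double b = hlf-double b (b + b) refl
    φ-quad : ∀ a b c d → par c ≡ false → a * d + (b + b) * hlf c ≡ a * d + b * c
    φ-quad a b c d e = r165 a b (hlf c) d ∙ cong (λ x → a * d + b * x) (sym (hlf-par c e))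
    ψ-quad : ∀ a b c d → par b ≡ false → a * d + hlf b * (c + c) ≡ a * d + b * c
    ψ-quad a b c d e = r166 a (hlf b) c d ∙ cong (λ x → a * d + x * c) (sym (hlf-par b e))
    bij : ∑ (Dom.L (box K)) (λ q → when (Pc? q) (f q)) ≡ ∑ (Dom.L (box K)) (λ q → when (Pb? q) (g q))
    bij = ∑-bij (box K) (box K) Pc? Pb? f g φ ψ (λ q h → S⁺-in q (proj₁ h)) (λ q h → S⁺-in q (proj₁ h))
      (λ { (a , b , c , d) ((e , a⁺ , b⁺ , c⁺ , d⁺) , z) → ((φ-quad a b c d z ∙ e , a⁺ , pos-double b b⁺ , pos-half c z c⁺ , d⁺) , par-double b) ,
          tet≡ refl (half-double b) (sym (hlf-par c z)) refl ,
          cong₂ (k (res₃ a)) (cong neg₃′ (res₃-+ b b ∙ double₃ (res₃ b)) ∙ neg-neg₃ (res₃ b))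
            (sym (cong res₃ (hlf-par c z) ∙ res₃-+ (hlf c) (hlf c) ∙ double₃ (res₃ (hlf c)))) })
      (λ { (a , b , c , d) ((e , a⁺ , b⁺ , c⁺ , d⁺) , z) → ((ψ-quad a b c d z ∙ e , a⁺ , pos-half b z b⁺ , pos-double c c⁺ , d⁺) , par-double c) ,
          tet≡ refl (sym (hlf-par b z)) (half-double c) refl })

  W Q U : ℤ
  W = sumS (λ q → χχ (resQ q))
  Q = sumS (λ { q@(a , b , c , d) → sgB (xor (par a) (par b)) * χχ (resQ q) })
  U = sumS (λ q → wU (resQ q))

  L₃ L₆ : ℤ
  L₃ = sumS (λ q → f₃ (dif q)) - sumS (λ q → f₃ (tot q))
  L₆ = sumS (λ q → f₆ (dif q)) - sumS (λ q → f₆ (tot q))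

  i₃q i₆q : T⁴ → ℤ
  i₃q (a , b , c , d) = I₃ (res₃ a) (res₃ b) (res₃ c)
  i₆q (a , b , c , d) = sgB (xor (xor (par a) (par b)) (par c)) * I₃ (res₃ a) (res₃ b) (res₃ c)

  sumS-- : ∀ f g → sumS (λ q → f q - g q) ≡ sumS f - sumS g
  sumS-- f g = sumS-cong (λ q _ → r99 (f q) (g q)) ∙ sumS-+ f (λ q → - (+ 1) * g q) ∙ cong (λ x → sumS f + x) (sumS-* (- (+ 1)) g) ∙ sym (r99 (sumS f) (sumS g))

  dif₃ : ∀ a b c → res₃ (a - b - c) ≡ add₃ (add₃ (res₃ a) (neg₃′ (res₃ b))) (neg₃′ (res₃ c))
  dif₃ a b c = res₃-sub (a - b) c ∙ cong (λ x → add₃ x (neg₃′ (res₃ c))) (res₃-sub a b)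
  tot₃ : ∀ a b c → res₃ (a + b + c) ≡ add₃ (add₃ (res₃ a) (res₃ b)) (res₃ c)
  tot₃ a b c = res₃-+ (a + b) c ∙ cong (λ x → add₃ x (res₃ c)) (res₃-+ a b)
  dif₂ : ∀ a b c → par (a - b - c) ≡ xor (xor (par a) (par b)) (par c)
  dif₂ a b c = par-sub (a - b) c ∙ cong (λ x → xor x (par c)) (par-sub a b)
  tot₂ : ∀ a b c → par (a + b + c) ≡ xor (xor (par a) (par b)) (par c)
  tot₂ a b c = par-+ (a + b) c ∙ cong (λ x → xor x (par c)) (par-+ a b)

  L₃≡ : L₃ ≡ sumS i₃q
  L₃≡ = sym (sumS-- (λ q → f₃ (dif q)) (λ q → f₃ (tot q))) ∙ sumS-cong (λ { (a , b , c , d) _ → cong₂ (λ x y → is0 x - is0 y) (dif₃ a b c) (tot₃ a b c) })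

  L₆≡ : L₆ ≡ sumS i₆q
  L₆≡ = sym (sumS-- (λ q → f₆ (dif q)) (λ q → f₆ (tot q))) ∙ sumS-cong (λ { (a , b , c , d) _ →
    trans (cong₂ _-_ (cong₂ (λ x y → sgB x * is0 y) (dif₂ a b c) (dif₃ a b c)) (cong₂ (λ x y → sgB x * is0 y) (tot₂ a b c) (tot₃ a b c))) (sym (r328 (sgB (xor (xor (par a) (par b)) (par c))) (is0 (add₃ (add₃ (res₃ a) (neg₃′ (res₃ b))) (neg₃′ (res₃ c)))) (is0 (add₃ (add₃ (res₃ a) (res₃ b)) (res₃ c))))) })

  -- a - b - c and a + b + c have the same parity, so test functions of the parity alone give no
  -- character sum.
  even-vanishes : ∀ (g : Bool → ℤ) → sumS (λ q → g (par (dif q))) - sumS (λ q → g (par (tot q))) ≡ + 0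
  even-vanishes g = sub0 {sumS (λ q → g (par (tot q)))} {sumS (λ q → g (par (dif q)))} (sumS-cong (λ { (a , b , c , d) _ → cong g (tot₂ a b c ∙ sym (dif₂ a b c)) }))

  module _ (po : par P ≡ true) where

    L₃-1 : res₃ P ≡ i₃ → + 2 * L₃ ≡ W
    L₃-1 pm = sym (≡-from-0 {W} {+ 2 * L₃} (cong (λ x → + 2 * x - W) L₃≡ ∙ cong (λ x → x - W) (sym (sumS-* (+ 2) i₃q)) ∙ sym (sumS-- (λ q → + 2 * i₃q q) (λ q → χχ (resQ q))) ∙ symmetrise i₃ h₁ pm po passes₁))

    L₆-1 : res₃ P ≡ i₃ → + 2 * L₆ ≡ + 3 * U + Q
    L₆-1 pm = sym (≡-from-0 {+ 3 * U + Q} {+ 2 * L₆} (cong (λ x → + 2 * x - (+ 3 * U + Q)) L₆≡ ∙ r167 (sumS i₆q) U Q ∙ cong (λ x → + 2 * sumS i₆q - + 3 * U - Q + x) (sym (shift k₁)) ∙ sym split ∙ symmetrise i₃ h₂ pm po passes₂)) where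
      sq : T⁴ → ℤ
      sq (a , b , c , d) = sgB (xor (par a) (par b)) * χχ (resQ (a , b , c , d))
      split : sumS (λ q → h₂ (resQ q)) ≡ + 2 * sumS i₆q - + 3 * U - Q + sumS (λ q → rk k₁ (resQ q))
      split = sumS-+ (λ q → + 2 * i₆q q - + 3 * wU (resQ q) - sq q) (λ q → rk k₁ (resQ q)) ∙ cong (λ x → x + sumS (λ q → rk k₁ (resQ q)))
        (sumS-- (λ q → + 2 * i₆q q - + 3 * wU (resQ q)) sq ∙ cong₂ _-_ (sumS-- (λ q → + 2 * i₆q q) (λ q → + 3 * wU (resQ q)) ∙ cong₂ _-_ (sumS-* (+ 2) i₆q) (sumS-* (+ 3) (λ q → wU (resQ q)))) (sumS-cong {sq} (λ { (a , b , c , d) _ → refl })))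

    L₃-2 : res₃ P ≡ j₃ → L₃ ≡ - W
    L₃-2 pm = sym (≡-from-0 { - W} {L₃} (r26 L₃ W ∙ cong (λ x → x + W) L₃≡ ∙ sym (sumS-+ i₃q (λ q → χχ (resQ q))) ∙ symmetrise j₃ h₃ pm po passes₃))

    L₆-2 : res₃ P ≡ j₃ → L₆ ≡ - Q
    L₆-2 pm = sym (≡-from-0 { - Q} {L₆} (r168 L₆ Q ∙ cong (λ x → x + Q + + 0) L₆≡ ∙ cong (λ x → sumS i₆q + Q + x) (sym (shift k₂)) ∙ sym split ∙ symmetrise j₃ h₄ pm po passes₄)) where
      sq : T⁴ → ℤ
      sq (a , b , c , d) = sgB (xor (par a) (par b)) * χχ (resQ (a , b , c , d))
      split : sumS (λ q → h₄ (resQ q)) ≡ sumS i₆q + Q + sumS (λ q → rk k₂ (resQ q))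
      split = sumS-+ (λ q → i₆q q + sq q) (λ q → rk k₂ (resQ q)) ∙ cong (λ x → x + sumS (λ q → rk k₂ (resQ q))) (sumS-+ i₆q sq ∙ cong (λ x → sumS i₆q + x) (sumS-cong {sq} (λ { (a , b , c , d) _ → refl })))

-- Liouville's identity on ad + bc = p

module Liouville (k : ℕ) (pr : Prime (suc (suc k))) (K : ℕ) (P : ℤ) (P≡ : P ≡ + suc (suc k)) (P≥2 : NN (P - + 2)) (K-big : NN (+ K - P - P - P)) where

  p : ℕ
  p = suc (suc k)

  open Sums p pr K P P≡ P≥2 K-big
  open Symm p pr K P P≡ P≥2 K-big using (s₃-pres; sumS--)

  k′≡ : + suc k ≡ P - + 1
  k′≡ = r312 (+ k) ∙ cong (λ x → x - + 1) (sym P≡)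

  k≤K : suc k ≤ K
  k≤K = nn⇒≤ (≈nn (nn+ (nn+ K-big (nn+ P₀ P₀)) (nn {1})) (cong (λ x → + K - x) k′≡ ∙ r313 (+ K) P))

  sum⁺ : (T⁴ → ℤ) → (T⁴ → ℤ) → ℤ
  sum⁺ h g = ∑ (Dom.L (box K)) (λ q → when (S⁺? q ×-dec NN? (h q - + 1)) (g q))

  sum⁰ : (T⁴ → ℤ) → (T⁴ → ℤ) → ℤ
  sum⁰ h g = ∑ (Dom.L (box K)) (λ q → when (S⁺? q ×-dec (h q ℤ.≟ + 0)) (g q))

  trichotomy : ∀ h g → sumS g ≡ sum⁺ h g + sum⁺ (λ q → - h q) g + sum⁰ h g
  trichotomy h g = ∑-cong L (λ q → go q (S⁺? q) (NN? (h q - + 1)) (NN? (- h q - + 1)) (h q ℤ.≟ + 0)) ∙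
    ∑-+ L (λ q → when (S⁺? q ×-dec NN? (h q - + 1)) (g q) + when (S⁺? q ×-dec NN? (- h q - + 1)) (g q)) (λ q → when (S⁺? q ×-dec (h q ℤ.≟ + 0)) (g q)) ∙
      cong (λ x → x + sum⁰ h g) (∑-+ L (λ q → when (S⁺? q ×-dec NN? (h q - + 1)) (g q)) (λ q → when (S⁺? q ×-dec NN? (- h q - + 1)) (g q))) where
    L = Dom.L (box K)
    go : ∀ q (d : Dec (S⁺ q)) (a : Dec (NN (h q - + 1))) (b : Dec (NN (- h q - + 1))) (c : Dec (h q ≡ + 0)) →
      when d (g q) ≡ when (d ×-dec a) (g q) + when (d ×-dec b) (g q) + when (d ×-dec c) (g q)
    go q (yes _) (yes x) (no _) (no _) = r169 (g q)
    go q (yes _) (no _) (yes x) (no _) = r170 (g q)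
    go q (yes _) (no _) (no _) (yes x) = r171 (g q)
    go q (yes _) (yes x) (yes y) _ = ⊥-elim (nn-neg⊥ (h q) (nn1 (h q) x) y)
    go q (yes _) (yes x) _ (yes z) = ⊥-elim (pos≢0 (h q) x z)
    go q (yes _) _ (yes y) (yes z) = ⊥-elim (neg1 (subst (λ x → NN (- x - + 1)) z y))
    go q (yes _) (no x) (no y) (no z) = ⊥-elim (t (tri (h q))) where
      t : Tri (h q) → ⊥
      t (pos v) = x v
      t (zer v) = z v
      t (neg v) = y v
    go q (no n) a b c = cong₂ _+_ (cong₂ _+_ (f a) (f b)) (f c) where
      f : ∀ {X : Set} (e : Dec X) → + 0 ≡ when (no n ×-dec e) (g q)
      f (yes _) = refl
      f (no _)  = refl

  sum⁺-inv : ∀ h h′ (φ : T⁴ → T⁴) → (∀ q → S⁺ q → S⁺ (φ q)) → (∀ q → φ (φ q) ≡ q) → (∀ q → h′ (φ q) ≡ h q) → ∀ g → sum⁺ h (λ q → g (φ q)) ≡ sum⁺ h′ g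
  sum⁺-inv h h′ φ pres inv eq g = ∑-bij (box K) (box K) (λ q → S⁺? q ×-dec NN? (h q - + 1)) (λ q → S⁺? q ×-dec NN? (h′ q - + 1)) (λ q → g (φ q)) g φ φ
    (λ q s → S⁺-in q (proj₁ s)) (λ q s → S⁺-in q (proj₁ s))
    (λ q s → (pres q (proj₁ s) , subst (λ x → NN (x - + 1)) (sym (eq q)) (proj₂ s)) , inv q , refl)
    (λ q s → (pres q (proj₁ s) , subst (λ x → NN (x - + 1)) (cong h′ (sym (inv q)) ∙ eq (φ q)) (proj₂ s)) , inv q)

  a-b b-a c-d d-c : T⁴ → ℤ
  a-b (a , b , c , d) = a - b
  b-a (a , b , c , d) = b - a
  c-d (a , b , c , d) = c - d
  d-c (a , b , c , d) = d - c

  down : T⁴ → T⁴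
  down (a , b , c , d) = a - b , b , c + d , d

  up : T⁴ → T⁴
  up (a , b , c , d) = a + b , b , c - d , d

  -- One subtractive Euclidean step: (a - b) d + b (c + d) = ad + bc. It carries the quadruples with
  -- a > b bijectively to those with c > d.
  euclid : ∀ g → sum⁺ a-b (λ q → g (down q)) ≡ sum⁺ c-d g
  euclid g = ∑-bij (box K) (box K) (λ q → S⁺? q ×-dec NN? (a-b q - + 1)) (λ q → S⁺? q ×-dec NN? (c-d q - + 1)) (λ q → g (down q)) g down up
    (λ q s → S⁺-in q (proj₁ s)) (λ q s → S⁺-in q (proj₁ s))
    (λ { (a , b , c , d) ((e , a⁺ , b⁺ , c⁺ , d⁺) , h) → ((r329 a b c d ∙ e , h , b⁺ , ≈nn (nn+ c⁺ (nn1 d d⁺)) (r35 c d) , d⁺) , ≈nn c⁺ (r330 c d)) , tet≡ (r173 a b) refl (r331 c d) refl , refl })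
    (λ { (a , b , c , d) ((e , a⁺ , b⁺ , c⁺ , d⁺) , h) → ((r332 a b c d ∙ e , ≈nn (nn+ a⁺ (nn1 b b⁺)) (r35 a b) , b⁺ , h , d⁺) , ≈nn a⁺ (r330 a b)) , tet≡ (r331 a b) refl (r173 c d) refl })

  neg-sub : ∀ x y → - (x - y) ≡ y - x
  neg-sub = ring

  sum⁺-cong : ∀ h h′ g g′ → (∀ q → h q ≡ h′ q) → (∀ q → g q ≡ g′ q) → sum⁺ h g ≡ sum⁺ h′ g′
  sum⁺-cong h h′ g g′ e f = ∑-cong (Dom.L (box K)) (λ q → when-⇔ (S⁺? q ×-dec NN? (h q - + 1)) (S⁺? q ×-dec NN? (h′ q - + 1))
    (λ s → proj₁ s , subst (λ x → NN (x - + 1)) (e q) (proj₂ s)) (λ s → proj₁ s , subst (λ x → NN (x - + 1)) (sym (e q)) (proj₂ s)) (λ _ → f q))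

  tri-ab : ∀ g → sumS g ≡ sum⁺ a-b g + sum⁺ b-a g + sum⁰ a-b g
  tri-ab g = trichotomy a-b g ∙ cong (λ x → sum⁺ a-b g + x + sum⁰ a-b g) (sum⁺-cong (λ q → - a-b q) b-a g g (λ { (a , b , c , d) → neg-sub a b }) (λ _ → refl))

  tri-cd : ∀ g → sumS g ≡ sum⁺ c-d g + sum⁺ d-c g + sum⁰ c-d g
  tri-cd g = trichotomy c-d g ∙ cong (λ x → sum⁺ c-d g + x + sum⁰ c-d g) (sum⁺-cong (λ q → - c-d q) d-c g g (λ { (a , b , c , d) → neg-sub c d }) (λ _ → refl))

  module _ (F : ℤ → ℤ) (ev : ∀ t → F (- t) ≡ F t) where

    fa f- f+ : T⁴ → ℤ
    fa (a , b , c , d) = F a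
    f- (a , b , c , d) = F (a - b)
    f+ (a , b , c , d) = F (a + b)

    ab-swap : ∀ g → sum⁺ b-a (λ q → g (s₃ q)) ≡ sum⁺ a-b g
    ab-swap g = sum⁺-inv b-a a-b s₃ s₃-pres (λ _ → refl) (λ _ → refl) g

    dc-swap : ∀ g → sum⁺ d-c (λ q → g (s₃ q)) ≡ sum⁺ c-d g
    dc-swap g = sum⁺-inv d-c c-d s₃ s₃-pres (λ _ → refl) (λ _ → refl) g

    -- The parts a > b and a < b agree by `s₃`, since F is even, and the Euclidean step turns each
    -- of them into the sum of F(a) over c > d. The diagonal a = b contributes F(0).
    diff-sum : sumS f- ≡ + 2 * sum⁺ c-d fa + F (+ 0) * sum⁰ a-b (λ _ → + 1)
    diff-sum = tri-ab f- ∙ cong₂ _+_ (cong₂ _+_ (euclid fa) (sum⁺-cong b-a b-a f- (λ q → f- (s₃ q)) (λ _ → refl) (λ { (a , b , c , d) → sym (ev (a - b)) ∙ cong F (neg-sub a b) }) ∙ ab-swap f- ∙ euclid fa)) zero-part′ ∙ r172 (sum⁺ c-d fa) (F (+ 0) * sum⁰ a-b (λ _ → + 1)) where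
      zero-part′ : sum⁰ a-b f- ≡ F (+ 0) * sum⁰ a-b (λ _ → + 1)
      zero-part′ = ∑-cong (Dom.L (box K)) (λ { q@(a , b , c , d) → go q (S⁺? q ×-dec (a-b q ℤ.≟ + 0)) }) ∙ ∑-* (Dom.L (box K)) (F (+ 0)) (λ q → when (S⁺? q ×-dec (a-b q ℤ.≟ + 0)) (+ 1)) where
        go : ∀ q (e : Dec (S⁺ q × a-b q ≡ + 0)) → when e (f- q) ≡ F (+ 0) * when e (+ 1)
        go (a , b , c , d) (yes e) = cong F (proj₂ e) ∙ sym (ZP.*-identityʳ (F (+ 0)))
        go q (no _) = sym (ZP.*-zeroʳ (F (+ 0)))

    -- Over c > d the number a + b is the first entry of the preimage under `down`, which gives the
    -- sum of F(a) over a > b. The part c < d follows by `s₃`.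
    plus-sum : sumS f+ ≡ + 2 * sum⁺ a-b fa + sum⁰ c-d f+
    plus-sum = tri-cd f+ ∙ cong (λ x → x + sum⁰ c-d f+) (cong₂ _+_ cd (sum⁺-cong d-c d-c f+ (λ q → f+ (s₃ q)) (λ _ → refl) (λ { (a , b , c , d) → cong F (ZP.+-comm a b) }) ∙ dc-swap f+ ∙ cd)) ∙ r172 (sum⁺ a-b fa) (sum⁰ c-d f+) where
      cd : sum⁺ c-d f+ ≡ sum⁺ a-b fa
      cd = sym (euclid f+) ∙ sum⁺-cong a-b a-b (λ q → f+ (down q)) fa (λ _ → refl) (λ { (a , b , c , d) → cong F (r173 a b) })

    fb : T⁴ → ℤ
    fb (a , b , c , d) = F b

    -- Exchange the products, apply the Euclidean step, which leaves b unchanged, and exchange the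
    -- products again.
    middle : sum⁺ d-c fa ≡ sum⁺ b-a fa
    middle = dc-swap fb ∙ sym (euclid fb) ∙ sym (ab-swap fb)

    -- The sum of F(a) is split once by comparing a with b and once by comparing c with d. The parts
    -- in `middle` cancel, and the unknown difference reduces to the diagonals.
    balance : sum⁺ c-d fa - sum⁺ a-b fa ≡ sum⁰ a-b fa - sum⁰ c-d fa
    balance = ≡-from-0 {sum⁺ c-d fa - sum⁺ a-b fa} {sum⁰ a-b fa - sum⁰ c-d fa} (r174 (sum⁺ c-d fa) (sum⁺ a-b fa) (sum⁰ a-b fa) (sum⁰ c-d fa) (sum⁺ b-a fa) ∙
      sub0 {sum⁺ c-d fa + sum⁺ b-a fa + sum⁰ c-d fa} {sum⁺ a-b fa + sum⁺ b-a fa + sum⁰ a-b fa} (cong (λ x → sum⁺ c-d fa + x + sum⁰ c-d fa) (sym middle) ∙ sym (tri-cd fa) ∙ tri-ab fa))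

    -- a = b forces a = 1, and c = d forces c = 1.
    ab-count : ∀ (g : ℤ → ℤ) → sum⁰ a-b (λ q → g (proj₁ q)) ≡ (P - + 1) * g (+ 1)
    ab-count g = ∑-bij (box K) (ℤD K) (λ q → S⁺? q ×-dec (a-b q ℤ.≟ + 0)) (Upto? (suc k)) (λ q → g (proj₁ q)) (λ _ → g (+ 1)) (λ q → proj₂ (proj₂ (proj₂ q))) (λ d → + 1 , + 1 , P - d , d)
        (λ q s → S⁺-in q (proj₁ s)) (λ d h → NP.≤-trans (nn-≤ {d} {suc k} (nn1 d (proj₁ h)) (proj₂ h)) k≤K) to from ∙
      ∑-Upto (suc k) K k≤K (λ _ → g (+ 1)) ∙ Σ1-cong (suc k) {λ _ → g (+ 1)} {λ _ → g (+ 1) * + 1} (λ _ _ → sym (ZP.*-identityʳ (g (+ 1)))) ∙ Σ1-* (suc k) (g (+ 1)) (λ _ → + 1) ∙ cong (λ x → g (+ 1) * x) (Σ1-const (suc k) ∙ k′≡) ∙ ZP.*-comm (g (+ 1)) (P - + 1) where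
      a≡1 : ∀ a b c d → S⁺ (a , b , c , d) → a - b ≡ + 0 → a ≡ + 1
      a≡1 a b c d s@(e , a⁺ , b⁺ , c⁺ , d⁺) z = go (P-split a (d + c) a⁺ (r76 a c d ∙ cong (λ b → a * d + b * c) (sym b≡a) ∙ e)) where
        b≡a : b ≡ a
        b≡a = ≡-from-0 {b} {a} z
        go : (a ≡ + 1 × d + c ≡ P) ⊎ (a ≡ P × d + c ≡ + 1) → a ≡ + 1
        go (inj₁ x) = proj₁ x
        go (inj₂ x) = ⊥-elim (nn-absurd (- (+ 1)) (nn+ c⁺ d⁺) (proj₂ x) (r8 c d))
      to : ∀ q → S⁺ q × a-b q ≡ + 0 → Upto (suc k) (proj₂ (proj₂ (proj₂ q))) × (+ 1 , + 1 , P - proj₂ (proj₂ (proj₂ q)) , proj₂ (proj₂ (proj₂ q))) ≡ q × g (+ 1) ≡ g (proj₁ q)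
      to (a , b , c , d) (s , z) = (Bounds.d⁺ a b c d s , subst (λ x → NN (x - d)) (sym k′≡) (≈nn (Bounds.d≤ a b c d s) (r61 P d))) , tet≡ (sym a1) (sym b1) c≡ refl , cong g (sym a1) where
        a1 = a≡1 a b c d s z
        b1 : b ≡ + 1
        b1 = ≡-from-0 {b} {a} z ∙ a1
        c≡ : P - d ≡ c
        c≡ = cong (λ x → x - d) (sym (proj₁ s)) ∙ cong₂ (λ x y → x * d + y * c - d) a1 b1 ∙ r9 c d
      from : ∀ d → Upto (suc k) d → (S⁺ (+ 1 , + 1 , P - d , d) × + 1 - + 1 ≡ + 0) × d ≡ d
      from d (d⁺ , d≤) = ((r77 P d , nn , nn , ≈nn (subst (λ x → NN (x - d)) k′≡ d≤) (r64 P d) , d⁺) , refl) , refl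

    cd-count : ∀ (g : ℤ → ℤ → ℤ) → sum⁰ c-d (λ q → g (proj₁ q) (proj₁ q + proj₁ (proj₂ q))) ≡ Σ1 (suc k) (λ a → g a P)
    cd-count g = ∑-bij (box K) (ℤD K) (λ q → S⁺? q ×-dec (c-d q ℤ.≟ + 0)) (Upto? (suc k)) (λ q → g (proj₁ q) (proj₁ q + proj₁ (proj₂ q))) (λ a → g a P) proj₁ (λ a → a , P - a , + 1 , + 1)
        (λ q s → S⁺-in q (proj₁ s)) (λ d h → NP.≤-trans (nn-≤ {d} {suc k} (nn1 d (proj₁ h)) (proj₂ h)) k≤K) to from ∙
      ∑-Upto (suc k) K k≤K (λ a → g a P) where
      c≡1 : ∀ a b c d → S⁺ (a , b , c , d) → c - d ≡ + 0 → c ≡ + 1 × a + b ≡ P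
      c≡1 a b c d s@(e , a⁺ , b⁺ , c⁺ , d⁺) z = go (P-split c (a + b) c⁺ (r78 a b c ∙ cong (λ d → a * d + b * c) (sym d≡c) ∙ e)) where
        d≡c : d ≡ c
        d≡c = ≡-from-0 {d} {c} z
        go : (c ≡ + 1 × a + b ≡ P) ⊎ (c ≡ P × a + b ≡ + 1) → c ≡ + 1 × a + b ≡ P
        go (inj₁ x) = x
        go (inj₂ x) = ⊥-elim (nn-absurd (- (+ 1)) (nn+ a⁺ b⁺) (proj₂ x) (r10 a b))
      to : ∀ q → S⁺ q × c-d q ≡ + 0 → Upto (suc k) (proj₁ q) × (proj₁ q , P - proj₁ q , + 1 , + 1) ≡ q × g (proj₁ q) P ≡ g (proj₁ q) (proj₁ q + proj₁ (proj₂ q))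
      to (a , b , c , d) (s , z) = (Bounds.a⁺ a b c d s , subst (λ x → NN (x - a)) (sym k′≡) (≈nn (Bounds.a≤ a b c d s) (r61 P a))) ,
          tet≡ refl (cong (λ x → x - a) (sym (proj₂ c1)) ∙ r79 a b) (sym (proj₁ c1)) (sym (≡-from-0 {d} {c} z ∙ proj₁ c1)) , cong (g a) (sym (proj₂ c1)) where
        c1 = c≡1 a b c d s z
      from : ∀ a → Upto (suc k) a → (S⁺ (a , P - a , + 1 , + 1) × + 1 - + 1 ≡ + 0) × a ≡ a
      from a (a⁺ , a≤) = ((r80 P a , a⁺ , ≈nn (subst (λ x → NN (x - a)) k′≡ a≤) (r64 P a) , nn , nn) , refl) , refl

    liouville : sumS f- - sumS f+ ≡ (P - + 1) * F (+ 0) + + 2 * ((P - + 1) * F (+ 1)) - + 2 * Σ1 (suc k) F - (P - + 1) * F P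
    liouville = cong₂ _-_ diff-sum plus-sum ∙ r175 (sum⁺ c-d fa) (sum⁺ a-b fa) (F (+ 0)) (sum⁰ a-b (λ _ → + 1)) (sum⁰ c-d f+) ∙
        cong (λ x → + 2 * x + F (+ 0) * sum⁰ a-b (λ _ → + 1) - sum⁰ c-d f+) balance ∙
          cong₂ (λ x y → + 2 * (x - y) + F (+ 0) * sum⁰ a-b (λ _ → + 1) - sum⁰ c-d f+) abF cdF ∙
            cong₂ (λ x y → + 2 * ((P - + 1) * F (+ 1) - Σ1 (suc k) F) + F (+ 0) * x - y) ab1 cd+ ∙ r176 P (F (+ 0)) (F (+ 1)) (F P) (Σ1 (suc k) F) where
      abF : sum⁰ a-b fa ≡ (P - + 1) * F (+ 1)
      abF = ∑-cong (Dom.L (box K)) (λ { (a , b , c , d) → refl }) ∙ ab-count F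
      cdF : sum⁰ c-d fa ≡ Σ1 (suc k) F
      cdF = ∑-cong (Dom.L (box K)) (λ { (a , b , c , d) → refl }) ∙ cd-count (λ a _ → F a)
      ab1 : sum⁰ a-b (λ _ → + 1) ≡ (P - + 1) * + 1
      ab1 = ab-count (λ _ → + 1)
      cd+ : sum⁰ c-d f+ ≡ (P - + 1) * F P
      cd+ = (∑-cong (Dom.L (box K)) (λ { (a , b , c , d) → refl }) ∙ cd-count (λ _ s → F s)) ∙
        Σ1-cong (suc k) {λ _ → F P} {λ _ → F P * + 1} (λ _ _ → sym (ZP.*-identityʳ (F P))) ∙ Σ1-* (suc k) (F P) (λ _ → + 1) ∙ cong (λ x → F P * x) (Σ1-const (suc k) ∙ k′≡) ∙ ZP.*-comm (F P) (P - + 1)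

-- Uspensky's identity on x² + 4y² - z² = 4n

sgn : ℤ → ℤ
sgn (+ zero)  = + 0
sgn (+ suc _) = + 1
sgn -[1+ _ ]  = - (+ 1)

δ₀ ind : ℤ → ℤ
δ₀ u = when (u ℤ.≟ + 0) (+ 1)
ind u = when (NN? (u - + 1)) (+ 1)

sgn-neg : ∀ u → sgn (- u) ≡ - sgn u
sgn-neg (+ zero)  = refl
sgn-neg (+ suc _) = refl
sgn-neg -[1+ _ ]  = refl

δ₀-neg : ∀ u → δ₀ (- u) ≡ δ₀ u
δ₀-neg (+ zero)  = refl
δ₀-neg (+ suc _) = refl
δ₀-neg -[1+ _ ]  = refl

-- Under u ↦ -u the terms 1 and `δ₀` are even and `sgn` is odd, so each term of a product of two
-- indicators behaves in a definite way under sign changes.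
2ind : ∀ u → + 2 * ind u ≡ + 1 + sgn u - δ₀ u
2ind (+ zero)  = refl
2ind (+ suc n) = cong (λ x → + 2 * x) (when-yes (NN? (+ suc n - + 1)) {+ 1} (≈nn (nn {n}) (suc-pos n)))
2ind -[1+ n ]  = refl

χ : ℤ → ℤ
χ x = val (res₃ x)

χ-neg : ∀ x → χ (- x) ≡ - χ x
χ-neg x = cong val (res₃-neg x) ∙ go (res₃ x) where
  go : ∀ r → val (neg₃′ r) ≡ - val r
  go o₃ = refl
  go i₃ = refl
  go j₃ = refl

fx fy fz nx : T³ → T³
fx (x , y , z) = - x , y , z
fy (x , y , z) = x , - y , z
nx (x , y , z) = - x , - y , - z
fz (x , y , z) = x , y , - z

module Uspensky (ε : Bool → Bool → ℤ) (B : ℕ) (n : ℤ) where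

  -- The three characters make this odd in x, odd in y and odd under total negation. The parity
  -- weight `ε` may be arbitrary, as parities ignore signs.
  F³ : T³ → ℤ
  F³ (x , y , z) = χ x * χ y * χ z * ε (par x) (par y)

  On : T³ → Set
  On (x , y , z) = x * x + + 4 * (y * y) - z * z ≡ + 4 * n

  On? : ∀ v → Dec (On v)
  On? (x , y , z) = x * x + + 4 * (y * y) - z * z ℤ.≟ + 4 * n

  sumQ : (T³ → ℤ) → ℤ
  sumQ g = ∑ (Dom.L (cube B)) (λ v → when (On? v) (g v))

  sumQ-cong : ∀ {f g : T³ → ℤ} → (∀ v → On v → f v ≡ g v) → sumQ f ≡ sumQ g
  sumQ-cong h = ∑-cong (Dom.L (cube B)) (λ v → when-⇔ (On? v) (On? v) (λ x → x) (λ x → x) (h v))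

  sumQ-+ : ∀ f g → sumQ (λ v → f v + g v) ≡ sumQ f + sumQ g
  sumQ-+ f g = ∑-cong (Dom.L (cube B)) (λ v → go v (On? v)) ∙ ∑-+ (Dom.L (cube B)) (λ v → when (On? v) (f v)) (λ v → when (On? v) (g v)) where
    go : ∀ v (d : Dec (On v)) → when d (f v + g v) ≡ when d (f v) + when d (g v)
    go v (yes _) = refl
    go v (no _)  = refl

  sumQ-* : ∀ k f → sumQ (λ v → k * f v) ≡ k * sumQ f
  sumQ-* k f = ∑-cong (Dom.L (cube B)) (λ v → go v (On? v)) ∙ ∑-* (Dom.L (cube B)) k (λ v → when (On? v) (f v)) where
    go : ∀ v (d : Dec (On v)) → when d (k * f v) ≡ k * when d (f v)
    go v (yes _) = refl
    go v (no _)  = sym (ZP.*-zeroʳ k)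

  module _ (φ : T³ → T³) (boxφ : ∀ g → ∑ (Dom.L (cube B)) (λ v → g (φ v)) ≡ ∑ (Dom.L (cube B)) g) (pres : ∀ v → On v → On (φ v)) (back : ∀ v → On (φ v) → On v) where

    sumQ-odd : ∀ g → (∀ v → g (φ v) ≡ - g v) → sumQ g ≡ + 0
    sumQ-odd g od = self-neg (sumQ g) (sym (boxφ (λ v → when (On? v) (g v))) ∙ ∑-cong (Dom.L (cube B)) (λ v → when-⇔ (On? (φ v)) (On? v) (back v) (pres v) (λ _ → od v ∙ r177 (g v)) ∙ refl) ∙ sumQ-* (- (+ 1)) g) where
      self-neg : ∀ x → x ≡ (- (+ 1)) * x → x ≡ + 0
      self-neg x e = cancelˡ {x} 1 (r81 x ∙ cong (λ y → x - y) (sym e) ∙ r16 x)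

  sq-neg : ∀ x → - x * - x ≡ x * x
  sq-neg = ring

  box-x : ∀ g → ∑ (Dom.L (cube B)) (λ v → g (fx v)) ≡ ∑ (Dom.L (cube B)) g
  box-x g = ∑-cube B (λ v → g (fx v)) ∙ ∑-ints-neg B (λ x → ∑ (ints B) (λ y → ∑ (ints B) (λ z → g (x , y , z)))) ∙ sym (∑-cube B g)

  box-y : ∀ g → ∑ (Dom.L (cube B)) (λ v → g (fy v)) ≡ ∑ (Dom.L (cube B)) g
  box-y g = ∑-cube B (λ v → g (fy v)) ∙ ∑-cong (ints B) (λ x → ∑-ints-neg B (λ y → ∑ (ints B) (λ z → g (x , y , z)))) ∙ sym (∑-cube B g)

  On-x : ∀ v → On v → On (fx v)
  On-x (x , y , z) e = cong (λ s → s + + 4 * (y * y) - z * z) (sq-neg x) ∙ e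
  On-x′ : ∀ v → On (fx v) → On v
  On-x′ (x , y , z) e = cong (λ s → s + + 4 * (y * y) - z * z) (sym (sq-neg x)) ∙ e
  On-y : ∀ v → On v → On (fy v)
  On-y (x , y , z) e = cong (λ s → x * x + + 4 * s - z * z) (sq-neg y) ∙ e
  On-y′ : ∀ v → On (fy v) → On v
  On-y′ (x , y , z) e = cong (λ s → x * x + + 4 * s - z * z) (sym (sq-neg y)) ∙ e
  On-n : ∀ v → On v → On (nx v)
  On-n (x , y , z) e = r333 x y z ∙ e
  On-n′ : ∀ v → On (nx v) → On v
  On-n′ (x , y , z) e = sym (r333 x y z) ∙ e

  odd-x : ∀ g → (∀ v → g (fx v) ≡ - g v) → sumQ g ≡ + 0
  odd-x = sumQ-odd fx box-x On-x On-x′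
  odd-y : ∀ g → (∀ v → g (fy v) ≡ - g v) → sumQ g ≡ + 0
  odd-y = sumQ-odd fy box-y On-y On-y′
  odd-n : ∀ g → (∀ v → g (nx v) ≡ - g v) → sumQ g ≡ + 0
  odd-n = sumQ-odd nx (∑-neg₃ B) On-n On-n′

  u₁′ u₂′ : T³ → ℤ
  u₁′ (x , y , z) = x + z
  u₂′ (x , y , z) = + 2 * y - z

  F-x : ∀ v → F³ (fx v) ≡ - F³ v
  F-x (x , y , z) = cong₂ (λ s b → s * χ y * χ z * ε b (par y)) (χ-neg x) (par-neg x) ∙ r334 (χ x) (χ y) (χ z) (ε (par x) (par y))
  F-y : ∀ v → F³ (fy v) ≡ - F³ v
  F-y (x , y , z) = cong₂ (λ s b → χ x * s * χ z * ε (par x) b) (χ-neg y) (par-neg y) ∙ r335 (χ x) (χ y) (χ z) (ε (par x) (par y))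
  F-n : ∀ v → F³ (nx v) ≡ - F³ v
  F-n (x , y , z) = cong₂ _*_ (cong₂ _*_ (cong₂ _*_ (χ-neg x) (χ-neg y)) (χ-neg z)) (cong₂ ε (par-neg x) (par-neg y)) ∙ r336 (χ x) (χ y) (χ z) (ε (par x) (par y))

  u₁-n : ∀ v → u₁′ (nx v) ≡ - u₁′ v
  u₁-n (x , y , z) = r337 x z
  u₂-n : ∀ v → u₂′ (nx v) ≡ - u₂′ v
  u₂-n (x , y , z) = r83 y z

  neg-* : ∀ a b → - a * b ≡ - (a * b)
  neg-* = ring

  odd-* : ∀ (φ : T³ → T³) (g : T³ → ℤ) → (∀ v → F³ (φ v) ≡ - F³ v) → (∀ v → g (φ v) ≡ g v) → ∀ v → F³ (φ v) * g (φ v) ≡ - (F³ v * g v)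
  odd-* φ g p q v = cong₂ _*_ (p v) (q v) ∙ neg-* (F³ v) (g v)

  v₀ v₁ v₂ v₃ v₄ v₅ v₆ : T³ → ℤ
  v₀ _ = + 1
  v₁ v = sgn (u₁′ v)
  v₂ v = sgn (u₂′ v)
  v₃ v = sgn (u₁′ v) * sgn (u₂′ v)
  v₄ v = δ₀ (u₁′ v)
  v₅ v = δ₀ (u₂′ v)
  v₆ v = δ₀ (u₁′ v) * δ₀ (u₂′ v)

  e₀ : sumQ (λ v → F³ v * v₀ v) ≡ + 0
  e₀ = odd-x (λ v → F³ v * v₀ v) (odd-* fx v₀ F-x (λ _ → refl))
  e₁ : sumQ (λ v → F³ v * v₁ v) ≡ + 0
  e₁ = odd-y (λ v → F³ v * v₁ v) (odd-* fy v₁ F-y (λ _ → refl))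
  e₂ : sumQ (λ v → F³ v * v₂ v) ≡ + 0
  e₂ = odd-x (λ v → F³ v * v₂ v) (odd-* fx v₂ F-x (λ _ → refl))
  e₃ : sumQ (λ v → F³ v * v₃ v) ≡ + 0
  e₃ = odd-n (λ v → F³ v * v₃ v) (odd-* nx v₃ F-n (λ v → cong₂ _*_ (cong sgn (u₁-n v) ∙ sgn-neg (u₁′ v)) (cong sgn (u₂-n v) ∙ sgn-neg (u₂′ v)) ∙ r338 (v₁ v) (v₂ v)))
  e₄ : sumQ (λ v → F³ v * v₄ v) ≡ + 0
  e₄ = odd-y (λ v → F³ v * v₄ v) (odd-* fy v₄ F-y (λ _ → refl))
  e₅ : sumQ (λ v → F³ v * v₅ v) ≡ + 0
  e₅ = odd-x (λ v → F³ v * v₅ v) (odd-* fx v₅ F-x (λ _ → refl))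
  e₆ : sumQ (λ v → F³ v * v₆ v) ≡ + 0
  e₆ = odd-n (λ v → F³ v * v₆ v) (odd-* nx v₆ F-n (λ v → cong₂ _*_ (cong δ₀ (u₁-n v) ∙ δ₀-neg (u₁′ v)) (cong δ₀ (u₂-n v) ∙ δ₀-neg (u₂′ v))))

  b₁ b₂ : T³ → ℤ
  b₁ v = F³ v * (δ₀ (u₁′ v) * sgn (u₂′ v))
  b₂ v = F³ v * (δ₀ (u₂′ v) * sgn (u₁′ v))

  region : T³ → ℤ
  region v = F³ v * (ind (u₁′ v) * ind (u₂′ v))

  -- The two indicators expand into nine products. Those depending on x + z alone die under y ↦ -y,
  -- those depending on 2y - z alone under x ↦ -x, and sgn·sgn and δ·δ under total negation. Only
  -- the two mixed terms, supported on x + z = 0 and on 2y = z, survive.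
  cancel-signs : + 4 * sumQ region ≡ - sumQ b₁ - sumQ b₂
  cancel-signs = sym (sumQ-* (+ 4) region) ∙ sumQ-cong (λ v _ → pointwise v) ∙ split ∙ cong₂ (λ x y → x + - (+ 1) * y) (cong₂ (λ x y → x + - (+ 1) * y) zeros (refl {x = sumQ b₁})) (refl {x = sumQ b₂}) ∙ r339 (sumQ b₁) (sumQ b₂) where
    P₁ : T³ → ℤ
    P₁ v = F³ v * v₀ v + F³ v * v₁ v + F³ v * v₂ v + F³ v * v₃ v + - (+ 1) * (F³ v * v₄ v) + - (+ 1) * (F³ v * v₅ v) + F³ v * v₆ v
    pointwise : ∀ v → + 4 * region v ≡ P₁ v + - (+ 1) * b₁ v + - (+ 1) * b₂ v
    pointwise v = r178 (F³ v) (ind (u₁′ v)) (ind (u₂′ v)) ∙ cong₂ (λ x y → F³ v * (x * y)) (2ind (u₁′ v)) (2ind (u₂′ v)) ∙ r179 (F³ v) (sgn (u₁′ v)) (δ₀ (u₁′ v)) (sgn (u₂′ v)) (δ₀ (u₂′ v))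
    split : sumQ (λ v → P₁ v + - (+ 1) * b₁ v + - (+ 1) * b₂ v) ≡ sumQ P₁ + - (+ 1) * sumQ b₁ + - (+ 1) * sumQ b₂
    split = sumQ-+ (λ v → P₁ v + - (+ 1) * b₁ v) (λ v → - (+ 1) * b₂ v) ∙ cong₂ _+_ (sumQ-+ P₁ (λ v → - (+ 1) * b₁ v) ∙ cong (λ x → sumQ P₁ + x) (sumQ-* (- (+ 1)) b₁)) (sumQ-* (- (+ 1)) b₂)
    w : (T³ → ℤ) → T³ → ℤ
    w g v = F³ v * g v
    zeros : sumQ P₁ ≡ + 0
    zeros = sumQ-+ (λ v → w v₀ v + w v₁ v + w v₂ v + w v₃ v + - (+ 1) * w v₄ v + - (+ 1) * w v₅ v) (w v₆) ∙ cong₂ _+_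
      (sumQ-+ (λ v → w v₀ v + w v₁ v + w v₂ v + w v₃ v + - (+ 1) * w v₄ v) (λ v → - (+ 1) * w v₅ v) ∙ cong₂ _+_
      (sumQ-+ (λ v → w v₀ v + w v₁ v + w v₂ v + w v₃ v) (λ v → - (+ 1) * w v₄ v) ∙ cong₂ _+_
      (sumQ-+ (λ v → w v₀ v + w v₁ v + w v₂ v) (w v₃) ∙ cong₂ _+_
      (sumQ-+ (λ v → w v₀ v + w v₁ v) (w v₂) ∙ cong₂ _+_ (sumQ-+ (w v₀) (w v₁) ∙ cong₂ _+_ e₀ e₁) e₂) e₃)
      (sumQ-* (- (+ 1)) (w v₄) ∙ cong (λ x → - (+ 1) * x) e₄)) (sumQ-* (- (+ 1)) (w v₅) ∙ cong (λ x → - (+ 1) * x) e₅)) e₆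

χ² : ℤ → ℤ
χ² x = χ x * χ x

χ²-neg : ∀ x → χ² (- x) ≡ χ² x
χ²-neg x = cong (λ s → s * s) (χ-neg x) ∙ r15 (χ x)

χ-double : ∀ x → χ (+ 2 * x) ≡ - χ x
χ-double x = cong val (res₃-* (+ 2) x) ∙ go (res₃ x) where
  go : ∀ r → val (mul₃ (res₃ (+ 2)) r) ≡ - val r
  go o₃ = refl
  go i₃ = refl
  go j₃ = refl

sgn⁺ : ∀ u → NN (u - + 1) → sgn u ≡ + 1
sgn⁺ (+ suc _) _ = refl

sgn⁻ : ∀ u → NN (- u - + 1) → sgn u ≡ - (+ 1)
sgn⁻ -[1+ _ ] _ = refl
sgn⁻ (+ zero) ()
sgn⁻ (+ suc _) ()

-- The weight is 2 up to m, 1 at m + 1 and 0 beyond, so the length of the summation range does not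
-- matter. The endpoint with half weight is kept, since it cancels later.
plus-sgn : ∀ m n → suc m ≤ n → (f : ℤ → ℤ) → Σ1 n (λ x → f x * (+ 1 + sgn (+ suc m - x))) ≡ + 2 * Σ1 m f + f (+ suc m)
plus-sgn m n h f = Σ1-cong n pointwise ∙ Σ1-+ n (λ x → when (Upto? m x) (f x)) (λ x → when (Upto? (suc m) x) (f x)) ∙
    cong₂ _+_ (Σ1-when m n (NP.≤-trans (NP.n≤1+n m) h) f) (Σ1-when (suc m) n h f) ∙ r543 (Σ1 m f) (f (+ suc m)) where
  pointwise : ∀ k → suc k ≤ n → f (+ suc k) * (+ 1 + sgn (+ suc m - + suc k)) ≡ when (Upto? m (+ suc k)) (f (+ suc k)) + when (Upto? (suc m) (+ suc k)) (f (+ suc k))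
  pointwise k _ = cong (λ s → y * (+ 1 + sgn s)) (r340 (+ m) (+ k)) ∙ go (tri (+ m - + k)) where
    y = f (+ suc k)
    k⁺ : NN (+ suc k - + 1)
    k⁺ = ≈nn (nn {k}) (suc-pos k)
    go : Tri (+ m - + k) → y * (+ 1 + sgn (+ m - + k)) ≡ when (Upto? m (+ suc k)) y + when (Upto? (suc m) (+ suc k)) y
    go (pos p) = cong (λ s → y * (+ 1 + s)) (sgn⁺ (+ m - + k) p) ∙ r341 y ∙ sym (cong₂ _+_ (when-yes (Upto? m (+ suc k)) {y} (k⁺ , ≈nn p (r344 (+ m) (+ k)))) (when-yes (Upto? (suc m) (+ suc k)) {y} (k⁺ , ≈nn (nn1 (+ m - + k) p) (r340 (+ m) (+ k)))))
    go (zer z) = cong (λ s → y * (+ 1 + sgn s)) z ∙ r342 y ∙ sym (cong₂ _+_ (when-no (Upto? m (+ suc k)) {y} (λ u → neg1 (subst (λ s → NN (s - + 1)) z (≈nn (proj₂ u) (sym (r344 (+ m) (+ k))))))) (when-yes (Upto? (suc m) (+ suc k)) {y} (k⁺ , ≈nn (subst NN (sym z) nn) (r340 (+ m) (+ k)))))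
    go (neg p) = cong (λ s → y * (+ 1 + s)) (sgn⁻ (+ m - + k) p) ∙ r343 y ∙ sym (cong₂ _+_ (when-no (Upto? m (+ suc k)) {y} (λ u → nn-neg⊥ (+ m - + k) (nn1 (+ m - + k) (≈nn (proj₂ u) (sym (r344 (+ m) (+ k))))) p)) (when-no (Upto? (suc m) (+ suc k)) {y} (λ u → nn-neg⊥ (+ m - + k) (≈nn (proj₂ u) (sym (r340 (+ m) (+ k)))) p)))

ints-in : ∀ m (f g : ℤ → ℤ) → (∀ x → ∣ x ∣ ≤ m → f x ≡ g x) → ∑ (ints m) f ≡ ∑ (ints m) g
ints-in zero f g h = cong (λ x → x + + 0) (h (+ 0) z≤n)
ints-in (suc m) f g h = cong₂ _+_ (h (+ suc m) NP.≤-refl) (cong₂ _+_ (h -[1+ m ] NP.≤-refl) (ints-in m f g (λ x x≤ → h x (NP.m≤n⇒m≤1+n x≤))))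

two-roots : ∀ G S {X Y Z : Set} (d : Dec X) (e : Dec Y) (f : Dec Z) → (Y → Z → ⊥) → (X → Y ⊎ Z) →
  G * (when d (+ 1) * S) ≡ when (d ×-dec e) (G * S) + when (d ×-dec f) (G * S)
two-roots G S d e f disjoint cover = go d e f where
  go : ∀ d e f → G * (when d (+ 1) * S) ≡ when (d ×-dec e) (G * S) + when (d ×-dec f) (G * S)
  go (yes d) (yes e) (yes f) = ⊥-elim (disjoint e f)
  go (yes d) (yes e) (no f) = r544 G S
  go (yes d) (no e) (yes f) = r545 G S
  go (yes d) (no e) (no f) = ⊥-elim (neither (cover d)) where
    neither : _ ⊎ _ → ⊥
    neither (inj₁ h) = e h
    neither (inj₂ h) = f h
  go (no d) (yes _) (yes _) = r345 G S
  go (no d) (yes _) (no _) = r345 G S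
  go (no d) (no _) (yes _) = r345 G S
  go (no d) (no _) (no _) = r345 G S

sq-root± : ∀ y s → y * y ≡ s * s → y ≡ s ⊎ y ≡ - s
sq-root± y s e = go (*≡0 {y - s} {y + s} (factors y s ∙ sub0 {s * s} {y * y} (sym e))) where
  factors : ∀ y s → (y - s) * (y + s) ≡ y * y - s * s
  factors = ring
  neg-sum : ∀ y s → - s - y ≡ - (y + s)
  neg-sum = ring
  go : y - s ≡ + 0 ⊎ y + s ≡ + 0 → y ≡ s ⊎ y ≡ - s
  go (inj₁ h) = inj₁ (sym (≡-from-0 {s} {y} h))
  go (inj₂ h) = inj₂ (≡-from-0 {y} { - s} (neg-sum y s ∙ cong -_ h))

4-inj : ∀ x y → + 4 * x ≡ + 4 * y → x ≡ y
4-inj x y q = ≡-from-0 {x} {y} (cancelˡ {y - x} 3 (r20 x y ∙ sub0 {+ 4 * x} {+ 4 * y} q))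

module Boundary (ε : Bool → Bool → ℤ) (B : ℕ) (n : ℤ) where

  open Uspensky ε B n

  δ₀-zero : ∀ u → u ≢ + 0 → δ₀ u ≡ + 0
  δ₀-zero u h = when-no (u ℤ.≟ + 0) h

  kill : ∀ F d s → d ≡ + 0 → F * (d * s) ≡ + 0
  kill F d s refl = r345 F s

  z-of : ∀ x z → x + z ≡ + 0 → z ≡ - x
  z-of x z e = r140 x z ∙ cong (λ s → s - x) e ∙ ZP.+-identityˡ (- x)

  On-b₁ : ∀ x y z → On (x , y , z) → x + z ≡ + 0 → y * y ≡ n
  On-b₁ x y z o e = 4-inj (y * y) n (sym (r182 x y) ∙ cong (λ z → x * x + + 4 * (y * y) - z * z) (sym (z-of x z e)) ∙ o)

  z-of₂ : ∀ y z → + 2 * y - z ≡ + 0 → z ≡ + 2 * y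
  z-of₂ y z e = ≡-from-0 {z} {+ 2 * y} e

  On-b₂ : ∀ x y z → On (x , y , z) → + 2 * y - z ≡ + 0 → hlf x * hlf x ≡ n × x ≡ + 2 * hlf x
  On-b₂ x y z o e = 4-inj (hlf x * hlf x) n (r346 (hlf x) ∙ cong (λ x → x * x) (sym x≡) ∙ x²) , x≡ ∙ r347 (hlf x) where
    x² : x * x ≡ + 4 * n
    x² = sym (r184 x y) ∙ cong (λ z → x * x + + 4 * (y * y) - z * z) (sym (z-of₂ y z e)) ∙ o
    even-x : par x ≡ false
    even-x = sym (idem (par x)) ∙ sym (par-* x x) ∙ cong par x² ∙ par-* (+ 4) n where
      idem : ∀ b → b ∧ b ≡ b
      idem true  = refl
      idem false = refl
    x≡ : x ≡ hlf x + hlf x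
    x≡ = hlf-par x even-x

  -- On x + z = 0 the equation of the quadric becomes y² = n, and on 2y = z it becomes (x/2)² = n,
  -- so for a nonsquare both boundary terms are empty.
  nonsquare : (∀ y → y * y ≢ n) → sumQ region ≡ + 0
  nonsquare ns = cancelˡ {sumQ region} 3 (cancel-signs ∙ cong₂ (λ x y → - x - y) z₁ z₂) where
    all0 : ∀ g → (∀ v → On v → g v ≡ + 0) → sumQ g ≡ + 0
    all0 g h = sumQ-cong {g} {λ _ → + 0} h ∙ ∑-cong (Dom.L (cube B)) {g = λ _ → + 0} (λ v → when-0 (On? v)) ∙ ∑-0 (Dom.L (cube B))
    z₁ : sumQ b₁ ≡ + 0
    z₁ = all0 b₁ (λ { (x , y , z) o → kill (F³ (x , y , z)) (δ₀ (x + z)) (sgn (+ 2 * y - z)) (δ₀-zero (x + z) (λ e → ns y (On-b₁ x y z o e))) })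
    z₂ : sumQ b₂ ≡ + 0
    z₂ = all0 b₂ (λ { (x , y , z) o → kill (F³ (x , y , z)) (δ₀ (+ 2 * y - z)) (sgn (x + z)) (δ₀-zero (+ 2 * y - z) (λ e → ns (hlf x) (proj₁ (On-b₂ x y z o e)))) })

  module Square (j : ℕ) (s : ℤ) (s≡ : s ≡ + suc j) (n≡ : n ≡ s * s) (2s≤B : suc (suc (j ℕ.+ j)) ≤ B) where

    s⁺ : NN (s - + 1)
    s⁺ = subst (λ s → NN (s - + 1)) (sym s≡) (≈nn (nn {j}) (suc-pos j))

    s≢-s : s ≢ - s
    s≢-s e = nn-absurd (- (+ 1)) (nn+ (nn+ s⁺ s⁺) (nn {1})) e (r180 s)

    2s≡ : + suc (suc (j ℕ.+ j)) ≡ + 2 * s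
    2s≡ = r181 (+ j) ∙ cong (λ s → + 2 * s) (sym s≡)

    s≤B : ∣ s ∣ ≤ B
    s≤B = NP.≤-trans (NP.≤-reflexive (cong ∣_∣ s≡)) (NP.≤-trans (s≤s (NP.m≤n⇒m≤1+n (NP.m≤m+n j j))) 2s≤B)

    -- A sum over the quadric restricted to a line parametrised by `σ`. A line may leave the cube,
    -- which is why the guard `D?` on the parameter remains.
    line : (σ : ℤ → T³) (π : T³ → ℤ) (D? : ∀ x → Dec (Dom.In (cube B) (σ x))) (C : T³ → Set) (C? : ∀ v → Dec (C v)) (g : T³ → ℤ) →
      (∀ x → On (σ x) × C (σ x)) → (∀ x → π (σ x) ≡ x) → (∀ v → On v → C v → σ (π v) ≡ v) → (∀ x → Dom.In (cube B) (σ x) → ∣ x ∣ ≤ B) →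
      sumQ (λ v → when (C? v) (g v)) ≡ ∑ (ints B) (λ x → when (D? x) (g (σ x)))
    line σ π D? C C? g on πσ σπ small = ∑-cong-in (λ v → go v (On? v) (C? v)) ∙ ∑-bij (cube B) (ℤD B) (λ v → (On? v ×-dec C? v) ×-dec inB? v) D? g (λ x → g (σ x)) π σ
        (λ v h → proj₂ h) (λ x h → small x h)
        (λ v h → subst (Dom.In (cube B)) (sym (σπ v (proj₁ (proj₁ h)) (proj₂ (proj₁ h)))) (proj₂ h) , σπ v (proj₁ (proj₁ h)) (proj₂ (proj₁ h)) , cong g (σπ v (proj₁ (proj₁ h)) (proj₂ (proj₁ h))))
        (λ x h → (on x , h) , πσ x) where
      inB? : ∀ v → Dec (Dom.In (cube B) v)
      inB? (x , y , z) = (∣ x ∣ ℕ.≤? B) ×-dec (∣ y ∣ ℕ.≤? B) ×-dec (∣ z ∣ ℕ.≤? B)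
      ∑-cong-in : ∀ {f g : T³ → ℤ} → (∀ v → Dom.In (cube B) v → f v ≡ g v) → ∑ (Dom.L (cube B)) f ≡ ∑ (Dom.L (cube B)) g
      ∑-cong-in {f} {g} h = ∑-cube B f ∙ ints-in B _ _ (λ x x≤ → ints-in B _ _ (λ y y≤ → ints-in B _ _ (λ z z≤ → h (x , y , z) (x≤ , y≤ , z≤)))) ∙ sym (∑-cube B g)
      go : ∀ v (d : Dec (On v)) (e : Dec (C v)) → Dom.In (cube B) v → when d (when e (g v)) ≡ when ((d ×-dec e) ×-dec inB? v) (g v)
      go v (yes o) (yes c) i = sym (when-yes ((yes o ×-dec yes c) ×-dec inB? v) {g v} ((o , c) , i))
      go v (yes o) (no c) i = sym (when-no ((yes o ×-dec no c) ×-dec inB? v) {g v} (λ h → c (proj₂ (proj₁ h))))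
      go v (no o) e i = sym (when-no ((no o ×-dec e) ×-dec inB? v) {g v} (λ h → o (proj₁ (proj₁ h))))

    sgn2 : ∀ u → sgn (+ 2 * u) ≡ sgn u
    sgn2 (+ zero)  = refl
    sgn2 (+ suc _) = refl
    sgn2 -[1+ _ ]  = refl

    D₁ : ∀ y x → ∣ y ∣ ≤ B → ∣ x ∣ ≤ B → Dom.In (cube B) (x , y , - x)
    D₁ y x hy hx = hx , hy , NP.≤-trans (NP.≤-reflexive (ZP.∣-i∣≡∣i∣ x)) hx

    C₁ : ℤ → T³ → Set
    C₁ t (x , y , z) = x + z ≡ + 0 × y ≡ t
    C₁? : ∀ t v → Dec (C₁ t v)
    C₁? t (x , y , z) = (x + z ℤ.≟ + 0) ×-dec (y ℤ.≟ t)

    in? : ∀ v → Dec (Dom.In (cube B) v)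
    in? (x , y , z) = (∣ x ∣ ℕ.≤? B) ×-dec (∣ y ∣ ℕ.≤? B) ×-dec (∣ z ∣ ℕ.≤? B)

    g₁ : T³ → ℤ
    g₁ v = F³ v * sgn (u₂′ v)

    line₁ : ∀ t → t * t ≡ n → ∣ t ∣ ≤ B → sumQ (λ v → when (C₁? t v) (g₁ v)) ≡ ∑ (ints B) (λ x → g₁ (x , t , - x))
    line₁ t t²≡ ht = line (λ x → x , t , - x) proj₁ (λ x → in? (x , t , - x)) (C₁ t) (C₁? t) g₁
        (λ x → r182 x t ∙ cong (λ m → + 4 * m) t²≡ , r183 x , refl) (λ _ → refl) (λ { (x , y , z) o (e , refl) → form≡ refl refl (sym (z-of x z e)) }) (λ x h → proj₁ h) ∙
      ints-in B (λ x → when (in? (x , t , - x)) (g₁ (x , t , - x))) (λ x → g₁ (x , t , - x)) (λ x hx → when-yes (in? (x , t , - x)) (D₁ t x ht hx))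

    b₁-split : ∀ v → On v → b₁ v ≡ when (C₁? s v) (g₁ v) + when (C₁? (- s) v) (g₁ v)
    b₁-split (x , y , z) o = two-roots (F³ (x , y , z)) (sgn (+ 2 * y - z)) (x + z ℤ.≟ + 0) (y ℤ.≟ s) (y ℤ.≟ - s) (λ e f → s≢-s (sym e ∙ f)) (λ d → sq-root± y s (On-b₁ x y z o d ∙ n≡))

    f₁′ f₂′ : ℤ → ℤ
    f₁′ x = χ² x * ε (par x) (par s)
    f₂′ y = χ² y * ε false (par y)

    par-double : ∀ x → par (+ 2 * x) ≡ false
    par-double x = par-* (+ 2) x

    χ²-double : ∀ x → χ² (+ 2 * x) ≡ χ² x
    χ²-double x = cong (λ w → w * w) (χ-double x) ∙ r15 (χ x)

    f₁′-neg : ∀ x → f₁′ (- x) ≡ f₁′ x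
    f₁′-neg x = cong₂ (λ a b → a * ε b (par s)) (χ²-neg x) (par-neg x)

    f₂′-neg : ∀ x → f₂′ (- x) ≡ f₂′ x
    f₂′-neg x = cong₂ (λ a b → a * ε false b) (χ²-neg x) (par-neg x)

    -- The boundary consists of the lines y = ±s, z = -x. Since χ is odd, adding the two lines
    -- produces sgn(2s + x) + sgn(2s - x), which is 0 for |x| > 2s; each line alone would depend on
    -- the size of the cube. At x = 2s half the weight remains.
    sum-b₁ : sumQ b₁ ≡ - (+ 2) * (χ s * (+ 2 * Σ1 (suc (j ℕ.+ j)) f₁′ + f₂′ s))
    sum-b₁ = sumQ-cong b₁-split ∙ sumQ-+ (λ v → when (C₁? s v) (g₁ v)) (λ v → when (C₁? (- s) v) (g₁ v)) ∙
        cong₂ _+_ (line₁ s (sym n≡) s≤B) (line₁ (- s) (sq-neg s ∙ sym n≡) (NP.≤-trans (NP.≤-reflexive (ZP.∣-i∣≡∣i∣ s)) s≤B)) ∙ sym (∑-+ (ints B) (λ x → g₁ (x , s , - x)) (λ x → g₁ (x , - s , - x))) ∙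
          ∑-cong (ints B) both ∙ ∑-ints B h ∙ cong₂ _+_ h0 (Σ1-cong B pair) ∙ ZP.+-identityˡ (Σ1 B (λ x → - (+ 2) * (χ s * (f₁′ x * (+ 1 + sgn (+ suc (suc (j ℕ.+ j)) - x)))))) ∙ Σ1-* B (- (+ 2)) (λ x → χ s * (f₁′ x * (+ 1 + sgn (+ suc (suc (j ℕ.+ j)) - x)))) ∙ cong (λ w → - (+ 2) * w)
            (Σ1-* B (χ s) (λ x → f₁′ x * (+ 1 + sgn (+ suc (suc (j ℕ.+ j)) - x))) ∙ cong (λ w → χ s * w) (plus-sgn (suc (j ℕ.+ j)) B 2s≤B f₁′ ∙ cong (λ w → + 2 * Σ1 (suc (j ℕ.+ j)) f₁′ + w) at-2s)) where
      at-2s : f₁′ (+ suc (suc (j ℕ.+ j))) ≡ f₂′ s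
      at-2s = cong f₁′ 2s≡ ∙ cong₂ (λ a b → a * ε b (par s)) (χ²-double s) (par-double s)
      h : ℤ → ℤ
      h x = - (χ s * (f₁′ x * (sgn (+ 2 * s + x) + sgn (+ 2 * s - x))))
      both : ∀ x → g₁ (x , s , - x) + g₁ (x , - s , - x) ≡ h x
      both x = cong₂ _+_ (cong₂ (λ a b → χ x * χ s * a * ε (par x) (par s) * sgn b) (χ-neg x) (r82 s x))
          (cong₂ _*_ (cong₂ _*_ (cong₂ (λ a b → χ x * a * b) (χ-neg s) (χ-neg x)) (cong (ε (par x)) (par-neg s))) (cong sgn (r83 s x) ∙ sgn-neg (+ 2 * s - x))) ∙ r84 (χ x) (χ s) (ε (par x) (par s)) (sgn (+ 2 * s + x)) (sgn (+ 2 * s - x))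
      h0 : h (+ 0) ≡ + 0
      h0 = r85 (χ s) (ε (par (+ 0)) (par s)) (sgn (+ 2 * s + + 0) + sgn (+ 2 * s - + 0))
      pair : ∀ k → suc k ≤ B → h (+ suc k) + h (- (+ suc k)) ≡ - (+ 2) * (χ s * (f₁′ (+ suc k) * (+ 1 + sgn (+ suc (suc (j ℕ.+ j)) - + suc k))))
      pair k _ = go (+ suc k) (≈nn (nn {k}) (suc-pos k)) where
        go : ∀ x → NN (x - + 1) → h x + h (- x) ≡ - (+ 2) * (χ s * (f₁′ x * (+ 1 + sgn (+ suc (suc (j ℕ.+ j)) - x))))
        go x x⁺ = cong (λ w → h x + w) (cong₂ (λ a b → - (χ s * (a * b))) (f₁′-neg x) (cong (λ w → sgn (+ 2 * s + - x) + sgn w) (r82 s x))) ∙ cong (λ w → - (χ s * (f₁′ x * (w + sgn (+ 2 * s - x)))) + - (χ s * (f₁′ x * (sgn (+ 2 * s - x) + w)))) (sgn⁺ (+ 2 * s + x) (≈nn (nn+ (nn+ (nn+ s⁺ s⁺) x⁺) (nn {2})) (r87 s x))) ∙ r86 (χ s) (f₁′ x) (sgn (+ 2 * s - x)) ∙ cong (λ w → - (+ 2) * (χ s * (f₁′ x * (+ 1 + sgn (w - x))))) (sym 2s≡)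

    C₂ : ℤ → T³ → Set
    C₂ t (x , y , z) = + 2 * y - z ≡ + 0 × x ≡ t
    C₂? : ∀ t v → Dec (C₂ t v)
    C₂? t (x , y , z) = (+ 2 * y - z ℤ.≟ + 0) ×-dec (x ℤ.≟ t)

    g₂ : T³ → ℤ
    g₂ v = F³ v * sgn (u₁′ v)

    2y? : ∀ y → Dec (∣ + 2 * y ∣ ≤ B)
    2y? y = ∣ + 2 * y ∣ ℕ.≤? B

    line₂ : ∀ t → t * t ≡ + 4 * n → ∣ t ∣ ≤ B → sumQ (λ v → when (C₂? t v) (g₂ v)) ≡ ∑ (ints B) (λ y → when (2y? y) (g₂ (t , y , + 2 * y)))
    line₂ t t²≡ ht = line (λ y → t , y , + 2 * y) (λ v → proj₁ (proj₂ v)) (λ y → in? (t , y , + 2 * y)) (C₂ t) (C₂? t) g₂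
        (λ y → r184 t y ∙ t²≡ , r185 y , refl) (λ _ → refl) (λ { (x , y , z) o (e , refl) → form≡ refl refl (sym (z-of₂ y z e)) }) (λ y h → proj₁ (proj₂ h)) ∙
      ints-in B (λ y → when (in? (t , y , + 2 * y)) (g₂ (t , y , + 2 * y))) (λ y → when (2y? y) (g₂ (t , y , + 2 * y))) (λ y hy → when-⇔ (in? (t , y , + 2 * y)) (2y? y) (λ h → proj₂ (proj₂ h)) (λ h → ht , hy , h) (λ _ → refl))

    b₂-split : ∀ v → On v → b₂ v ≡ when (C₂? (+ 2 * s) v) (g₂ v) + when (C₂? (- (+ 2 * s)) v) (g₂ v)
    b₂-split (x , y , z) o = two-roots (F³ (x , y , z)) (sgn (x + z)) (+ 2 * y - z ℤ.≟ + 0) (x ℤ.≟ + 2 * s) (x ℤ.≟ - (+ 2 * s)) (λ e f → 2s≢ (sym e ∙ f)) (λ d → roots (On-b₂ x y z o d)) where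
      2s≢ : + 2 * s ≢ - (+ 2 * s)
      2s≢ e = nn-absurd (- (+ 1)) (nn+ (nn* (nn {4}) s⁺) (nn {3})) e (r88 s)
      roots : ∀ {h} → h * h ≡ n × x ≡ + 2 * h → x ≡ + 2 * s ⊎ x ≡ - (+ 2 * s)
      roots {h} (h² , x≡) = go (sq-root± h s (h² ∙ n≡)) where
        go : h ≡ s ⊎ h ≡ - s → x ≡ + 2 * s ⊎ x ≡ - (+ 2 * s)
        go (inj₁ e) = inj₁ (x≡ ∙ cong (λ w → + 2 * w) e)
        go (inj₂ e) = inj₂ (x≡ ∙ cong (λ w → + 2 * w) e ∙ r89 s)

    -- The same on the lines x = ±2s, z = 2y, where sgn(s + y) + sgn(s - y) vanishes for |y| > s.
    -- The cube cuts these lines at |2y| ≤ B, which is harmless because 2s ≤ B.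
    sum-b₂ : sumQ b₂ ≡ + 2 * (χ s * (+ 2 * Σ1 j f₂′ + f₂′ s))
    sum-b₂ = sumQ-cong b₂-split ∙ sumQ-+ (λ v → when (C₂? (+ 2 * s) v) (g₂ v)) (λ v → when (C₂? (- (+ 2 * s)) v) (g₂ v)) ∙
        cong₂ _+_ (line₂ (+ 2 * s) (r186 s ∙ cong (λ w → + 4 * w) (sym n≡)) 2s≤) (line₂ (- (+ 2 * s)) (sq-neg (+ 2 * s) ∙ r186 s ∙ cong (λ w → + 4 * w) (sym n≡)) (NP.≤-trans (NP.≤-reflexive (ZP.∣-i∣≡∣i∣ (+ 2 * s))) 2s≤)) ∙ sym (∑-+ (ints B) (λ y → when (2y? y) (g₂ (+ 2 * s , y , + 2 * y))) (λ y → when (2y? y) (g₂ (- (+ 2 * s) , y , + 2 * y)))) ∙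
          ∑-cong (ints B) both ∙ ∑-ints B (λ y → when (2y? y) (h y)) ∙ cong₂ _+_ h0 (Σ1-cong B pair) ∙ ZP.+-identityˡ (Σ1 B (λ x → + 2 * (χ s * (f₂′ x * (+ 1 + sgn (+ suc j - x)))))) ∙ Σ1-* B (+ 2) (λ x → χ s * (f₂′ x * (+ 1 + sgn (+ suc j - x)))) ∙ cong (λ w → + 2 * w)
            (Σ1-* B (χ s) (λ x → f₂′ x * (+ 1 + sgn (+ suc j - x))) ∙ cong (λ w → χ s * w) (plus-sgn j B (NP.≤-trans (NP.≤-reflexive (cong ∣_∣ (sym s≡))) s≤B) f₂′ ∙ cong (λ w → + 2 * Σ1 j f₂′ + f₂′ w) (sym s≡))) where
      2s≤ : ∣ + 2 * s ∣ ≤ B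
      2s≤ = NP.≤-trans (NP.≤-reflexive (cong ∣_∣ (sym 2s≡))) 2s≤B
      h : ℤ → ℤ
      h y = χ s * (f₂′ y * (sgn (s + y) + sgn (s - y)))
      both : ∀ y → when (2y? y) (g₂ (+ 2 * s , y , + 2 * y)) + when (2y? y) (g₂ (- (+ 2 * s) , y , + 2 * y)) ≡ when (2y? y) (h y)
      both y = go (2y? y) where
        go : (d : Dec (∣ + 2 * y ∣ ≤ B)) → when d (g₂ (+ 2 * s , y , + 2 * y)) + when d (g₂ (- (+ 2 * s) , y , + 2 * y)) ≡ when d (h y)
        go (no _) = refl
        go (yes _) = cong₂ _+_ (cong₂ _*_ (cong₂ _*_ (cong₂ (λ a b → a * χ y * b) (χ-double s) (χ-double y)) (cong (λ b → ε b (par y)) (par-double s))) (cong sgn (r90 s y) ∙ sgn2 (s + y)))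
          (cong₂ _*_ (cong₂ _*_ (cong₂ (λ a b → a * χ y * b) (χ-neg (+ 2 * s) ∙ cong -_ (χ-double s)) (χ-double y)) (cong (λ b → ε b (par y)) (par-neg (+ 2 * s) ∙ par-double s))) (cong sgn (r91 s y) ∙ sgn-neg (+ 2 * (s - y)) ∙ cong -_ (sgn2 (s - y)))) ∙ r92 (χ y) (χ s) (ε false (par y)) (sgn (s + y)) (sgn (s - y))
      h0 : when (2y? (+ 0)) (h (+ 0)) ≡ + 0
      h0 = cong (when (2y? (+ 0))) (r93 (χ s) (ε false (par (+ 0))) (sgn (s + + 0) + sgn (s - + 0))) ∙ when-0 (2y? (+ 0))
      pair : ∀ k → suc k ≤ B → when (2y? (+ suc k)) (h (+ suc k)) + when (2y? (- (+ suc k))) (h (- (+ suc k))) ≡ + 2 * (χ s * (f₂′ (+ suc k) * (+ 1 + sgn (+ suc j - + suc k))))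
      pair k _ = go (+ suc k) (≈nn (nn {k}) (suc-pos k)) ∙ cong (λ w → + 2 * (χ s * (f₂′ (+ suc k) * (+ 1 + sgn (w - + suc k))))) s≡ where
        drop : ∀ {Q : Set} (d : Dec Q) {w v} → w ≡ v → (¬ Q → v ≡ + 0) → when d w ≡ v
        drop (yes _) e _ = e
        drop (no n) _ f = sym (f n)
        go : ∀ y → NN (y - + 1) → when (2y? y) (h y) + when (2y? (- y)) (h (- y)) ≡ + 2 * (χ s * (f₂′ y * (+ 1 + sgn (s - y))))
        go y y⁺ = cong₂ _+_ (drop (2y? y) {h y} {v} hy zero-v) (drop (2y? (- y)) {h (- y)} {v} hny (λ nb → zero-v (λ q → nb (NP.≤-trans (NP.≤-reflexive abs-neg) q)))) ∙ r94 (χ s) (f₂′ y) (sgn (s - y)) where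
          v = χ s * (f₂′ y * (+ 1 + sgn (s - y)))
          one′ : sgn (s + y) ≡ + 1
          one′ = sgn⁺ (s + y) (≈nn (nn+ (nn+ s⁺ y⁺) (nn {1})) (r96 s y))
          hy : h y ≡ v
          hy = cong (λ w → χ s * (f₂′ y * (w + sgn (s - y)))) one′
          hny : h (- y) ≡ v
          hny = cong₂ (λ a b → χ s * (a * (sgn (s - y) + sgn b))) (f₂′-neg y) (r26 s y) ∙ cong (λ w → χ s * (f₂′ y * w)) (cong (λ w → sgn (s - y) + w) one′ ∙ ZP.+-comm (sgn (s - y)) (+ 1))
          abs-neg : ∣ + 2 * - y ∣ ≡ ∣ + 2 * y ∣
          abs-neg = cong ∣_∣ (r89 y) ∙ ZP.∣-i∣≡∣i∣ (+ 2 * y)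
          small₂ : NN (s - y) → ∣ + 2 * y ∣ ≤ B
          small₂ q = nn-≤ {+ 2 * y} {B} (≈nn (nn+ (nn* (nn {2}) y⁺) (nn {2})) (r98 y)) (≈nn (nn+ (subst (λ w → NN (+ B - w)) 2s≡ (≤⇒nn 2s≤B)) (nn* (nn {2}) q)) (r97 (+ B) s y))
          zero-v : ¬ (∣ + 2 * y ∣ ≤ B) → v ≡ + 0
          zero-v nb = cong (λ w → χ s * (f₂′ y * (+ 1 + w))) (sgn⁻ (s - y) (¬nn {s - y} (λ q → nb (small₂ q)))) ∙ r95 (χ s) (f₂′ y)

    -- The half weights at x = 2s and at y = s are the same number `f₂′ s` and cancel, leaving full
    -- sums up to 2s - 1 and s - 1.
    square : sumQ region ≡ χ s * (Σ1 (suc (j ℕ.+ j)) f₁′ - Σ1 j f₂′)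
    square = 4-inj (sumQ region) (χ s * (Σ1 (suc (j ℕ.+ j)) f₁′ - Σ1 j f₂′)) (cancel-signs ∙ cong₂ (λ x y → - x - y) sum-b₁ sum-b₂ ∙ r187 (χ s) (Σ1 (suc (j ℕ.+ j)) f₁′) (Σ1 j f₂′) (f₂′ s))

-- The positive region as the set of solutions of i² + de = n

κ : ℤ → ℤ
κ x = κ₃ (res₃ x)

V : ℤ → T³ → Set
V n (i , d , e) = i * i + d * e ≡ n × NN (d - + 1) × NN (e - + 1)

V? : ∀ n v → Dec (V n v)
V? n (i , d , e) = (i * i + d * e ℤ.≟ n) ×-dec NN? (d - + 1) ×-dec NN? (e - + 1)

sq≥ : ∀ x → NN (x * x - x)
sq≥ x = go (tri x) where
  go : Tri x → NN (x * x - x)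
  go (pos p) = ≈nn (nn+ (nn* p p) p) (r546 x)
  go (zer e) = subst (λ x → NN (x * x - x)) (sym e) nn
  go (neg p) = ≈nn (nn+ (nn+ (nn² x) p) (nn {1})) (r547 x)

sq≥-neg : ∀ x → NN (x * x + x)
sq≥-neg x = ≈nn (sq≥ (- x)) (r548 x)

when-flatten : ∀ G {X Y Z : Set} (d : Dec X) (e : Dec Y) (f : Dec Z) → when d (G * (when e (+ 1) * when f (+ 1))) ≡ when (d ×-dec e ×-dec f) G
when-flatten G (no _) (yes _) (yes _) = refl
when-flatten G (no _) (yes _) (no _) = refl
when-flatten G (no _) (no _) (yes _) = refl
when-flatten G (no _) (no _) (no _) = refl
when-flatten G (yes _) (yes _) (yes _) = r370 G
when-flatten G (yes _) (yes _) (no _) = r371 G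
when-flatten G (yes _) (no _) (yes _) = r345 G (+ 1)
when-flatten G (yes _) (no _) (no _) = r345 G (+ 0)

module Region (ε : Bool → Bool → ℤ) (B : ℕ) (n : ℤ) (M : ℕ) (n≤M : NN (+ M - n)) (6M≤B : NN (+ B - + 6 * + M)) where

  open Uspensky ε B n

  -- Under `ψ` one has x + z = 2d and 2y - z = e, so the region x + z > 0, 2y - z > 0 is exactly d,
  -- e ≥ 1.
  φ ψ : T³ → T³
  φ (x , y , z) = y - hlf (x + z) , hlf (x + z) , + 2 * y - z
  ψ (i , d , e) = e - + 2 * i , d + i , + 2 * (d + i) - e

  m = + M

  record Bnd (i d e : ℤ) : Set where
    field
      i⁻ : NN (m - i)
      i⁺ : NN (m + i)
      d⁻ : NN (m - d)
      d⁺ : NN (m + d)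
      e⁻ : NN (m - e)
      e⁺ : NN (m + e)

  bnd : ∀ i d e → V n (i , d , e) → Bnd i d e
  bnd i d e (q , p , r) = record
    { i⁻ = nn-mod {g = m - i} (- (+ 1)) (nn+ (nn+ n≤M (sq≥ i)) de) q (r349 m n i d e)
    ; i⁺ = nn-mod {g = m + i} (- (+ 1)) (nn+ (nn+ n≤M (sq≥-neg i)) de) q (r350 m n i d e)
    ; d⁻ = d′
    ; d⁺ = ≈nn (nn+ (nn+ d′ (nn* (nn {2}) p)) (nn {2})) (r353 m d)
    ; e⁻ = e′
    ; e⁺ = ≈nn (nn+ (nn+ e′ (nn* (nn {2}) r)) (nn {2})) (r353 m e) } where
    de : NN ((d - + 1) * (e - + 1) + (d - + 1) + (e - + 1) + + 1)
    de = nn+ (nn+ (nn+ (nn* p r) p) r) (nn {1})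
    d′ : NN (m - d)
    d′ = nn-mod {g = m - d} (- (+ 1)) (nn+ (nn+ n≤M (nn² i)) (nn+ (nn* p r) r)) q (r351 m n i d e)
    e′ : NN (m - e)
    e′ = nn-mod {g = m - e} (- (+ 1)) (nn+ (nn+ n≤M (nn² i)) (nn+ (nn* p r) p)) q (r352 m n i d e)

  inM : ∀ v → V n v → Dom.In (cube M) v
  inM (i , d , e) h = ∣∣≤ {i} {M} i⁻ i⁺ , ∣∣≤ {d} {M} d⁻ d⁺ , ∣∣≤ {e} {M} e⁻ e⁺
    where open Bnd (bnd i d e h)

  -- With |i|, |d|, |e| ≤ M the largest coordinate, 2(d + i) - e, is at most 5M in absolute value;
  -- radius 6M is enough.
  inψ : ∀ v → V n v → Dom.In (cube B) (ψ v)
  inψ (i , d , e) h =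
      ∣∣≤ {e - + 2 * i} {B} (≈nn (nn+ (nn+ (nn+ 6M≤B e⁻) (nn* (nn {2}) i⁺)) (nn* (nn {3}) (nn {M}))) (r354 b m i e)) (≈nn (nn+ (nn+ (nn+ 6M≤B e⁺) (nn* (nn {2}) i⁻)) (nn* (nn {3}) (nn {M}))) (r355 b m i e))
    , ∣∣≤ {d + i} {B} (≈nn (nn+ (nn+ (nn+ 6M≤B d⁻) i⁻) (nn* (nn {4}) (nn {M}))) (r356 b m i d)) (≈nn (nn+ (nn+ (nn+ 6M≤B d⁺) i⁺) (nn* (nn {4}) (nn {M}))) (r357 b m i d))
    , ∣∣≤ {+ 2 * (d + i) - e} {B} (≈nn (nn+ (nn+ (nn+ (nn+ 6M≤B (nn* (nn {2}) d⁻)) (nn* (nn {2}) i⁻)) e⁺) (nn {M})) (r358 b m i d e)) (≈nn (nn+ (nn+ (nn+ (nn+ 6M≤B (nn* (nn {2}) d⁺)) (nn* (nn {2}) i⁺)) e⁻) (nn {M})) (r359 b m i d e)) where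
    open Bnd (bnd i d e h)
    b = + B

  Rg : T³ → Set
  Rg v@(x , y , z) = On v × NN (x + z - + 1) × NN (+ 2 * y - z - + 1)

  Rg? : ∀ v → Dec (Rg v)
  Rg? v@(x , y , z) = On? v ×-dec NN? (x + z - + 1) ×-dec NN? (+ 2 * y - z - + 1)

  onψ : ∀ v → V n v → Rg (ψ v)
  onψ (i , d , e) (q , p , r) = r360 i d e ∙ cong (λ s → + 4 * s) q , ≈nn (nn+ (nn+ p p) (nn {1})) (r361 i d e) , ≈nn r (r362 i d e)

  φψ : ∀ v → φ (ψ v) ≡ v
  φψ (i , d , e) = form≡ (cong (λ h → d + i - h) h≡ ∙ r79 d i) h≡ (r364 i d e) where
    h≡ : hlf (e - + 2 * i + (+ 2 * (d + i) - e)) ≡ d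
    h≡ = hlf-double d (e - + 2 * i + (+ 2 * (d + i) - e)) (r363 i d e)

  x+z-even : ∀ x y z → On (x , y , z) → par (x + z) ≡ false
  x+z-even x y z o = par-+ x z ∙ go (par x) (par z) (sym (par-sub (x * x + + 4 * (y * y)) (z * z) ∙ cong₂ xor (par-+ (x * x) (+ 4 * (y * y)) ∙ cong₂ xor (par-* x x) (par-* (+ 4) (y * y))) (par-* z z)) ∙ cong par o ∙ par-* (+ 4) n) where
    go : ∀ a b → xor (xor (a ∧ a) false) (b ∧ b) ≡ false → xor a b ≡ false
    go true  true  _ = refl
    go false false _ = refl
    go true  false ()
    go false true  ()

  back : ∀ v h → (let (x , y , z) = v in x + z ≡ h + h) → Rg v → V n (let (x , y , z) = v in y - h , h , + 2 * y - z)
  back (x , y , z) h ev (o , p , r) = 4-inj ((y - h) * (y - h) + h * (+ 2 * y - z)) n (r365 y z h ∙ cong (λ x → x * x + + 4 * (y * y) - z * z) (sym x≡) ∙ o)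
      , half1 (h - + 1) (≈nn (subst (λ s → NN (s - + 1)) ev p) (r366 h)) , r where
    x≡ : x ≡ h + h - z
    x≡ = r54 x z ∙ cong (λ s → s - z) ev

  φ-V : ∀ v → Rg v → V n (φ v)
  φ-V v@(x , y , z) h = back v (hlf (x + z)) (hlf-par (x + z) (x+z-even x y z (proj₁ h))) h

  ψφ : ∀ v → On v → ψ (φ v) ≡ v
  ψφ (x , y , z) o = form≡ (r367 y z h ∙ cong (λ s → s - z) (sym (hlf-par (x + z) (x+z-even x y z o))) ∙ r331 x z) (r368 y h) (r369 y z h) where
    h = hlf (x + z)

  region-V : sumQ region ≡ ∑ (Dom.L (cube M)) (λ v → when (V? n v) (F³ (ψ v)))
  region-V = ∑-cong (Dom.L (cube B)) (λ { (x , y , z) → when-flatten (F³ (x , y , z)) (On? (x , y , z)) (NN? (x + z - + 1)) (NN? (+ 2 * y - z - + 1)) }) ∙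
    ∑-bij (cube B) (cube M) {Rg} {V n} Rg? (V? n) F³ (λ v → F³ (ψ v)) φ ψ
      (λ v h → subst (Dom.In (cube B)) (ψφ v (proj₁ h)) (inψ (φ v) (φ-V v h))) inM
      (λ v h → φ-V v h , ψφ v (proj₁ h) , cong F³ (ψφ v (proj₁ h)))
      (λ v h → onψ v h , φψ v)

-- Simplifying the weight by averaging over residues

R³ : Set
R³ = Res × Res × Res

-- The product of characters at `ψ` in terms of residues; `mul₃ j₃` is doubling, because 2 ≡ -1 (mod
-- 3).
ψ-weight : (Bool → Bool → ℤ) → R³ → ℤ
ψ-weight ε ((i , _) , (d , y) , (e , z)) = val (add₃ e (neg₃′ (mul₃ j₃ i))) * val (add₃ d i) * val (add₃ (mul₃ j₃ (add₃ d i)) (neg₃′ e))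

ψ-parity : (Bool → Bool → ℤ) → R³ → ℤ
ψ-parity ε ((_ , x) , (_ , y) , (_ , z)) = ε (xor z false) (xor y x)

V-weight : (Bool → ℤ) → R³ → ℤ
V-weight ω ((i , _) , (d , y) , (e , z)) = κ₃ i * val d * ω (y ∧ z)

-- The transported weight minus the simple weight κ(i) χ(d) ω(de). On i² + de ≡ 1 (mod 3) it cancels
-- after averaging over i ↦ -i and over the exchange of d and e, so both weights have the same
-- total.
gap : (Bool → Bool → ℤ) → (Bool → ℤ) → R³ → ℤ
gap ε ω r = ψ-weight ε r * ψ-parity ε r - V-weight ω r

n₁ n₂ : R³ → R³
n₁ ((i , x) , d , e) = (neg₃′ i , x) , d , e
n₂ (i , d , e) = i , e , d

sum₄ : (R³ → ℤ) → R³ → ℤ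
sum₄ h r = (h r + h (n₁ r)) + (h (n₂ r) + h (n₁ (n₂ r)))

onQuadric : Bool → R³ → Bool
onQuadric b ((i , x) , (d , y) , (e , z)) = eq₃ (add₃ (mul₃ i i) (mul₃ d e)) i₃ ∧ not (xor (xor (x ∧ x) (y ∧ z)) b)

balanced : Bool → (R³ → ℤ) → Bool
balanced b h = allR λ i → allR λ d → allR λ e → not (onQuadric b (i , d , e)) ∨ isZero (sum₄ h (i , d , e))

balanced-elim : ∀ b h → balanced b h ≡ true → ∀ r → onQuadric b r ≡ true → sum₄ h r ≡ + 0
balanced-elim b h p (i , d , e) adm = isZero-sound (sum₄ h (i , d , e)) (strip adm
    (allR-elim (t i d) (allR-elim (λ d → allR (t i d)) (allR-elim (λ i → allR λ d → allR (t i d)) p i) d) e)) where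
  t : Res → Res → Res → Bool
  t i d e = not (onQuadric b (i , d , e)) ∨ isZero (sum₄ h (i , d , e))
  strip : ∀ {a b} → a ≡ true → not a ∨ b ≡ true → b ≡ true
  strip refl h = h

res³ : T³ → R³
res³ (i , d , e) = res i , res d , res e

sw : T³ → T³
sw (i , d , e) = i , e , d

W³ : (Bool → ℤ) → T³ → ℤ
W³ ω (i , d , e) = κ i * χ d * ω (par (d * e))

sumV : ℕ → ℤ → (T³ → ℤ) → ℤ
sumV M n g = ∑ (Dom.L (cube M)) (λ v → when (V? n v) (g v))

module Balance (M : ℕ) (n : ℤ) where

  V-fx : ∀ v → V n v → V n (fx v)
  V-fx (i , d , e) (q , p) = r372 i d e ∙ q , p
  V-fx′ : ∀ v → V n (fx v) → V n v
  V-fx′ (i , d , e) (q , p) = r373 i d e ∙ q , p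
  V-sw : ∀ v → V n v → V n (sw v)
  V-sw (i , d , e) (q , p , r) = cong (λ s → i * i + s) (ZP.*-comm e d) ∙ q , r , p

  sumV-fx : ∀ g → sumV M n (λ v → g (fx v)) ≡ sumV M n g
  sumV-fx g = ∑-cong (Dom.L (cube M)) (λ v → when-⇔ (V? n v) (V? n (fx v)) {g (fx v)} {g (fx v)} (V-fx v) (V-fx′ v) (λ _ → refl)) ∙ Uspensky.box-x (λ _ _ → + 0) M n (λ v → when (V? n v) (g v))

  sumV-sw : ∀ g → sumV M n (λ v → g (sw v)) ≡ sumV M n g
  sumV-sw g = ∑-cong (Dom.L (cube M)) (λ { v@(i , d , e) → when-⇔ (V? n v) (V? n (sw v)) {g (sw v)} {g (sw v)} (V-sw v) (V-sw (sw v)) (λ _ → refl) }) ∙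
    ∑-cube M (λ v → G (sw v)) ∙ ∑-cong (ints M) (λ i → ∑-swap (ints M) (ints M) (λ d e → G (i , e , d))) ∙ sym (∑-cube M G) where
    G : T³ → ℤ
    G v = when (V? n v) (g v)

  sumV-+ : ∀ f g → sumV M n (λ v → f v + g v) ≡ sumV M n f + sumV M n g
  sumV-+ f g = ∑-cong (Dom.L (cube M)) (λ v → go (V? n v) (f v) (g v)) ∙ ∑-+ (Dom.L (cube M)) (λ v → when (V? n v) (f v)) (λ v → when (V? n v) (g v)) where
    go : ∀ {X : Set} (d : Dec X) a b → when d (a + b) ≡ when d a + when d b
    go (yes _) a b = refl
    go (no _) a b = refl

  sumV-cong : ∀ f g → (∀ v → V n v → f v ≡ g v) → sumV M n f ≡ sumV M n g
  sumV-cong f g h = ∑-cong (Dom.L (cube M)) (λ v → when-⇔ (V? n v) (V? n v) {f v} {g v} (λ x → x) (λ x → x) (h v))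

  balance : ∀ b (h : R³ → ℤ) → balanced b h ≡ true → res₃ n ≡ i₃ → par n ≡ b → sumV M n (λ v → h (res³ v)) ≡ + 0
  balance b h pass r₃ pn = cancelˡ {S} 3 (r374 S ∙ sym sums ∙ sumV-cong (λ v → sum₄ h (res³ v)) (λ _ → + 0) zero₄ ∙ zeros) where
    S = sumV M n (λ v → h (res³ v))
    H : T³ → ℤ
    H v = h (res³ v)
    zeros : sumV M n (λ _ → + 0) ≡ + 0
    zeros = ∑-cong (Dom.L (cube M)) {g = λ _ → + 0} (λ v → when-0 (V? n v)) ∙ ∑-0 (Dom.L (cube M))
    neg-res : ∀ v → n₁ (res³ v) ≡ res³ (fx v)
    neg-res (i , d , e) = cong (λ s → s , res d , res e) (sym (cong₂ _,_ (res₃-neg i) (par-neg i)))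
    t₁ : sumV M n (λ v → h (n₁ (res³ v))) ≡ S
    t₁ = sumV-cong (λ v → h (n₁ (res³ v))) (λ v → H (fx v)) (λ v _ → cong h (neg-res v)) ∙ sumV-fx H
    t₂ : sumV M n (λ v → h (n₂ (res³ v))) ≡ S
    t₂ = sumV-sw H
    t₃ : sumV M n (λ v → h (n₁ (n₂ (res³ v)))) ≡ S
    t₃ = sumV-sw (λ v → h (n₁ (res³ v))) ∙ t₁
    sums : sumV M n (λ v → sum₄ h (res³ v)) ≡ (S + S) + (S + S)
    sums = sumV-+ (λ v → h (res³ v) + h (n₁ (res³ v))) (λ v → h (n₂ (res³ v)) + h (n₁ (n₂ (res³ v)))) ∙
      cong₂ _+_ (sumV-+ H (λ v → h (n₁ (res³ v))) ∙ cong (λ s → S + s) t₁)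
        (sumV-+ (λ v → h (n₂ (res³ v))) (λ v → h (n₁ (n₂ (res³ v)))) ∙ cong₂ _+_ t₂ t₃)
    eq₃-≡ : ∀ {r s} → r ≡ s → eq₃ r s ≡ true
    eq₃-≡ {o₃} refl = refl
    eq₃-≡ {i₃} refl = refl
    eq₃-≡ {j₃} refl = refl
    xnor-refl : ∀ {a b} → a ≡ b → not (xor a b) ≡ true
    xnor-refl {true} refl = refl
    xnor-refl {false} refl = refl
    zero₄ : ∀ v → V n v → sum₄ h (res³ v) ≡ + 0
    zero₄ (i , d , e) (q , _) = balanced-elim b h pass (res i , res d , res e) (∧-intro
      (eq₃-≡ (sym (res₃-+ (i * i) (d * e) ∙ cong₂ add₃ (res₃-* i i) (res₃-* d e)) ∙ cong res₃ q ∙ r₃))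
      (xnor-refl (sym (par-+ (i * i) (d * e) ∙ cong₂ xor (par-* i i) (par-* d e)) ∙ cong par q ∙ pn)))

  module _ (ε : Bool → Bool → ℤ) (ω : Bool → ℤ) (B : ℕ) (n≤M : NN (+ M - n)) (6M≤B : NN (+ B - + 6 * + M)) where
    open Uspensky ε B n using (sumQ; region; F³)
    open Region ε B n M n≤M 6M≤B using (ψ; region-V)

    sumV-region : balanced (par n) (gap ε ω) ≡ true → res₃ n ≡ i₃ → sumV M n (W³ ω) ≡ sumQ region
    sumV-region pass r₃ = ≡-from-0 {sumV M n (W³ ω)} {sumV M n (λ v → F³ (ψ v))} (cong (λ s → sumV M n (λ v → F³ (ψ v)) - s) (refl {x = sumV M n (W³ ω)}) ∙ sym minus ∙ balance (par n) (gap ε ω) pass r₃ refl) ∙ sym region-V where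
      pt : ∀ v → gap ε ω (res³ v) ≡ F³ (ψ v) + - (+ 1) * W³ ω v
      pt (i , d , e) = cong₂ (λ a b → a - b) (sym (cong₂ _*_ (cong₂ _*_ (cong₂ _*_ (cong val xr) (cong val (res₃-+ d i))) (cong val zr)) (cong₂ ε xp (par-+ d i)))) (cong (λ b → κ i * χ d * ω b) (sym (par-* d e))) ∙ r99 (F³ (ψ (i , d , e))) (W³ ω (i , d , e)) where
        xr : res₃ (e - + 2 * i) ≡ add₃ (res₃ e) (neg₃′ (mul₃ j₃ (res₃ i)))
        xr = res₃-sub e (+ 2 * i) ∙ cong (λ r → add₃ (res₃ e) (neg₃′ r)) (res₃-* (+ 2) i)
        zr : res₃ (+ 2 * (d + i) - e) ≡ add₃ (mul₃ j₃ (add₃ (res₃ d) (res₃ i))) (neg₃′ (res₃ e))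
        zr = res₃-sub (+ 2 * (d + i)) e ∙ cong (λ r → add₃ r (neg₃′ (res₃ e))) (res₃-* (+ 2) (d + i) ∙ cong (mul₃ j₃) (res₃-+ d i))
        xp : par (e - + 2 * i) ≡ xor (par e) false
        xp = par-sub e (+ 2 * i) ∙ cong (xor (par e)) (par-* (+ 2) i)
      minus : sumV M n (λ v → gap ε ω (res³ v)) ≡ sumV M n (λ v → F³ (ψ v)) - sumV M n (W³ ω)
      minus = sumV-cong (λ v → gap ε ω (res³ v)) (λ v → F³ (ψ v) + - (+ 1) * W³ ω v) (λ v _ → pt v) ∙
        sumV-+ (λ v → F³ (ψ v)) (λ v → - (+ 1) * W³ ω v) ∙ cong (λ s → sumV M n (λ v → F³ (ψ v)) + s) scale ∙ r100 (sumV M n (λ v → F³ (ψ v))) (sumV M n (W³ ω)) where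
        go : ∀ {X : Set} (d : Dec X) a → when d (- (+ 1) * a) ≡ - (+ 1) * when d a
        go (yes _) a = refl
        go (no _) a = refl
        scale : sumV M n (λ v → - (+ 1) * W³ ω v) ≡ - (+ 1) * sumV M n (W³ ω)
        scale = ∑-cong (Dom.L (cube M)) (λ v → go (V? n v) (W³ ω v)) ∙ ∑-* (Dom.L (cube M)) (- (+ 1)) (λ v → when (V? n v) (W³ ω v))

ε₁ : Bool → Bool → ℤ
ε₁ _ _ = + 1

ω₁ : Bool → ℤ
ω₁ _ = + 1

-- The parity weights for which the terms of the boundary linear in s cancel.
ε₂ : Bool → Bool → Bool → ℤ
ε₂ true  false false = + 5
ε₂ true  false true  = + 3
ε₂ true  true  false = - (+ 1)
ε₂ true  true  true  = + 1
ε₂ false false false = + 3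
ε₂ false false true  = + 5
ε₂ false true  false = + 1
ε₂ false true  true  = - (+ 1)

-- Half of the factor 2 + 4 [2 | m], as a function of the parity of m.
ω₂ : Bool → ℤ
ω₂ true  = + 1
ω₂ false = + 3

balanced₁ : ∀ b → balanced b (gap ε₁ ω₁) ≡ true
balanced₁ true  = refl
balanced₁ false = refl

balanced₂ : ∀ b → balanced b (gap (ε₂ b) ω₂) ≡ true
balanced₂ true  = refl
balanced₂ false = refl

-- For a weight of period 6 the partial sums are linear plus periodic. The factor 3 keeps the slope
-- k and the correction c integral in the cases below, and one step per residue proves the formula.
periodic-sum : ∀ (w c : F₃ → Bool → ℤ) k → (∀ r b → c r b + + 3 * w (add₃ i₃ r) (not b) ≡ k + c (add₃ i₃ r) (not b)) → c o₃ false ≡ + 0 →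
  ∀ m → + 3 * Σ1 m (λ x → w (res₃ x) (par x)) ≡ k * + m + c (res₃ (+ m)) (par (+ m))
periodic-sum w c k step start zero    = sym (cong₂ _+_ (ZP.*-zeroʳ k) start ∙ refl)
periodic-sum w c k step start (suc m) = r549 (Σ1 m f) (f (+ suc m)) ∙ cong₂ (λ s t → s + + 3 * t) (periodic-sum w c k step start m) (cong₂ w r≡ b≡) ∙
    r550 (k * + m) (c (res₃ (+ m)) (par (+ m))) (+ 3 * w (add₃ i₃ (res₃ (+ m))) (not (par (+ m)))) ∙ cong (λ s → k * + m + s) (step (res₃ (+ m)) (par (+ m))) ∙ r551 k (+ m) (c (add₃ i₃ (res₃ (+ m))) (not (par (+ m)))) ∙ cong₂ (λ r b → k * + suc m + c r b) (sym r≡) (sym b≡) where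
  f : ℤ → ℤ
  f x = w (res₃ x) (par x)
  r≡ : res₃ (+ suc m) ≡ add₃ i₃ (res₃ (+ m))
  r≡ = res₃-+ (+ 1) (+ m)
  b≡ : par (+ suc m) ≡ not (par (+ m))
  b≡ = par-+ (+ 1) (+ m)

-- The six arguments, here and in `table`, follow the residues 0, 1, 2, 3, 4, 5 modulo 6.
six : (P : F₃ → Bool → Set) → P o₃ false → P i₃ true → P j₃ false → P o₃ true → P i₃ false → P j₃ true → ∀ r b → P r b
six P a b c d e f o₃ false = a
six P a b c d e f i₃ true  = b
six P a b c d e f j₃ false = c
six P a b c d e f o₃ true  = d
six P a b c d e f i₃ false = e
six P a b c d e f j₃ true  = f

table : ℤ → ℤ → ℤ → ℤ → ℤ → ℤ → F₃ → Bool → ℤ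
table a b c d e f o₃ false = a
table a b c d e f i₃ true  = b
table a b c d e f j₃ false = c
table a b c d e f o₃ true  = d
table a b c d e f i₃ false = e
table a b c d e f j₃ true  = f

c₁ c₂ : F₃ → Bool → ℤ
c₁ = table (+ 0) (+ 1) (+ 2) (+ 0) (+ 1) (+ 2)
c₂ = table (+ 0) (- (+ 1)) (+ 4) (+ 0) (+ 5) (+ 4)

c₃ : Bool → F₃ → Bool → ℤ
c₃ true  = table (+ 0) (+ 1) (+ 8) (+ 0) (+ 7) (+ 8)
c₃ false = table (+ 0) (+ 7) (+ 8) (+ 0) (+ 1) (+ 8)

-- The slope is 2 on both sums: 2(2s - 1) - 2(s - 1) = 2s. The periodic corrections, multiplied by
-- χ(s), give the 1.
boundary-1 : ∀ j (s : ℤ) → s ≡ + suc j → χ² s ≡ + 1 →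
  + 3 * (χ s * (Σ1 (suc (j ℕ.+ j)) (λ x → χ² x * ε₁ (par x) (par s)) - Σ1 j (λ y → χ² y * ε₁ false (par y)))) ≡ + 2 * (χ s * s) + + 1
boundary-1 j s refl h = r552 (χ s) (Σ1 (suc (j ℕ.+ j)) (λ x → χ² x * + 1)) (Σ1 j (λ y → χ² y * + 1)) ∙
    cong₂ (λ a b → χ s * (a - b)) (periodic-sum (λ r _ → val r * val r * + 1) c₁ (+ 2) steps refl (suc (j ℕ.+ j))) (periodic-sum (λ r _ → val r * val r * + 1) c₁ (+ 2) steps refl j) ∙
      cong₂ (λ r b → χ s * (+ 2 * (+ 1 + (+ j + + j)) + c₁ r b - (+ 2 * + j + c₁ (res₃ (+ j)) (par (+ j))))) res≡ par≡ ∙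
        r553 (χ s) (+ j) (c₁ (add₃ i₃ (add₃ r r)) (not (xor b b))) (c₁ r b) ∙ cong (λ t → + 2 * (χ s * s) + val t * (c₁ (add₃ i₃ (add₃ r r)) (not (xor b b)) - c₁ r b)) sj≡ ∙
          cong (λ t → + 2 * (χ s * s) + t) (six (λ r b → val (add₃ i₃ r) * val (add₃ i₃ r) ≡ + 1 → val (add₃ i₃ r) * (c₁ (add₃ i₃ (add₃ r r)) (not (xor b b)) - c₁ r b) ≡ + 1)
            (λ _ → refl) (λ _ → refl) (λ ()) (λ _ → refl) (λ _ → refl) (λ ()) r b (cong (λ t → val t * val t) (sym sj≡) ∙ h)) where
  r = res₃ (+ j)
  b = par (+ j)
  steps : ∀ r b → c₁ r b + + 3 * (val (add₃ i₃ r) * val (add₃ i₃ r) * + 1) ≡ + 2 + c₁ (add₃ i₃ r) (not b)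
  steps = six (λ r b → c₁ r b + + 3 * (val (add₃ i₃ r) * val (add₃ i₃ r) * + 1) ≡ + 2 + c₁ (add₃ i₃ r) (not b)) refl refl refl refl refl refl
  sj≡ : res₃ (+ suc j) ≡ add₃ i₃ r
  sj≡ = res₃-+ (+ 1) (+ j)
  res≡ : res₃ (+ suc (j ℕ.+ j)) ≡ add₃ i₃ (add₃ r r)
  res≡ = res₃-+ (+ 1) (+ j + + j) ∙ cong (add₃ i₃) (res₃-+ (+ j) (+ j))
  par≡ : par (+ suc (j ℕ.+ j)) ≡ not (xor b b)
  par≡ = par-+ (+ 1) (+ j + + j) ∙ cong not (par-+ (+ j) (+ j))

-- The slopes are 4 and 8, and 4(2s - 1) - 8(s - 1) = 4 no longer depends on s. The periodic
-- corrections turn this into 3 after multiplication by χ(s).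
boundary-2 : ∀ j (s : ℤ) → s ≡ + suc j → χ² s ≡ + 1 →
  + 3 * (χ s * (Σ1 (suc (j ℕ.+ j)) (λ x → χ² x * ε₂ (par s) (par x) (par s)) - Σ1 j (λ y → χ² y * ε₂ (par s) false (par y)))) ≡ + 3
boundary-2 j s refl h = r552 (χ s) (Σ1 (suc (j ℕ.+ j)) (λ x → χ² x * ε₂ t (par x) t)) (Σ1 j (λ y → χ² y * ε₂ t false (par y))) ∙
    cong₂ (λ a b → χ s * (a - b)) (periodic-sum (λ r b → val r * val r * ε₂ t b t) c₂ (+ 4) (steps t) refl (suc (j ℕ.+ j))) (periodic-sum (λ r b → val r * val r * ε₂ t false b) (c₃ t) (+ 8) (steps′ t) (start t) j) ∙
      cong₂ (λ r b → χ s * (+ 4 * (+ 1 + (+ j + + j)) + c₂ r b - (+ 8 * + j + c₃ t (res₃ (+ j)) (par (+ j))))) res≡ par≡ ∙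
        r554 (χ s) (+ j) (c₂ (add₃ i₃ (add₃ r r)) (not (xor b b))) (c₃ t r b) ∙ cong₂ (λ q t → val q * (+ 4 + c₂ (add₃ i₃ (add₃ r r)) (not (xor b b)) - c₃ t r b)) sj≡ pj≡ ∙
          six (λ r b → val (add₃ i₃ r) * val (add₃ i₃ r) ≡ + 1 → val (add₃ i₃ r) * (+ 4 + c₂ (add₃ i₃ (add₃ r r)) (not (xor b b)) - c₃ (not b) r b) ≡ + 3)
            (λ _ → refl) (λ _ → refl) (λ ()) (λ _ → refl) (λ _ → refl) (λ ()) r b (cong (λ t → val t * val t) (sym sj≡) ∙ h) where
  r = res₃ (+ j)
  b = par (+ j)
  t = par (+ suc j)
  start : ∀ t → c₃ t o₃ false ≡ + 0
  start true  = refl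
  start false = refl
  steps : ∀ t r b → c₂ r b + + 3 * (val (add₃ i₃ r) * val (add₃ i₃ r) * ε₂ t (not b) t) ≡ + 4 + c₂ (add₃ i₃ r) (not b)
  steps true  = six (λ r b → c₂ r b + + 3 * (val (add₃ i₃ r) * val (add₃ i₃ r) * ε₂ true (not b) true) ≡ + 4 + c₂ (add₃ i₃ r) (not b)) refl refl refl refl refl refl
  steps false = six (λ r b → c₂ r b + + 3 * (val (add₃ i₃ r) * val (add₃ i₃ r) * ε₂ false (not b) false) ≡ + 4 + c₂ (add₃ i₃ r) (not b)) refl refl refl refl refl refl
  steps′ : ∀ t r b → c₃ t r b + + 3 * (val (add₃ i₃ r) * val (add₃ i₃ r) * ε₂ t false (not b)) ≡ + 8 + c₃ t (add₃ i₃ r) (not b)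
  steps′ true  = six (λ r b → c₃ true r b + + 3 * (val (add₃ i₃ r) * val (add₃ i₃ r) * ε₂ true false (not b)) ≡ + 8 + c₃ true (add₃ i₃ r) (not b)) refl refl refl refl refl refl
  steps′ false = six (λ r b → c₃ false r b + + 3 * (val (add₃ i₃ r) * val (add₃ i₃ r) * ε₂ false false (not b)) ≡ + 8 + c₃ false (add₃ i₃ r) (not b)) refl refl refl refl refl refl
  sj≡ : res₃ (+ suc j) ≡ add₃ i₃ r
  sj≡ = res₃-+ (+ 1) (+ j)
  pj≡ : t ≡ not b
  pj≡ = par-+ (+ 1) (+ j)
  res≡ : res₃ (+ suc (j ℕ.+ j)) ≡ add₃ i₃ (add₃ r r)
  res≡ = res₃-+ (+ 1) (+ j + + j) ∙ cong (add₃ i₃) (res₃-+ (+ j) (+ j))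
  par≡ : par (+ suc (j ℕ.+ j)) ≡ not (xor b b)
  par≡ = par-+ (+ 1) (+ j + + j) ∙ cong not (par-+ (+ j) (+ j))

module Evaluate (M : ℕ) (n : ℤ) (n≤M : NN (+ M - n)) (r₃ : res₃ n ≡ i₃) where

  6M : ℕ
  6M = 6 ℕ.* M

  6M≤ : NN (+ 6M - + 6 * + M)
  6M≤ = subst (λ s → NN (+ 6M - s)) (ZP.pos-* 6 M) (≤⇒nn {6M} {6M} NP.≤-refl)

  sumV-nonsquare₁ : (∀ y → y * y ≢ n) → sumV M n (W³ ω₁) ≡ + 0
  sumV-nonsquare₁ ns = Balance.sumV-region M n ε₁ ω₁ 6M n≤M 6M≤ (balanced₁ (par n)) r₃ ∙ Boundary.nonsquare ε₁ 6M n ns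

  sumV-nonsquare₂ : (∀ y → y * y ≢ n) → sumV M n (W³ ω₂) ≡ + 0
  sumV-nonsquare₂ ns = Balance.sumV-region M n (ε₂ (par n)) ω₂ 6M n≤M 6M≤ (balanced₂ (par n)) r₃ ∙ Boundary.nonsquare (ε₂ (par n)) 6M n ns

  module _ (j : ℕ) (s : ℤ) (s≡ : s ≡ + suc j) (n≡ : n ≡ s * s) where

    2s≤ : suc (suc (j ℕ.+ j)) ≤ 6M
    2s≤ = NP.≤-trans (NP.≤-reflexive (cong suc (sym (NP.+-suc j j)))) (NP.+-mono-≤ s≤ (NP.≤-trans s≤ (NP.m≤m+n M (4 ℕ.* M)))) where
      s≤ : suc j ≤ M
      s≤ = nn⇒≤ {suc j} {M} (subst (λ s → NN (+ M - s)) s≡ (≈nn (nn+ (subst (λ n → NN (+ M - n)) n≡ n≤M) (sq≥ s)) (r188 (+ M) s)))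

    χ²s : χ² s ≡ + 1
    χ²s = val-mul (res₃ s) (res₃ s) ∙ cong val (sym (res₃-* s s) ∙ cong res₃ (sym n≡) ∙ r₃)

    par-s : par n ≡ par s
    par-s = cong par n≡ ∙ par-* s s ∙ go (par s) where
      go : ∀ b → b ∧ b ≡ b
      go true  = refl
      go false = refl

    sumV-square₁ : + 3 * sumV M n (W³ ω₁) ≡ + 2 * (χ s * s) + + 1
    sumV-square₁ = cong (λ t → + 3 * t) (Balance.sumV-region M n ε₁ ω₁ 6M n≤M 6M≤ (balanced₁ (par n)) r₃ ∙ Boundary.Square.square ε₁ 6M n j s s≡ n≡ 2s≤) ∙ boundary-1 j s s≡ χ²s

    sumV-square₂ : sumV M n (W³ ω₂) ≡ + 1
    sumV-square₂ = 3-inj (sumV M n (W³ ω₂)) (+ 1) (cong (λ t → + 3 * t) (Balance.sumV-region M n (ε₂ (par s)) ω₂ 6M n≤M 6M≤ (cong (λ b → balanced b (gap (ε₂ (par s)) ω₂)) par-s ∙ balanced₂ (par s)) r₃ ∙ Boundary.Square.square (ε₂ (par s)) 6M n j s s≡ n≡ 2s≤) ∙ boundary-2 j s s≡ χ²s) where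
      3-inj : ∀ x y → + 3 * x ≡ + 3 * y → x ≡ y
      3-inj x y q = ≡-from-0 {x} {y} (cancelˡ {y - x} 2 (r101 x y ∙ sub0 {+ 3 * x} {+ 3 * y} q))

-- Representations by x² + 3y²

third : ℤ → ℤ
third x = proj₁ (mod₃ x)

third-mul : ∀ x → res₃ x ≡ o₃ → x ≡ + 3 * third x
third-mul x e = proj₂ (mod₃ x) ∙ cong (λ r → + 3 * third x + val r) e ∙ ZP.+-identityʳ (+ 3 * third x)

res₃-3* : ∀ x → res₃ (+ 3 * x) ≡ o₃
res₃-3* x = res₃-* (+ 3) x

three-inj : ∀ x y → + 3 * x ≡ + 3 * y → x ≡ y
three-inj x y q = ≡-from-0 {x} {y} (cancelˡ {y - x} 2 (r101 x y ∙ sub0 {+ 3 * x} {+ 3 * y} q))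

third-3* : ∀ x → third (+ 3 * x) ≡ x
third-3* x = three-inj (third (+ 3 * x)) x (sym (third-mul (+ 3 * x) (res₃-3* x)))

T² : Set
T² = ℤ × ℤ

square² : ℕ → Dom
square² M = ℤD M ×D ℤD M

Sol Div : ℤ → T² → Set
Sol x (a , y) = a * a + + 3 * (y * y) ≡ x
Div x (b , c) = b * c ≡ x × NN (b - + 1) × NN (c - + 1)

Sol? : ∀ x v → Dec (Sol x v)
Sol? x (a , y) = a * a + + 3 * (y * y) ℤ.≟ x

Div? : ∀ x v → Dec (Div x v)
Div? x (b , c) = (b * c ℤ.≟ x) ×-dec NN? (b - + 1) ×-dec NN? (c - + 1)

sqrt? : ∀ k x → (Σ ℕ λ j → x ≡ + suc j * + suc j) ⊎ (∀ j → suc j ≤ k → + suc j * + suc j ≢ x)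
sqrt? zero x = inj₂ (λ j ())
sqrt? (suc k) x with x ℤ.≟ + suc k * + suc k
... | yes e = inj₁ (k , e)
... | no n with sqrt? k x
...   | inj₁ h = inj₁ h
...   | inj₂ h = inj₂ (λ j j≤ → go j (NP.m≤n⇒m<n∨m≡n j≤)) where
  go : ∀ j → suc j ℕ.< suc k ⊎ suc j ≡ suc k → + suc j * + suc j ≢ x
  go j (inj₁ (s≤s lt)) = h j lt
  go j (inj₂ refl) e = n (sym e)

module Representations (M : ℕ) where

  m = + M
  I = ints M

  -- Both sums are taken over a square of radius M, so for arguments up to M they are the number of
  -- representations by a² + 3y² and the divisor sum of χ.
  r ρ : ℤ → ℤ
  r x = ∑ (Dom.L (square² M)) (λ v → when (Sol? x v) (+ 1))
  ρ x = ∑ (Dom.L (square² M)) (λ v → when (Div? x v) (χ (proj₁ v)))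

  ∑² : ∀ (f : T² → ℤ) → ∑ (Dom.L (square² M)) f ≡ ∑ I (λ a → ∑ I (λ b → f (a , b)))
  ∑² f = ∑-cart I I f

  none² : ∀ {P : T² → Set} (P? : ∀ v → Dec (P v)) (g : T² → ℤ) → (∀ v → ¬ P v) → ∑ (Dom.L (square² M)) (λ v → when (P? v) (g v)) ≡ + 0
  none² P? g h = ∑-cong (Dom.L (square² M)) {g = λ _ → + 0} (λ v → when-no (P? v) {g v} (h v)) ∙ ∑-0 (Dom.L (square² M))

  r-neg : ∀ x → NN (- x - + 1) → r x ≡ + 0
  r-neg x h = none² (Sol? x) (λ _ → + 1) (λ { (a , y) e → nn-absurd (- (+ 1)) (nn+ (nn+ (nn² a) (nn* (nn {3}) (nn² y))) h) e (r375 a y x) })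

  ρ-nonpos : ∀ x → NN (- x) → ρ x ≡ + 0
  ρ-nonpos x h = none² (Div? x) (λ v → χ (proj₁ v)) (λ { (b , c) (e , p , q) → nn-absurd (- (+ 1)) (nn+ (nn+ (nn+ (nn* p q) p) q) h) e (r376 b c x) })

  sum-squares-0 : ∀ a y → a * a + + 3 * (y * y) ≡ + 0 → a ≡ + 0 × y ≡ + 0
  sum-squares-0 a y e = root a (antisym0 {a * a} (nn² a) (nn-mod {g = - (a * a)} (- (+ 1)) (nn* (nn {3}) (nn² y)) e (r377 a y))) , root y (antisym0 {y * y} (nn² y) (half (- (y * y)) (nn-mod {g = - (y * y) + - (y * y)} (- (+ 1)) (nn+ (nn² a) (nn² y)) e (r378 a y)))) where
    root : ∀ x → x * x ≡ + 0 → x ≡ + 0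
    root x e with *≡0 {x} {x} e
    ... | inj₁ h = h
    ... | inj₂ h = h

  r-0 : r (+ 0) ≡ + 1
  r-0 = ∑-enum (square² M) (Sol? (+ 0)) (λ _ → + 1) ((+ 0 , + 0) ∷ []) ([] ∷ []) ((z≤n , z≤n) ∷ []) (refl ∷ [])
    (λ { (a , y) e → here (cong₂ _,_ (proj₁ (sum-squares-0 a y e)) (proj₂ (sum-squares-0 a y e))) })

  Sol-in : ∀ x → NN (m - x) → ∀ v → Sol x v → Dom.In (square² M) v
  Sol-in x h (a , y) e =
      ∣∣≤ {a} {M} (nn-mod {g = m - a} (- (+ 1)) (nn+ (nn+ h (sq≥ a)) (nn* (nn {3}) (nn² y))) e (r379 m x a y)) (nn-mod {g = m + a} (- (+ 1)) (nn+ (nn+ h (sq≥-neg a)) (nn* (nn {3}) (nn² y))) e (r380 m x a y))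
    , ∣∣≤ {y} {M} (nn-mod {g = m - y} (- (+ 1)) (nn+ (nn+ h (sq≥ y)) (nn+ (nn² a) (nn* (nn {2}) (nn² y)))) e (r381 m x a y)) (nn-mod {g = m + y} (- (+ 1)) (nn+ (nn+ h (sq≥-neg y)) (nn+ (nn² a) (nn* (nn {2}) (nn² y)))) e (r382 m x a y))

  Div-in : ∀ x → NN (m - x) → ∀ v → Div x v → Dom.In (square² M) v
  Div-in x h (b , c) (e , p , q) = nn-≤ {b} {M} (nn1 b p) (nn-mod {g = m - b} (- (+ 1)) (nn+ h (nn+ (nn* p q) q)) e (r383 m x b c)) , nn-≤ {c} {M} (nn1 c q) (nn-mod {g = m - c} (- (+ 1)) (nn+ h (nn+ (nn* p q) p)) e (r384 m x b c))

  module Triple (x : ℤ) (x⁺ : NN (x - + 1)) (3x≤M : NN (m - + 3 * x)) where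

    x≤M : NN (m - x)
    x≤M = ≈nn (nn+ 3x≤M (nn+ (nn* (nn {2}) x⁺) (nn {2}))) (r189 m x)

    -- a² + 3y² = 3x forces 3 | a, and then y² + 3(a/3)² = x.
    r-3* : r (+ 3 * x) ≡ r x
    r-3* = ∑-bij (square² M) (square² M) {Sol (+ 3 * x)} {Sol x} (Sol? (+ 3 * x)) (Sol? x) (λ _ → + 1) (λ _ → + 1) (λ v → proj₂ v , third (proj₁ v)) (λ v → + 3 * proj₂ v , proj₁ v)
        (Sol-in (+ 3 * x) 3x≤M) (Sol-in x x≤M) (λ { (a , y) e → to a y e , cong (λ t → t , y) (sym (third-mul a (div a y e))) , refl })
        (λ { (a , y) e → r191 a y ∙ cong (λ t → + 3 * t) e , cong (λ t → a , t) (third-3* y) }) where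
      div : ∀ a y → Sol (+ 3 * x) (a , y) → res₃ a ≡ o₃
      div a y e = go (res₃ a) (sym (res₃-+ (a * a) (+ 3 * (y * y)) ∙ cong₂ add₃ (res₃-* a a) (res₃-3* (y * y))) ∙ cong res₃ e ∙ res₃-3* x) where
        go : ∀ r → add₃ (mul₃ r r) o₃ ≡ o₃ → r ≡ o₃
        go o₃ _ = refl
        go i₃ ()
        go j₃ ()
      to : ∀ a y → Sol (+ 3 * x) (a , y) → Sol x (y , third a)
      to a y e = three-inj (y * y + + 3 * (third a * third a)) x (r190 y (third a) ∙ cong (λ t → t * t + + 3 * (y * y)) (sym (third-mul a (div a y e))) ∙ e)

    Unit₃ : T² → Set
    Unit₃ (b , c) = res₃ b ≢ o₃

    Unit₃? : ∀ v → Dec (Unit₃ v)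
    Unit₃? (b , c) = go (res₃ b) where
      go : ∀ r → Dec (r ≢ o₃)
      go o₃ = no (λ n → n refl)
      go i₃ = yes (λ ())
      go j₃ = yes (λ ())

    ρ-unit : ∀ z → ρ z ≡ ∑ (Dom.L (square² M)) (λ v → when (Div? z v ×-dec Unit₃? v) (χ (proj₁ v)))
    ρ-unit z = ∑-cong (Dom.L (square² M)) (λ v → go v (Div? z v) (Unit₃? v)) where
      zero-χ : ∀ r → ¬ (r ≢ o₃) → val r ≡ + 0
      zero-χ o₃ _ = refl
      zero-χ i₃ n = ⊥-elim (n (λ ()))
      zero-χ j₃ n = ⊥-elim (n (λ ()))
      go : ∀ v (d : Dec (Div z v)) (e : Dec (Unit₃ v)) → when d (χ (proj₁ v)) ≡ when (d ×-dec e) (χ (proj₁ v))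
      go v (no _) (yes _) = refl
      go v (no _) (no _) = refl
      go v (yes _) (yes _) = refl
      go v (yes _) (no n) = zero-χ (res₃ (proj₁ v)) n

    -- Only divisors prime to 3 carry a nonzero χ, and x and 3x have the same such divisors; the
    -- complementary divisor is divided by 3.
    ρ-3* : ρ (+ 3 * x) ≡ ρ x
    ρ-3* = ρ-unit (+ 3 * x) ∙ ∑-bij (square² M) (square² M) {λ v → Div (+ 3 * x) v × Unit₃ v} {λ v → Div x v × Unit₃ v} (λ v → Div? (+ 3 * x) v ×-dec Unit₃? v) (λ v → Div? x v ×-dec Unit₃? v) (λ v → χ (proj₁ v)) (λ v → χ (proj₁ v)) (λ v → proj₁ v , third (proj₂ v)) (λ v → proj₁ v , + 3 * proj₂ v)
        (λ v h → Div-in (+ 3 * x) 3x≤M v (proj₁ h)) (λ v h → Div-in x x≤M v (proj₁ h))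
        (λ { (b , c) h → (to b c h , proj₂ h) , cong (λ t → b , t) (sym (third-mul c (div b c h))) , refl })
        (λ { (b , c) ((e , p , q) , u) → ((r193 b c ∙ cong (λ t → + 3 * t) e , p , ≈nn (nn+ (nn* (nn {3}) q) (nn {2})) (r194 c)) , u) , cong (λ t → b , t) (third-3* c) }) ∙ sym (ρ-unit x) where
      div : ∀ b c → Div (+ 3 * x) (b , c) × Unit₃ (b , c) → res₃ c ≡ o₃
      div b c ((e , _) , u) = go (res₃ b) (res₃ c) u (sym (res₃-* b c) ∙ cong res₃ e ∙ res₃-3* x) where
        go : ∀ r s → r ≢ o₃ → mul₃ r s ≡ o₃ → s ≡ o₃
        go r o₃ _ _ = refl
        go o₃ s n _ = ⊥-elim (n refl)
        go i₃ i₃ _ ()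
        go i₃ j₃ _ ()
        go j₃ i₃ _ ()
        go j₃ j₃ _ ()
      to : ∀ b c → Div (+ 3 * x) (b , c) × Unit₃ (b , c) → Div x (b , third c)
      to b c h@((e , p , q) , u) = three-inj (b * third c) x (r192 b (third c) ∙ cong (λ t → b * t) (sym c≡) ∙ e) , p , pos-factor (+ 3) (third c) nn (subst (λ t → NN (t - + 1)) c≡ q) where
        c≡ = third-mul c (div b c h)

  r-j : ∀ x → res₃ x ≡ j₃ → r x ≡ + 0
  r-j x h = none² (Sol? x) (λ _ → + 1) (λ { (a , y) e → go (res₃ a) (sym (res₃-+ (a * a) (+ 3 * (y * y)) ∙ cong₂ add₃ (res₃-* a a) (res₃-3* (y * y))) ∙ cong res₃ e ∙ h) }) where
    go : ∀ r → add₃ (mul₃ r r) o₃ ≢ j₃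
    go o₃ ()
    go i₃ ()
    go j₃ ()

  when-+ : ∀ {X : Set} (d : Dec X) a b → when d a + when d b ≡ when d (a + b)
  when-+ (yes _) a b = refl
  when-+ (no _) a b = refl

  double-0 : ∀ x → x + x ≡ + 0 → x ≡ + 0
  double-0 x e = cancelˡ {x} 1 (r385 x ∙ e)

  -- If bc ≡ 2 (mod 3), then χ(b) + χ(c) = 0, so the sum is cancelled by its image under exchanging
  -- the divisors.
  ρ-j : ∀ x → res₃ x ≡ j₃ → ρ x ≡ + 0
  ρ-j x h = double-0 (ρ x) (cong (λ t → ρ x + t) swapped ∙ sym (∑-+ L (λ v → when (Div? x v) (χ (proj₁ v))) (λ v → when (Div? x v) (χ (proj₂ v)))) ∙ ∑-cong L {g = λ _ → + 0} (λ v → when-+ (Div? x v) (χ (proj₁ v)) (χ (proj₂ v)) ∙ zero-pt v) ∙ ∑-0 L) where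
    L = Dom.L (square² M)
    swapped : ρ x ≡ ∑ L (λ v → when (Div? x v) (χ (proj₂ v)))
    swapped = ∑² (λ v → when (Div? x v) (χ (proj₁ v))) ∙ ∑-swap I I (λ b c → when (Div? x (b , c)) (χ b)) ∙ ∑-cong I (λ c → ∑-cong I (λ b → when-⇔ (Div? x (b , c)) (Div? x (c , b)) {χ b} {χ b} (λ { (e , p , q) → ZP.*-comm c b ∙ e , q , p }) (λ { (e , p , q) → ZP.*-comm b c ∙ e , q , p }) (λ _ → refl))) ∙ sym (∑² (λ v → when (Div? x v) (χ (proj₂ v))))
    zero-pt : ∀ v → when (Div? x v) (χ (proj₁ v) + χ (proj₂ v)) ≡ + 0
    zero-pt (b , c) = when-⇔ (Div? x (b , c)) (Div? x (b , c)) {χ b + χ c} {+ 0} (λ t → t) (λ t → t) (λ { (e , _) → go (res₃ b) (res₃ c) (sym (res₃-* b c) ∙ cong res₃ e ∙ h) }) ∙ when-0 (Div? x (b , c)) where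
      go : ∀ r s → mul₃ r s ≡ j₃ → val r + val s ≡ + 0
      go i₃ j₃ _ = refl
      go j₃ i₃ _ = refl
      go o₃ _ ()
      go i₃ o₃ ()
      go i₃ i₃ ()
      go j₃ o₃ ()
      go j₃ j₃ ()

  -- For fixed i the pairs (d, e) run over the factorisations of n - i², on which κ(i) and the
  -- parity weight are constant.
  sumV-ρ : ∀ ω n → sumV M n (W³ ω) ≡ ∑ I (λ i → κ i * (ω (par (n - i * i)) * ρ (n - i * i)))
  sumV-ρ ω n = ∑-cube M (λ v → when (V? n v) (W³ ω v)) ∙ ∑-cong I inner where
    inner : ∀ i → ∑ I (λ d → ∑ I (λ e → when (V? n (i , d , e)) (W³ ω (i , d , e)))) ≡ κ i * (ω (par (n - i * i)) * ρ (n - i * i))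
    inner i = sym (∑² (λ v → when (V? n (i , v)) (W³ ω (i , v)))) ∙ ∑-cong (Dom.L (square² M)) pt ∙ ∑-* (Dom.L (square² M)) (κ i * w) (λ v → when (Div? (n - i * i) v) (χ (proj₁ v))) ∙ ZP.*-assoc (κ i) w (ρ (n - i * i)) where
      w = ω (par (n - i * i))
      pull : ∀ {X : Set} (d : Dec X) a b → when d (a * b) ≡ a * when d b
      pull (yes _) a b = refl
      pull (no _) a b = sym (ZP.*-zeroʳ a)
      eq : ∀ d e → i * i + d * e ≡ n → d * e ≡ n - i * i
      eq d e q = r196 i (d * e) ∙ cong (λ t → t - i * i) q
      pt : ∀ v → when (V? n (i , v)) (W³ ω (i , v)) ≡ κ i * w * when (Div? (n - i * i) v) (χ (proj₁ v))
      pt (d , e) = when-⇔ (V? n (i , d , e)) (Div? (n - i * i) (d , e)) {κ i * χ d * ω (par (d * e))} {κ i * w * χ d}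
          (λ { (q , p) → eq d e q , p }) (λ { (q , p) → cong (λ t → i * i + t) q ∙ r197 i n , p })
          (λ { (q , _) → cong (λ t → κ i * χ d * ω (par t)) (eq d e q) ∙ r198 (κ i) (χ d) w }) ∙ pull (Div? (n - i * i) (d , e)) (κ i * w) (χ d)

  -- In i² + a² + 3y² = n exactly one of i, a is divisible by 3, so exchanging them flips the sign of κ(i).
  r-recurrence : ∀ n → res₃ n ≡ i₃ → ∑ I (λ i → κ i * r (n - i * i)) ≡ + 0
  r-recurrence n h = double-0 S (cong₂ _+_ expand (expand ∙ ∑-swap I I (λ i a → ∑ I (λ y → when (P? i a y) (κ i)))) ∙ sym (∑-+ I (λ i → ∑ I (λ a → ∑ I (λ y → when (P? i a y) (κ i)))) (λ i → ∑ I (λ a → ∑ I (λ y → when (P? a i y) (κ a))))) ∙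
      ∑-cong I {g = λ _ → + 0} (λ i → sym (∑-+ I (λ a → ∑ I (λ y → when (P? i a y) (κ i))) (λ a → ∑ I (λ y → when (P? a i y) (κ a)))) ∙ ∑-cong I {g = λ _ → + 0} (λ a → sym (∑-+ I (λ y → when (P? i a y) (κ i)) (λ y → when (P? a i y) (κ a))) ∙ ∑-cong I {g = λ _ → + 0} (λ y → pt i a y) ∙ ∑-0 I) ∙ ∑-0 I) ∙ ∑-0 I) where
    S = ∑ I (λ i → κ i * r (n - i * i))
    P : ℤ → ℤ → ℤ → Set
    P i a y = i * i + a * a + + 3 * (y * y) ≡ n
    P? : ∀ i a y → Dec (P i a y)
    P? i a y = i * i + a * a + + 3 * (y * y) ℤ.≟ n
    pull : ∀ {X : Set} (d : Dec X) k → k * when d (+ 1) ≡ when d k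
    pull (yes _) k = ZP.*-identityʳ k
    pull (no _) k = ZP.*-zeroʳ k
    expand : S ≡ ∑ I (λ i → ∑ I (λ a → ∑ I (λ y → when (P? i a y) (κ i))))
    expand = ∑-cong I (λ i → sym (∑-* (Dom.L (square² M)) (κ i) (λ v → when (Sol? (n - i * i) v) (+ 1))) ∙ ∑² (λ v → κ i * when (Sol? (n - i * i) v) (+ 1)) ∙ ∑-cong I (λ a → ∑-cong I (λ y →
      trans (pull (Sol? (n - i * i) (a , y)) (κ i)) (when-⇔ (Sol? (n - i * i) (a , y)) (P? i a y) {κ i} {κ i} (λ e → r387 i a y ∙ cong (λ t → i * i + t) e ∙ r197 i n) (λ e → r386 i a y ∙ cong (λ t → t - i * i) e) (λ _ → refl)))))
    pt : ∀ i a y → when (P? i a y) (κ i) + when (P? a i y) (κ a) ≡ + 0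
    pt i a y = cong (λ t → when (P? i a y) (κ i) + t) (when-⇔ (P? a i y) (P? i a y) {κ a} {κ a} (trans (sym (r388 i a y))) (trans (r388 i a y)) (λ _ → refl)) ∙
      when-+ (P? i a y) (κ i) (κ a) ∙ when-⇔ (P? i a y) (P? i a y) {κ i + κ a} {+ 0} (λ t → t) (λ t → t) (λ e → go (res₃ i) (res₃ a) (sym (res₃-+ (i * i + a * a) (+ 3 * (y * y)) ∙ cong₂ add₃ (res₃-+ (i * i) (a * a) ∙ cong₂ add₃ (res₃-* i i) (res₃-* a a)) (res₃-3* (y * y))) ∙ cong res₃ e ∙ h)) ∙ when-0 (P? i a y) where
      go : ∀ r s → add₃ (add₃ (mul₃ r r) (mul₃ s s)) o₃ ≡ i₃ → κ₃ r + κ₃ s ≡ + 0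
      go o₃ i₃ _ = refl
      go o₃ j₃ _ = refl
      go i₃ o₃ _ = refl
      go j₃ o₃ _ = refl
      go o₃ o₃ ()
      go i₃ i₃ ()
      go i₃ j₃ ()
      go j₃ i₃ ()
      go j₃ j₃ ()

  -- The defect of the formula to be proved. Its value at 0 is 1, as r(0) = 1 while 0 has no
  -- factorisation into positive integers; this accounts for the contribution of squares in the
  -- recurrence.
  E : ℤ → ℤ
  E x = r x - + 2 * (ω₂ (par x) * ρ x)

  E-neg : ∀ x → NN (- x - + 1) → E x ≡ + 0
  E-neg x h = cong₂ (λ a b → a - + 2 * (ω₂ (par x) * b)) (r-neg x h) (ρ-nonpos x (nn1 (- x) h)) ∙ r200 (ω₂ (par x))

  E-0 : E (+ 0) ≡ + 1
  E-0 = cong₂ (λ a b → a - + 2 * (+ 3 * b)) r-0 (ρ-nonpos (+ 0) nn)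

  E-recurrence : ∀ n → res₃ n ≡ i₃ → ∑ I (λ i → κ i * E (n - i * i)) ≡ - (+ 2) * sumV M n (W³ ω₂)
  E-recurrence n h = ∑-cong I (λ i → r389 (κ i) (r (n - i * i)) (ω₂ (par (n - i * i)) * ρ (n - i * i))) ∙ ∑-+ I (λ i → κ i * r (n - i * i)) (λ i → - (+ 2) * (κ i * (ω₂ (par (n - i * i)) * ρ (n - i * i)))) ∙ cong₂ _+_ (r-recurrence n h) (∑-* I (- (+ 2)) (λ i → κ i * (ω₂ (par (n - i * i)) * ρ (n - i * i))) ∙ cong (λ t → - (+ 2) * t) (sym (sumV-ρ ω₂ n))) ∙ ZP.+-identityˡ (- (+ 2) * sumV M n (W³ ω₂))

  module Step (x : ℤ) (x⁺ : NN (x - + 1)) (x≤M : NN (m - x)) (r₃ : res₃ x ≡ i₃) (IH : ∀ z → NN (z - + 1) → NN (x - z - + 1) → E z ≡ + 0) where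

    S : ℤ
    S = ∑ I (λ i → when (i * i ℤ.≟ x) (- (+ 1)))

    pt : ∀ i → κ i * E (x - i * i) ≡ when (i ℤ.≟ + 0) (E x) + when (i * i ℤ.≟ x) (- (+ 1))
    pt i = go (i ℤ.≟ + 0) (i * i ℤ.≟ x) (tri (x - i * i)) where
      κ₋ : ∀ r → mul₃ r r ≡ i₃ → κ₃ r ≡ - (+ 1)
      κ₋ o₃ ()
      κ₋ i₃ _ = refl
      κ₋ j₃ _ = refl
      sq⁺ : i ≢ + 0 → NN (i * i - + 1)
      sq⁺ n = sq-pos (tri i) where
        sq-pos : Tri i → NN (i * i - + 1)
        sq-pos (pos p) = ≈nn (nn+ (nn* p p) (nn* (nn {2}) p)) (r102 i)
        sq-pos (zer z) = ⊥-elim (n z)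
        sq-pos (neg p) = ≈nn (nn+ (nn* p p) (nn* (nn {2}) p)) (r103 i)
      go : (d : Dec (i ≡ + 0)) (e : Dec (i * i ≡ x)) → Tri (x - i * i) → κ i * E (x - i * i) ≡ when d (E x) + when e (- (+ 1))
      go (yes d) (yes e) _ = ⊥-elim (0≢pos {x} (sym e ∙ cong (λ i → i * i) d) x⁺)
      go (yes d) (no e) _ = cong (λ i → κ i * E (x - i * i)) d ∙ ZP.*-identityˡ (E (x - + 0)) ∙ cong E (ZP.+-identityʳ x) ∙ sym (ZP.+-identityʳ (E x))
      go (no d) (yes e) _ = cong₂ (λ k z → k * E z) (κ₋ (res₃ i) (sym (res₃-* i i) ∙ cong res₃ e ∙ r₃)) (sub0 {i * i} {x} e) ∙ cong (λ t → - (+ 1) * t) E-0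
      go (no d) (no e) (pos p) = cong (λ t → κ i * t) (IH (x - i * i) p (≈nn (sq⁺ d) (r199 x i))) ∙ ZP.*-zeroʳ (κ i)
      go (no d) (no e) (zer z) = ⊥-elim (e (≡-from-0 {i * i} {x} z))
      go (no d) (no e) (neg p) = cong (λ t → κ i * t) (E-neg (x - i * i) p) ∙ ZP.*-zeroʳ (κ i)

    -- By induction and by vanishing at negative arguments only two kinds of terms of the recurrence
    -- survive: i = 0 with κ = 1, and i² = x with κ = -1 and E(0) = 1.
    total-E : E x + S ≡ - (+ 2) * sumV M x (W³ ω₂)
    total-E = cong (λ t → t + S) (sym (Dom.full (ℤD M) (+ 0) z≤n (E x))) ∙ sym (∑-+ I (λ i → when (i ℤ.≟ + 0) (E x)) (λ i → when (i * i ℤ.≟ x) (- (+ 1)))) ∙ ∑-cong I (λ i → sym (pt i)) ∙ E-recurrence x r₃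

    -- `S` and the right side of `total-E` are both -2 if x is a square and both 0 otherwise.
    E-zero : E x ≡ + 0
    E-zero = go (sqrt? M x) where
      go : (Σ ℕ λ j → x ≡ + suc j * + suc j) ⊎ (∀ j → suc j ≤ M → + suc j * + suc j ≢ x) → E x ≡ + 0
      go (inj₂ ns) = r104 (E x) ∙ cong (λ t → E x + t) (sym S0) ∙ total-E ∙ cong (λ t → - (+ 2) * t) (Evaluate.sumV-nonsquare₂ M x x≤M r₃ nsq) where
        nsq : ∀ y → y * y ≢ x
        nsq (+ zero) e = 0≢pos {x} (sym e) x⁺
        nsq (+ suc j) e = ns j (nn⇒≤ {suc j} {M} (nn-mod {g = m - + suc j} (- (+ 1)) (nn+ x≤M (sq≥ (+ suc j))) e (r105 m (+ suc j) x))) e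
        nsq -[1+ j ] e = nsq (+ suc j) e
        S0 : S ≡ + 0
        S0 = ∑-cong I {g = λ _ → + 0} (λ i → when-no (i * i ℤ.≟ x) (nsq i)) ∙ ∑-0 I
      go (inj₁ (j , x≡)) = fin (+ suc j) refl x≡ where
        fin : ∀ s → s ≡ + suc j → x ≡ s * s → E x ≡ + 0
        fin s s≡ q = r11 (E x) ∙ cong (λ t → E x + t + + 2) (sym S2) ∙ cong (λ t → t + + 2) total-E ∙ cong (λ t → - (+ 2) * t + + 2) (Evaluate.sumV-square₂ M x x≤M r₃ j s s≡ q) where
          zr : NN (x - s * s)
          zr = subst NN (sym (sub0 {s * s} {x} (sym q))) nn
          s≤ : ∣ s ∣ ≤ M
          s≤ = ∣∣≤ {s} {M} (≈nn (nn+ (nn+ x≤M (sq≥ s)) zr) (r12 m s x)) (≈nn (nn+ (nn+ x≤M (sq≥-neg s)) zr) (r13 m s x))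
          s⁺ : NN (s - + 1)
          s⁺ = subst (λ s → NN (s - + 1)) (sym s≡) (≈nn (nn {j}) (suc-pos j))
          split : ∀ i → when (i * i ℤ.≟ x) (- (+ 1)) ≡ when (i ℤ.≟ s) (- (+ 1)) + when (i ℤ.≟ - s) (- (+ 1))
          split i = cases (i * i ℤ.≟ x) (i ℤ.≟ s) (i ℤ.≟ - s) where
            cases : (d : Dec (i * i ≡ x)) (e : Dec (i ≡ s)) (f : Dec (i ≡ - s)) → when d (- (+ 1)) ≡ when e (- (+ 1)) + when f (- (+ 1))
            cases d (yes e) (yes f) = ⊥-elim (nn-absurd (- (+ 1)) (nn+ (nn+ s⁺ s⁺) (nn {1})) (sym e ∙ f) (r14 s))
            cases (yes _) (yes _) (no _) = refl
            cases (yes _) (no _) (yes _) = refl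
            cases (yes d) (no e) (no f) = ⊥-elim (case± (sq-root± i s (d ∙ q))) where
              case± : i ≡ s ⊎ i ≡ - s → ⊥
              case± (inj₁ h) = e h
              case± (inj₂ h) = f h
            cases (no n) (yes e) (no _) = ⊥-elim (n (cong (λ i → i * i) e ∙ sym q))
            cases (no n) (no _) (yes f) = ⊥-elim (n (cong (λ i → i * i) f ∙ r15 s ∙ sym q))
            cases (no _) (no _) (no _) = refl
          S2 : S ≡ - (+ 2)
          S2 = ∑-cong I split ∙ ∑-+ I (λ i → when (i ℤ.≟ s) (- (+ 1))) (λ i → when (i ℤ.≟ - s) (- (+ 1))) ∙ cong₂ _+_ (Dom.full (ℤD M) s s≤ (- (+ 1))) (Dom.full (ℤD M) (- s) (NP.≤-trans (NP.≤-reflexive (ZP.∣-i∣≡∣i∣ s)) s≤) (- (+ 1)))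

  E-vanishes : ∀ k x → NN (+ k - x) → NN (x - + 1) → NN (m - x) → E x ≡ + 0
  E-vanishes zero x h p _ = ⊥-elim (nn⊥ (nn+ h p) (r390 x))
  E-vanishes (suc k) x h p q = go (res₃ x) refl where
    go : ∀ s → res₃ x ≡ s → E x ≡ + 0
    -- For x ≡ 2 (mod 3) both sides of the formula vanish, x ≡ 1 is the recurrence, and x = 3t
    -- reduces to t because tripling changes neither the two counts nor the parity.
    go j₃ e = cong₂ (λ a b → a - + 2 * (ω₂ (par x) * b)) (r-j x e) (ρ-j x e) ∙ r200 (ω₂ (par x))
    go i₃ e = Step.E-zero x p q e (λ z z⁺ z< → E-vanishes k z (≈nn (nn+ h z<) (r391 (+ k) x z)) z⁺ (≈nn (nn+ (nn+ q z<) (nn {1})) (r392 m x z)))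
    go o₃ e = cong E x≡ ∙ cong₂ (λ a b → a - + 2 * b) (Triple.r-3* t t⁺ 3t≤) (cong₂ (λ b c → ω₂ b * c) (par-* (+ 3) t) (Triple.ρ-3* t t⁺ 3t≤)) ∙ E-vanishes k t (≈nn (nn+ (subst (λ x → NN (+ suc k - x)) x≡ h) (nn+ (nn* (nn {2}) t⁺) (nn {1}))) (r201 (+ k) t)) t⁺ (Triple.x≤M t t⁺ 3t≤) where
      t = third x
      x≡ : x ≡ + 3 * t
      x≡ = third-mul x e
      t⁺ : NN (t - + 1)
      t⁺ = pos-factor (+ 3) t nn (subst (λ x → NN (x - + 1)) x≡ p)
      3t≤ : NN (m - + 3 * t)
      3t≤ = subst (λ x → NN (m - x)) x≡ q

  r≡ρ : ∀ x → NN (x - + 1) → NN (m - x) → r x ≡ + 2 * (ω₂ (par x) * ρ x)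
  r≡ρ x p q = sym (≡-from-0 {+ 2 * (ω₂ (par x) * ρ x)} {r x} (E-vanishes M x q p q))

-- Evaluation of the sum U for p ≡ 1 (mod 3)

∑-null : ∀ {A : Set} {P : A → Set} (P? : ∀ x → Dec (P x)) (g : A → ℤ) (L : List A) → ∑ L (λ x → when (P? x) (+ 1)) ≡ + 0 → ∑ L (λ x → when (P? x) (g x)) ≡ + 0
∑-null P? g [] e = refl
∑-null {P = P} P? g (x ∷ L) e = go (P? x) e where
  count : ∀ L → NN (∑ L (λ x → when (P? x) (+ 1)))
  count [] = nn
  count (x ∷ L) = nn+ (bit-nn (P? x)) (count L) where
    bit-nn : (d : Dec (P x)) → NN (when d (+ 1))
    bit-nn (yes _) = nn
    bit-nn (no _) = nn
  go : (d : Dec (P x)) → when d (+ 1) + ∑ L (λ x → when (P? x) (+ 1)) ≡ + 0 → when d (g x) + ∑ L (λ x → when (P? x) (g x)) ≡ + 0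
  go (yes _) e = ⊥-elim (nn-absurd (- (+ 1)) (count L) e (r555 (∑ L (λ x → when (P? x) (+ 1)))))
  go (no _) e = ZP.+-identityˡ (∑ L (λ x → when (P? x) (g x))) ∙ ∑-null P? g L (sym (ZP.+-identityˡ (∑ L (λ x → when (P? x) (+ 1)))) ∙ e)

when-merge₂ : ∀ {X Y Z : Set} (a : Dec (X × Y)) (b : Dec Y) (c : Dec Z) u v → (X → Z) → (Z → X) → (Z → u ≡ v * + 1) → when a u ≡ when b (v * when c (+ 1))
when-merge₂ (yes (x , y)) (yes _) (yes z) u v f g h = h z
when-merge₂ (yes (x , y)) (yes _) (no n) u v f g h = ⊥-elim (n (f x))
when-merge₂ (yes (x , y)) (no n) c u v f g h = ⊥-elim (n y)
when-merge₂ (no n) (yes y) (yes z) u v f g h = ⊥-elim (n (g z , y))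
when-merge₂ (no _) (yes _) (no _) u v f g h = sym (ZP.*-zeroʳ v)
when-merge₂ (no _) (no _) c u v f g h = refl

when-merge₃ : ∀ {X₁ X₂ A B C D : Set} (s : Dec (X₁ × A × B × C × D)) (t : Dec (A × D)) (u : Dec (X₂ × B × C)) m n o → (X₁ → X₂) → (X₂ → X₁) → (X₂ → m ≡ n * o) → when s m ≡ when t (n * when u o)
when-merge₃ (yes _) (yes _) (yes (x , _)) m n o f g h = h x
when-merge₃ (yes (x , a , b , c , d)) (yes _) (no w) m n o f g h = ⊥-elim (w (f x , b , c))
when-merge₃ (yes (x , a , b , c , d)) (no w) u m n o f g h = ⊥-elim (w (a , d))
when-merge₃ (no w) (yes (a , d)) (yes (x , b , c)) m n o f g h = ⊥-elim (w (g x , a , b , c , d))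
when-merge₃ (no _) (yes _) (no _) m n o f g h = sym (ZP.*-zeroʳ n)
when-merge₃ (no _) (no _) u m n o f g h = refl

module Theta (p : ℕ) (pr : Prime p) (K : ℕ) (P : ℤ) (P≡ : P ≡ + p) (P≥2 : NN (P - + 2)) (K-big : NN (+ K - P - P - P))
  (r₃ : res₃ P ≡ i₃) (odd-P : par P ≡ true) where

  open Sums p pr K P P≡ P≥2 K-big using (S⁺; S⁺?; P-split)
  open Symm p pr K P P≡ P≥2 K-big using (U)
  open Representations K

  S² = Dom.L (square² K)

  P≤K : NN (+ K - P)
  P≤K = ≈nn (nn+ (nn+ K-big (nn+ P≥2 P≥2)) (nn {4})) (r393 (+ K) P)

  P⁺ : NN (P - + 1)
  P⁺ = ≈nn (nn+ P≥2 (nn {1})) (r112 P)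

  Both : T² → Set
  Both (a , d) = NN (a - + 1) × NN (d - + 1)

  Both? : ∀ v → Dec (Both v)
  Both? (a , d) = NN? (a - + 1) ×-dec NN? (d - + 1)

  cof : T² → ℤ
  cof (a , d) = P - a * d

  lc : ∀ P a d → a * d + (P - a * d) ≡ P
  lc = ring
  ld : ∀ x z → z ≡ x + z - x
  ld = ring

  pull² : ∀ {X : T² → Set} {B : Set} (b : Dec B) (X? : ∀ v → Dec (X v)) k (f : T² → ℤ) → ∑ S² (λ v → when b (k * when (X? v) (f v))) ≡ when b (k * ∑ S² (λ v → when (X? v) (f v)))
  pull² b X? k f = ∑-when S² b (λ v → k * when (X? v) (f v)) ∙ cong (when b) (∑-* S² k (λ v → when (X? v) (f v)))

  -- The sum of κ(i) χ(d) over i² + de + 3y² = p. Grouped by y it is evaluated by Uspensky's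
  -- identity; grouped by (d, e) it counts representations of p - de and leads to U.
  A : ℤ
  A = ∑ I (λ y → sumV K (P - + 3 * (y * y)) (W³ ω₁))

  A≡ : A ≡ ∑ S² (λ w → when (Both? w) (χ (proj₁ w) * κ (cof w) * r (cof w)))
  A≡ = ∑-swap I (Dom.L (cube K)) T ∙ ∑-cart I S² (λ v → ∑ I (λ y → T y v)) ∙ ∑-swap I S² (λ i w → ∑ I (λ y → T y (i , w))) ∙ ∑-cong S² inner where
    T : ℤ → T³ → ℤ
    T y v = when (V? (P - + 3 * (y * y)) v) (W³ ω₁ v)
    inner : ∀ w → ∑ I (λ i → ∑ I (λ y → T y (i , w))) ≡ when (Both? w) (χ (proj₁ w) * κ (cof w) * r (cof w))
    inner w@(d , e) = ∑-cong I (λ i → ∑-cong I (λ y → pt i y)) ∙ sym (∑² (λ v → when (Both? w) (χ d * κ (cof w) * when (Sol? (cof w) v) (+ 1)))) ∙ pull² (Both? w) (Sol? (cof w)) (χ d * κ (cof w)) (λ _ → + 1) where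
      to : ∀ i y → i * i + d * e ≡ P - + 3 * (y * y) → Sol (cof w) (i , y)
      to i y q = r202 i d e y P ∙ cong (λ t → t - d * e) (cong (λ t → t + + 3 * (y * y)) q ∙ r203 P y)
      from : ∀ i y → Sol (cof w) (i , y) → i * i + d * e ≡ P - + 3 * (y * y)
      from i y q = r204 i d e y ∙ cong (λ t → t + d * e - + 3 * (y * y)) q ∙ r205 P d e y
      -- Since i² + 3y² = p - de, the number i is divisible by 3 exactly when p - de is.
      κ≡ : ∀ i y → Sol (cof w) (i , y) → κ i ≡ κ (cof w)
      κ≡ i y q = go (res₃ i) ∙ cong κ₃ (sym (res₃-+ (i * i) (+ 3 * (y * y)) ∙ cong₂ add₃ (res₃-* i i) (res₃-3* (y * y))) ∙ cong res₃ q) where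
        go : ∀ r → κ₃ r ≡ κ₃ (add₃ (mul₃ r r) o₃)
        go o₃ = refl
        go i₃ = refl
        go j₃ = refl
      pt : ∀ i y → T y (i , w) ≡ when (Both? w) (χ d * κ (cof w) * when (Sol? (cof w) (i , y)) (+ 1))
      pt i y = when-merge₂ (V? (P - + 3 * (y * y)) (i , d , e)) (Both? w) (Sol? (cof w) (i , y)) (κ i * χ d * + 1) (χ d * κ (cof w)) (to i y) (from i y) (λ q → r206 (κ i) (χ d) ∙ cong (λ k → χ d * k * + 1) (κ≡ i y q))

  U≡ : U ≡ ∑ S² (λ w → when (Both? w) (χ (proj₁ w) * κ (cof w) * (+ 2 * (ω₂ (par (cof w)) * ρ (cof w)))))
  U≡ = ∑-cart I (cart I (cart I I)) H ∙ ∑-cong I (λ a → ∑-cart I (cart I I) (λ v → H (a , v)) ∙ ∑-cong I (λ b → ∑-cart I I (λ v → H (a , b , v)) ∙ ∑-swap I I (λ c d → H (a , b , c , d))) ∙ ∑-swap I I (λ b d → ∑ I (λ c → H (a , b , c , d)))) ∙ sym (∑² (λ w → ∑ I (λ b → ∑ I (λ c → H (proj₁ w , b , c , proj₂ w))))) ∙ ∑-cong S² inner where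
    H : T⁴ → ℤ
    H q = when (S⁺? q) (wU (resQ q))
    inner : ∀ w → ∑ I (λ b → ∑ I (λ c → H (proj₁ w , b , c , proj₂ w))) ≡ when (Both? w) (χ (proj₁ w) * κ (cof w) * (+ 2 * (ω₂ (par (cof w)) * ρ (cof w))))
    inner w@(a , d) = ∑-cong I (λ b → ∑-cong I (λ c → pt b c)) ∙ sym (∑² (λ v → when (Both? w) (k * when (Div? z v) (χ (proj₁ v))))) ∙ pull² (Both? w) (Div? z) k (λ v → χ (proj₁ v)) ∙ cong (when (Both? w)) (r207 (χ a) (κ z) (ω₂ (par z)) (ρ z)) where
      z = cof w
      k = χ a * κ z * (+ 2 * ω₂ (par z))
      to : ∀ b c → a * d + b * c ≡ P → b * c ≡ z
      to b c q = ld (a * d) (b * c) ∙ cong (λ t → t - a * d) q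
      from : ∀ b c → b * c ≡ z → a * d + b * c ≡ P
      from b c q = cong (λ t → a * d + t) q ∙ lc P a d
      2ω : ∀ t → + 2 + + 4 * bit (not t) ≡ + 2 * ω₂ t
      2ω true  = refl
      2ω false = refl
      wt≡ : ∀ b c → b * c ≡ z → wU (resQ (a , b , c , d)) ≡ k * χ b
      wt≡ b c q = cong₂ (λ o r → χ a * χ b * o * κ₃ r) (2ω (par b ∧ par c) ∙ cong (λ t → + 2 * ω₂ t) (sym (par-* b c) ∙ cong par q)) (sym (res₃-* b c) ∙ cong res₃ q) ∙ r208 (χ a) (χ b) (+ 2 * ω₂ (par z)) (κ z)
      pt : ∀ b c → H (a , b , c , d) ≡ when (Both? w) (k * when (Div? z (b , c)) (χ b))
      pt b c = when-merge₃ (S⁺? (a , b , c , d)) (Both? w) (Div? z (b , c)) (wU (resQ (a , b , c , d))) k (χ b) (to b c) (from b c) (wt≡ b c)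

  -- The formula r = 2 ω₂ ρ replaces r by ρ at positive arguments. At argument 0 one has r = 1 but ρ
  -- = 0, so the pairs with ad = p leave the extra term ρ(p).
  A-U : A ≡ ρ P + U
  A-U = A≡ ∙ ∑-cong S² pt ∙ ∑-+ S² (λ w → when (Div? P w) (χ (proj₁ w))) (λ w → when (Both? w) (G w)) ∙ cong (λ t → ρ P + t) (sym U≡) where
    G : T² → ℤ
    G w = χ (proj₁ w) * κ (cof w) * (+ 2 * (ω₂ (par (cof w)) * ρ (cof w)))
    pt : ∀ w → when (Both? w) (χ (proj₁ w) * κ (cof w) * r (cof w)) ≡ when (Div? P w) (χ (proj₁ w)) + when (Both? w) (G w)
    pt w@(a , d) = go (Both? w) (Div? P w) (tri z) where
      z = cof w
      neg-zero : ∀ k → k * (+ 2 * (ω₂ (par z) * + 0)) ≡ + 0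
      neg-zero k = r106 k (ω₂ (par z))
      go : (s : Dec (Both w)) (t : Dec (Div P w)) → Tri z → when s (χ a * κ z * r z) ≡ when t (χ a) + when s (G w)
      go (no n) (yes (_ , h)) _ = ⊥-elim (n h)
      go (no _) (no _) _ = refl
      go (yes h) (yes (q , _)) _ = cong₂ (λ u v → χ a * u * v) (cong κ z0) (cong r z0 ∙ r-0) ∙ r107 (χ a) ∙ cong (λ t → χ a + t) (sym (cong (λ t → χ a * κ z * (+ 2 * (ω₂ (par z) * t))) (cong ρ z0 ∙ ρ-nonpos (+ 0) nn) ∙ neg-zero (χ a * κ z))) where
        z0 : z ≡ + 0
        z0 = sub0 {a * d} {P} q
      go (yes h) (no _) (pos z⁺) = cong (λ t → χ a * κ z * t) (r≡ρ z z⁺ (≈nn (nn+ P≤K (nn+ (nn+ (nn+ (nn* (proj₁ h) (proj₂ h)) (proj₁ h)) (proj₂ h)) (nn {1}))) (r209 (+ K) P a d))) ∙ r394 (G w)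
      go (yes h) (no n) (zer z0) = ⊥-elim (n (≡-from-0 {a * d} {P} z0 , h))
      go (yes h) (no _) (neg z⁻) = cong (λ t → χ a * κ z * t) (r-neg z z⁻) ∙ ZP.*-zeroʳ (χ a * κ z) ∙ cong (λ t → + 0 + t) (sym (cong (λ t → χ a * κ z * (+ 2 * (ω₂ (par z) * t))) (ρ-nonpos z (nn1 (- z) z⁻)) ∙ neg-zero (χ a * κ z)))

  ρ-P : ρ P ≡ + 2
  ρ-P = ∑-enum (square² K) (Div? P) (λ v → χ (proj₁ v)) ((+ 1 , P) ∷ (P , + 1) ∷ []) (((λ e → P≢1 (sym (cong proj₁ e))) ∷ []) ∷ [] ∷ [])
      (Div-in P P≤K (+ 1 , P) d₁ ∷ Div-in P P≤K (P , + 1) d₂ ∷ []) (d₁ ∷ d₂ ∷ []) complete ∙ cong (λ r → + 1 + (val r + + 0)) r₃ where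
    d₁ : Div P (+ 1 , P)
    d₁ = ZP.*-identityˡ P , nn , P⁺
    d₂ : Div P (P , + 1)
    d₂ = ZP.*-identityʳ P , P⁺ , nn
    P≢1 : P ≢ + 1
    P≢1 e = neg1 (subst (λ P → NN (P - + 2)) e P≥2)
    complete : ∀ v → Div P v → v ∈ ((+ 1 , P) ∷ (P , + 1) ∷ [])
    complete (b , c) (q , b⁺ , c⁺) = go (P-split b c b⁺ q) where
      go : (b ≡ + 1 × c ≡ P) ⊎ (b ≡ P × c ≡ + 1) → (b , c) ∈ ((+ 1 , P) ∷ (P , + 1) ∷ [])
      go (inj₁ (e , f)) = here (cong₂ _,_ e f)
      go (inj₂ (e , f)) = there (here (cong₂ _,_ e f))

  -- Four representations in all: once (±x, ±y) are found to be four distinct ones, there is room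
  -- for no other.
  r-P : r P ≡ + 4
  r-P = r≡ρ P P⁺ P≤K ∙ cong₂ (λ b t → + 2 * (ω₂ b * t)) odd-P ρ-P

  g : ℤ → ℤ
  g u = + 2 * (χ u * u) + + 1

  g-neg : ∀ u → g (- u) ≡ g u
  g-neg u = cong (λ t → + 2 * t + + 1) (cong (λ t → t * - u) (χ-neg u) ∙ r338 (χ u) u)

  Sol⁺ Sol⁻ : T² → Set
  Sol⁺ (u , y) = Sol P (u , y) × NN (u - + 1)
  Sol⁻ (u , y) = Sol P (u , y) × NN (- u - + 1)

  Sol⁺? : ∀ v → Dec (Sol⁺ v)
  Sol⁺? (u , y) = Sol? P (u , y) ×-dec NN? (u - + 1)
  Sol⁻? : ∀ v → Dec (Sol⁻ v)
  Sol⁻? (u , y) = Sol? P (u , y) ×-dec NN? (- u - + 1)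

  -- p - 3y² is ≡ 1 (mod 3), so Uspensky's evaluation applies for every y. A negative value counts
  -- as a nonsquare and contributes 0; a square s² contributes once, for u = s > 0.
  sum-at : ∀ y → + 3 * sumV K (P - + 3 * (y * y)) (W³ ω₁) ≡ ∑ I (λ u → when (Sol⁺? (u , y)) (g u))
  sum-at y = go (sqrt? K n) where
    n = P - + 3 * (y * y)
    n≤K : NN (+ K - n)
    n≤K = ≈nn (nn+ P≤K (nn* (nn {3}) (nn² y))) (r210 (+ K) P y)
    n₃′ : res₃ n ≡ i₃
    n₃′ = res₃-sub P (+ 3 * (y * y)) ∙ cong₂ (λ a b → add₃ a (neg₃′ b)) r₃ (res₃-3* (y * y))
    to-n : ∀ u → Sol P (u , y) → u * u ≡ n
    to-n u q = r395 u y P ∙ cong (λ t → t - + 3 * (y * y)) q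
    go : (Σ ℕ λ j → n ≡ + suc j * + suc j) ⊎ (∀ j → suc j ≤ K → + suc j * + suc j ≢ n) → + 3 * sumV K n (W³ ω₁) ≡ ∑ I (λ u → when (Sol⁺? (u , y)) (g u))
    go (inj₂ ns) = cong (λ t → + 3 * t) (Evaluate.sumV-nonsquare₁ K n n≤K n₃′ nsq) ∙ sym (∑-cong I {g = λ _ → + 0} (λ u → when-no (Sol⁺? (u , y)) {g u} (λ h → nsq u (to-n u (proj₁ h)))) ∙ ∑-0 I) where
      nsq : ∀ y → y * y ≢ n
      nsq (+ zero) e = o≢i (cong res₃ e ∙ n₃′) where
        o≢i : o₃ ≢ i₃
        o≢i ()
      nsq (+ suc j) e = ns j (nn⇒≤ {suc j} {K} (nn-mod {g = + K - + suc j} (- (+ 1)) (nn+ n≤K (sq≥ (+ suc j))) e (r105 (+ K) (+ suc j) n))) e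
      nsq -[1+ j ] e = nsq (+ suc j) e
    go (inj₁ (j , n≡)) = fin (+ suc j) refl n≡ where
      fin : ∀ s → s ≡ + suc j → n ≡ s * s → + 3 * sumV K n (W³ ω₁) ≡ ∑ I (λ u → when (Sol⁺? (u , y)) (g u))
      fin s s≡ q = Evaluate.sumV-square₁ K n n≤K n₃′ j s s≡ q ∙ sym (Dom.full (ℤD K) s (proj₁ (Sol-in P P≤K (s , y) sol)) (g s)) ∙ ∑-cong I (λ u → when-⇔ (u ℤ.≟ s) (Sol⁺? (u , y)) {g s} {g u} (λ { refl → sol , s⁺ }) (unique u) (λ e → cong g (sym e))) where
        sol : Sol P (s , y)
        sol = cong (λ t → t + + 3 * (y * y)) (sym q) ∙ r203 P y
        s⁺ : NN (s - + 1)
        s⁺ = subst (λ s → NN (s - + 1)) (sym s≡) (≈nn (nn {j}) (suc-pos j))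
        unique : ∀ u → Sol⁺ (u , y) → u ≡ s
        unique u (h , u⁺) = case± (sq-root± u s (to-n u h ∙ q)) where
          case± : u ≡ s ⊎ u ≡ - s → u ≡ s
          case± (inj₁ e) = e
          case± (inj₂ e) = ⊥-elim (nn-absurd (- (+ 1)) (nn+ (nn+ u⁺ s⁺) (nn {1})) e (r108 u s))

  sum⁺ : + 3 * A ≡ ∑ I (λ y → ∑ I (λ u → when (Sol⁺? (u , y)) (g u)))
  sum⁺ = sym (∑-* I (+ 3) (λ y → sumV K (P - + 3 * (y * y)) (W³ ω₁))) ∙ ∑-cong I sum-at

  all-solutions : + 6 * A ≡ ∑ S² (λ v → when (Sol? P v) (g (proj₁ v)))
  all-solutions = r396 A ∙ cong₂ _+_ sum⁺ (sum⁺ ∙ ∑-cong I flip) ∙ sym (∑-+ I (λ y → ∑ I (λ u → when (Sol⁺? (u , y)) (g u))) (λ y → ∑ I (λ u → when (Sol⁻? (u , y)) (g u)))) ∙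
      ∑-cong I (λ y → sym (∑-+ I (λ u → when (Sol⁺? (u , y)) (g u)) (λ u → when (Sol⁻? (u , y)) (g u))) ∙ ∑-cong I (λ u → pt u y)) ∙ ∑-swap I I (λ y u → when (Sol? P (u , y)) (g u)) ∙ sym (∑² (λ v → when (Sol? P v) (g (proj₁ v)))) where
    flip : ∀ y → ∑ I (λ u → when (Sol⁺? (u , y)) (g u)) ≡ ∑ I (λ u → when (Sol⁻? (u , y)) (g u))
    flip y = ∑-cong I (λ u → when-⇔ (Sol⁺? (u , y)) (Sol⁻? (- u , y)) {g u} {g (- u)} (λ { (q , h) → r212 u y ∙ q , ≈nn h (r397 u) }) (λ { (q , h) → sym (r212 u y) ∙ q , ≈nn h (sym (r397 u)) }) (λ _ → sym (g-neg u))) ∙ ∑-ints-neg K (λ u → when (Sol⁻? (u , y)) (g u))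
    pt : ∀ u y → when (Sol⁺? (u , y)) (g u) + when (Sol⁻? (u , y)) (g u) ≡ when (Sol? P (u , y)) (g u)
    pt u y = go (Sol? P (u , y)) (NN? (u - + 1)) (NN? (- u - + 1)) where
      nonzero : Sol P (u , y) → u ≢ + 0
      nonzero q z = o≢i (sym (res₃-3* (y * y)) ∙ cong res₃ (sym (ZP.+-identityˡ (+ 3 * (y * y))) ∙ cong (λ u → u * u + + 3 * (y * y)) (sym z) ∙ q) ∙ r₃) where
        o≢i : o₃ ≢ i₃
        o≢i ()
      go : ∀ (d : Dec (Sol P (u , y))) (e : Dec (NN (u - + 1))) (f : Dec (NN (- u - + 1))) → when (d ×-dec e) (g u) + when (d ×-dec f) (g u) ≡ when d (g u)
      go (no _) (yes _) (yes _) = refl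
      go (no _) (yes _) (no _) = refl
      go (no _) (no _) (yes _) = refl
      go (no _) (no _) (no _) = refl
      go (yes _) (yes p) (yes q) = ⊥-elim (nn-neg⊥ u (nn1 u p) q)
      go (yes _) (yes _) (no _) = ZP.+-identityʳ (g u)
      go (yes _) (no _) (yes _) = ZP.+-identityˡ (g u)
      go (yes q) (no n) (no n′) = ⊥-elim (none± (tri u)) where
        none± : Tri u → ⊥
        none± (pos h) = n h
        none± (zer h) = nonzero q h
        none± (neg h) = n′ h

  module Unique (x y : ℤ) (sol : Sol P (x , y)) where

    Near : T² → Set
    Near (u , _) = u * u ≡ x * x
    Near? : ∀ v → Dec (Near v)
    Near? (u , _) = u * u ℤ.≟ x * x

    R : List T²
    R = (x , y) ∷ (x , - y) ∷ (- x , y) ∷ (- x , - y) ∷ []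

    self-neg : ∀ x → x ≡ - x → x ≡ + 0
    self-neg x e = double-0 x (cong (λ t → x + t) e ∙ r183 x)

    x≢0 : x ≢ + 0
    x≢0 z = o≢i (sym (res₃-3* (y * y)) ∙ cong res₃ (sym (ZP.+-identityˡ (+ 3 * (y * y))) ∙ cong (λ u → u * u + + 3 * (y * y)) (sym z) ∙ sol) ∙ r₃) where
      o≢i : o₃ ≢ i₃
      o≢i ()

    y≢0 : y ≢ + 0
    y≢0 z = go (tri x) where
      x² : x * x ≡ P
      x² = sym (ZP.+-identityʳ (x * x)) ∙ cong (λ y → x * x + + 3 * (y * y)) (sym z) ∙ sol
      clash : ∀ u → NN (u - + 1) → u * u ≡ P → ⊥
      clash u u⁺ q = split (P-split u u u⁺ q) where
        split : (u ≡ + 1 × u ≡ P) ⊎ (u ≡ P × u ≡ + 1) → ⊥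
        split (inj₁ (e , f)) = neg1 (subst (λ P → NN (P - + 2)) (sym f ∙ e) P≥2)
        split (inj₂ (e , f)) = neg1 (subst (λ P → NN (P - + 2)) (sym e ∙ f) P≥2)
      go : Tri x → ⊥
      go (pos h) = clash x h x²
      go (zer h) = x≢0 h
      go (neg h) = clash (- x) h (r15 x ∙ x²)

    sols : Sol P (x , - y) × Sol P (- x , y) × Sol P (- x , - y)
    sols = r211 x y ∙ sol , r212 x y ∙ sol , r213 x y ∙ sol

    -- The four sign choices are distinct because neither x nor y vanishes: p is not divisible by 3
    -- and is not a square.
    near-sum : ∀ f → ∑ S² (λ v → when (Sol? P v ×-dec Near? v) (f v)) ≡ ∑ R f
    near-sum f = ∑-enum (square² K) (λ v → Sol? P v ×-dec Near? v) f R
      (((λ e → y≢0 (self-neg y (cong proj₂ e))) ∷ (λ e → x≢0 (self-neg x (cong proj₁ e))) ∷ (λ e → x≢0 (self-neg x (cong proj₁ e))) ∷ [])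
        ∷ ((λ e → x≢0 (self-neg x (cong proj₁ e))) ∷ (λ e → x≢0 (self-neg x (cong proj₁ e))) ∷ []) ∷ ((λ e → y≢0 (self-neg y (cong proj₂ e))) ∷ []) ∷ [] ∷ [])
      (Sol-in P P≤K (x , y) sol ∷ Sol-in P P≤K (x , - y) (proj₁ sols) ∷ Sol-in P P≤K (- x , y) (proj₁ (proj₂ sols)) ∷ Sol-in P P≤K (- x , - y) (proj₂ (proj₂ sols)) ∷ [])
      ((sol , refl) ∷ (proj₁ sols , refl) ∷ (proj₁ (proj₂ sols) , r15 x) ∷ (proj₂ (proj₂ sols) , r15 x) ∷ [])
      complete where
      complete : ∀ v → Sol P v × Near v → v ∈ R
      complete (u , z) (s , n) = go (sq-root± u x n) (sq-root± z y (three-inj (z * z) (y * y) 3z)) where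
        3z : + 3 * (z * z) ≡ + 3 * (y * y)
        3z = r109 u z ∙ cong₂ (λ a b → a - b) (s ∙ sym sol) n ∙ r110 x y
        go : u ≡ x ⊎ u ≡ - x → z ≡ y ⊎ z ≡ - y → (u , z) ∈ R
        go (inj₁ e) (inj₁ f) = here (cong₂ _,_ e f)
        go (inj₁ e) (inj₂ f) = there (here (cong₂ _,_ e f))
        go (inj₂ e) (inj₁ f) = there (there (here (cong₂ _,_ e f)))
        go (inj₂ e) (inj₂ f) = there (there (there (here (cong₂ _,_ e f))))

    split : ∀ f → ∑ S² (λ v → when (Sol? P v) (f v)) ≡ ∑ R f + ∑ S² (λ v → when (Sol? P v ×-dec ¬? (Near? v)) (f v))
    split f = ∑-cong S² (λ v → go (Sol? P v) (Near? v) (f v)) ∙ ∑-+ S² (λ v → when (Sol? P v ×-dec Near? v) (f v)) (λ v → when (Sol? P v ×-dec ¬? (Near? v)) (f v)) ∙ cong (λ t → t + ∑ S² (λ v → when (Sol? P v ×-dec ¬? (Near? v)) (f v))) (near-sum f) where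
      go : ∀ {X Y : Set} (d : Dec X) (e : Dec Y) x → when d x ≡ when (d ×-dec e) x + when (d ×-dec ¬? e) x
      go (yes _) (yes _) x = sym (ZP.+-identityʳ x)
      go (yes _) (no _) x = sym (ZP.+-identityˡ x)
      go (no _) (yes _) x = refl
      go (no _) (no _) x = refl

    -- The four known solutions already exhaust r(p) = 4. As a count is nonnegative termwise,
    -- `∑-null` then discards every weighted sum over the remaining solutions.
    no-more : ∑ S² (λ v → when (Sol? P v ×-dec ¬? (Near? v)) (+ 1)) ≡ + 0
    no-more = cancel4 (∑ S² (λ v → when (Sol? P v ×-dec ¬? (Near? v)) (+ 1))) (sym (split (λ _ → + 1)) ∙ r-P) where
      cancel4 : ∀ s → + 4 + s ≡ + 4 → s ≡ + 0
      cancel4 s e = r111 s ∙ cong (λ t → t - + 4) e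

    -- This is 6 (ρ(p) + U) = 6 A = 4 (2 χ(x) x + 1) with ρ(p) = 2, divided by 2.
    3U : + 3 * U ≡ + 4 * (χ x * x) - + 4
    3U = double-inj (+ 3 * U) (+ 4 * (χ x * x) - + 4) (r214 U ∙ cong (λ t → + 6 * (t + U) - + 12) (sym ρ-P) ∙ cong (λ t → + 6 * t - + 12) (sym A-U) ∙ cong (λ t → t - + 12) all-solutions ∙
        cong (λ t → t - + 12) (split (λ v → g (proj₁ v)) ∙ cong₂ (λ a b → g x + (g x + (a + (a + + 0))) + b) (g-neg x) (∑-null (λ v → Sol? P v ×-dec ¬? (Near? v)) (λ v → g (proj₁ v)) S² no-more)) ∙ r215 (χ x * x))

-- The four total sums and the separation of classes modulo 6

alt : ℤ → ℤ
alt t = sgB (par t)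

3Σf₃ : ∀ m → + 3 * Σ1 m f₃ ≡ + 1 * + m + table (+ 0) (- (+ 1)) (- (+ 2)) (+ 0) (- (+ 1)) (- (+ 2)) (res₃ (+ m)) (par (+ m))
3Σf₃ = periodic-sum (λ r _ → is0 r) c (+ 1) (six (λ r b → c r b + + 3 * is0 (add₃ i₃ r) ≡ + 1 + c (add₃ i₃ r) (not b)) refl refl refl refl refl refl) refl where
  c = table (+ 0) (- (+ 1)) (- (+ 2)) (+ 0) (- (+ 1)) (- (+ 2))

3Σf₆ : ∀ m → + 3 * Σ1 m f₆ ≡ + 0 * + m + table (+ 0) (+ 0) (+ 0) (- (+ 3)) (- (+ 3)) (- (+ 3)) (res₃ (+ m)) (par (+ m))
3Σf₆ = periodic-sum (λ r b → sgB b * is0 r) c (+ 0) (six (λ r b → c r b + + 3 * (sgB (not b) * is0 (add₃ i₃ r)) ≡ + 0 + c (add₃ i₃ r) (not b)) refl refl refl refl refl refl) refl where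
  c = table (+ 0) (+ 0) (+ 0) (- (+ 3)) (- (+ 3)) (- (+ 3))

3Σalt : ∀ m → + 3 * Σ1 m alt ≡ + 0 * + m + table (+ 0) (- (+ 3)) (+ 0) (- (+ 3)) (+ 0) (- (+ 3)) (res₃ (+ m)) (par (+ m))
3Σalt = periodic-sum (λ _ b → sgB b) c (+ 0) (six (λ r b → c r b + + 3 * sgB (not b) ≡ + 0 + c (add₃ i₃ r) (not b)) refl refl refl refl refl refl) refl where
  c = table (+ 0) (- (+ 3)) (+ 0) (- (+ 3)) (+ 0) (- (+ 3))

module Totals (k : ℕ) (pr : Prime (suc (suc k))) (K : ℕ) (P : ℤ) (P≡ : P ≡ + suc (suc k)) (P≥2 : NN (P - + 2)) (K-big : NN (+ K - P - P - P))
  (B : ℕ) (2K≤B : K ℕ.+ K ≤ B) (odd-P : par P ≡ true) where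

  p : ℕ
  p = suc (suc k)

  open Total k pr K P P≡ P≥2 K-big B 2K≤B using (Pt; Pt-neg; total; sumS; sumS-cong; dif; tot; k′≡)
  open Symm p pr K P P≡ P≥2 K-big using (W; Q; U; L₃; L₆; even-vanishes; L₃-1; L₆-1; L₃-2; L₆-2; sumS--)
  open Liouville k pr K P P≡ P≥2 K-big using (liouville)

  T : (ℤ → ℤ) → ℤ
  T f = ∑ (ints p) (λ t → f t * Pt t)

  Lf : (ℤ → ℤ) → ℤ
  Lf f = sumS (λ q → f (dif q)) - sumS (λ q → f (tot q))

  T≡ : ∀ f → (∀ t → f (- t) ≡ f t) → ∀ v w → f (P + + 1) ≡ v → f P ≡ w →
    + 3 * T f ≡ + 6 * Lf f + + 6 * (P - + 1 + (P - + 2)) * v + + 18 * f (+ 0) + + 8 * (+ 3 * Σ1 p f) + + 6 * f (+ 1) - + 6 * w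
  T≡ f ev v w refl refl = cong (λ t → + 3 * t) (total f ev) ∙ r398 (sumS (λ q → f (dif q))) (sumS (λ q → f (tot q))) (P - + 1 + (P - + 2)) (f (P + + 1)) (f (+ 0)) (Σ1 p f) (f (+ 1)) (f P)

  par-P+1 : par (P + + 1) ≡ false
  par-P+1 = par-+ P (+ 1) ∙ cong (λ b → xor b true) odd-P

  par-p : par (+ p) ≡ true
  par-p = cong par (sym P≡) ∙ odd-P

  par-k′ : par (+ suc k) ≡ false
  par-k′ = cong par k′≡ ∙ par-sub P (+ 1) ∙ cong (λ b → xor b true) odd-P

  -- The Hurwitz-Kronecker relation for a prime: with the factor 6 removed, it says that H(4p - t²)
  -- sums to 2p over all t.
  T-one : T (λ _ → + 1) ≡ + 12 * P
  T-one = three-inj (T (λ _ → + 1)) (+ 12 * P) (T≡ (λ _ → + 1) (λ _ → refl) (+ 1) (+ 1) refl refl ∙ cong₂ (λ a b → + 6 * a + + 6 * (P - + 1 + (P - + 2)) * + 1 + + 18 + + 8 * (+ 3 * b) + + 6 - + 6) (even-vanishes (λ _ → + 1)) (Σ1-const p ∙ sym P≡) ∙ r399 P)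

  T-alt : T alt ≡ + 4 * P - + 8
  T-alt = three-inj (T alt) (+ 4 * P - + 8) (T≡ alt (λ t → cong sgB (par-neg t)) (+ 1) (- (+ 1)) (cong sgB par-P+1) (cong sgB odd-P) ∙ cong₂ (λ a b → + 6 * a + + 6 * (P - + 1 + (P - + 2)) * + 1 + + 18 + + 8 * b + - (+ 6) - + 6 * - (+ 1)) (even-vanishes sgB) (3Σalt p ∙ cong (λ b → + 0 * + p + table (+ 0) (- (+ 3)) (+ 0) (- (+ 3)) (+ 0) (- (+ 3)) (res₃ (+ p)) b) par-p ∙ go (res₃ (+ p))) ∙ r400 P) where
    go : ∀ r → + 0 * + p + table (+ 0) (- (+ 3)) (+ 0) (- (+ 3)) (+ 0) (- (+ 3)) r true ≡ - (+ 3)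
    go o₃ = refl
    go i₃ = refl
    go j₃ = refl

  W≡ : + 3 * W ≡ + 3 * ((P - + 1) + + 2 * ((P - + 1) * + 0) - + 2 * Σ1 (suc k) f₃ - (P - + 1) * f₃ P)
  W≡ = cong (λ t → + 3 * t) ((sumS-cong (λ { (a , b , c , d) _ → sym (is0-χ (res₃ a) (res₃ b)) ∙ sym (cong₂ (λ x y → is0 x - is0 y) (res₃-sub a b) (res₃-+ a b)) }) ∙ sumS-- (λ { (a , b , c , d) → f₃ (a - b) }) (λ { (a , b , c , d) → f₃ (a + b) })) ∙
    liouville f₃ f₃-even ∙ cong (λ t → t + + 2 * ((P - + 1) * + 0) - + 2 * Σ1 (suc k) f₃ - (P - + 1) * f₃ P) (ZP.*-identityʳ (P - + 1)))

  Q≡ : + 3 * Q ≡ + 3 * ((P - + 1) + + 2 * ((P - + 1) * + 0) - + 2 * Σ1 (suc k) f₆ - (P - + 1) * f₆ P)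
  Q≡ = cong (λ t → + 3 * t) ((sumS-cong (λ { (a , b , c , d) _ → pt a b }) ∙ sumS-- (λ { (a , b , c , d) → f₆ (a - b) }) (λ { (a , b , c , d) → f₆ (a + b) })) ∙
    liouville f₆ f₆-even ∙ cong (λ t → t + + 2 * ((P - + 1) * + 0) - + 2 * Σ1 (suc k) f₆ - (P - + 1) * f₆ P) (ZP.*-identityʳ (P - + 1))) where
    pt : ∀ a b → sgB (xor (par a) (par b)) * (χ a * χ b) ≡ f₆ (a - b) - f₆ (a + b)
    pt a b = cong (λ t → sgB (xor (par a) (par b)) * t) (sym (is0-χ (res₃ a) (res₃ b)) ∙ sym (cong₂ (λ x y → is0 x - is0 y) (res₃-sub a b) (res₃-+ a b))) ∙
      r328 (sgB (xor (par a) (par b))) (f₃ (a - b)) (f₃ (a + b)) ∙ sym (cong₂ (λ x y → sgB x * f₃ (a - b) - sgB y * f₃ (a + b)) (par-sub a b) (par-+ a b))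

  module One (r₃ : res₃ P ≡ i₃) where

    at-P+1 : res₃ (P + + 1) ≡ j₃
    at-P+1 = res₃-+ P (+ 1) ∙ cong (λ r → add₃ r i₃) r₃
    at-p : res₃ (+ p) ≡ i₃
    at-p = cong res₃ (sym P≡) ∙ r₃
    at-k′ : res₃ (+ suc k) ≡ o₃
    at-k′ = cong res₃ k′≡ ∙ res₃-sub P (+ 1) ∙ cong (λ r → add₃ r j₃) r₃

    T-f₃ : T f₃ ≡ + 3 * (P + + 1)
    T-f₃ = three-inj (T f₃) (+ 3 * (P + + 1)) (T≡ f₃ f₃-even (+ 0) (+ 0) (cong is0 at-P+1) (cong is0 r₃) ∙ cong₂ (λ a b → a + + 6 * (P - + 1 + (P - + 2)) * + 0 + + 18 + + 8 * b + + 0 - + 0) 6L Σp ∙ r218 P) where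
      Σp : + 3 * Σ1 p f₃ ≡ P - + 1
      Σp = 3Σf₃ p ∙ cong₂ (λ r b → + 1 * + p + table (+ 0) (- (+ 1)) (- (+ 2)) (+ 0) (- (+ 1)) (- (+ 2)) r b) at-p par-p ∙ cong (λ t → + 1 * t + - (+ 1)) (sym P≡) ∙ cong (λ t → t - + 1) (ZP.*-identityˡ P)
      Σk : + 3 * Σ1 (suc k) f₃ ≡ P - + 1
      Σk = 3Σf₃ (suc k) ∙ cong₂ (λ r b → + 1 * + suc k + table (+ 0) (- (+ 1)) (- (+ 2)) (+ 0) (- (+ 1)) (- (+ 2)) r b) at-k′ par-k′ ∙ cong (λ t → + 1 * t + + 0) k′≡ ∙ ZP.+-identityʳ (+ 1 * (P - + 1)) ∙ ZP.*-identityˡ (P - + 1)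
      6L : + 6 * Lf f₃ ≡ + 3 * (P - + 1) - + 2 * (P - + 1)
      6L = r217 (Lf f₃) ∙ cong (λ t → + 3 * t) (L₃-1 odd-P r₃) ∙ W≡ ∙ cong (λ t → + 3 * ((P - + 1) + + 2 * ((P - + 1) * + 0) - + 2 * Σ1 (suc k) f₃ - (P - + 1) * is0 t)) r₃ ∙ r216 P (Σ1 (suc k) f₃) ∙ cong (λ t → + 3 * (P - + 1) - + 2 * t) Σk

    T-f₆ : ∀ X → + 3 * U ≡ + 4 * X - + 4 → T f₆ ≡ + 4 * X + P + + 1
    T-f₆ X 3U≡ = three-inj (T f₆) (+ 4 * X + P + + 1) (T≡ f₆ f₆-even (+ 0) (+ 0) (cong₂ (λ b r → sgB b * is0 r) par-P+1 at-P+1) (cong₂ (λ b r → sgB b * is0 r) odd-P r₃) ∙ cong₂ (λ a b → a + + 6 * (P - + 1 + (P - + 2)) * + 0 + + 18 + + 8 * b + + 0 - + 0) 6L Σp ∙ r220 X P) where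
      Σp : + 3 * Σ1 p f₆ ≡ + 0
      Σp = 3Σf₆ p ∙ cong₂ (λ r b → + 0 * + p + table (+ 0) (+ 0) (+ 0) (- (+ 3)) (- (+ 3)) (- (+ 3)) r b) at-p par-p
      Σk : + 3 * Σ1 (suc k) f₆ ≡ + 0
      Σk = 3Σf₆ (suc k) ∙ cong₂ (λ r b → + 0 * + suc k + table (+ 0) (+ 0) (+ 0) (- (+ 3)) (- (+ 3)) (- (+ 3)) r b) at-k′ par-k′
      3Q : + 3 * Q ≡ + 3 * (P - + 1) - + 2 * + 0
      3Q = Q≡ ∙ cong₂ (λ b t → + 3 * ((P - + 1) + + 2 * ((P - + 1) * + 0) - + 2 * Σ1 (suc k) f₆ - (P - + 1) * (sgB b * is0 t))) odd-P r₃ ∙ r216 P (Σ1 (suc k) f₆) ∙ cong (λ t → + 3 * (P - + 1) - + 2 * t) Σk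
      6L : + 6 * Lf f₆ ≡ + 3 * (+ 4 * X - + 4) + (+ 3 * (P - + 1) - + 2 * + 0)
      6L = r217 (Lf f₆) ∙ cong (λ t → + 3 * t) (L₆-1 odd-P r₃) ∙ r219 U Q ∙ cong₂ (λ a b → + 3 * a + b) 3U≡ 3Q

  module Two (r₃ : res₃ P ≡ j₃) where

    at-P+1 : res₃ (P + + 1) ≡ o₃
    at-P+1 = res₃-+ P (+ 1) ∙ cong (λ r → add₃ r i₃) r₃
    at-p : res₃ (+ p) ≡ j₃
    at-p = cong res₃ (sym P≡) ∙ r₃
    at-k′ : res₃ (+ suc k) ≡ i₃
    at-k′ = cong res₃ k′≡ ∙ res₃-sub P (+ 1) ∙ cong (λ r → add₃ r j₃) r₃
    l6 : ∀ x → + 6 * - x ≡ - (+ 2) * (+ 3 * x)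
    l6 = ring
    lw : ∀ P s → + 3 * ((P - + 1) + + 2 * ((P - + 1) * + 0) - + 2 * s - (P - + 1) * + 0) ≡ + 3 * (P - + 1) - + 2 * (+ 3 * s)
    lw = ring

    T-f₃ : T f₃ ≡ + 6 * P - + 6
    T-f₃ = three-inj (T f₃) (+ 6 * P - + 6) (T≡ f₃ f₃-even (+ 1) (+ 0) (cong is0 at-P+1) (cong is0 r₃) ∙ cong₂ (λ a b → a + + 6 * (P - + 1 + (P - + 2)) * + 1 + + 18 + + 8 * b + + 0 - + 0) 6L Σp ∙ r221 P) where
      Σp : + 3 * Σ1 p f₃ ≡ + 1 * P + - (+ 2)
      Σp = 3Σf₃ p ∙ cong₂ (λ r b → + 1 * + p + table (+ 0) (- (+ 1)) (- (+ 2)) (+ 0) (- (+ 1)) (- (+ 2)) r b) at-p par-p ∙ cong (λ t → + 1 * t + - (+ 2)) (sym P≡)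
      Σk : + 3 * Σ1 (suc k) f₃ ≡ + 1 * (P - + 1) + - (+ 1)
      Σk = 3Σf₃ (suc k) ∙ cong₂ (λ r b → + 1 * + suc k + table (+ 0) (- (+ 1)) (- (+ 2)) (+ 0) (- (+ 1)) (- (+ 2)) r b) at-k′ par-k′ ∙ cong (λ t → + 1 * t + - (+ 1)) k′≡
      6L : + 6 * Lf f₃ ≡ - (+ 2) * (+ 3 * (P - + 1) - + 2 * (+ 1 * (P - + 1) + - (+ 1)))
      6L = cong (λ t → + 6 * t) (L₃-2 odd-P r₃) ∙ l6 W ∙ cong (λ t → - (+ 2) * t) (W≡ ∙ cong (λ t → + 3 * ((P - + 1) + + 2 * ((P - + 1) * + 0) - + 2 * Σ1 (suc k) f₃ - (P - + 1) * is0 t)) r₃ ∙ lw P (Σ1 (suc k) f₃) ∙ cong (λ t → + 3 * (P - + 1) - + 2 * t) Σk)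

    T-f₆ : T f₆ ≡ + 2 * P - + 10
    T-f₆ = three-inj (T f₆) (+ 2 * P - + 10) (T≡ f₆ f₆-even (+ 1) (+ 0) (cong₂ (λ b r → sgB b * is0 r) par-P+1 at-P+1) (cong₂ (λ b r → sgB b * is0 r) odd-P r₃) ∙ cong₂ (λ a b → a + + 6 * (P - + 1 + (P - + 2)) * + 1 + + 18 + + 8 * b + + 0 - + 0) 6L Σp ∙ r222 P) where
      Σp : + 3 * Σ1 p f₆ ≡ - (+ 3)
      Σp = 3Σf₆ p ∙ cong₂ (λ r b → + 0 * + p + table (+ 0) (+ 0) (+ 0) (- (+ 3)) (- (+ 3)) (- (+ 3)) r b) at-p par-p
      Σk : + 3 * Σ1 (suc k) f₆ ≡ - (+ 3)
      Σk = 3Σf₆ (suc k) ∙ cong₂ (λ r b → + 0 * + suc k + table (+ 0) (+ 0) (+ 0) (- (+ 3)) (- (+ 3)) (- (+ 3)) r b) at-k′ par-k′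
      6L : + 6 * Lf f₆ ≡ - (+ 2) * (+ 3 * (P - + 1) - + 2 * - (+ 3))
      6L = cong (λ t → + 6 * t) (L₆-2 odd-P r₃) ∙ l6 Q ∙ cong (λ t → - (+ 2) * t) (Q≡ ∙ cong₂ (λ b t → + 3 * ((P - + 1) + + 2 * ((P - + 1) * + 0) - + 2 * Σ1 (suc k) f₆ - (P - + 1) * (sgB b * is0 t))) odd-P r₃ ∙ lw P (Σ1 (suc k) f₆) ∙ cong (λ t → + 3 * (P - + 1) - + 2 * t) Σk)

  -- The four even test functions separate the classes of t modulo 6 up to sign.
  class : F₃ → Bool → ℤ
  class r b = T (λ t → bit (eq₃ (res₃ t) r ∧ not (xor (par t) b)))

  class-neg : ∀ r b → class (neg₃′ r) b ≡ class r b
  class-neg r b = sym (∑-ints-neg p (λ t → bit (eq₃ (res₃ t) (neg₃′ r) ∧ not (xor (par t) b)) * Pt t)) ∙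
      ∑-cong (ints p) (λ t → cong₂ _*_ (cong₂ (λ s c → bit (eq₃ s (neg₃′ r) ∧ not (xor c b))) (res₃-neg t) (par-neg t) ∙ cong (λ e → bit (e ∧ not (xor (par t) b))) (eq-neg (res₃ t) r)) (Pt-neg t)) where
    eq-neg : ∀ s r → eq₃ (neg₃′ s) (neg₃′ r) ≡ eq₃ s r
    eq-neg o₃ o₃ = refl
    eq-neg o₃ i₃ = refl
    eq-neg o₃ j₃ = refl
    eq-neg i₃ o₃ = refl
    eq-neg i₃ i₃ = refl
    eq-neg i₃ j₃ = refl
    eq-neg j₃ o₃ = refl
    eq-neg j₃ i₃ = refl
    eq-neg j₃ j₃ = refl

  T-cong : ∀ f g → (∀ t → f t ≡ g t) → T f ≡ T g
  T-cong f g h = ∑-cong (ints p) (λ t → cong (λ x → x * Pt t) (h t))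

  T-+ : ∀ f g → T (λ t → f t + g t) ≡ T f + T g
  T-+ f g = ∑-cong (ints p) (λ t → ZP.*-distribʳ-+ (Pt t) (f t) (g t)) ∙ ∑-+ (ints p) (λ t → f t * Pt t) (λ t → g t * Pt t)

  T-* : ∀ k f → T (λ t → k * f t) ≡ k * T f
  T-* k f = ∑-cong (ints p) (λ t → ZP.*-assoc k (f t) (Pt t)) ∙ ∑-* (ints p) k (λ t → f t * Pt t)

  in-class : F₃ → Bool → F₃ → Bool → ℤ
  in-class r b s c = bit (eq₃ s r ∧ not (xor c b))

  -- A weight modulo 6 has six values, but negation identifies the classes with t ≡ 2 and t ≡ 1 (mod
  -- 3) of equal parity, so four class sums suffice.
  T-classes : ∀ (w : F₃ → Bool → ℤ) → T (λ t → w (res₃ t) (par t)) ≡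
    w o₃ false * class o₃ false + (w o₃ true * class o₃ true + (w i₃ false * class i₃ false + (w i₃ true * class i₃ true + (w j₃ false * class i₃ false + w j₃ true * class i₃ true))))
  T-classes w = T-cong (λ t → w (res₃ t) (par t)) (λ t → g (res₃ t) (par t)) (λ t → pt (res₃ t) (par t)) ∙
      add o₃ false (add o₃ true (add i₃ false (add i₃ true (add j₃ false (last j₃ true)))))
     where
    u : F₃ → Bool → F₃ → Bool → ℤ
    u r b s c = w r b * in-class r b s c
    g : F₃ → Bool → ℤ
    g s c = u o₃ false s c + (u o₃ true s c + (u i₃ false s c + (u i₃ true s c + (u j₃ false s c + u j₃ true s c))))
    pt : ∀ s c → w s c ≡ g s c
    pt o₃ false = r401 (w o₃ false) (w o₃ true) (w i₃ false) (w i₃ true) (w j₃ false) (w j₃ true)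
    pt o₃ true  = r402 (w o₃ false) (w o₃ true) (w i₃ false) (w i₃ true) (w j₃ false) (w j₃ true)
    pt i₃ false = r403 (w o₃ false) (w o₃ true) (w i₃ false) (w i₃ true) (w j₃ false) (w j₃ true)
    pt i₃ true  = r404 (w o₃ false) (w o₃ true) (w i₃ false) (w i₃ true) (w j₃ false) (w j₃ true)
    pt j₃ false = r405 (w o₃ false) (w o₃ true) (w i₃ false) (w i₃ true) (w j₃ false) (w j₃ true)
    pt j₃ true  = r406 (w o₃ false) (w o₃ true) (w i₃ false) (w i₃ true) (w j₃ false) (w j₃ true)
    rep : F₃ → F₃
    rep j₃ = i₃
    rep r  = r
    same : ∀ r b → class r b ≡ class (rep r) b
    same o₃ b = refl
    same i₃ b = refl
    same j₃ b = class-neg i₃ b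
    last : ∀ r b → T (λ t → u r b (res₃ t) (par t)) ≡ w r b * class (rep r) b
    last r b = T-* (w r b) (λ t → in-class r b (res₃ t) (par t)) ∙ cong (λ x → w r b * x) (same r b)
    add : ∀ r b {h : ℤ → ℤ} {x} → T h ≡ x → T (λ t → u r b (res₃ t) (par t) + h t) ≡ w r b * class (rep r) b + x
    add r b {h} e = T-+ (λ t → u r b (res₃ t) (par t)) h ∙ cong₂ _+_ (last r b) e

  module _ where
    -- The sums over t congruent to 0, 3, 4 and 1 modulo 6, in this order; 2 and 5 are the negatives
    -- of the last two.
    a b c d : ℤ
    a = class o₃ false
    b = class o₃ true
    c = class i₃ false
    d = class i₃ true

    T-one-classes : a + b + + 2 * c + + 2 * d ≡ T (λ _ → + 1)
    T-one-classes = r223 a b c d ∙ sym (T-classes (λ _ _ → + 1))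
    T-alt-classes : a - b + + 2 * c - + 2 * d ≡ T alt
    T-alt-classes = r224 a b c d ∙ sym (T-classes (λ _ b → sgB b))
    T-f₃-classes : a + b ≡ T f₃
    T-f₃-classes = r225 a b c d ∙ sym (T-classes (λ r _ → is0 r))
    T-f₆-classes : a - b ≡ T f₆
    T-f₆-classes = r226 a b c d ∙ sym (T-classes (λ r b → sgB b * is0 r))

    -- Everything is doubled or quadrupled, so that no division occurs.
    solved : ∀ t₁ t₂ t₃ t₆ → T (λ _ → + 1) ≡ t₁ → T alt ≡ t₂ → T f₃ ≡ t₃ → T f₆ ≡ t₆ →
      + 2 * a ≡ t₃ + t₆ × + 2 * b ≡ t₃ - t₆ × + 4 * c ≡ t₁ + t₂ - t₃ - t₆ × + 4 * d ≡ t₁ - t₂ - t₃ + t₆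
    solved t₁ t₂ t₃ t₆ e₁ e₂ e₃ e₆ =
        trans (r227 a b) (cong₂ _+_ q₃ q₆)
      , r228 a b ∙ cong₂ _-_ q₃ q₆
      , r229 a b c d ∙ cong₂ _-_ (cong₂ _-_ (cong₂ _+_ q₁ q₂) q₃) q₆
      , r230 a b c d ∙ cong₂ _+_ (cong₂ _-_ (cong₂ _-_ q₁ q₂) q₃) q₆ where
      q₁ = T-one-classes ∙ e₁
      q₂ = T-alt-classes ∙ e₂
      q₃ = T-f₃-classes ∙ e₃
      q₆ = T-f₆-classes ∙ e₆

-- From the definition of the class number sum to integer sums

χ₋₃≡χ : ∀ x → χ₋₃ x ≡ χ x
χ₋₃≡χ x with x %ℕ 3
... | 0 = refl
... | 1 = refl
... | suc (suc _) = refl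

-- The step function is local to `Hmod`; the existential lets unification supply it, so that its two
-- cases can be stated.
Hmod-step : ∀ Hf m n → Σ (ℤ → ℚ → ℚ) λ step → Hmod Hf m 6 n ≡ foldr step ℚ.0ℚ (tRange n)
Hmod-step Hf m n = _ , refl

Hmod-step-yes : ∀ Hf m n t acc → (t - m) %ℕ 6 ≡ 0 → proj₁ (Hmod-step Hf m n) t acc ≡ Hℤ Hf (+ (4 ℕ.* n) - t * t) ℚ.+ acc
Hmod-step-yes Hf m n t acc e with (t - m) %ℕ 6 ℕ.≟ 0
... | yes _ = refl
... | no h  = ⊥-elim (h e)

Hmod-step-no : ∀ Hf m n t acc → (t - m) %ℕ 6 ≢ 0 → proj₁ (Hmod-step Hf m n) t acc ≡ acc
Hmod-step-no Hf m n t acc e with (t - m) %ℕ 6 ℕ.≟ 0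
... | yes h = ⊥-elim (e h)
... | no _  = refl

module _ (Hf : ℕ → ℚ) (m : ℤ) (n : ℕ) (g : ℤ → ℤ) (Hg : ∀ t → Hℤ Hf (+ (4 ℕ.* n) - t * t) ≡ g t ℚ./ 6) where

  fold-sum : ∀ L → foldr (proj₁ (Hmod-step Hf m n)) ℚ.0ℚ L ≡ ∑ L (λ t → when ((t - m) %ℕ 6 ℕ.≟ 0) (g t)) ℚ./ 6
  fold-sum []      = refl
  fold-sum (t ∷ L) = go ((t - m) %ℕ 6 ℕ.≟ 0) where
    S = ∑ L (λ t → when ((t - m) %ℕ 6 ℕ.≟ 0) (g t))
    acc = foldr (proj₁ (Hmod-step Hf m n)) ℚ.0ℚ L
    go : (d : Dec ((t - m) %ℕ 6 ≡ 0)) → proj₁ (Hmod-step Hf m n) t acc ≡ (when d (g t) + S) ℚ./ 6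
    go (yes e) = Hmod-step-yes Hf m n t acc e ∙ cong₂ ℚ._+_ (Hg t) (fold-sum L) ∙ /6-+ (g t) S
    go (no e)  = Hmod-step-no Hf m n t acc e ∙ fold-sum L ∙ cong (λ s → s ℚ./ 6) (sym (ZP.+-identityˡ S))

  Hmod-sum : Hmod Hf m 6 n ≡ ∑ (tRange n) (λ t → when ((t - m) %ℕ 6 ℕ.≟ 0) (g t)) ℚ./ 6
  Hmod-sum = proj₂ (Hmod-step Hf m n) ∙ fold-sum (tRange n)

∑-snoc : ∀ (h : ℕ → ℤ) n (f : ℤ → ℤ) → ∑ (applyUpTo h (suc n)) f ≡ ∑ (applyUpTo h n) f + f (h n)
∑-snoc h zero    f = ZP.+-comm (f (h 0)) (+ 0)
∑-snoc h (suc n) f = cong (λ s → f (h 0) + s) (∑-snoc (λ i → h (suc i)) n f) ∙ sym (ZP.+-assoc (f (h 0)) (∑ (applyUpTo (λ i → h (suc i)) n) f) (f (h (suc n))))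

∑-applyUpTo-cong : ∀ (h h′ : ℕ → ℤ) n (f : ℤ → ℤ) → (∀ i → h i ≡ h′ i) → ∑ (applyUpTo h n) f ≡ ∑ (applyUpTo h′ n) f
∑-applyUpTo-cong h h′ zero    f e = refl
∑-applyUpTo-cong h h′ (suc n) f e = cong₂ _+_ (cong f (e 0)) (∑-applyUpTo-cong (λ i → h (suc i)) (λ i → h′ (suc i)) n f (λ i → e (suc i)))

-- The left list is increasing, the right one ordered from the outside inwards; the induction
-- removes one element at each end.
∑-shifted : ∀ N (f : ℤ → ℤ) → ∑ (applyUpTo (λ i → + i - + N) (suc (N ℕ.+ N))) f ≡ ∑ (ints N) f
∑-shifted zero    f = refl
∑-shifted (suc N) f = cong (λ n → f (h 0) + ∑ (applyUpTo (λ i → h (suc i)) (suc n)) f) (NP.+-suc N N) ∙ cong (λ s → f (h 0) + s) (∑-snoc (λ i → h (suc i)) (suc (N ℕ.+ N)) f ∙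
    cong₂ _+_ (∑-applyUpTo-cong (λ i → h (suc i)) (λ i → + i - + N) (suc (N ℕ.+ N)) f (λ i → r340 (+ i) (+ N)) ∙ ∑-shifted N f) (cong f (r556 (+ N)))) ∙ r557 (f -[1+ N ]) (∑ (ints N) f) (f (+ suc N)) where
  h : ℕ → ℤ
  h i = + i - + suc N

∑-tRange : ∀ n f → ∑ (tRange n) f ≡ ∑ (ints (2 ℕ.* n ℕ.+ 1)) f
∑-tRange n f = cong (λ L → ∑ L f) (map-applyUpTo (λ i → i) (λ i → + i - + (2 ℕ.* n ℕ.+ 1)) (4 ℕ.* n ℕ.+ 3)) ∙ cong (λ k → ∑ (applyUpTo (λ i → + i - + (2 ℕ.* n ℕ.+ 1)) k) f) (count n) ∙ ∑-shifted (2 ℕ.* n ℕ.+ 1) f where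
  count : ∀ n → 4 ℕ.* n ℕ.+ 3 ≡ suc (2 ℕ.* n ℕ.+ 1 ℕ.+ (2 ℕ.* n ℕ.+ 1))
  count = NS.solve-∀

∑-trim : ∀ n k (f : ℤ → ℤ) → (∀ t → n ℕ.< ∣ t ∣ → f t ≡ + 0) → ∑ (ints (k ℕ.+ n)) f ≡ ∑ (ints n) f
∑-trim n zero    f h = refl
∑-trim n (suc k) f h = cong₂ _+_ (h (+ suc (k ℕ.+ n)) (s≤s (NP.m≤n+m n k))) (cong₂ _+_ (h -[1+ k ℕ.+ n ] (s≤s (NP.m≤n+m n k))) (∑-trim n k f h)) ∙ ZP.+-identityˡ (+ 0 + ∑ (ints n) f) ∙ ZP.+-identityˡ (∑ (ints n) f)

-- For an obtuse triple `dsc` = XY + YZ + ZX is nonnegative.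
P2-neg : ∀ B D → NN (- D - + 1) → P2 B D ≡ + 0
P2-neg B D h = ∑-cong (Dom.L (cube B)) {g = λ _ → + 0} (λ { (u , v , w) → go u v w (dsc u v w ℤ.≟ D) (obt? u v w) }) ∙ ∑-0 (Dom.L (cube B)) where
  go : ∀ u v w (d : Dec (dsc u v w ≡ D)) (o : Dec (Obt u v w)) {x} → when d (when o x) ≡ + 0
  go u v w (no _) o = refl
  go u v w (yes _) (no _) = refl
  go u v w (yes e) (yes (X , Y , Z)) = ⊥-elim (nn-absurd (- (+ 1)) (nn+ (subst NN (sym (dsc-XYZ u v w)) (nn+ (nn+ (nn* X Y) (nn* Y Z)) (nn* Z X))) h) e (r407 (dsc u v w) D))

rem-unique : ∀ q {r s} → r ≤ 3 → s ≤ 3 → + 4 * q ≡ + r - + s → r ≡ s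
rem-unique q {r} {s} r≤ s≤ e = go (tri q) where
  go : Tri q → r ≡ s
  go (pos h) = ⊥-elim (nn-absurd (- (+ 1)) (nn+ (nn+ (≤⇒nn r≤) (nn {s})) (nn* (nn {4}) h)) e (r558 q (+ r) (+ s)))
  go (zer h) = ZP.+-injective (sym (≡-from-0 {+ s} {+ r} (sym e ∙ cong (λ q → + 4 * q) h)))
  go (neg h) = ⊥-elim (nn-absurd (+ 1) (nn+ (nn+ (≤⇒nn s≤) (nn {r})) (nn* (nn {4}) h)) e (r559 q (+ r) (+ s)))

-- By the parity of t: -t² is ≡ 0 or ≡ 3 (mod 4). These are the residues for which `IsHurwitz`
-- provides a representative system.
disc-mod4 : ∀ P t n → + n ≡ + 4 * P - t * t → n % 4 ≡ 0 ⊎ n % 4 ≡ 3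
disc-mod4 P t n e = go (par t) (mod₂ t) where
  r≤ : n % 4 ≤ 3
  r≤ = NP.≤-pred (ND.m%n<n n 4)
  n≡ : + n ≡ + (n % 4) + (+ n ℤ./ℕ 4) * + 4
  n≡ = DM.a≡a%ℕn+[a/ℕn]*n (+ n) 4
  q₀ = + n ℤ./ℕ 4
  go : ∀ b → Mod₂ t b → n % 4 ≡ 0 ⊎ n % 4 ≡ 3
  go false (h , t≡) = inj₁ (rem-unique (P - h * h - q₀) r≤ z≤n (r560 P h q₀ (+ (n % 4)) ∙ cong (λ s → s + (+ (n % 4) - + 0)) (sub0 {+ (n % 4) + q₀ * + 4} {+ 4 * P - (h + h + + 0) * (h + h + + 0)} (sym n≡ ∙ e ∙ cong (λ t → + 4 * P - t * t) t≡)) ∙ ZP.+-identityˡ (+ (n % 4) - + 0)))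
  go true (h , t≡) = inj₂ (rem-unique (P - h * h - h - + 1 - q₀) r≤ NP.≤-refl (r561 P h q₀ (+ (n % 4)) ∙ cong (λ s → s + (+ (n % 4) - + 3)) (sub0 {+ (n % 4) + q₀ * + 4} {+ 4 * P - (h + h + + 1) * (h + h + + 1)} (sym n≡ ∙ e ∙ cong (λ t → + 4 * P - t * t) t≡)) ∙ ZP.+-identityˡ (+ (n % 4) - + 3)))

add₃-o : ∀ r → add₃ r o₃ ≡ r
add₃-o o₃ = refl
add₃-o i₃ = refl
add₃-o j₃ = refl

xor-false : ∀ b → xor b false ≡ b
xor-false true  = refl
xor-false false = refl

res-6 : ∀ x c → x %ℕ 6 ≡ c → res₃ x ≡ res₃ (+ c) × par x ≡ par (+ c)
res-6 x c refl = cong res₃ x≡ ∙ res₃-+ (+ (x %ℕ 6)) (q * + 6) ∙ cong (add₃ (res₃ (+ (x %ℕ 6)))) (res₃-* q (+ 6) ∙ mo (res₃ q)) ∙ add₃-o (res₃ (+ (x %ℕ 6)))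
    , cong par x≡ ∙ par-+ (+ (x %ℕ 6)) (q * + 6) ∙ cong (xor (par (+ (x %ℕ 6)))) (par-* q (+ 6) ∙ mf (par q)) ∙ xor-false (par (+ (x %ℕ 6))) where
  q = x ℤ./ℕ 6
  x≡ : x ≡ + (x %ℕ 6) + q * + 6
  x≡ = DM.a≡a%ℕn+[a/ℕn]*n x 6
  mo : ∀ r → mul₃ r o₃ ≡ o₃
  mo o₃ = refl
  mo i₃ = refl
  mo j₃ = refl
  mf : ∀ b → b ∧ false ≡ false
  mf true  = refl
  mf false = refl

divisible-6 : ∀ x → res₃ x ≡ o₃ → par x ≡ false → x %ℕ 6 ≡ 0
divisible-6 x r b = go (x %ℕ 6) (DM.n%ℕd<d x 6) (sym (proj₁ (res-6 x (x %ℕ 6) refl)) ∙ r) (sym (proj₂ (res-6 x (x %ℕ 6) refl)) ∙ b) where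
  go : ∀ c → c ℕ.< 6 → res₃ (+ c) ≡ o₃ → par (+ c) ≡ false → c ≡ 0
  go 0 _ _ _ = refl
  go 1 _ () _
  go 2 _ () _
  go 3 _ _ ()
  go 4 _ () _
  go 5 _ () _
  go (suc (suc (suc (suc (suc (suc c)))))) (s≤s (s≤s (s≤s (s≤s (s≤s (s≤s ())))))) _ _

fromℚᵘ-neg : ∀ p → ℚ.- ℚ.fromℚᵘ p ≡ ℚ.fromℚᵘ (ℚᵘ.- p)
fromℚᵘ-neg p = QP.toℚᵘ-injective (UP.≃-trans (QP.toℚᵘ-homo‿- (ℚ.fromℚᵘ p)) (UP.≃-trans (UP.-‿cong (QP.toℚᵘ-fromℚᵘ p)) (UP.≃-sym (QP.toℚᵘ-fromℚᵘ (ℚᵘ.- p)))))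

≡-/ : ∀ a x k → a * + suc k ≡ x * + 6 → a ℚ./ 6 ≡ x ℚ./ suc k
≡-/ a x k e = QP.fromℚᵘ-cong {mkℚᵘ a 5} {mkℚᵘ x k} (*≡* e)

≡-/+/ : ∀ a x j y k → a * (+ suc j * + suc k) ≡ (x * + suc k + y * + suc j) * + 6 → a ℚ./ 6 ≡ x ℚ./ suc j ℚ.+ y ℚ./ suc k
≡-/+/ a x j y k e = QP.fromℚᵘ-cong {mkℚᵘ a 5} {mkℚᵘ x j ℚᵘ.+ mkℚᵘ y k} (*≡* e) ∙ sym (fromℚᵘ-+ (mkℚᵘ x j) (mkℚᵘ y k))

≡-/-/ : ∀ a x j y k → a * (+ suc j * + suc k) ≡ (x * + suc k + (- y) * + suc j) * + 6 → a ℚ./ 6 ≡ x ℚ./ suc j ℚ.- y ℚ./ suc k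
≡-/-/ a x j y k e = ≡-/+/ a x j (- y) k e ∙ cong (λ s → x ℚ./ suc j ℚ.+ s) (sym (fromℚᵘ-neg (mkℚᵘ y k)))

-- Assembly of the residue classes

module Main (Hf : ℕ → ℚ) (hz : IsHurwitz Hf) (k : ℕ) (pr : Prime (suc (suc k))) (p≥5 : 5 ≤ suc (suc k)) where

  p : ℕ
  p = suc (suc k)

  -- 3p bounds the entries of all quadruples, boundary solutions included. Triples have entries d ±
  -- c, hence the doubled radius 6p, which also exceeds every discriminant 4p - t².
  K B : ℕ
  K = 3 ℕ.* p
  B = K ℕ.+ K

  -- `P` is a variable equal to `+ p`, so that expressions in it stay polynomial instead of
  -- unfolding along the successors of `p`.
  module At (P : ℤ) (P≡ : P ≡ + p) where

    P≥5 : NN (P - + 5)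
    P≥5 = subst (λ P → NN (P - + 5)) (sym P≡) (≤⇒nn p≥5)

    P≥2 : NN (P - + 2)
    P≥2 = ≈nn (nn+ P≥5 (nn {3})) (r231 P)

    K≡ : + K ≡ + 3 * P
    K≡ = ZP.pos-* 3 p ∙ cong (λ t → + 3 * t) (sym P≡)

    K-big : NN (+ K - P - P - P)
    K-big = subst (λ t → NN (t - P - P - P)) (sym K≡) (≈nn (nn {0}) (r232 P))

    open Sums p pr K P P≡ P≥2 K-big using (P-split)

    not-square : ∀ u → u * u ≢ P
    not-square u e = go (tri u) where
      clash : ∀ u → NN (u - + 1) → u * u ≡ P → ⊥
      clash u u⁺ q = split (P-split u u u⁺ q) where
        split : (u ≡ + 1 × u ≡ P) ⊎ (u ≡ P × u ≡ + 1) → ⊥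
        split (inj₁ (e , f)) = neg1 (subst (λ P → NN (P - + 2)) (sym f ∙ e) P≥2)
        split (inj₂ (e , f)) = neg1 (subst (λ P → NN (P - + 2)) (sym e ∙ f) P≥2)
      go : Tri u → ⊥
      go (pos h) = clash u h e
      go (zer h) = 0≢pos {P} (sym e ∙ cong (λ u → u * u) h) (≈nn (nn+ P≥2 (nn {1})) (r112 P))
      go (neg h) = clash (- u) h (r15 u ∙ e)

    odd-P : par P ≡ true
    odd-P = go (par P) refl where
      go : ∀ b → par P ≡ b → par P ≡ true
      go true  e = e
      go false e = ⊥-elim (split (P-split (+ 2) h nn (sym (proj₂ M₂ ∙ r233 h)))) where
        M₂ : Mod₂ P false
        M₂ = subst (Mod₂ P) e (mod₂ P)
        h = proj₁ M₂
        not2 : + 2 ≢ P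
        not2 f = neg-3 (subst (λ P → NN (P - + 5)) (sym f) P≥5) where
          neg-3 : ¬ NN (- (+ 3))
          neg-3 ()
        split : (+ 2 ≡ + 1 × h ≡ P) ⊎ (+ 2 ≡ P × h ≡ + 1) → ⊥
        split (inj₁ (() , _))
        split (inj₂ (f , _)) = not2 f

    open Totals k pr K P P≡ P≥2 K-big B NP.≤-refl odd-P hiding (p)
    open Total k pr K P P≡ P≥2 K-big B NP.≤-refl using (Pt)

    4P≡ : + (4 ℕ.* p) ≡ + 4 * P
    4P≡ = ZP.pos-* 4 p ∙ cong (λ t → + 4 * t) (sym P≡)

    -- t odd is excluded modulo 4, and t even would make p a square. Hence H(0) = -1/12, which is no
    -- weighted count of triples, never enters.
    nonzero-disc : ∀ t → + 4 * P - t * t ≢ + 0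
    nonzero-disc t e = go (par t) (mod₂ t) where
      t² : t * t ≡ + 4 * P
      t² = ≡-from-0 {t * t} {+ 4 * P} e
      go : ∀ b → Mod₂ t b → ⊥
      go false (h , t≡) = not-square h (4-inj (h * h) P (r234 h ∙ cong (λ t → t * t) (sym t≡) ∙ t²))
      go true (h , t≡) = odd≢0 (+ 2 * (h * h) + + 2 * h - + 2 * P) (r235 h P ∙ sub0 {+ 4 * P} {(h + h + + 1) * (h + h + + 1)} (sym (cong (λ t → t * t) (sym t≡) ∙ t²)))

    Hf≡ : ∀ t → Hℤ Hf (+ (4 ℕ.* p) - t * t) ≡ Pt t ℚ./ 6
    Hf≡ t = cong (λ s → Hℤ Hf (s - t * t)) 4P≡ ∙ go (+ 4 * P - t * t) refl where
      go : ∀ D → + 4 * P - t * t ≡ D → Hℤ Hf D ≡ P2 B (+ 4 * P - t * t) ℚ./ 6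
      go (+ zero) e = ⊥-elim (nonzero-disc t e)
      go (+ suc n) e = count (proj₂ (proj₂ hz) (suc n) (s≤s z≤n) (disc-mod4 P t (suc n) (sym e))) ∙ cong (λ D → P2 B D ℚ./ 6) (sym e) where
        B≡ : + B ≡ + 3 * P + + 3 * P
        B≡ = cong₂ _+_ K≡ K≡
        n≤B : suc n ≤ B
        n≤B = nn⇒≤ {suc n} {B} (subst (λ s → NN (+ B - s)) e (subst (λ s → NN (s - (+ 4 * P - t * t))) (sym B≡) (≈nn (nn+ (nn+ (nn* (nn {2}) P≥2) (nn {4})) (nn² t)) (r113 P t))))
        count : Σ (List Form) (λ L → RepSystem (suc n) L × WeightedSum L (Hf (suc n))) → Hf (suc n) ≡ P2 B (+ suc n) ℚ./ 6
        count (L , R , W) = hurwitz-count B (suc n) n≤B (≈nn (nn {n}) (suc-pos n)) R W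
      go -[1+ n ] e = cong (λ x → x ℚ./ 6) (sym (P2-neg B (+ 4 * P - t * t) (subst (λ D → NN (- D - + 1)) (sym e) (¬nn { -[1+ n ]} (λ ())))))

    -- For |t| ≥ p + 1 the discriminant 4p - t² is at most 4p - (p + 1)² = -(p - 1)² < 0. The range
    -- |t| ≤ 2p + 1 in the definition may therefore be cut down to |t| ≤ p.
    Pt-far : ∀ t → p ℕ.< ∣ t ∣ → Pt t ≡ + 0
    Pt-far t h = P2-neg B (+ 4 * P - t * t) (≈nn (nn+ (nn+ (nn* t≥ (nn+ t≥ (nn* (nn {2}) P₁))) (nn* P≥2 P≥2)) (nn* (nn {2}) P≥2)) (cong (λ s → - (+ 4 * P - s) - + 1) t² ∙ r236 P s)) where
      s = + ∣ t ∣
      P₁ : NN (P + + 1)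
      P₁ = ≈nn (nn+ P≥2 (nn {3})) (r114 P)
      t≥ : NN (s - (P + + 1))
      t≥ = subst (λ x → NN (s - x)) (ZP.+-comm (+ 1) (+ p) ∙ cong (λ x → x + + 1) (sym P≡)) (≤⇒nn h)
      t² : t * t ≡ s * s
      t² = abs-sq t where
        abs-sq : ∀ t → t * t ≡ + ∣ t ∣ * + ∣ t ∣
        abs-sq (+ _) = refl
        abs-sq -[1+ _ ] = refl

    H-class : ∀ m → Hmod Hf m 6 p ≡ class (res₃ m) (par m) ℚ./ 6
    H-class m = Hmod-sum Hf m p Pt Hf≡ ∙ cong (λ s → s ℚ./ 6) (∑-tRange p f ∙ cong (λ n → ∑ (ints n) f) (width p) ∙ ∑-trim p (suc p) f (λ t h → cong (when ((t - m) %ℕ 6 ℕ.≟ 0)) (Pt-far t h) ∙ when-0 ((t - m) %ℕ 6 ℕ.≟ 0)) ∙ ∑-cong (ints p) (λ t → pt t ((t - m) %ℕ 6 ℕ.≟ 0))) where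
      f : ℤ → ℤ
      f t = when ((t - m) %ℕ 6 ℕ.≟ 0) (Pt t)
      width : ∀ p → 2 ℕ.* p ℕ.+ 1 ≡ suc p ℕ.+ p
      width = NS.solve-∀
      yes-case : ∀ r s b c → add₃ r (neg₃′ s) ≡ o₃ → xor b c ≡ false → bit (eq₃ r s ∧ not (xor b c)) ≡ + 1
      yes-case o₃ o₃ b c _ e = cong (λ x → bit (not x)) e
      yes-case i₃ i₃ b c _ e = cong (λ x → bit (not x)) e
      yes-case j₃ j₃ b c _ e = cong (λ x → bit (not x)) e
      yes-case o₃ i₃ b c () e
      yes-case o₃ j₃ b c () e
      yes-case i₃ o₃ b c () e
      yes-case i₃ j₃ b c () e
      yes-case j₃ o₃ b c () e
      yes-case j₃ i₃ b c () e
      no-case : ∀ r s b c → (add₃ r (neg₃′ s) ≡ o₃ → xor b c ≡ false → ⊥) → bit (eq₃ r s ∧ not (xor b c)) ≡ + 0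
      no-case o₃ i₃ b c h = refl
      no-case o₃ j₃ b c h = refl
      no-case i₃ o₃ b c h = refl
      no-case i₃ j₃ b c h = refl
      no-case j₃ o₃ b c h = refl
      no-case j₃ i₃ b c h = refl
      no-case o₃ o₃ b c h = odd-case (xor b c) (h refl) where
        odd-case : ∀ x → (x ≡ false → ⊥) → bit (not x) ≡ + 0
        odd-case true  _ = refl
        odd-case false h = ⊥-elim (h refl)
      no-case i₃ i₃ b c h = no-case o₃ o₃ b c h
      no-case j₃ j₃ b c h = no-case o₃ o₃ b c h
      pt : ∀ t (d : Dec ((t - m) %ℕ 6 ≡ 0)) → when d (Pt t) ≡ bit (eq₃ (res₃ t) (res₃ m) ∧ not (xor (par t) (par m))) * Pt t
      pt t (yes e) = sym (cong (λ x → x * Pt t) (yes-case (res₃ t) (res₃ m) (par t) (par m) (sym (res₃-sub t m) ∙ proj₁ (res-6 (t - m) 0 e)) (sym (par-sub t m) ∙ proj₂ (res-6 (t - m) 0 e))) ∙ ZP.*-identityˡ (Pt t))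
      pt t (no n) = sym (cong (λ x → x * Pt t) (no-case (res₃ t) (res₃ m) (par t) (par m) (λ r b → n (divisible-6 (t - m) (res₃-sub t m ∙ r) (par-sub t m ∙ b)))) ∙ ZP.*-zeroˡ (Pt t))

    H≡class : ∀ m c → m %ℕ 6 ≡ c → Hmod Hf m 6 p ≡ class (res₃ (+ c)) (par (+ c)) ℚ./ 6
    H≡class m c e = H-class m ∙ cong₂ (λ r b → class r b ℚ./ 6) (proj₁ (res-6 m c e)) (proj₂ (res-6 m c e))

    H₀ : ∀ m → m %ℕ 6 ≡ 0 → Hmod Hf m 6 p ≡ a ℚ./ 6
    H₀ m = H≡class m 0

    H₃ : ∀ m → m %ℕ 6 ≡ 3 → Hmod Hf m 6 p ≡ b ℚ./ 6
    H₃ m = H≡class m 3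

    -- 2 and 4 are negatives of each other modulo 6, as are 1 and 5, so one class sum serves both by
    -- `class-neg`.
    H₂₄ : ∀ m → m %ℕ 6 ≡ 2 ⊎ m %ℕ 6 ≡ 4 → Hmod Hf m 6 p ≡ c ℚ./ 6
    H₂₄ m (inj₁ e) = H≡class m 2 e ∙ cong (λ x → x ℚ./ 6) (class-neg i₃ false)
    H₂₄ m (inj₂ e) = H≡class m 4 e

    H₁₅ : ∀ m → m %ℕ 6 ≡ 1 ⊎ m %ℕ 6 ≡ 5 → Hmod Hf m 6 p ≡ d ℚ./ 6
    H₁₅ m (inj₁ e) = H≡class m 1 e
    H₁₅ m (inj₂ e) = H≡class m 5 e ∙ cong (λ x → x ℚ./ 6) (class-neg i₃ true)

    module Case₁ (r₃ : res₃ P ≡ i₃) (x y : ℤ) (sol : Sol P (x , y)) where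

      X = χ x * x

      values : + 2 * a ≡ + 3 * (P + + 1) + (+ 4 * X + P + + 1) × + 2 * b ≡ + 3 * (P + + 1) - (+ 4 * X + P + + 1)
        × + 4 * c ≡ + 12 * P + (+ 4 * P - + 8) - + 3 * (P + + 1) - (+ 4 * X + P + + 1) × + 4 * d ≡ + 12 * P - (+ 4 * P - + 8) - + 3 * (P + + 1) + (+ 4 * X + P + + 1)
      values = solved (+ 12 * P) (+ 4 * P - + 8) (+ 3 * (P + + 1)) (+ 4 * X + P + + 1) T-one T-alt (One.T-f₃ r₃) (One.T-f₆ r₃ X (Theta.Unique.3U p pr K P P≡ P≥2 K-big r₃ odd-P x y sol))

      a≡ : a ℚ./ 6 ≡ (P + + 1) ℚ./ 3 ℚ.+ X ℚ./ 3
      a≡ = ≡-/+/ a (P + + 1) 2 X 2 (4-inj (a * (+ 3 * + 3)) (((P + + 1) * + 3 + X * + 3) * + 6) (r115 a ∙ cong (λ t → + 18 * t) (proj₁ values) ∙ r116 P X))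

      b≡ : b ℚ./ 6 ≡ (P + + 1) ℚ./ 6 ℚ.- X ℚ./ 3
      b≡ = ≡-/-/ b (P + + 1) 5 X 2 (4-inj (b * (+ 6 * + 3)) (((P + + 1) * + 3 + - X * + 6) * + 6) (r117 b ∙ cong (λ t → + 36 * t) (proj₁ (proj₂ values)) ∙ r118 P X))

      c≡ : c ℚ./ 6 ≡ (P - + 1) ℚ./ 2 ℚ.- X ℚ./ 6
      c≡ = ≡-/-/ c (P - + 1) 1 X 5 (4-inj (c * (+ 2 * + 6)) (((P - + 1) * + 6 + - X * + 2) * + 6) (r119 c ∙ cong (λ t → + 12 * t) (proj₁ (proj₂ (proj₂ values))) ∙ r120 P X))

      d≡ : d ℚ./ 6 ≡ (P + + 1) ℚ./ 4 ℚ.+ X ℚ./ 6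
      d≡ = ≡-/+/ d (P + + 1) 3 X 5 (4-inj (d * (+ 4 * + 6)) (((P + + 1) * + 6 + X * + 4) * + 6) (r121 d ∙ cong (λ t → + 24 * t) (proj₂ (proj₂ (proj₂ values))) ∙ r122 P X))

    module Case₂ (r₃ : res₃ P ≡ j₃) where

      values : + 2 * a ≡ + 6 * P - + 6 + (+ 2 * P - + 10) × + 2 * b ≡ + 6 * P - + 6 - (+ 2 * P - + 10)
        × + 4 * c ≡ + 12 * P + (+ 4 * P - + 8) - (+ 6 * P - + 6) - (+ 2 * P - + 10) × + 4 * d ≡ + 12 * P - (+ 4 * P - + 8) - (+ 6 * P - + 6) + (+ 2 * P - + 10)
      values = solved (+ 12 * P) (+ 4 * P - + 8) (+ 6 * P - + 6) (+ 2 * P - + 10) T-one T-alt (Two.T-f₃ r₃) (Two.T-f₆ r₃)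

      a≡ : a ℚ./ 6 ≡ (+ 2 * P - + 4) ℚ./ 3
      a≡ = ≡-/ a (+ 2 * P - + 4) 2 (4-inj (a * + 3) ((+ 2 * P - + 4) * + 6) (r123 a ∙ cong (λ t → + 6 * t) (proj₁ values) ∙ r124 P))

      b≡ : b ℚ./ 6 ≡ (P + + 1) ℚ./ 3
      b≡ = ≡-/ b (P + + 1) 2 (4-inj (b * + 3) ((P + + 1) * + 6) (r123 b ∙ cong (λ t → + 6 * t) (proj₁ (proj₂ values)) ∙ r125 P))

      c≡ : c ℚ./ 6 ≡ (P + + 1) ℚ./ 3
      c≡ = ≡-/ c (P + + 1) 2 (4-inj (c * + 3) ((P + + 1) * + 6) (r126 c ∙ cong (λ t → + 3 * t) (proj₁ (proj₂ (proj₂ values))) ∙ r127 P))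

      d≡ : d ℚ./ 6 ≡ (P + + 1) ℚ./ 6
      d≡ = ≡-/ d (P + + 1) 5 (4-inj (d * + 6) ((P + + 1) * + 6) (r128 d ∙ cong (λ t → + 6 * t) (proj₂ (proj₂ (proj₂ values))) ∙ r129 P))

theorem4p4 : (Hf : ℕ → ℚ) → IsHurwitz Hf →
    (p : ℕ) → Prime p → 5 ≤ p → (m : ℤ) →
    (p % 3 ≡ 1 → (x y : ℤ) → + p ≡ x ℤ.* x ℤ.+ + 3 ℤ.* y ℤ.* y →
    (m %ℕ 6 ≡ 0 →
    Hmod Hf m 6 p ≡ (+ (p ℕ.+ 1)) ℚ./ 3 ℚ.+ (χ₋₃ x ℤ.* x) ℚ./ 3)
    × ((m %ℕ 6 ≡ 1 ⊎ m %ℕ 6 ≡ 5) →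
    Hmod Hf m 6 p ≡ (+ (p ℕ.+ 1)) ℚ./ 4 ℚ.+ (χ₋₃ x ℤ.* x) ℚ./ 6)
    × ((m %ℕ 6 ≡ 2 ⊎ m %ℕ 6 ≡ 4) →
    Hmod Hf m 6 p ≡ (+ p ℤ.- + 1) ℚ./ 2 ℚ.- (χ₋₃ x ℤ.* x) ℚ./ 6)
    × (m %ℕ 6 ≡ 3 →
    Hmod Hf m 6 p ≡ (+ (p ℕ.+ 1)) ℚ./ 6 ℚ.- (χ₋₃ x ℤ.* x) ℚ./ 3))
    × (p % 3 ≡ 2 →
    (m %ℕ 6 ≡ 0 →
    Hmod Hf m 6 p ≡ (+ (2 ℕ.* p) ℤ.- + 4) ℚ./ 3)
    × ((m %ℕ 6 ≡ 1 ⊎ m %ℕ 6 ≡ 5) →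
    Hmod Hf m 6 p ≡ (+ (p ℕ.+ 1)) ℚ./ 6)
    × ((m %ℕ 6 ≡ 2 ⊎ m %ℕ 6 ≡ 3 ⊎ m %ℕ 6 ≡ 4) →
    Hmod Hf m 6 p ≡ (+ (p ℕ.+ 1)) ℚ./ 3))
theorem4p4 Hf hz 0 pr () m
theorem4p4 Hf hz 1 pr (s≤s ()) m
theorem4p4 Hf hz (suc (suc k)) pr p≥5 m = core (+ p) refl where
  p = suc (suc k)
  module _ (P : ℤ) (P≡ : P ≡ + p) where
    open Main.At Hf hz k pr p≥5 P P≡

    +1/ : ∀ n .{{_ : ℕ.NonZero n}} → (P + + 1) ℚ./ n ≡ + (p ℕ.+ 1) ℚ./ n
    +1/ n = cong (λ t → (t + + 1) ℚ./ n) P≡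

    core : _ × _
    core = case₁ , case₂ where
      case₁ : p % 3 ≡ 1 → (x y : ℤ) → + p ≡ x * x + + 3 * y * y →
        (m %ℕ 6 ≡ 0 → Hmod Hf m 6 p ≡ + (p ℕ.+ 1) ℚ./ 3 ℚ.+ (χ₋₃ x * x) ℚ./ 3)
        × ((m %ℕ 6 ≡ 1 ⊎ m %ℕ 6 ≡ 5) → Hmod Hf m 6 p ≡ + (p ℕ.+ 1) ℚ./ 4 ℚ.+ (χ₋₃ x * x) ℚ./ 6)
        × ((m %ℕ 6 ≡ 2 ⊎ m %ℕ 6 ≡ 4) → Hmod Hf m 6 p ≡ (+ p - + 1) ℚ./ 2 ℚ.- (χ₋₃ x * x) ℚ./ 6)
        × (m %ℕ 6 ≡ 3 → Hmod Hf m 6 p ≡ + (p ℕ.+ 1) ℚ./ 6 ℚ.- (χ₋₃ x * x) ℚ./ 3)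
      case₁ p≡1 x y q =
          (λ e → H₀ m e ∙ a≡ ∙ cong₂ ℚ._+_ (+1/ 3) (X/ 3))
        , (λ e → H₁₅ m e ∙ d≡ ∙ cong₂ ℚ._+_ (+1/ 4) (X/ 6))
        , (λ e → H₂₄ m e ∙ c≡ ∙ cong₂ ℚ._-_ (cong (λ t → (t - + 1) ℚ./ 2) P≡) (X/ 6))
        , (λ e → H₃ m e ∙ b≡ ∙ cong₂ ℚ._-_ (+1/ 6) (X/ 3)) where
        r₃ : res₃ P ≡ i₃
        r₃ = cong res₃ P≡ ∙ res₃-1 p≡1 where
          res₃-1 : p % 3 ≡ 1 → res₃ (+ p) ≡ i₃
          res₃-1 e rewrite e = refl
        open Case₁ r₃ x y (sym (r130 x y) ∙ sym q ∙ sym P≡)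
        X/ : ∀ n .{{_ : ℕ.NonZero n}} → (χ x * x) ℚ./ n ≡ (χ₋₃ x * x) ℚ./ n
        X/ n = cong (λ t → (t * x) ℚ./ n) (sym (χ₋₃≡χ x))
      case₂ : p % 3 ≡ 2 →
        (m %ℕ 6 ≡ 0 → Hmod Hf m 6 p ≡ (+ (2 ℕ.* p) - + 4) ℚ./ 3)
        × ((m %ℕ 6 ≡ 1 ⊎ m %ℕ 6 ≡ 5) → Hmod Hf m 6 p ≡ + (p ℕ.+ 1) ℚ./ 6)
        × ((m %ℕ 6 ≡ 2 ⊎ m %ℕ 6 ≡ 3 ⊎ m %ℕ 6 ≡ 4) → Hmod Hf m 6 p ≡ + (p ℕ.+ 1) ℚ./ 3)
      case₂ p≡2 =
          (λ e → H₀ m e ∙ a≡ ∙ cong (λ t → (t - + 4) ℚ./ 3) (cong (λ t → + 2 * t) P≡ ∙ sym (ZP.pos-* 2 p)))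
        , (λ e → H₁₅ m e ∙ d≡ ∙ +1/ 6)
        , λ { (inj₁ e) → H₂₄ m (inj₁ e) ∙ c≡ ∙ +1/ 3
            ; (inj₂ (inj₁ e)) → H₃ m e ∙ b≡ ∙ +1/ 3
            ; (inj₂ (inj₂ e)) → H₂₄ m (inj₂ e) ∙ c≡ ∙ +1/ 3 } where
        r₃ : res₃ P ≡ j₃
        r₃ = cong res₃ P≡ ∙ res₃-2 p≡2 where
          res₃-2 : p % 3 ≡ 2 → res₃ (+ p) ≡ j₃
          res₃-2 e rewrite e = refl
        open Case₂ r₃
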